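{- Let $p_1,\dots,p_s$ be distinct primes, $m_1,\dots,m_s\ge1$, and let $\Gamma$ be a finite multi-sorted constraint language over $\{\mathbb Z_{p_1^{m_1}},\dots,\mathbb Z_{p_s^{m_s}}\}$ which is invariant under the affine operation of $\mathbb Z_{p_1^{m_1}},\dots,\mathbb Z_{p_s^{m_s}}$. Then for every fixed $d$, $\textsc{IMP}_d(\Gamma)$ is decidable in polynomial time.
   Context: Elements of $\mathbb Z_{q}$ are identified with the complex numbers $0,1,\dots,q-1$. A multi-sorted constraint language is a set of relations $R\subseteq D_{t_1}\times\dots\times D_{t_n}$ with specified signatures, the $D_t$ being the given groups. Invariance under the affine operation: for all $\mathbf a,\mathbf b,\mathbf c\in R$, the coordinatewise $\mathbf a-\mathbf b+\mathbf c$ (in the respective groups) lies in $R$. An instance of $\textsc{MCSP}(\Gamma)$ has variables with sorts and constraints from $\Gamma$ matching the sorts; its ideal $\mathtt I(\mathcal P)\subseteq\mathbb C[X]$ is generated by domain polynomials $\prod_{a\in D_{\delta(x)}}(x-a)$ and polynomials interpolating the constraints, and equals the vanishing ideal of the solution set. $\textsc{IMP}_d(\Gamma)$: given an instance $\mathcal P$ and $f\in\mathbb C[X]$ with $\deg f\le d$, decide whether $f\in\mathtt I(\mathcal P)$. -}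

module Defs where

open import Algebra.Bundles.Raw using (RawRing)
open import Data.Bool.Base using (Bool; T)
open import Data.Fin.Base using (Fin; zero; suc; toℕ)
open import Data.Integer.Base using (ℤ; +_; -[1+_])
open import Data.List.Base as List using (List; []; _∷_; [_]; _++_; length; allFin)
open import Data.List.Membership.Propositional using (_∈_)
open import Data.List.Relation.Unary.All as Listᴬ using ()
open import Data.Nat.Base as ℕ using (ℕ; zero; suc)
open import Data.Nat.Binary.Base as ℕᵇ using (ℕᵇ; 2[1+_]; 1+[2_])
open import Data.Nat.DivMod using (_mod_)
open import Data.Nat.Properties as ℕₚ using ()
open import Data.Product.Base using (Σ; ∃; ∃-syntax; _×_; _,_; proj₁; proj₂)
open import Data.Rational.Base as Rat using (ℚ; 0ℚ; 1ℚ; ½; ↥_; ↧ₙ_)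
open import Data.Rational.Properties as ℚₚ using ()
open import Data.Rational.Solver using (module +-*-Solver)
open import Data.Vec.Base as Vec using (Vec; []; _∷_; lookup; replicate; zipWith; updateAt; _[_]≔_)
open import Data.Vec.Properties using (≡-dec)
open import Data.Vec.Relation.Unary.All as Vecᴬ using (All; []; _∷_)
open import Function.Bundles using (_⇔_)
open import Level using (0ℓ; _⊔_)
open import Relation.Binary.PropositionalEquality
  using (_≡_; _≢_; refl; sym; trans; cong; cong₂; subst)
open import Relation.Nullary using (¬_; yes; no)

-- A real number is a Cauchy sequence of rationals, considered up to _≃ᴿ_.
module _ where
  open Rat using (_+_; _*_; -_; _-_; _<_; _≤_; ∣_∣)

  Cauchy : (ℕ → ℚ) → Set
  Cauchy x = ∀ ε → 0ℚ < ε →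
    ∃[ N ] (∀ m n → N ℕ.≤ m → N ℕ.≤ n → ∣ x m - x n ∣ < ε)

  record ℝ : Set where
    constructor real
    field
      seq    : ℕ → ℚ
      cauchy : Cauchy seq

  open ℝ public

  infix 4 _≃ᴿ_
  _≃ᴿ_ : ℝ → ℝ → Set
  x ≃ᴿ y = ∀ ε → 0ℚ < ε →
    ∃[ N ] (∀ n → N ℕ.≤ n → ∣ seq x n - seq y n ∣ < ε)

  private
    0<* : ∀ {p q} → 0ℚ < p → 0ℚ < q → 0ℚ < p * q
    0<* {p} {q} 0<p 0<q =
      ℚₚ.positive⁻¹ (p * q)
        {{ℚₚ.pos*pos⇒pos p {{Rat.positive 0<p}} q {{Rat.positive 0<q}}}}

    0<½ : 0ℚ < ½
    0<½ = ℚₚ.positive⁻¹ ½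

    0<1 : 0ℚ < 1ℚ
    0<1 = ℚₚ.positive⁻¹ 1ℚ

    halves : ∀ ε → ε * ½ + ε * ½ ≡ ε
    halves ε = trans (sym (ℚₚ.*-distribˡ-+ ε ½ ½)) (ℚₚ.*-identityʳ ε)

    0≤∣_∣ : ∀ p → 0ℚ ≤ ∣ p ∣
    0≤∣ p ∣ = ℚₚ.nonNegative⁻¹ ∣ p ∣ {{ℚₚ.∣-∣-nonNeg p}}

    x-x : ∀ p → ∣ p - p ∣ ≡ 0ℚ
    x-x p = cong ∣_∣ (ℚₚ.+-inverseʳ p)

    const-cauchy : ∀ p → Cauchy (λ _ → p)
    const-cauchy p ε 0<ε = 0 , λ _ _ _ _ → subst (_< ε) (sym (x-x p)) 0<ε

    neg-cauchy : ∀ {x} → Cauchy x → Cauchy (λ n → - x n)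
    neg-cauchy {x} cx ε 0<ε with cx ε 0<ε
    ... | N , h = N , λ m n N≤m N≤n →
      subst (_< ε)
        (trans (sym (ℚₚ.∣-p∣≡∣p∣ (x m - x n)))
               (cong ∣_∣ (ℚₚ.neg-distrib-+ (x m) (- x n))))
        (h m n N≤m N≤n)

    +-cauchy : ∀ {x y} → Cauchy x → Cauchy y → Cauchy (λ n → x n + y n)
    +-cauchy {x} {y} cx cy ε 0<ε
      with cx (ε * ½) (0<* 0<ε 0<½) | cy (ε * ½) (0<* 0<ε 0<½)
    ... | M , hx | N , hy = M ℕ.⊔ N , λ m n m≥ n≥ → begin-strict
      ∣ (x m + y m) - (x n + y n) ∣
        ≡⟨ cong ∣_∣ (rearrange (x m) (y m) (x n) (y n)) ⟩
      ∣ (x m - x n) + (y m - y n) ∣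
        ≤⟨ ℚₚ.∣p+q∣≤∣p∣+∣q∣ (x m - x n) (y m - y n) ⟩
      ∣ x m - x n ∣ + ∣ y m - y n ∣
        <⟨ ℚₚ.+-mono-<
             (hx m n (ℕₚ.m⊔n≤o⇒m≤o M N m≥) (ℕₚ.m⊔n≤o⇒m≤o M N n≥))
             (hy m n (ℕₚ.m⊔n≤o⇒n≤o M N m≥) (ℕₚ.m⊔n≤o⇒n≤o M N n≥)) ⟩
      ε * ½ + ε * ½
        ≡⟨ halves ε ⟩
      ε ∎
      where
      open ℚₚ.≤-Reasoning
      open +-*-Solver
      rearrange : ∀ a b c d → (a + b) - (c + d) ≡ (a - c) + (b - d)
      rearrange = solve 4 (λ a b c d →
        (a :+ b) :- (c :+ d) := (a :- c) :+ (b :- d)) refl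

    Bounded : (ℕ → ℚ) → Set
    Bounded x = ∃[ N ] ∃[ B ] (0ℚ < B × (∀ n → N ℕ.≤ n → ∣ x n ∣ ≤ B))

    cauchy⇒bounded : ∀ {x} → Cauchy x → Bounded x
    cauchy⇒bounded {x} cx with cx 1ℚ 0<1
    ... | N , h = N , 1ℚ + ∣ x N ∣ , ℚₚ.+-mono-<-≤ 0<1 0≤∣ x N ∣ , λ n N≤n → begin
      ∣ x n ∣                      ≡⟨ cong ∣_∣ (split (x n) (x N)) ⟩
      ∣ (x n - x N) + x N ∣        ≤⟨ ℚₚ.∣p+q∣≤∣p∣+∣q∣ (x n - x N) (x N) ⟩
      ∣ x n - x N ∣ + ∣ x N ∣      ≤⟨ ℚₚ.+-monoˡ-≤ ∣ x N ∣
                                        (ℚₚ.<⇒≤ (h n N N≤n ℕₚ.≤-refl)) ⟩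
      1ℚ + ∣ x N ∣                 ∎
      where
      open ℚₚ.≤-Reasoning
      open +-*-Solver
      split : ∀ a b → a ≡ (a - b) + b
      split = solve 2 (λ a b → a := (a :- b) :+ b) refl

    ∣*∣< : ∀ {p u B δ} → 0ℚ < B → ∣ p ∣ ≤ B → ∣ u ∣ < δ → ∣ p * u ∣ < B * δ
    ∣*∣< {p} {u} {B} {δ} 0<B p≤B u<δ = begin-strict
      ∣ p * u ∣      ≡⟨ ℚₚ.∣p*q∣≡∣p∣*∣q∣ p u ⟩
      ∣ p ∣ * ∣ u ∣  ≤⟨ ℚₚ.*-monoʳ-≤-nonNeg ∣ u ∣ {{ℚₚ.∣-∣-nonNeg u}} p≤B ⟩
      B * ∣ u ∣      <⟨ ℚₚ.*-monoʳ-<-pos B {{Rat.positive 0<B}} u<δ ⟩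
      B * δ          ∎
      where open ℚₚ.≤-Reasoning

    shrink : ∀ {C ε} → 0ℚ < C → 0ℚ < ε → ∃[ δ ] (0ℚ < δ × C * δ ≡ ε)
    shrink {C} {ε} 0<C 0<ε = ε * 1/C ,
      0<* 0<ε (ℚₚ.positive⁻¹ 1/C {{ℚₚ.1/pos⇒pos C {{Rat.positive 0<C}}}}) ,
      trans (swap C ε 1/C)
        (trans (cong (ε *_) (ℚₚ.*-inverseʳ C {{Rat.>-nonZero 0<C}}))
               (ℚₚ.*-identityʳ ε))
      where
      1/C = (Rat.1/ C) {{Rat.>-nonZero 0<C}}
      open +-*-Solver
      swap : ∀ a e i → a * (e * i) ≡ e * (a * i)
      swap = solve 3 (λ a e i → a :* (e :* i) := e :* (a :* i)) refl

    *-cauchy : ∀ {x y} → Cauchy x → Cauchy y → Cauchy (λ n → x n * y n)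
    *-cauchy {x} {y} cx cy ε 0<ε =
      let K , A , 0<A , hA = cauchy⇒bounded cx
          L , B , 0<B , hB = cauchy⇒bounded cy
          δ , 0<δ , Aδ≡    = shrink 0<A (0<* 0<ε 0<½)
          γ , 0<γ , Bγ≡    = shrink 0<B (0<* 0<ε 0<½)
          M , hx           = cx γ 0<γ
          N , hy           = cy δ 0<δ
      in estimate K L M N 0<A 0<B hA hB Aδ≡ Bγ≡ hx hy
      where
      open ℚₚ.≤-Reasoning
      open +-*-Solver
      rearrange : ∀ a b c d → a * b - c * d ≡ a * (b - d) + d * (a - c)
      rearrange = solve 4 (λ a b c d →
        a :* b :- c :* d := a :* (b :- d) :+ d :* (a :- c)) refl
      estimate : ∀ K L M N {A B δ γ} → 0ℚ < A → 0ℚ < B →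
        (∀ n → K ℕ.≤ n → ∣ x n ∣ ≤ A) → (∀ n → L ℕ.≤ n → ∣ y n ∣ ≤ B) →
        A * δ ≡ ε * ½ → B * γ ≡ ε * ½ →
        (∀ m n → M ℕ.≤ m → M ℕ.≤ n → ∣ x m - x n ∣ < γ) →
        (∀ m n → N ℕ.≤ m → N ℕ.≤ n → ∣ y m - y n ∣ < δ) →
        ∃[ P ] (∀ m n → P ℕ.≤ m → P ℕ.≤ n → ∣ x m * y m - x n * y n ∣ < ε)
      estimate K L M N {A} {B} {δ} {γ} 0<A 0<B hA hB Aδ≡ Bγ≡ hx hy =
        KL ℕ.⊔ MN , λ m n m≥ n≥ → begin-strict
        ∣ x m * y m - x n * y n ∣
          ≡⟨ cong ∣_∣ (rearrange (x m) (y m) (x n) (y n)) ⟩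
        ∣ x m * (y m - y n) + y n * (x m - x n) ∣
          ≤⟨ ℚₚ.∣p+q∣≤∣p∣+∣q∣ (x m * (y m - y n)) (y n * (x m - x n)) ⟩
        ∣ x m * (y m - y n) ∣ + ∣ y n * (x m - x n) ∣
          <⟨ ℚₚ.+-mono-<
               (∣*∣< {x m} {y m - y n} 0<A (hA m (≥K m≥)) (hy m n (≥N m≥) (≥N n≥)))
               (∣*∣< {y n} {x m - x n} 0<B (hB n (≥L n≥)) (hx m n (≥M m≥) (≥M n≥))) ⟩
        A * δ + B * γ
          ≡⟨ cong₂ _+_ Aδ≡ Bγ≡ ⟩
        ε * ½ + ε * ½
          ≡⟨ halves ε ⟩
        ε ∎
        where
        KL = K ℕ.⊔ L
        MN = M ℕ.⊔ N
        ≥K : ∀ {i} → KL ℕ.⊔ MN ℕ.≤ i → K ℕ.≤ i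
        ≥K h = ℕₚ.m⊔n≤o⇒m≤o K L (ℕₚ.m⊔n≤o⇒m≤o KL MN h)
        ≥L : ∀ {i} → KL ℕ.⊔ MN ℕ.≤ i → L ℕ.≤ i
        ≥L h = ℕₚ.m⊔n≤o⇒n≤o K L (ℕₚ.m⊔n≤o⇒m≤o KL MN h)
        ≥M : ∀ {i} → KL ℕ.⊔ MN ℕ.≤ i → M ℕ.≤ i
        ≥M h = ℕₚ.m⊔n≤o⇒m≤o M N (ℕₚ.m⊔n≤o⇒n≤o KL MN h)
        ≥N : ∀ {i} → KL ℕ.⊔ MN ℕ.≤ i → N ℕ.≤ i
        ≥N h = ℕₚ.m⊔n≤o⇒n≤o M N (ℕₚ.m⊔n≤o⇒n≤o KL MN h)

  infixl 6 _+ᴿ_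
  infixl 7 _*ᴿ_
  infix  8 -ᴿ_

  _+ᴿ_ _*ᴿ_ : ℝ → ℝ → ℝ
  real x cx +ᴿ real y cy = real (λ n → x n + y n) (+-cauchy {x} {y} cx cy)
  real x cx *ᴿ real y cy = real (λ n → x n * y n) (*-cauchy {x} {y} cx cy)

  -ᴿ_ : ℝ → ℝ
  -ᴿ real x cx = real (λ n → - x n) (neg-cauchy {x} cx)

  ℚ→ℝ : ℚ → ℝ
  ℚ→ℝ p = real (λ _ → p) (const-cauchy p)

record ℂ : Set where
  constructor _+i_
  field
    re im : ℝ

open ℂ public

ℚ→ℂ : ℚ → ℂ
ℚ→ℂ p = ℚ→ℝ p +i ℚ→ℝ 0ℚ

ℕ→ℂ : ℕ → ℂ
ℕ→ℂ n = ℚ→ℂ ((+ n) Rat./ 1)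

ℂ-ring : RawRing 0ℓ 0ℓ
ℂ-ring = record
  { Carrier = ℂ
  ; _≈_     = λ z w → (re z ≃ᴿ re w) × (im z ≃ᴿ im w)
  ; _+_     = λ z w → (re z +ᴿ re w) +i (im z +ᴿ im w)
  ; _*_     = λ z w → (re z *ᴿ re w +ᴿ -ᴿ (im z *ᴿ im w))
                   +i (re z *ᴿ im w +ᴿ im z *ᴿ re w)
  ; -_      = λ z → (-ᴿ re z) +i (-ᴿ im z)
  ; 0#      = ℚ→ℂ 0ℚ
  ; 1#      = ℚ→ℂ 1ℚ
  }

module Polynomials {c ℓ} (R : RawRing c ℓ) where
  open RawRing R

  Monomial : ℕ → Set
  Monomial n = Vec ℕ n

  -- A formal sum of terms.  The same monomial may occur several times, so
  -- polynomials are compared with _≈ₚ_.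
  Poly : ℕ → Set c
  Poly n = List (Carrier × Monomial n)

  coeff : ∀ {n} → Poly n → Monomial n → Carrier
  coeff []            α = 0#
  coeff ((a , β) ∷ f) α with ≡-dec ℕₚ._≟_ β α
  ... | yes _ = a + coeff f α
  ... | no  _ = coeff f α

  infix 4 _≈ₚ_
  _≈ₚ_ : ∀ {n} → Poly n → Poly n → Set ℓ
  f ≈ₚ g = ∀ α → coeff f α ≈ coeff g α

  infixl 6 _+ₚ_
  infixl 7 _*ₚ_

  _+ₚ_ _*ₚ_ : ∀ {n} → Poly n → Poly n → Poly n
  f +ₚ g = f ++ g
  f *ₚ g = List.concatMap
    (λ (a , α) → List.map (λ (b , β) → a * b , zipWith ℕ._+_ α β) g) f

  constₚ : ∀ {n} → Carrier → Poly n
  constₚ a = [ a , replicate _ 0 ]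

  varₚ : ∀ {n} → Fin n → Poly n
  varₚ i = [ 1# , replicate _ 0 [ i ]≔ 1 ]

  sumₚ productₚ : ∀ {n} → List (Poly n) → Poly n
  sumₚ     = List.foldr _+ₚ_ []
  productₚ = List.foldr _*ₚ_ (constₚ 1#)

  -- The substitution y_i ↦ x_{ρ i}; ρ need not be injective.
  renameMonomial : ∀ {k n} → Vec (Fin n) k → Monomial k → Monomial n
  renameMonomial []      []      = replicate _ 0
  renameMonomial (j ∷ ρ) (e ∷ α) = updateAt (renameMonomial ρ α) j (e ℕ.+_)

  rename : ∀ {k n} → Vec (Fin n) k → Poly k → Poly n
  rename ρ = List.map (λ (a , α) → a , renameMonomial ρ α)

  power : Carrier → ℕ → Carrier
  power a zero    = 1#
  power a (suc e) = a * power a e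

  evalMonomial : ∀ {n} → Monomial n → Vec Carrier n → Carrier
  evalMonomial []      []      = 1#
  evalMonomial (e ∷ α) (a ∷ v) = power a e * evalMonomial α v

  eval : ∀ {n} → Poly n → Vec Carrier n → Carrier
  eval f v = List.foldr (λ (a , α) r → a * evalMonomial α v + r) 0# f

  infix 4 _∈⟨_⟩
  _∈⟨_⟩ : ∀ {n g} → Poly n → (Poly n → Set g) → Set (c ⊔ ℓ ⊔ g)
  _∈⟨_⟩ {n} f G = Σ (List (Poly n × Σ (Poly n) G)) λ hs →
    f ≈ₚ sumₚ (List.map (λ (h , g , _) → h *ₚ g) hs)

open RawRing ℂ-ring public
  using () renaming (_≈_ to _≈ᶜ_; _+_ to _+ᶜ_; _*_ to _*ᶜ_; -_ to -ᶜ_; 0# to 0ᶜ; 1# to 1ᶜ)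
open Polynomials ℂ-ring public

-- The WHILE language over binary trees (Jones,
-- "Computability and Complexity from a Programming Perspective"), with
-- a unit charge for every elementary tree operation.  Trees are shared
-- pointer structures, so each of these operations is a constant number of
-- pointer manipulations; decidability in polynomial time in this model
-- coincides with decidability in polynomial time by Turing machines.

data Tree : Set where
  nil  : Tree
  cons : Tree → Tree → Tree

size : Tree → ℕ
size nil        = 1
size (cons l r) = suc (size l ℕ.+ size r)

hd tl : Tree → Tree
hd nil        = nil
hd (cons l r) = l
tl nil        = nil
tl (cons l r) = r

Store : ℕ → Set
Store k = Vec Tree k

data Expr (k : ℕ) : Set where
  var   : Fin k → Expr k
  nilᴱ  : Expr k
  consᴱ : Expr k → Expr k → Expr k
  hdᴱ   : Expr k → Expr k
  tlᴱ   : Expr k → Expr k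

evalᴱ : ∀ {k} → Expr k → Store k → Tree
evalᴱ (var x)     σ = lookup σ x
evalᴱ nilᴱ        σ = nil
evalᴱ (consᴱ e f) σ = cons (evalᴱ e σ) (evalᴱ f σ)
evalᴱ (hdᴱ e)     σ = hd (evalᴱ e σ)
evalᴱ (tlᴱ e)     σ = tl (evalᴱ e σ)

cost : ∀ {k} → Expr k → ℕ
cost (var x)     = 1
cost nilᴱ        = 1
cost (consᴱ e f) = suc (cost e ℕ.+ cost f)
cost (hdᴱ e)     = suc (cost e)
cost (tlᴱ e)     = suc (cost e)

infixr 5 _﹔_
infix  6 _≔_

data Cmd (k : ℕ) : Set where
  _≔_           : Fin k → Expr k → Cmd k
  _﹔_           : Cmd k → Cmd k → Cmd k
  if_then_else_ : Expr k → Cmd k → Cmd k → Cmd k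
  while_run_    : Expr k → Cmd k → Cmd k

-- ⟨ C , σ ⟩⇓[ t ] τ : run from σ, C terminates in store τ after time t.
infix 4 ⟨_,_⟩⇓[_]_
data ⟨_,_⟩⇓[_]_ {k : ℕ} : Cmd k → Store k → ℕ → Store k → Set where
  assign : ∀ {x e σ} →
    ⟨ x ≔ e , σ ⟩⇓[ suc (cost e) ] (σ [ x ]≔ evalᴱ e σ)
  sequence : ∀ {C D σ τ υ s t} →
    ⟨ C , σ ⟩⇓[ s ] τ → ⟨ D , τ ⟩⇓[ t ] υ →
    ⟨ C ﹔ D , σ ⟩⇓[ s ℕ.+ t ] υ
  if-true : ∀ {e C D σ τ t} → evalᴱ e σ ≢ nil →
    ⟨ C , σ ⟩⇓[ t ] τ →
    ⟨ if e then C else D , σ ⟩⇓[ suc (cost e ℕ.+ t) ] τ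
  if-false : ∀ {e C D σ τ t} → evalᴱ e σ ≡ nil →
    ⟨ D , σ ⟩⇓[ t ] τ →
    ⟨ if e then C else D , σ ⟩⇓[ suc (cost e ℕ.+ t) ] τ
  while-true : ∀ {e C σ τ υ s t} → evalᴱ e σ ≢ nil →
    ⟨ C , σ ⟩⇓[ s ] τ → ⟨ while e run C , τ ⟩⇓[ t ] υ →
    ⟨ while e run C , σ ⟩⇓[ suc (cost e ℕ.+ (s ℕ.+ t)) ] υ
  while-false : ∀ {e C σ} → evalᴱ e σ ≡ nil →
    ⟨ while e run C , σ ⟩⇓[ suc (cost e) ] σ

record DecisionProblem : Set₁ where
  field
    Input  : Set
    encode : Input → Tree
    Yes    : Input → Set

-- Register zero holds the input at the start and the verdict at the end
-- (nil for "no"); all other registers start as nil.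
PolynomialTime : DecisionProblem → Set
PolynomialTime P =
  ∃[ k ] Σ (Cmd (suc k)) λ C → ∃[ a ] ∃[ e ] ∀ (x : Input) →
    ∃[ t ] Σ (Store (suc k)) λ τ →
      (⟨ C , encode x ∷ replicate k nil ⟩⇓[ t ] τ)
      × t ℕ.≤ a ℕ.* size (encode x) ℕ.^ e
      × (lookup τ zero ≢ nil ⇔ Yes x)
  where open DecisionProblem P

encodeList : ∀ {A : Set} → (A → Tree) → List A → Tree
encodeList enc []       = nil
encodeList enc (x ∷ xs) = cons (enc x) (encodeList enc xs)

encodeVec : ∀ {A : Set} {n} → (A → Tree) → Vec A n → Tree
encodeVec enc xs = encodeList enc (Vec.toList xs)

encodeUnary : ℕ → Tree
encodeUnary zero    = nil
encodeUnary (suc n) = cons nil (encodeUnary n)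

encodeℕᵇ : ℕᵇ → Tree
encodeℕᵇ ℕᵇ.zero  = nil
encodeℕᵇ 2[1+ b ] = cons nil (encodeℕᵇ b)
encodeℕᵇ 1+[2 b ] = cons (cons nil nil) (encodeℕᵇ b)

encodeBinary : ℕ → Tree
encodeBinary n = encodeℕᵇ (ℕᵇ.fromℕ n)

encodeℤ : ℤ → Tree
encodeℤ (+ n)    = cons nil (encodeBinary n)
encodeℤ -[1+ n ] = cons (cons nil nil) (encodeBinary n)

encodeℚ : ℚ → Tree
encodeℚ r = cons (encodeℤ (↥ r)) (encodeBinary (↧ₙ r))

-- A polynomial can be an input only if its coefficients have
-- finite descriptions.  They are given exactly, by rational coordinates
-- with respect to complex numbers b₁,…,b_k linearly independent over ℚ
-- (for instance, a ℚ-basis of a number field).  Classically every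
-- polynomial over ℂ can be presented in this way, since its finitely many
-- coefficients span a finite-dimensional ℚ-subspace of ℂ.

combination : ∀ {k} → Vec ℚ k → Vec ℂ k → ℂ
combination []      []      = 0ᶜ
combination (r ∷ u) (z ∷ b) = (ℚ→ℂ r *ᶜ z) +ᶜ combination u b

LinearlyIndependent : ∀ {k} → Vec ℂ k → Set
LinearlyIndependent {k} b =
  ∀ (u : Vec ℚ k) → combination u b ≈ᶜ 0ᶜ → u ≡ replicate k 0ℚ

-- a - b + c in ℤ_q
affine : ∀ {q} → Fin q → Fin q → Fin q → Fin q
affine {suc q} a b c = (toℕ a ℕ.+ (suc q ℕ.∸ toℕ b) ℕ.+ toℕ c) mod suc q

module MCSP {s : ℕ} (q : Fin s → ℕ) where

  D : Fin s → Set
  D t = Fin (q t)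

  record Relation : Set where
    field
      {arity}   : ℕ
      signature : Vec (Fin s) arity
      holds     : All D signature → Bool

  open Relation public

  infix 4 _∈ᴿ_
  _∈ᴿ_ : ∀ {k} {σ : Vec (Fin s) k} → All D σ → (All D σ → Bool) → Set
  a ∈ᴿ R = T (R a)

  affineTuple : ∀ {k} {σ : Vec (Fin s) k} →
                All D σ → All D σ → All D σ → All D σ
  affineTuple []       []       []       = []
  affineTuple (a ∷ as) (b ∷ bs) (c ∷ cs) = affine a b c ∷ affineTuple as bs cs

  AffineInvariant : Relation → Set
  AffineInvariant R = ∀ a b c →
    a ∈ᴿ holds R → b ∈ᴿ holds R → c ∈ᴿ holds R →
    affineTuple a b c ∈ᴿ holds R

  point : ∀ {k} {σ : Vec (Fin s) k} → All D σ → Vec ℂ k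
  point = Vecᴬ.reduce (λ a → ℕ→ℂ (toℕ a))

  -- On the product of the domains, f vanishes exactly on R.  "Nonzero" is
  -- expressed by an inverse, which constructively is the usual positive
  -- notion for ℂ.
  Interpolates : (R : Relation) → Poly (arity R) → Set
  Interpolates R f = ∀ (a : All D (signature R)) →
    (a ∈ᴿ holds R → eval f (point a) ≈ᶜ 0ᶜ) ×
    (¬ (a ∈ᴿ holds R) → ∃[ w ] ((eval f (point a) *ᶜ w) ≈ᶜ 1ᶜ))

  Language : ℕ → Set
  Language l = Vec Relation l

  module _ {l : ℕ} (Γ : Language l) where

    Interpolants : Set
    Interpolants = ∀ (r : Fin l) →
      Σ (Poly (arity (lookup Γ r))) (Interpolates (lookup Γ r))

    record Constraint {n : ℕ} (δ : Vec (Fin s) n) : Set where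
      field
        rel   : Fin l
        scope : All (λ t → Σ (Fin n) λ x → lookup δ x ≡ t)
                    (signature (lookup Γ rel))

      variables : Vec (Fin n) (arity (lookup Γ rel))
      variables = Vecᴬ.reduce proj₁ scope

    open Constraint public

    record Instance : Set where
      field
        {#vars}     : ℕ
        sort        : Vec (Fin s) #vars
        constraints : List (Constraint sort)

    open Instance public

    domainPoly : ∀ {n} → Vec (Fin s) n → Fin n → Poly n
    domainPoly δ x = productₚ
      (List.map (λ a → varₚ x +ₚ constₚ (-ᶜ ℕ→ℂ (toℕ a)))
                (allFin (q (lookup δ x))))

    -- Any choice F of interpolating polynomials, one per relation, is allowed.
    -- The interpolant of R, a polynomial in arity-many variables, is
    -- transported to the variables of each constraint using R.
    data Generator (F : Interpolants) (P : Instance) : Poly (#vars P) → Set where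
      domain     : ∀ x → Generator F P (domainPoly (sort P) x)
      constraint : ∀ {C} → C ∈ constraints P →
                   Generator F P (rename (variables C) (proj₁ (F (rel C))))

    record IMPInput (d : ℕ) : Set where
      field
        inst        : Instance
        {dim}       : ℕ
        basis       : Vec ℂ dim
        independent : LinearlyIndependent basis
        terms       : List (Vec ℚ dim × Monomial (#vars inst))
        deg≤d       : Listᴬ.All (λ (_ , α) → Vec.sum α ℕ.≤ d) terms

      poly : Poly (#vars inst)
      poly = List.map (λ (u , α) → combination u basis , α) terms

    encodeConstraint : ∀ {n} {δ : Vec (Fin s) n} → Constraint δ → Tree
    encodeConstraint C =
      cons (encodeUnary (toℕ (rel C)))
           (encodeVec (λ x → encodeUnary (toℕ x)) (variables C))

    encodeInstance : Instance → Tree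
    encodeInstance P =
      cons (encodeVec (λ t → encodeUnary (toℕ t)) (sort P))
           (encodeList encodeConstraint (constraints P))

    -- The basis is not transmitted: an algorithm sees only coordinates.
    encodeInput : ∀ {d} → IMPInput d → Tree
    encodeInput x =
      cons (encodeInstance inst)
           (encodeList
             (λ (u , α) → cons (encodeVec encodeℚ u) (encodeVec encodeUnary α))
             terms)
      where open IMPInput x

    IMP : Interpolants → ℕ → DecisionProblem
    IMP F d = record
      { Input  = IMPInput d
      ; encode = encodeInput
      ; Yes    = λ x → IMPInput.poly x ∈⟨ Generator F (IMPInput.inst x) ⟩
      }

{-# OPTIONS --safe #-}

-- A polynomial f lies in the ideal exactly if it vanishes on the solution set S.  Domain
-- polynomials split into comaximal factors x - b, so only f modulo the maximal ideals of the
-- points of the product of the domains matters.  At a point outside S some interpolant is a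
-- unit, and at a point of S all generators vanish.
--
-- Write f = Σ u_α x^α.  Since the basis is independent over ℚ, f vanishes on S exactly if each
-- rational coordinate f_j does.  The sum Σ_{a ∈ S} f_j(a)² vanishes exactly if the sums
-- Σ_α u_{α,j} Σ_{a ∈ S} a^{α+β} do for all monomials x^β of f, because it is a combination of
-- them.  Up to the factor |S|, the inner sums are the moments of the uniform distribution on S of
-- monomials with at most 2d variables.
--
-- An affine invariant relation is a product over the sorts of solution sets of linear systems
-- modulo q = p^m: over coprime moduli the affine combinations of tuples can be chosen for each
-- sort separately.  Modulo a prime power, of any two elements one is a multiple of the other, so
-- unknowns are eliminated one at a time: a pivot row clears all others and is then multiplied by
-- a generator of the annihilator of its leading coefficient.  A moment is computed by fixing the
-- at most 2d variables that occur in the monomial to each of their values and eliminating the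
-- others.  Each elimination multiplies the number of solutions by a factor that depends on the
-- coefficients of the system only, hence is the same in all branches and cancels in the quotient
-- by |S|.

module Submission where

-- The solution set may be exponentially large, so only the values of boundedly many variables are
-- enumerated. The language is fixed, so whatever depends on it alone (the equations of each
-- relation, arithmetic modulo a common multiple Q of the moduli, pivots, annihilators) is a finite
-- table built into the program. The interpolants matter only through their zeros, and the algorithm
-- never sees them. An empty relation has no linear system; instances that use one are accepted at
-- once.
--
-- Running times are proved along with the programs. Combinators return a program together with a
-- time bound, a bound for the size of the result and a proof that it computes a given function on
-- all encoded arguments, also those that describe no instance. Composing such bounds is harmless,
-- iterating them is not: a loop body could square its accumulator in every round. Hence each loop
-- needs an estimate made in advance, by a measure that grows additively or, for systems of
-- equations, by their number of coefficients, which elimination does not increase.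

open import Data.Product.Base using (∃-syntax; _×_; _,_; proj₁; proj₂; uncurry; Σ)
open import Data.Fin.Base using (Fin; zero; suc; toℕ)
open import Function.Bundles using (_⇔_; mk⇔; Equivalence)

-- Combinators for tree programs with polynomial time and space bounds

module TreePrograms where

  open import Defs
  open import Data.Bool.Base using (Bool; true; false) renaming (if_then_else_ to if′_then_else_)
  open import Data.List.Base using (List; []; _∷_; length; foldl; take; replicate)
  open import Data.Nat.Base
  open import Data.Nat.Properties
  open import Data.Nat.Solver using (module +-*-Solver)
  open import Data.Vec.Base using ([]; _∷_; _[_]≔_)
  open import Relation.Binary.PropositionalEquality
  open +-*-Solver using (solve; _:+_; _:*_; _:=_; con)

  infixl 6 _⊕_
  infixl 7 _⊙_
  infixr 9 _∘ᵇ_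

  -- Bounds are syntax closed under composition. Monotonicity, needed whenever a bound is applied to
  -- a mere estimate of a size, and the final form a n^e are then each obtained by one induction.
  data Bd : Set where
    κ    : ℕ → Bd
    X    : Bd
    _⊕_ _⊙_ _∘ᵇ_ : Bd → Bd → Bd

  ⟦_⟧ : Bd → ℕ → ℕ
  ⟦ κ c ⟧    n = c
  ⟦ X ⟧      n = n
  ⟦ p ⊕ q ⟧  n = ⟦ p ⟧ n + ⟦ q ⟧ n
  ⟦ p ⊙ q ⟧  n = ⟦ p ⟧ n * ⟦ q ⟧ n
  ⟦ p ∘ᵇ q ⟧ n = ⟦ p ⟧ (⟦ q ⟧ n)

  ⟦⟧-mono : ∀ p {m n} → m ≤ n → ⟦ p ⟧ m ≤ ⟦ p ⟧ n
  ⟦⟧-mono (κ c)    m≤n = ≤-refl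
  ⟦⟧-mono X        m≤n = m≤n
  ⟦⟧-mono (p ⊕ q)  m≤n = +-mono-≤ (⟦⟧-mono p m≤n) (⟦⟧-mono q m≤n)
  ⟦⟧-mono (p ⊙ q)  m≤n = *-mono-≤ (⟦⟧-mono p m≤n) (⟦⟧-mono q m≤n)
  ⟦⟧-mono (p ∘ᵇ q) m≤n = ⟦⟧-mono p (⟦⟧-mono q m≤n)

  ^-distribˡ-* : ∀ a b e → (a * b) ^ e ≡ a ^ e * b ^ e
  ^-distribˡ-* a b zero    = refl
  ^-distribˡ-* a b (suc e) = trans (cong (a * b *_) (^-distribˡ-* a b e))
    (solve 4 (λ a b x y → (a :* b) :* (x :* y) := (a :* x) :* (b :* y)) refl a b (a ^ e) (b ^ e))

  ⟦⟧-polynomial : ∀ p → ∃[ a ] ∃[ e ] (∀ n → 1 ≤ n → ⟦ p ⟧ n ≤ a * n ^ e)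
  ⟦⟧-polynomial (κ c) = c , 0 , λ n _ → ≤-reflexive (sym (*-identityʳ c))
  ⟦⟧-polynomial X     = 1 , 1 , λ n _ →
    ≤-reflexive (sym (trans (*-identityˡ (n * 1)) (*-identityʳ n)))
  ⟦⟧-polynomial (p ⊕ q) with ⟦⟧-polynomial p | ⟦⟧-polynomial q
  ... | a , e , ha | b , f , hb = a + b , e + f , λ { n@(suc _) 1≤n → begin
    ⟦ p ⟧ n + ⟦ q ⟧ n             ≤⟨ +-mono-≤ (ha n 1≤n) (hb n 1≤n) ⟩
    a * n ^ e + b * n ^ f         ≤⟨ +-mono-≤ (*-monoʳ-≤ a (^-monoʳ-≤ n (m≤m+n e f)))
                                              (*-monoʳ-≤ b (^-monoʳ-≤ n (m≤n+m f e))) ⟩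
    a * n ^ (e + f) + b * n ^ (e + f) ≡⟨ *-distribʳ-+ (n ^ (e + f)) a b ⟨
    (a + b) * n ^ (e + f) ∎ }
    where open ≤-Reasoning
  ⟦⟧-polynomial (p ⊙ q) with ⟦⟧-polynomial p | ⟦⟧-polynomial q
  ... | a , e , ha | b , f , hb = a * b , e + f , λ n 1≤n → begin
    ⟦ p ⟧ n * ⟦ q ⟧ n             ≤⟨ *-mono-≤ (ha n 1≤n) (hb n 1≤n) ⟩
    (a * n ^ e) * (b * n ^ f)
      ≡⟨ solve 4 (λ a b x y → (a :* x) :* (b :* y) := (a :* b) :* (x :* y)) refl a b (n ^ e) (n ^ f) ⟩
    a * b * (n ^ e * n ^ f)       ≡⟨ cong (a * b *_) (^-distribˡ-+-* n e f) ⟨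
    a * b * n ^ (e + f) ∎
    where open ≤-Reasoning
  ⟦⟧-polynomial (p ∘ᵇ q) with ⟦⟧-polynomial p | ⟦⟧-polynomial q
  ... | a , e , ha | b , f , hb = a * suc b ^ e , f * e , λ { n@(suc k) 1≤n → begin
    -- `suc b` in place of `b` keeps the inner argument at least 1, where the bound for `p` applies,
    -- even if `b` is 0.
    ⟦ p ⟧ (⟦ q ⟧ n)               ≤⟨ ⟦⟧-mono p (≤-trans (hb n 1≤n) (*-monoˡ-≤ (n ^ f) (n≤1+n b))) ⟩
    ⟦ p ⟧ (suc b * n ^ f)         ≤⟨ ha _ (≤-trans (m^n>0 n f) (m≤m+n _ (b * n ^ f))) ⟩
    a * (suc b * n ^ f) ^ e       ≡⟨ cong (a *_) (^-distribˡ-* (suc b) (n ^ f) e) ⟩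
    a * (suc b ^ e * (n ^ f) ^ e) ≡⟨ *-assoc a (suc b ^ e) _ ⟨
    a * suc b ^ e * (n ^ f) ^ e   ≡⟨ cong (a * suc b ^ e *_) (^-*-assoc n f e) ⟩
    a * suc b ^ e * n ^ (f * e) ∎ }
    where open ≤-Reasoning

  infixr 5 _⊗_

  -- The types name encodings, not sets: `un` and `bin` both mean ℕ. Exponents and variable indices
  -- come in unary and can drive loops; coefficients and the numbers computed from them need the
  -- binary form.
  data Ty : Set where
    un bin bool : Ty
    fin  : ℕ → Ty
    _⊗_  : Ty → Ty → Ty
    list : Ty → Ty

  El : Ty → Set
  El un       = ℕ
  El bin      = ℕ
  El bool     = Bool
  El (fin n)  = Fin n
  El (A ⊗ B)  = El A × El B
  El (list A) = List (El A)

  enc : ∀ A → El A → Tree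
  enc un       n       = encodeUnary n
  enc bin      n       = encodeBinary n
  enc bool     false   = nil
  enc bool     true    = cons nil nil
  enc (fin n)  i       = encodeUnary (toℕ i)
  enc (A ⊗ B)  (a , b) = cons (enc A a) (enc B b)
  enc (list A) as      = encodeList (enc A) as

  sz : ∀ A → El A → ℕ
  sz A x = size (enc A x)

  1≤size : ∀ t → 1 ≤ size t
  1≤size nil        = s≤s z≤n
  1≤size (cons _ _) = s≤s z≤n

  1≤sz : ∀ A x → 1 ≤ sz A x
  1≤sz A x = 1≤size (enc A x)

  Exec : Cmd 2 → Store 2 → Store 2 → ℕ → Set
  Exec C σ τ b = ∃[ t ] (⟨ C , σ ⟩⇓[ t ] τ × t ≤ b)

  -- Register zero carries the current value and register one a stack of
  -- saved values, which a program leaves as it found it.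
  r0 r1 : Fin 2
  r0 = zero
  r1 = suc zero

  weaken : ∀ {C σ τ b c} → b ≤ c → Exec C σ τ b → Exec C σ τ c
  weaken b≤c (t , ev , t≤b) = t , ev , ≤-trans t≤b b≤c

  asn : ∀ x e {σ} → Exec (x ≔ e) σ (σ [ x ]≔ evalᴱ e σ) (suc (cost e))
  asn x e = _ , assign , ≤-refl

  infixr 5 _▹_
  _▹_ : ∀ {C D σ τ υ b c} → Exec C σ τ b → Exec D τ υ c → Exec (C ﹔ D) σ υ (b + c)
  (_ , ev₁ , le₁) ▹ (_ , ev₂ , le₂) = _ , sequence ev₁ ev₂ , +-mono-≤ le₁ le₂

  -- `space` is recorded beside `time` because a composite charges its second program at the size of
  -- the intermediate value. The universal `s` says that a program works on top of any stack and
  -- restores it, so pairs and loops can save data beneath a running program.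
  record PT (A B : Ty) (f : El A → El B) : Set where
    field
      prog  : Cmd 2
      time  : Bd
      space : Bd
      runs  : ∀ x s → Exec prog (enc A x ∷ s ∷ []) (enc B (f x) ∷ s ∷ []) (⟦ time ⟧ (sz A x))
      small : ∀ x → sz B (f x) ≤ ⟦ space ⟧ (sz A x)
  open PT public

  lift : Expr 1 → Expr 2
  lift (var _)     = var r0
  lift nilᴱ        = nilᴱ
  lift (consᴱ e f) = consᴱ (lift e) (lift f)
  lift (hdᴱ e)     = hdᴱ (lift e)
  lift (tlᴱ e)     = tlᴱ (lift e)

  eval-lift : ∀ e t s → evalᴱ (lift e) (t ∷ s ∷ []) ≡ evalᴱ e (t ∷ [])
  eval-lift (var zero)  t s = refl
  eval-lift nilᴱ        t s = refl
  eval-lift (consᴱ e f) t s = cong₂ cons (eval-lift e t s) (eval-lift f t s)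
  eval-lift (hdᴱ e)     t s = cong hd (eval-lift e t s)
  eval-lift (tlᴱ e)     t s = cong tl (eval-lift e t s)

  size-hd : ∀ t → size (hd t) ≤ size t
  size-hd nil        = ≤-refl
  size-hd (cons l r) = m≤n⇒m≤1+n (m≤m+n (size l) (size r))

  size-tl : ∀ t → size (tl t) ≤ size t
  size-tl nil        = ≤-refl
  size-tl (cons l r) = m≤n⇒m≤1+n (m≤n+m (size r) (size l))

  size-eval : ∀ e t → size (evalᴱ e (t ∷ [])) ≤ cost e * size t
  size-eval (var zero) t = ≤-reflexive (sym (*-identityˡ (size t)))
  size-eval nilᴱ t = ≤-trans (1≤size t) (≤-reflexive (sym (*-identityˡ (size t))))
  size-eval (consᴱ e f) t = +-mono-≤ (1≤size t)
    (≤-trans (+-mono-≤ (size-eval e t) (size-eval f t))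
      (≤-reflexive (sym (*-distribʳ-+ (size t) (cost e) (cost f)))))
  size-eval (hdᴱ e) t = ≤-trans (size-hd (evalᴱ e (t ∷ [])))
    (≤-trans (size-eval e t) (m≤n+m _ (size t)))
  size-eval (tlᴱ e) t = ≤-trans (size-tl (evalᴱ e (t ∷ [])))
    (≤-trans (size-eval e t) (m≤n+m _ (size t)))

  abstract
    exprP : ∀ {A B f} (e : Expr 1) →
      (∀ x → evalᴱ e (enc A x ∷ []) ≡ enc B (f x)) → PT A B f
    exprP {A} {B} {f} e eq = record
      { prog  = r0 ≔ lift e
      ; time  = κ (suc (cost (lift e)))
      ; space = κ (cost e) ⊙ X
      ; runs  = λ x s → subst (λ t → Exec (r0 ≔ lift e) _ (t ∷ s ∷ []) _)
                  (trans (eval-lift e (enc A x) s) (eq x)) (asn r0 (lift e))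
      ; small = λ x → subst (λ t → size t ≤ cost e * sz A x) (eq x) (size-eval e (enc A x))
      }

    infixr 9 _∘ᴾ_
    _∘ᴾ_ : ∀ {A B C f g} → PT B C f → PT A B g → PT A C (λ x → f (g x))
    _∘ᴾ_ {A} {B} {C} {f} {g} F G = record
      { prog  = prog G ﹔ prog F
      ; time  = time G ⊕ (time F ∘ᵇ space G)
      ; space = space F ∘ᵇ space G
      ; runs  = λ x s → runs G x s ▹ weaken (⟦⟧-mono (time F) (small G x)) (runs F (g x) s)
      ; small = λ x → ≤-trans (small F (g x)) (⟦⟧-mono (space F) (small G x))
      }

    infixr 4 _,ᴾ_
    _,ᴾ_ : ∀ {A B C f g} → PT A B f → PT A C g → PT A (B ⊗ C) (λ x → f x , g x)
    F ,ᴾ G = record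
      -- The input is saved while F runs; the result of F then takes its place on the stack while G
      -- runs on the input.
      { prog  = (r1 ≔ consᴱ (var r0) (var r1)) ﹔ prog F
              ﹔ (r0 ≔ consᴱ (var r0) (var r1))
              ﹔ (r1 ≔ consᴱ (hdᴱ (var r0)) (tlᴱ (tlᴱ (var r0))))
              ﹔ (r0 ≔ hdᴱ (tlᴱ (var r0))) ﹔ prog G
              ﹔ (r0 ≔ consᴱ (hdᴱ (var r1)) (var r0)) ﹔ (r1 ≔ tlᴱ (var r1))
      ; time  = κ 4 ⊕ (time F ⊕ (κ 4 ⊕ (κ 7 ⊕ (κ 4 ⊕ (time G ⊕ (κ 5 ⊕ κ 3))))))
      ; space = κ 1 ⊕ (space F ⊕ space G)
      ; runs  = λ x s → asn _ _ ▹ runs F x _ ▹ asn _ _ ▹ asn _ _ ▹ asn _ _ ▹ runs G x _ ▹ asn _ _ ▹ asn _ _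
      ; small = λ x → s≤s (+-mono-≤ (small F x) (small G x))
      }

    extP : ∀ {A B f g} → (∀ x → f x ≡ g x) → PT A B f → PT A B g
    extP {A} {B} eq F = record
      { prog  = prog F
      ; time  = time F
      ; space = space F
      ; runs  = λ x s → subst (λ y → Exec (prog F) _ (enc B y ∷ s ∷ []) _) (eq x) (runs F x s)
      ; small = λ x → subst (λ y → sz B y ≤ _) (eq x) (small F x)
      }

  idP : ∀ {A} → PT A A (λ x → x)
  idP = exprP (var zero) (λ _ → refl)

  fstP : ∀ {A B} → PT (A ⊗ B) A proj₁
  fstP = exprP (hdᴱ (var zero)) (λ _ → refl)

  sndP : ∀ {A B} → PT (A ⊗ B) B proj₂
  sndP = exprP (tlᴱ (var zero)) (λ _ → refl)

  reify : Tree → Expr 1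
  reify nil        = nilᴱ
  reify (cons l r) = consᴱ (reify l) (reify r)

  eval-reify : ∀ t {σ} → evalᴱ (reify t) σ ≡ t
  eval-reify nil        = refl
  eval-reify (cons l r) = cong₂ cons (eval-reify l) (eval-reify r)

  constP : ∀ {A} B (b : El B) → PT A B (λ _ → b)
  constP B b = exprP (reify (enc B b)) (λ _ → eval-reify (enc B b))

  recode : ∀ {A B f} → (∀ x → enc A x ≡ enc B (f x)) → PT A B f
  recode eq = exprP (var zero) eq

  consP : ∀ {A} → PT (A ⊗ list A) (list A) (uncurry _∷_)
  consP = exprP (var zero) (λ _ → refl)

  infixr 5 _∷ᴾ_
  _∷ᴾ_ : ∀ {Γ A a as} → PT Γ A a → PT Γ (list A) as → PT Γ (list A) (λ x → a x ∷ as x)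
  a ∷ᴾ as = consP ∘ᴾ (a ,ᴾ as)

  []ᴾ : ∀ {Γ A} → PT Γ (list A) (λ _ → [])
  []ᴾ {A = A} = constP (list A) []

  sucP : PT un un suc
  sucP = exprP (consᴱ nilᴱ (var zero)) (λ _ → refl)

  -- Both sides are the same tree, so a unary number becomes a loop counter by mere
  -- reinterpretation.
  unit-list : PT un (list un) (λ n → replicate n 0)
  unit-list = recode go
    where
    go : ∀ n → encodeUnary n ≡ encodeList encodeUnary (replicate n 0)
    go zero    = refl
    go (suc n) = cong (cons nil) (go n)

  v0 : ∀ {Γ A} → PT (Γ ⊗ A) A proj₂
  v0 = sndP
  v1 : ∀ {Γ A B} → PT ((Γ ⊗ A) ⊗ B) A (λ x → proj₂ (proj₁ x))
  v1 = sndP ∘ᴾ fstP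
  v2 : ∀ {Γ A B C} → PT (((Γ ⊗ A) ⊗ B) ⊗ C) A (λ x → proj₂ (proj₁ (proj₁ x)))
  v2 = v1 ∘ᴾ fstP

  caseList : ∀ {A Γ B : Set} → (Γ → B) → ((Γ × A) × List A → B) → List A × Γ → B
  caseList g h ([] , x)     = g x
  caseList g h (a ∷ as , x) = h ((x , a) , as)

  abstract
    ifP : ∀ {A B c f g} → PT A bool c → PT A B f → PT A B g →
      PT A B (λ x → if′ c x then f x else g x)
    ifP {A} {B} {c} {f} {g} P F G = record
      { prog  = prog P′ ﹔ (if hdᴱ (var r0) then ((r0 ≔ tlᴱ (var r0)) ﹔ prog F)
                                           else ((r0 ≔ tlᴱ (var r0)) ﹔ prog G))
      ; time  = time P′ ⊕ (κ 6 ⊕ (time F ⊕ time G))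
      ; space = space F ⊕ space G
      ; runs  = λ x s → runs P′ x s ▹ select x s
      ; small = sm
      }
      where
      P′ : PT A (bool ⊗ A) (λ x → c x , x)
      P′ = P ,ᴾ idP
      select : ∀ x s → Exec (if hdᴱ (var r0) then ((r0 ≔ tlᴱ (var r0)) ﹔ prog F)
                                             else ((r0 ≔ tlᴱ (var r0)) ﹔ prog G))
        (cons (enc bool (c x)) (enc A x) ∷ s ∷ [])
        (enc B (if′ c x then f x else g x) ∷ s ∷ [])
        (6 + (⟦ time F ⟧ (sz A x) + ⟦ time G ⟧ (sz A x)))
      select x s with c x
      ... | true  = let _ , r , le = asn r0 (tlᴱ (var r0)) ▹ runs F x s in
        _ , if-true (λ ()) r , s≤s (s≤s (s≤s (≤-trans le (+-monoʳ-≤ 3 (m≤m+n _ _)))))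
      ... | false = let _ , r , le = asn r0 (tlᴱ (var r0)) ▹ runs G x s in
        _ , if-false refl r , s≤s (s≤s (s≤s (≤-trans le (+-monoʳ-≤ 3 (m≤n+m _ _)))))
      sm : ∀ x → sz B (if′ c x then f x else g x) ≤ ⟦ space F ⟧ (sz A x) + ⟦ space G ⟧ (sz A x)
      sm x with c x
      ... | true  = ≤-trans (small F x) (m≤m+n _ _)
      ... | false = ≤-trans (small G x) (m≤n+m _ _)

    caseFinP : ∀ {n Γ B g} {f : El (fin n ⊗ Γ) → El B} → PT Γ B g → PT (fin n ⊗ Γ) B f →
      PT (fin (suc n) ⊗ Γ) B (λ { (zero , x) → g x ; (suc i , x) → f (i , x) })
    caseFinP {n} {Γ} {B} {g} {f} G F = record
      { prog  = if hdᴱ (var r0) then ((r0 ≔ consᴱ (tlᴱ (hdᴱ (var r0))) (tlᴱ (var r0))) ﹔ prog F)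
                                else ((r0 ≔ tlᴱ (var r0)) ﹔ prog G)
      ; time  = κ 20 ⊕ (time F ⊕ time G)
      ; space = space F ⊕ space G
      ; runs  = λ
        { (zero , x) s → let _ , r , le = asn r0 (tlᴱ (var r0)) ▹ runs G x s in
            _ , if-false refl r , ≤-trans (+-monoʳ-≤ 3 le)
              (+-mono-≤ {6} {20} (m≤m+n 6 14) (≤-trans (⟦⟧-mono (time G) (m≤n+m _ 2)) (m≤n+m _ _)))
        ; (suc i , x) s → let _ , r , le = asn r0 _ ▹ runs F (i , x) s in
            _ , if-true (λ ()) r , ≤-trans (+-monoʳ-≤ 3 le)
              (+-mono-≤ {10} {20} (m≤m+n 10 10) (≤-trans (⟦⟧-mono (time F) (m≤n+m _ 2)) (m≤m+n _ _))) }
      ; small = λ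
        { (zero , x)  → ≤-trans (≤-trans (small G x) (⟦⟧-mono (space G) (m≤n+m _ 2))) (m≤n+m _ _)
        ; (suc i , x) → ≤-trans (≤-trans (small F (i , x)) (⟦⟧-mono (space F) (m≤n+m _ 2))) (m≤m+n _ _) }
      }

    caseListP : ∀ {A Γ B g h} → PT Γ B g → PT ((Γ ⊗ A) ⊗ list A) B h →
      PT (list A ⊗ Γ) B (caseList g h)
    caseListP {A} {Γ} {B} {g} {h} G H = record
      { prog  = if hdᴱ (var r0) then ((r0 ≔ consᴱ (consᴱ (tlᴱ (var r0)) (hdᴱ (hdᴱ (var r0)))) (tlᴱ (hdᴱ (var r0)))) ﹔ prog H)
                                else ((r0 ≔ tlᴱ (var r0)) ﹔ prog G)
      ; time  = κ 20 ⊕ (time H ⊕ time G)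
      ; space = space H ⊕ space G
      ; runs  = λ
        { ([] , x) s → let _ , r , le = asn r0 (tlᴱ (var r0)) ▹ runs G x s in
            _ , if-false refl r , ≤-trans (+-monoʳ-≤ 3 le)
              (+-mono-≤ {6} {20} (m≤m+n 6 14) (≤-trans (⟦⟧-mono (time G) (m≤n+m _ 2)) (m≤n+m _ _)))
        ; (a ∷ as , x) s → let _ , r , le = asn r0 _ ▹ runs H ((x , a) , as) s in
            _ , if-true (λ ()) r , ≤-trans (+-monoʳ-≤ 3 le)
              (+-mono-≤ {14} {20} (m≤m+n 14 6) (≤-trans (⟦⟧-mono (time H) (swapped x a as)) (m≤m+n _ _))) }
      ; small = λ
        { ([] , x)     → ≤-trans (≤-trans (small G x) (⟦⟧-mono (space G) (m≤n+m _ 2))) (m≤n+m _ _)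
        ; (a ∷ as , x) → ≤-trans (≤-trans (small H ((x , a) , as)) (⟦⟧-mono (space H) (swapped x a as))) (m≤m+n _ _) }
      }
      where
      swapped : ∀ x a as → sz ((Γ ⊗ A) ⊗ list A) ((x , a) , as) ≤ sz (list A ⊗ Γ) (a ∷ as , x)
      swapped x a as = ≤-reflexive
        (solve 3 (λ x a as → con 1 :+ ((con 1 :+ (x :+ a)) :+ as) := con 1 :+ ((con 1 :+ (a :+ as)) :+ x)) refl
          (sz Γ x) (sz A a) (sz (list A) as))

  length≤sz : ∀ A (as : El (list A)) → length as ≤ sz (list A) as
  length≤sz A []       = z≤n
  length≤sz A (a ∷ as) = s≤s (≤-trans (length≤sz A as) (m≤n+m _ (sz A a)))

  sz-take : ∀ A k (as : El (list A)) → sz (list A) (take k as) ≤ sz (list A) as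
  sz-take A zero    as       = 1≤sz (list A) as
  sz-take A (suc k) []       = ≤-refl
  sz-take A (suc k) (a ∷ as) = s≤s (+-monoʳ-≤ (sz A a) (sz-take A k as))

  module Loop {Γ A B : Ty} {f : El ((Γ ⊗ B) ⊗ A) → El B} (F : PT ((Γ ⊗ B) ⊗ A) B f) where

    step : El Γ → El B → El A → El B
    step g b a = f ((g , b) , a)

    -- The whole state ((g , b) , as) is pushed because the body of the fold consumes its argument;
    -- `g` and the rest of the list are read back from the stack afterwards.
    body loop : Cmd 2
    body = (r1 ≔ consᴱ (var r0) (var r1))
         ﹔ (r0 ≔ consᴱ (hdᴱ (var r0)) (hdᴱ (tlᴱ (var r0))))
         ﹔ prog F
         ﹔ (r0 ≔ consᴱ (consᴱ (hdᴱ (hdᴱ (hdᴱ (var r1)))) (var r0)) (tlᴱ (tlᴱ (hdᴱ (var r1)))))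
         ﹔ (r1 ≔ tlᴱ (var r1))
    loop = while tlᴱ (var r0) run body

    store : El Γ → El B → El (list A) → Tree → Store 2
    store g b as s = enc ((Γ ⊗ B) ⊗ list A) ((g , b) , as) ∷ s ∷ []

    body-runs : ∀ g b a as s → Exec body (store g b (a ∷ as) s) (store g (step g b a) as s)
      (4 + (7 + (⟦ time F ⟧ (sz ((Γ ⊗ B) ⊗ A) ((g , b) , a)) + (12 + 3))))
    body-runs g b a as s = asn _ _ ▹ asn _ _ ▹ runs F ((g , b) , a) _ ▹ asn _ _ ▹ asn _ _

    -- Every round is charged alike, at the largest accumulator, so `V` has to bound the accumulator
    -- after each prefix of the list. A round costs 29 besides F: 3 for the guard and 26 for moving
    -- data. The last 3 pays for the guard that fails.
    iterate : ∀ L V g as b s → sz (list A) as ≤ L →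
      (∀ k → sz B (foldl (step g) b (take k as)) ≤ V) →
      Exec loop (store g b as s) (store g (foldl (step g) b as) [] s)
                (length as * (29 + ⟦ time F ⟧ (2 + (sz Γ g + L) + V)) + 3)
    iterate L V g []       b s as≤L H = _ , while-false refl , ≤-refl
    iterate L V g (a ∷ as) b s as≤L H =
      let _ , ev  , le  = body-runs g b a as s
          _ , ev′ , le′ = iterate L V g as (step g b a) s
                            (≤-trans (≤-trans (m≤n+m _ (sz A a)) (n≤1+n _)) as≤L) (λ k → H (suc k))
      in _ , while-true (λ ()) ev ev′ ,
         ≤-trans (s≤s (+-monoʳ-≤ 2 (+-mono-≤ (≤-trans le (+-monoʳ-≤ 11 (+-monoˡ-≤ 15 (⟦⟧-mono (time F) gb≤)))) le′)))
                 (bounding (⟦ time F ⟧ (2 + (sz Γ g + L) + V)) (length as))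
      where
      gb≤ : sz ((Γ ⊗ B) ⊗ A) ((g , b) , a) ≤ 2 + (sz Γ g + L) + V
      gb≤ = ≤-trans (≤-reflexive (solve 3 (λ g b a → con 1 :+ ((con 1 :+ (g :+ b)) :+ a)
                                     := con 2 :+ (g :+ a) :+ b) refl (sz Γ g) (sz B b) (sz A a)))
              (+-mono-≤ (+-monoʳ-≤ (2 + sz Γ g) (≤-trans (≤-trans (m≤m+n _ _) (n≤1+n _)) as≤L)) (H 0))
      bounding : ∀ t n → 3 + ((4 + (7 + (t + 15))) + (n * (29 + t) + 3)) ≤ suc n * (29 + t) + 3
      bounding t n = ≤-reflexive
        (solve 2 (λ t n → con 3 :+ ((con 4 :+ (con 7 :+ (t :+ con 15))) :+ (n :* (con 29 :+ t) :+ con 3))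
                       := (con 1 :+ n) :* (con 29 :+ t) :+ con 3) refl t n)

    abstract
      -- The bound on the fold is required for all lists; applied to prefixes it controls every
      -- intermediate accumulator, which the time bound of the body alone could not do.
      loopP : (bound : Bd) →
        (∀ g b as → sz B (foldl (step g) b as) ≤ ⟦ bound ⟧ (sz ((Γ ⊗ B) ⊗ list A) ((g , b) , as))) →
        PT ((Γ ⊗ B) ⊗ list A) B (λ ((g , b) , as) → foldl (λ b a → f ((g , b) , a)) b as)
      loopP bound bounded = record
        { prog  = loop ﹔ (r0 ≔ hdᴱ (var r0)) ﹔ (r0 ≔ tlᴱ (var r0))
        ; time  = ((X ⊙ (κ 29 ⊕ (time F ∘ᵇ (X ⊕ bound)))) ⊕ κ 3) ⊕ (κ 3 ⊕ κ 3)
        ; space = bound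
        ; runs  = λ ((g , b) , as) s →
            weaken (+-monoˡ-≤ 3 (*-mono-≤
                (≤-trans (length≤sz A as) (m≤n+m _ (suc (sz (Γ ⊗ B) (g , b)))))
                (+-monoʳ-≤ 29 (⟦⟧-mono (time F) (+-monoˡ-≤ _
                  (s≤s (s≤s (+-monoˡ-≤ (sz (list A) as) (m≤m+n (sz Γ g) (sz B b))))))))))
              (iterate (sz (list A) as) (⟦ bound ⟧ (sz ((Γ ⊗ B) ⊗ list A) ((g , b) , as))) g as b s ≤-refl
                (λ k → ≤-trans (bounded g b (take k as))
                         (⟦⟧-mono bound (s≤s (+-monoʳ-≤ (sz (Γ ⊗ B) (g , b)) (sz-take A k as))))))
            ▹ asn _ _ ▹ asn _ _
        ; small = λ ((g , b) , as) → bounded g b as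
        }

  open Loop public using (loopP)

-- List functions and finite tables as polynomial-time programs

module ListPrograms where

  open import Defs
  open TreePrograms
  open import Data.Bool.Base using (true; false; _∧_) renaming (if_then_else_ to if′_then_else_)
  open import Data.List.Base using (List; []; _∷_; length; foldl; foldr; map; concatMap; reverse; _ʳ++_; _++_; zip; null)
  open import Data.Bool.ListAction using (all)
  open import Data.List.Properties
  open import Data.Nat.Base
  open import Data.Nat.Properties
  open import Data.Nat.Solver using (module +-*-Solver)
  open import Relation.Binary.PropositionalEquality
  open +-*-Solver using (solve; _:+_; _:*_; _:=_; con)

  foldP : ∀ {Γ A B l z f} → PT Γ (list A) l → PT Γ B z → (F : PT ((Γ ⊗ B) ⊗ A) B f) → (bound : Bd) →
    (∀ g b as → sz B (foldl (λ b a → f ((g , b) , a)) b as) ≤ ⟦ bound ⟧ (sz ((Γ ⊗ B) ⊗ list A) ((g , b) , as))) →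
    PT Γ B (λ x → foldl (λ b a → f ((x , b) , a)) (z x) (l x))
  foldP l z F bound bounded = loopP F bound bounded ∘ᴾ ((idP ,ᴾ z) ,ᴾ l)

  -- A loop is safe if a measure comparable to the size grows in each round by an amount that
  -- depends on the context and the current element but not on the accumulator. For lists the
  -- measure is the size itself, for numbers the number of digits; `k` bounds the size per unit of
  -- measure.
  foldμP : ∀ {Γ A B l z f} → PT Γ (list A) l → PT Γ B z → (F : PT ((Γ ⊗ B) ⊗ A) B f) →
    (μ : El B → ℕ) (k : ℕ) (inc : Bd) →
    (∀ b → μ b ≤ sz B b) → (∀ b → sz B b ≤ k * suc (μ b)) →
    (∀ g b a → μ (f ((g , b) , a)) ≤ μ b + ⟦ inc ⟧ (sz (Γ ⊗ A) (g , a))) →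
    PT Γ B (λ x → foldl (λ b a → f ((x , b) , a)) (z x) (l x))
  foldμP {Γ} {A} {B} {f = f} l z F μ k inc μ≤sz sz≤μ additive =
    foldP l z F (κ k ⊙ (κ 1 ⊕ (X ⊕ X ⊙ inc))) λ g b as →
      ≤-trans (sz≤μ _) (*-monoʳ-≤ k (s≤s (≤-trans (grows (sz Γ g + sz (list A) as) g b as (+-monoʳ-≤ (sz Γ g) ≤-refl))
        (+-mono-≤ (≤-trans (μ≤sz b) (≤-trans (m≤n+m _ (sz Γ g)) (≤-trans (n≤1+n _) (≤-trans (m≤m+n _ _) (n≤1+n _)))))
          (*-mono-≤ (≤-trans (length≤sz A as) (m≤n+m _ (suc (sz (Γ ⊗ B) (g , b)))))
            (⟦⟧-mono inc (s≤s (m≤n⇒m≤1+n (+-monoˡ-≤ (sz (list A) as) (m≤m+n (sz Γ g) (sz B b)))))))))))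
    where
    grows : ∀ n g b as → sz Γ g + sz (list A) as ≤ n →
      μ (foldl (λ b a → f ((g , b) , a)) b as) ≤ μ b + length as * ⟦ inc ⟧ (suc n)
    grows n g b []       le = m≤m+n (μ b) 0
    grows n g b (a ∷ as) le = begin
      μ (foldl (λ b a → f ((g , b) , a)) (f ((g , b) , a)) as)
        ≤⟨ grows n g (f ((g , b) , a)) as (≤-trans (+-monoʳ-≤ (sz Γ g) (m≤n⇒m≤1+n (m≤n+m _ (sz A a)))) le) ⟩
      μ (f ((g , b) , a)) + length as * i
        ≤⟨ +-monoˡ-≤ _ (≤-trans (additive g b a) (+-monoʳ-≤ (μ b) (⟦⟧-mono inc
             (s≤s (≤-trans (+-monoʳ-≤ (sz Γ g) (m≤n⇒m≤1+n (m≤m+n (sz A a) _))) le))))) ⟩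
      μ b + i + length as * i
        ≡⟨ +-assoc (μ b) i _ ⟩
      μ b + suc (length as) * i ∎
      where
      open ≤-Reasoning
      i = ⟦ inc ⟧ (suc n)

  foldˢP : ∀ {Γ A B l z f} → PT Γ (list A) l → PT Γ B z → (F : PT ((Γ ⊗ B) ⊗ A) B f) → (inc : Bd) →
    (∀ g b a → sz B (f ((g , b) , a)) ≤ sz B b + ⟦ inc ⟧ (sz (Γ ⊗ A) (g , a))) →
    PT Γ B (λ x → foldl (λ b a → f ((x , b) , a)) (z x) (l x))
  foldˢP {B = B} l z F inc = foldμP l z F (sz B) 1 inc (λ _ → ≤-refl)
    (λ b → ≤-trans (n≤1+n _) (≤-reflexive (sym (*-identityˡ _))))

  wk : ∀ {Γ A B f} → PT Γ A f → PT (Γ ⊗ B) A (λ x → f (proj₁ x))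
  wk F = F ∘ᴾ fstP

  skip : ∀ {Γ A B C f} → PT (Γ ⊗ A) C f → PT ((Γ ⊗ B) ⊗ A) C (λ x → f (proj₁ (proj₁ x) , proj₂ x))
  skip F = F ∘ᴾ (wk fstP ,ᴾ v0)

  revOntoP : ∀ {Γ A as bs} → PT Γ (list A) as → PT Γ (list A) bs → PT Γ (list A) (λ x → as x ʳ++ bs x)
  revOntoP {Γ} {A} as bs = foldˢP as bs (v0 ∷ᴾ v1) X λ g b a → ≤-trans
    (≤-reflexive (solve 2 (λ a b → con 1 :+ (a :+ b) := b :+ (con 1 :+ a)) refl (sz A a) (sz (list A) b)))
    (+-monoʳ-≤ (sz (list A) b) (s≤s (m≤n+m (sz A a) (sz Γ g))))

  reverseP : ∀ {Γ A as} → PT Γ (list A) as → PT Γ (list A) (λ x → reverse (as x))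
  reverseP as = revOntoP as []ᴾ

  infixr 5 _++ᴾ_
  _++ᴾ_ : ∀ {Γ A as bs} → PT Γ (list A) as → PT Γ (list A) bs → PT Γ (list A) (λ x → as x ++ bs x)
  _++ᴾ_ {as = f} {g} as bs = extP (λ x → trans (ʳ++-defn (reverse (f x))) (cong (_++ g x) (reverse-involutive (f x))))
    (revOntoP (reverseP as) bs)

  foldl-snoc-reverse : ∀ {A B : Set} (f : A → B) as bs →
    foldl (λ o a → f a ∷ o) bs as ≡ map f as ʳ++ bs
  foldl-snoc-reverse f []       bs = refl
  foldl-snoc-reverse f (a ∷ as) bs = foldl-snoc-reverse f as (f a ∷ bs)

  -- The only recursion is the left fold, which collects its output in reverse order; a final
  -- reversal repairs this. `concatMapP` and `zipP` do the same.
  mapP : ∀ {Γ A B f l} → PT (Γ ⊗ A) B f → PT Γ (list A) l → PT Γ (list B) (λ x → map (λ a → f (x , a)) (l x))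
  mapP {Γ} {A} {B} {f} {l} F L = extP
    (λ x → trans (cong reverse (foldl-snoc-reverse (λ a → f (x , a)) (l x) [])) (reverse-involutive _))
    (reverseP (foldˢP L []ᴾ (skip F ∷ᴾ v1) (κ 1 ⊕ space F) λ g b a → ≤-trans
      (s≤s (+-monoˡ-≤ (sz (list B) b) (small F (g , a))))
      (≤-reflexive (solve 2 (λ a b → con 1 :+ (a :+ b) := b :+ (con 1 :+ a)) refl
        (⟦ space F ⟧ (sz (Γ ⊗ A) (g , a))) (sz (list B) b)))))

  sz-ʳ++ : ∀ A as bs → sz (list A) (as ʳ++ bs) ≤ sz (list A) bs + sz (list A) as
  sz-ʳ++ A []       bs = m≤m+n _ 1
  sz-ʳ++ A (a ∷ as) bs = ≤-trans (sz-ʳ++ A as (a ∷ bs))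
    (≤-reflexive (solve 3 (λ a as bs → (con 1 :+ (a :+ bs)) :+ as := bs :+ (con 1 :+ (a :+ as))) refl
      (sz A a) (sz (list A) as) (sz (list A) bs)))

  foldl-ʳ++-concatMap : ∀ {A B : Set} (f : A → List B) as bs →
    foldl (λ o a → f a ʳ++ o) bs as ≡ concatMap f as ʳ++ bs
  foldl-ʳ++-concatMap f []       bs = refl
  foldl-ʳ++-concatMap f (a ∷ as) bs = trans (foldl-ʳ++-concatMap f as (f a ʳ++ bs))
    (sym (++-ʳ++ (f a)))

  concatMapP : ∀ {Γ A B f l} → PT (Γ ⊗ A) (list B) f → PT Γ (list A) l →
    PT Γ (list B) (λ x → concatMap (λ a → f (x , a)) (l x))
  concatMapP {Γ} {A} {B} {f} {l} F L = extP
    (λ x → trans (cong reverse (foldl-ʳ++-concatMap (λ a → f (x , a)) (l x) [])) (reverse-involutive _))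
    (reverseP (foldˢP L []ᴾ (revOntoP (skip F) v1) (space F) λ g b a →
      ≤-trans (sz-ʳ++ B (f (g , a)) b) (+-monoʳ-≤ (sz (list B) b) (small F (g , a)))))

  foldl-reverse-foldr : ∀ {A B : Set} (f : A → B → B) z as → foldl (λ b a → f a b) z (reverse as) ≡ foldr f z as
  foldl-reverse-foldr f z as = reverse-foldl (λ b a → f a b) z as

  infixr 6 _∧ᴾ_
  _∧ᴾ_ : ∀ {Γ p q} → PT Γ bool p → PT Γ bool q → PT Γ bool (λ x → p x ∧ q x)
  _∧ᴾ_ {p = p} {q} P Q = extP (λ x → by-cases (p x) (q x)) (ifP P Q (constP bool false))
    where
    by-cases : ∀ b c → (if′ b then c else false) ≡ b ∧ c
    by-cases true  c = refl
    by-cases false c = refl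

  allP : ∀ {Γ A p l} → PT (Γ ⊗ A) bool p → PT Γ (list A) l → PT Γ bool (λ x → all (λ a → p (x , a)) (l x))
  allP {Γ} {p = p} {l} P L = extP (λ x → foldl-reverse-foldr _∧_ true (map (λ a → p (x , a)) (l x)))
    (foldˢP (reverseP (mapP P L)) (constP bool true) (v0 ∧ᴾ v1)
      (κ 3) λ { g b true → m≤m+n _ 3 ; g b false → m≤n⇒m≤o+n (sz bool b) (s≤s z≤n) })

  -- A fold runs over one list only, so the second list is consumed from within the accumulator.
  zip-step : ∀ {A B : Set} → (List B × List (A × B)) → A → List B × List (A × B)
  zip-step ([]     , out) a = [] , out
  zip-step (b ∷ bs , out) a = bs , (a , b) ∷ out

  foldl-zip-step : ∀ {A B : Set} (as : List A) (bs : List B) out →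
    proj₂ (foldl zip-step (bs , out) as) ≡ zip as bs ʳ++ out
  foldl-zip-step []       []       out = refl
  foldl-zip-step []       (b ∷ bs) out = refl
  foldl-zip-step (a ∷ as) []       out = trans (foldl-zip-step as [] out) (cong (_ʳ++ out) (zip-[] as))
    where
    zip-[] : ∀ {A B : Set} (as : List A) → zip as ([] {A = B}) ≡ []
    zip-[] []       = refl
    zip-[] (a ∷ as) = refl
  foldl-zip-step (a ∷ as) (b ∷ bs) out = foldl-zip-step as bs ((a , b) ∷ out)

  zipP : ∀ {Γ A B as bs} → PT Γ (list A) as → PT Γ (list B) bs → PT Γ (list (A ⊗ B)) (λ x → zip (as x) (bs x))
  zipP {Γ} {A} {B} {as} {bs} AS BS = extP
    (λ x → trans (cong reverse (foldl-zip-step (as x) (bs x) [])) (reverse-involutive _))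
    (reverseP (sndP ∘ᴾ foldˢP AS (BS ,ᴾ []ᴾ) stepP (κ 1 ⊕ X) additive))
    where
    S = list B ⊗ list (A ⊗ B)
    stepP : PT ((Γ ⊗ S) ⊗ A) S (λ x → zip-step (proj₂ (proj₁ x)) (proj₂ x))
    stepP = extP (λ { ((g , ([] , out)) , a) → refl ; ((g , (b ∷ bs , out)) , a) → refl })
      (caseListP ([]ᴾ ,ᴾ fstP) (v0 ,ᴾ ((sndP ∘ᴾ wk fstP) ,ᴾ v1) ∷ᴾ (fstP ∘ᴾ wk fstP))
        ∘ᴾ ((fstP ∘ᴾ v1) ,ᴾ (sndP ∘ᴾ v1 ,ᴾ v0)))
    additive : ∀ g b a → sz S (zip-step b a) ≤ sz S b + (1 + sz (Γ ⊗ A) (g , a))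
    additive g ([]     , out) a = m≤m+n _ _
    additive g (b ∷ bs , out) a = ≤-trans
      (≤-reflexive (solve 4 (λ a b bs out → con 1 :+ (bs :+ (con 1 :+ ((con 1 :+ (a :+ b)) :+ out)))
         := (con 1 :+ ((con 1 :+ (b :+ bs)) :+ out)) :+ (con 1 :+ a)) refl (sz A a) (sz B b) (sz (list B) bs) (sz (list (A ⊗ B)) out)))
      (+-monoʳ-≤ (sz S (b ∷ bs , out)) (s≤s (m≤n⇒m≤1+n (m≤n+m (sz A a) (sz Γ g)))))

  tabulateP : ∀ {n Γ B} {f : El (fin n ⊗ Γ) → El B} → (∀ i → PT Γ B (λ x → f (i , x))) → PT (fin n ⊗ Γ) B f
  tabulateP {zero} {Γ} {B} F = record
    { prog = r0 ≔ nilᴱ ; time = κ 0 ; space = κ 0 ; runs = λ { (() , _) } ; small = λ { (() , _) } }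
  tabulateP {suc n} F = extP (λ { (zero , x) → refl ; (suc i , x) → refl })
    (caseFinP (F zero) (tabulateP (λ i → F (suc i))))

  -- Any function on a fixed finite set is a case tree of constant size. Arithmetic modulo Q, the
  -- choice of pivots and the equations of the relations enter the algorithm in this way and are
  -- never programmed.
  tableP : ∀ {n Γ B i} (f : Fin n → El B) → PT Γ (fin n) i → PT Γ B (λ x → f (i x))
  tableP {B = B} f I = tabulateP {f = λ (i , _) → f i} (λ i → constP B (f i)) ∘ᴾ (I ,ᴾ I)

  table₂P : ∀ {m n Γ B i j} (f : Fin m → Fin n → El B) → PT Γ (fin m) i → PT Γ (fin n) j → PT Γ B (λ x → f (i x) (j x))
  table₂P f I J = tabulateP {f = λ (i , j) → f i j} (λ i → tableP (f i) idP) ∘ᴾ (I ,ᴾ J)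

  table₃P : ∀ {l m n Γ B i j k} (f : Fin l → Fin m → Fin n → El B) →
    PT Γ (fin l) i → PT Γ (fin m) j → PT Γ (fin n) k → PT Γ B (λ x → f (i x) (j x) (k x))
  table₃P f I J K = tabulateP {f = λ (i , (j , k)) → f i j k} (λ i → table₂P (f i) fstP sndP) ∘ᴾ (I ,ᴾ (J ,ᴾ K))

  nullP : ∀ {Γ A l} → PT Γ (list A) l → PT Γ bool (λ x → null (l x))
  nullP {l = l} L = extP (λ x → by-cases (l x)) (caseListP (constP bool true) (constP bool false) ∘ᴾ (L ,ᴾ L))
    where
    by-cases : ∀ {A Γ : Set} {x : Γ} (as : List A) → caseList (λ _ → true) (λ _ → false) (as , x) ≡ null as
    by-cases []      = refl
    by-cases (_ ∷ _) = refl

-- Addition, multiplication and comparison of binary numbers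

module BinaryArithmetic where

  open import Defs
  open TreePrograms
  open ListPrograms
  open import Data.Bool.Base using (Bool; true; false; _∧_) renaming (if_then_else_ to if′_then_else_)
  open import Data.Bool.Properties using (∧-assoc)
  open import Data.Fin.Patterns using (0F; 1F; 2F)
  open import Data.List.Base using (List; []; _∷_; length; foldl; foldr; replicate; reverse; _ʳ++_; _++_; null)
  open import Data.List.Properties
  open import Data.Nat.Base
  open import Data.Nat.Properties
  open import Data.Nat.Binary.Base using (ℕᵇ; 2[1+_]; 1+[2_]; fromℕ) renaming (zero to 0ᵇ; toℕ to fromᵇ)
  open import Data.Nat.Binary.Properties using (toℕ-fromℕ; fromℕ-toℕ)
  open import Data.Nat.Solver using (module +-*-Solver)
  open import Relation.Binary.PropositionalEquality
  open import Relation.Nullary using (yes; no)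
  open +-*-Solver using (solve; _:+_; _:*_; _:=_; con)

  bits : ℕᵇ → List Bool
  bits 0ᵇ       = []
  bits 2[1+ b ] = false ∷ bits b
  bits 1+[2 b ] = true ∷ bits b

  digit : Bool → ℕ
  digit false = 2
  digit true  = 1

  -- Bijective base two: least significant digit first, digits 1 and 2.
  val : List Bool → ℕ
  val []       = 0
  val (d ∷ ds) = digit d + 2 * val ds

  digits : ℕ → List Bool
  digits n = bits (fromℕ n)

  unbits : List Bool → ℕᵇ
  unbits []           = 0ᵇ
  unbits (false ∷ ds) = 2[1+ unbits ds ]
  unbits (true ∷ ds)  = 1+[2 unbits ds ]

  bits-unbits : ∀ ds → bits (unbits ds) ≡ ds
  bits-unbits []           = refl
  bits-unbits (false ∷ ds) = cong (false ∷_) (bits-unbits ds)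
  bits-unbits (true ∷ ds)  = cong (true ∷_) (bits-unbits ds)

  from-unbits : ∀ ds → fromᵇ (unbits ds) ≡ val ds
  from-unbits []           = refl
  from-unbits (false ∷ ds) = trans (cong (λ n → 2 * suc n) (from-unbits ds)) (*-suc 2 (val ds))
  from-unbits (true ∷ ds)  = cong (λ n → suc (2 * n)) (from-unbits ds)

  val-bits : ∀ b → val (bits b) ≡ fromᵇ b
  val-bits 0ᵇ       = refl
  val-bits 2[1+ b ] = trans (cong (λ n → 2 + 2 * n) (val-bits b)) (sym (*-suc 2 (fromᵇ b)))
  val-bits 1+[2 b ] = cong (λ n → suc (2 * n)) (val-bits b)

  -- Bijective base two has no leading zeros, so every digit list is the expansion of its value. A
  -- number and its digit list are therefore the same tree, and programs on digit lists are programs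
  -- on numbers.
  digits-val : ∀ ds → digits (val ds) ≡ ds
  digits-val ds = trans (cong (λ n → bits (fromℕ n)) (sym (from-unbits ds)))
    (trans (cong bits (fromℕ-toℕ (unbits ds))) (bits-unbits ds))

  val-digits : ∀ n → val (digits n) ≡ n
  val-digits n = trans (val-bits (fromℕ n)) (toℕ-fromℕ n)

  enc-bits : ∀ b → encodeℕᵇ b ≡ enc (list bool) (bits b)
  enc-bits 0ᵇ       = refl
  enc-bits 2[1+ b ] = cong (cons nil) (enc-bits b)
  enc-bits 1+[2 b ] = cong (cons (cons nil nil)) (enc-bits b)

  digitsP : ∀ {Γ n} → PT Γ bin n → PT Γ (list bool) (λ x → digits (n x))
  digitsP N = recode (λ n → enc-bits (fromℕ n)) ∘ᴾ N

  valP : ∀ {Γ ds} → PT Γ (list bool) ds → PT Γ bin (λ x → val (ds x))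
  valP DS = recode {f = val} (λ ds → trans (cong (enc (list bool)) (sym (digits-val ds)))
    (sym (enc-bits (fromℕ (val ds))))) ∘ᴾ DS

  -- The index is the digit itself, with 0 for an exhausted summand, so `toℕ` adds digits and carry
  -- directly.
  head₃ : List Bool → Fin 3
  head₃ []          = 0F
  head₃ (true ∷ _)  = 1F
  head₃ (false ∷ _) = 2F

  tail₀ : ∀ {A : Set} → List A → List A
  tail₀ []       = []
  tail₀ (_ ∷ as) = as

  head₃P : ∀ {Γ ds} → PT Γ (list bool) ds → PT Γ (fin 3) (λ x → head₃ (ds x))
  head₃P {ds = ds} DS = extP (λ x → by-cases (ds x))
    (caseListP (constP (fin 3) 0F) (ifP v1 (constP (fin 3) 1F) (constP (fin 3) 2F)) ∘ᴾ (DS ,ᴾ DS))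
    where
    by-cases : ∀ {Γ : Set} {x : Γ} ds → caseList (λ _ → 0F) (λ y → if′ proj₂ (proj₁ y) then 1F else 2F) (ds , x) ≡ head₃ ds
    by-cases []          = refl
    by-cases (true ∷ _)  = refl
    by-cases (false ∷ _) = refl

  tailP : ∀ {Γ A as} → PT Γ (list A) as → PT Γ (list A) (λ x → tail₀ (as x))
  tailP AS = exprP {f = tail₀} (tlᴱ (var zero)) (λ { [] → refl ; (_ ∷ _) → refl }) ∘ᴾ AS

  sz-tail : ∀ {A} as → sz (list A) (tail₀ as) ≤ sz (list A) as
  sz-tail []           = ≤-refl
  sz-tail {A} (a ∷ as) = m≤n⇒m≤1+n (m≤n+m _ (sz A a))

  Adder : Set
  Adder = (List Bool × List Bool) × (Fin 3 × List Bool)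

  -- A column sum from 1 to 6 is written as digit plus twice the carry with digit 1 or 2, so the
  -- carry can reach 2. The sum 0 occurs only when both summands and the carry are used up, and then
  -- nothing may be emitted, as there is no digit 0.
  emit : ℕ → List Bool
  emit 1 = true ∷ []
  emit 2 = false ∷ []
  emit 3 = true ∷ []
  emit 4 = false ∷ []
  emit 5 = true ∷ []
  emit 6 = false ∷ []
  emit _ = []

  carry : ℕ → Fin 3
  carry 3 = 1F
  carry 4 = 1F
  carry 5 = 2F
  carry 6 = 2F
  carry _ = 0F

  emit₃ : Fin 3 → Fin 3 → Fin 3 → List Bool
  emit₃ d e c = emit (toℕ d + toℕ e + toℕ c)

  carry₃ : Fin 3 → Fin 3 → Fin 3 → Fin 3
  carry₃ d e c = carry (toℕ d + toℕ e + toℕ c)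

  add-step : Adder → Adder
  add-step ((x , y) , (c , out)) =
    (tail₀ x , tail₀ y) , (carry₃ (head₃ x) (head₃ y) c , emit₃ (head₃ x) (head₃ y) c ++ out)

  -- The number whose low digits are out, most recent first, followed by n.
  above : List Bool → ℕ → ℕ
  above []        n = n
  above (d ∷ out) n = above out (digit d + 2 * n)

  above-val : ∀ out ds → above out (val ds) ≡ val (out ʳ++ ds)
  above-val []        ds = refl
  above-val (d ∷ out) ds = above-val out (d ∷ ds)

  value : Adder → ℕ
  value ((x , y) , (c , out)) = above out (val x + val y + toℕ c)

  val-head : ∀ ds → val ds ≡ toℕ (head₃ ds) + 2 * val (tail₀ ds)
  val-head []           = refl
  val-head (true ∷ ds)  = refl
  val-head (false ∷ ds) = refl

  emit-correct : ∀ σ out n → 1 ≤ σ → σ ≤ 6 → above (emit σ ++ out) (n + toℕ (carry σ)) ≡ above out (σ + 2 * n)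
  emit-correct 1 out n _ _ = cong (λ k → above out (1 + 2 * k)) (+-identityʳ n)
  emit-correct 2 out n _ _ = cong (λ k → above out (2 + 2 * k)) (+-identityʳ n)
  emit-correct 3 out n _ _ = cong (above out) (solve 1 (λ n → con 1 :+ con 2 :* (n :+ con 1) := con 3 :+ con 2 :* n) refl n)
  emit-correct 4 out n _ _ = cong (above out) (solve 1 (λ n → con 2 :+ con 2 :* (n :+ con 1) := con 4 :+ con 2 :* n) refl n)
  emit-correct 5 out n _ _ = cong (above out) (solve 1 (λ n → con 1 :+ con 2 :* (n :+ con 2) := con 5 :+ con 2 :* n) refl n)
  emit-correct 6 out n _ _ = cong (above out) (solve 1 (λ n → con 2 :+ con 2 :* (n :+ con 2) := con 6 :+ con 2 :* n) refl n)
  emit-correct (suc (suc (suc (suc (suc (suc (suc _))))))) out n _ (s≤s (s≤s (s≤s (s≤s (s≤s (s≤s ()))))))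

  toℕ₃≤2 : ∀ (i : Fin 3) → toℕ i ≤ 2
  toℕ₃≤2 0F = z≤n
  toℕ₃≤2 1F = s≤s z≤n
  toℕ₃≤2 2F = s≤s (s≤s z≤n)

  add-step-value : ∀ s → value (add-step s) ≡ value s
  add-step-value (([] , []) , (0F , out)) = refl
  add-step-value ((x , y) , (c , out)) with 1 ≤? toℕ (head₃ x) + toℕ (head₃ y) + toℕ c
  ... | yes 1≤σ = trans (emit-correct _ out (val (tail₀ x) + val (tail₀ y)) 1≤σ
                          (+-mono-≤ (+-mono-≤ (toℕ₃≤2 (head₃ x)) (toℕ₃≤2 (head₃ y))) (toℕ₃≤2 c)))
    (cong (above out) (sym (trans (cong₂ (λ m n → m + n + toℕ c) (val-head x) (val-head y))
      (solve 5 (λ a b c x y → (a :+ con 2 :* x) :+ (b :+ con 2 :* y) :+ c := (a :+ b :+ c) :+ con 2 :* (x :+ y)) refl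
        (toℕ (head₃ x)) (toℕ (head₃ y)) (toℕ c) (val (tail₀ x)) (val (tail₀ y))))))
  add-step-value (([] , []) , (0F , out)) | no _ = refl
  add-step-value (([] , []) , (suc c , out)) | no 1≰σ with () ← 1≰σ (s≤s z≤n)
  add-step-value ((true ∷ x , y) , (c , out)) | no 1≰σ with () ← 1≰σ (s≤s z≤n)
  add-step-value ((false ∷ x , y) , (c , out)) | no 1≰σ with () ← 1≰σ (s≤s z≤n)
  add-step-value (([] , true ∷ y) , (c , out)) | no 1≰σ with () ← 1≰σ (s≤s z≤n)
  add-step-value (([] , false ∷ y) , (c , out)) | no 1≰σ with () ← 1≰σ (s≤s z≤n)

  sign₃ : Fin 3 → ℕ
  sign₃ 0F = 0
  sign₃ (suc _) = 1

  -- An upper bound for the number of steps until both summands and the carry are used up.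
  pending : Adder → ℕ
  pending ((x , y) , (c , out)) = length x + length y + sign₃ c

  sign₃≤1 : ∀ c → sign₃ c ≤ 1
  sign₃≤1 0F = z≤n
  sign₃≤1 (suc _) = ≤-refl

  -- A carry that is left alone is 1 or 2, hence a digit: one more step emits it and leaves no
  -- carry. So it counts once in `pending`, whatever its value.
  add-step-pending : ∀ s → pending (add-step s) ≤ pred (pending s)
  add-step-pending (([] , []) , (0F , out)) = z≤n
  add-step-pending (([] , []) , (1F , out)) = z≤n
  add-step-pending (([] , []) , (2F , out)) = z≤n
  add-step-pending (([] , true ∷ y) , (0F , out)) = ≤-refl
  add-step-pending (([] , false ∷ y) , (0F , out)) = ≤-refl
  add-step-pending (([] , e ∷ y) , (suc c , out)) = +-monoʳ-≤ (length y) (sign₃≤1 _)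
  add-step-pending ((true ∷ x , []) , (0F , out)) = ≤-refl
  add-step-pending ((false ∷ x , []) , (0F , out)) = ≤-refl
  add-step-pending ((d ∷ x , []) , (suc c , out)) = +-monoʳ-≤ (length x + 0) (sign₃≤1 _)
  add-step-pending ((d ∷ x , e ∷ y) , (c , out)) = ≤-trans (+-monoʳ-≤ (length x + length y) (sign₃≤1 _))
    (≤-trans (≤-reflexive (solve 2 (λ x y → x :+ y :+ con 1 := x :+ (con 1 :+ y)) refl (length x) (length y))) (m≤m+n _ (sign₃ c)))

  add-loop : ∀ (as : List Bool) s → pending s ≤ length as →
    val (reverse (proj₂ (proj₂ (foldl (λ s _ → add-step s) s as)))) ≡ value s
  add-loop [] (([] , []) , (0F , out)) _ = sym (above-val out [])
  add-loop (a ∷ as) s le = trans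
    (add-loop as (add-step s) (≤-trans (add-step-pending s) (pred-mono-≤ le)))
    (add-step-value s)

  infixl 6 _+ᴾ_
  _+ᴾ_ : ∀ {Γ m n} → PT Γ bin m → PT Γ bin n → PT Γ bin (λ x → m x + n x)
  _+ᴾ_ {Γ} {m} {n} M N = extP (λ x → trans
      (add-loop (digits (m x) ++ digits (n x)) ((digits (m x) , digits (n x)) , (0F , []))
        (≤-reflexive (trans (+-identityʳ _) (sym (length-++ (digits (m x)))))))
      (trans (+-identityʳ _) (cong₂ _+_ (val-digits (m x)) (val-digits (n x)))))
    (valP (reverseP (sndP ∘ᴾ sndP ∘ᴾ
      -- The concatenated digit lists act as a clock: their length bounds the number of steps
      -- needed.
      foldˢP (digitsP M ++ᴾ digitsP N) ((digitsP M ,ᴾ digitsP N) ,ᴾ (constP (fin 3) 0F ,ᴾ []ᴾ)) stepP (κ 10) additive)))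
    where
    S = (list bool ⊗ list bool) ⊗ (fin 3 ⊗ list bool)
    stepP : PT ((Γ ⊗ S) ⊗ bool) S (λ x → add-step (proj₂ (proj₁ x)))
    stepP = (tailP x ,ᴾ tailP y) ,ᴾ (table₃P carry₃ (head₃P x) (head₃P y) c ,ᴾ
            (table₃P emit₃ (head₃P x) (head₃P y) c ++ᴾ (sndP ∘ᴾ sndP ∘ᴾ v1)))
      where
      x = fstP ∘ᴾ fstP ∘ᴾ v1
      y = sndP ∘ᴾ fstP ∘ᴾ v1
      c = fstP ∘ᴾ sndP ∘ᴾ v1
    sz-emit : ∀ σ out → sz (list bool) (emit σ ++ out) ≤ 4 + sz (list bool) out
    sz-emit 0 out = m≤n+m _ 4
    sz-emit 1 out = ≤-refl
    sz-emit 2 out = m≤n+m _ 2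
    sz-emit 3 out = ≤-refl
    sz-emit 4 out = m≤n+m _ 2
    sz-emit 5 out = ≤-refl
    sz-emit 6 out = m≤n+m _ 2
    sz-emit (suc (suc (suc (suc (suc (suc (suc _))))))) out = m≤n+m _ 4
    sz-fin₃ : ∀ (c : Fin 3) → 1 ≤ sz (fin 3) c × sz (fin 3) c ≤ 5
    sz-fin₃ 0F = s≤s z≤n , s≤s z≤n
    sz-fin₃ 1F = s≤s z≤n , s≤s (s≤s (s≤s z≤n))
    sz-fin₃ 2F = s≤s z≤n , ≤-refl
    additive : ∀ (g : El Γ) s (b : Bool) → sz S (add-step s) ≤ sz S s + 10
    additive g ((x , y) , (c , out)) b = ≤-trans
      (s≤s (+-mono-≤ (s≤s (+-mono-≤ (sz-tail {bool} x) (sz-tail {bool} y)))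
        (s≤s (+-mono-≤ (≤-trans (proj₂ (sz-fin₃ (carry₃ (head₃ x) (head₃ y) c))) (+-monoʳ-≤ 4 (proj₁ (sz-fin₃ c))))
          (sz-emit (toℕ (head₃ x) + toℕ (head₃ y) + toℕ c) out)))))
      (≤-trans (≤-reflexive (solve 4 (λ x y c o → con 1 :+ ((con 1 :+ (x :+ y)) :+ (con 1 :+ ((con 4 :+ c) :+ (con 4 :+ o))))
         := (con 1 :+ ((con 1 :+ (x :+ y)) :+ (con 1 :+ (c :+ o)))) :+ con 8) refl
         (sz (list bool) x) (sz (list bool) y) (sz (fin 3) c) (sz (list bool) out)))
        (+-monoʳ-≤ (sz S ((x , y) , (c , out))) (m≤m+n 8 2)))

  len : ℕ → ℕ
  len n = length (digits n)

  -- The least number with k digits is 1...1, which is 2^k - 1, and the greatest is 2...2, which is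
  -- 2^(k+1) - 2. Together with `<2^len` this turns length estimates into inequalities between
  -- numbers.
  2^len≤ : ∀ n → 2 ^ len n ≤ suc n
  2^len≤ n = subst (λ k → 2 ^ len n ≤ suc k) (val-digits n) (go (digits n))
    where
    go : ∀ ds → 2 ^ length ds ≤ suc (val ds)
    go []       = ≤-refl
    go (d ∷ ds) = ≤-trans (*-monoʳ-≤ 2 (go ds)) (≤-trans (≤-reflexive (*-suc 2 (val ds)))
      (s≤s (+-monoˡ-≤ (2 * val ds) (1≤digit d))))
      where
      1≤digit : ∀ d → 1 ≤ digit d
      1≤digit false = s≤s z≤n
      1≤digit true  = s≤s z≤n

  <2^len : ∀ n → suc n < 2 ^ suc (len n)
  <2^len n = subst (λ k → suc k < 2 ^ suc (len n)) (val-digits n) (go (digits n))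
    where
    go : ∀ ds → suc (val ds) < 2 ^ suc (length ds)
    go []       = ≤-refl
    go (d ∷ ds) = ≤-trans (≤-trans (s≤s (s≤s (+-monoˡ-≤ (2 * val ds) (digit≤2 d))))
        (≤-reflexive (solve 1 (λ v → con 4 :+ con 2 :* v := con 2 :* (con 2 :+ v)) refl (val ds))))
      (*-monoʳ-≤ 2 (go ds))
      where
      digit≤2 : ∀ d → digit d ≤ 2
      digit≤2 false = ≤-refl
      digit≤2 true  = s≤s z≤n

  len-bound : ∀ {m k} → suc m < 2 ^ suc k → len m ≤ k
  len-bound {m} {k} m<2^k with len m ≤? k
  ... | yes le = le
  ... | no  gt with () ← n≮n _ (≤-<-trans (≤-trans (^-monoʳ-≤ 2 (≰⇒> gt)) (2^len≤ m)) m<2^k)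

  len-mono : ∀ {m n} → m ≤ n → len m ≤ len n
  len-mono {m} {n} m≤n = len-bound (≤-<-trans (s≤s m≤n) (<2^len n))

  -- Formulated with successors because it is `suc n` that lies between consecutive powers of two.
  -- Sums, products and steps of Horner's scheme all satisfy the hypothesis.
  len-product : ∀ {m} a b → suc m ≤ suc a * suc b → len m ≤ suc (len a + len b)
  len-product {m} a b le = len-bound (≤-<-trans le (<-≤-trans (*-mono-< (<2^len a) (<2^len b))
    (≤-reflexive (trans (sym (^-distribˡ-+-* 2 (suc (len a)) (suc (len b))))
      (cong (λ k → 2 ^ suc k) (+-suc (len a) (len b)))))))

  len-+ : ∀ a b → len (a + b) ≤ suc (len a + len b)
  len-+ a b = len-product a b (s≤s (≤-trans (≤-reflexive (+-comm a b)) (+-monoʳ-≤ b (m≤m*n a (suc b)))))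

  len-* : ∀ a b → len (a * b) ≤ suc (len a + len b)
  len-* a b = len-product a b (s≤s (≤-trans (*-monoʳ-≤ a (n≤1+n b)) (m≤n+m _ b)))

  len≤sz : ∀ n → len n ≤ sz bin n
  len≤sz n = subst (λ t → len n ≤ size t) (sym (enc-bits (fromℕ n))) (length≤sz bool (digits n))

  sz≤len : ∀ n → sz bin n ≤ 4 * suc (len n)
  sz≤len n = subst (λ t → size t ≤ 4 * suc (len n)) (sym (enc-bits (fromℕ n))) (go (digits n))
    where
    go : ∀ ds → sz (list bool) ds ≤ 4 * suc (length ds)
    go []       = s≤s z≤n
    go (d ∷ ds) = ≤-trans (+-mono-≤ (s≤s (sz-bool d)) (go ds)) (≤-reflexive (sym (*-suc 4 (suc (length ds)))))
      where
      sz-bool : ∀ b → sz bool b ≤ 3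
      sz-bool true  = ≤-refl
      sz-bool false = s≤s z≤n

  horner : ℕ → ℕ → Bool → ℕ
  horner y acc d = (acc + acc) + (if′ d then y else (y + y))

  -- Horner's scheme starts at the most significant digit, while digits are stored from the least
  -- significant one; hence the reversal.
  horner-digits : ∀ y ds → foldl (horner y) 0 (reverse ds) ≡ val ds * y
  horner-digits y ds = trans (reverse-foldl (horner y) 0 ds) (go ds)
    where
    go : ∀ ds → foldr (λ d acc → horner y acc d) 0 ds ≡ val ds * y
    go [] = refl
    go (true ∷ ds) rewrite go ds =
      solve 2 (λ v y → (v :* y :+ v :* y) :+ y := (con 1 :+ con 2 :* v) :* y) refl (val ds) y
    go (false ∷ ds) rewrite go ds =
      solve 2 (λ v y → (v :* y :+ v :* y) :+ (y :+ y) := (con 2 :+ con 2 :* v) :* y) refl (val ds) y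

  len-horner : ∀ y acc d → len (horner y acc d) ≤ len acc + (3 + len y)
  -- 1 + 2 acc + 2 y is at most 2 (acc + 1)(y + 1), and (acc + 1)(y + 1) is the successor of
  -- `y + acc * suc y`. So a step adds a number of digits that depends on y only.
  len-horner y acc d = ≤-trans (len-product 1 (y + acc * suc y) (≤-trans (s≤s (+-monoʳ-≤ (acc + acc) (by-cases d)))
      (≤-trans (m≤m+n _ (1 + 2 * (acc * y))) (≤-reflexive
        (solve 2 (λ a y → (con 1 :+ ((a :+ a) :+ (y :+ y))) :+ (con 1 :+ con 2 :* (a :* y)) :=
          con 2 :* (con 1 :+ (y :+ a :* (con 1 :+ y)))) refl acc y)))))
    (≤-trans (s≤s (s≤s (len-product acc y ≤-refl)))
      (≤-reflexive (solve 2 (λ a y → con 3 :+ (a :+ y) := a :+ (con 3 :+ y)) refl (len acc) (len y))))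
    where
    by-cases : ∀ d → (if′ d then y else (y + y)) ≤ y + y
    by-cases true  = m≤m+n y y
    by-cases false = ≤-refl

  infixl 7 _*ᴾ_
  _*ᴾ_ : ∀ {Γ m n} → PT Γ bin m → PT Γ bin n → PT Γ bin (λ x → m x * n x)
  _*ᴾ_ {Γ} {m} {n} M N = extP (λ x → trans (horner-digits (n x) (digits (m x))) (cong (_* n x) (val-digits (m x))))
    (loop ∘ᴾ (M ,ᴾ N))
    where
    loop : PT (bin ⊗ bin) bin (λ x → foldl (horner (proj₂ x)) 0 (reverse (digits (proj₁ x))))
    loop = foldμP (reverseP (digitsP fstP)) (constP bin 0)
      ((v1 +ᴾ v1) +ᴾ ifP v0 (sndP ∘ᴾ wk fstP) ((sndP ∘ᴾ wk fstP) +ᴾ (sndP ∘ᴾ wk fstP)))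
      len 4 (κ 3 ⊕ X) len≤sz sz≤len λ { (m , y) acc d → ≤-trans (len-horner y acc d)
        (+-monoʳ-≤ (len acc) (+-monoʳ-≤ 3 (≤-trans (len≤sz y)
          (≤-trans (m≤n+m _ (suc (sz bin m))) (m≤n⇒m≤1+n (m≤m+n _ (sz bool d))))))) }

  same : List Bool → List Bool → Bool
  same []           []           = true
  same []           (_ ∷ _)      = false
  same (_ ∷ _)      []           = false
  same (true ∷ as)  (true ∷ bs)  = same as bs
  same (false ∷ as) (false ∷ bs) = same as bs
  same (true ∷ as)  (false ∷ bs) = false
  same (false ∷ as) (true ∷ bs)  = false

  same⇒≡ : ∀ as bs → same as bs ≡ true → as ≡ bs
  same⇒≡ []           []           eq = refl
  same⇒≡ (true ∷ as)  (true ∷ bs)  eq = cong (true ∷_) (same⇒≡ as bs eq)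
  same⇒≡ (false ∷ as) (false ∷ bs) eq = cong (false ∷_) (same⇒≡ as bs eq)

  same-refl : ∀ as → same as as ≡ true
  same-refl []           = refl
  same-refl (true ∷ as)  = same-refl as
  same-refl (false ∷ as) = same-refl as

  eq₃ : Fin 3 → Bool → Bool
  eq₃ 1F true  = true
  eq₃ 2F false = true
  eq₃ _  _     = false

  same-step : List Bool × Bool → Bool → List Bool × Bool
  same-step (bs , ok) a = tail₀ bs , ok ∧ eq₃ (head₃ bs) a

  -- Unequal lengths show up in two ways: if `bs` is too short, `head₃` yields 0, which equals no
  -- digit; if it is too long, a rest remains and `null` rejects it.
  same-loop : ∀ as bs ok →
    let r , ok′ = foldl same-step (bs , ok) as in ok′ ∧ null r ≡ ok ∧ same as bs
  same-loop []           []           ok = refl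
  same-loop []           (b ∷ bs)     ok = refl
  same-loop (true ∷ as)  []           ok = trans (same-loop as [] (ok ∧ false)) (∧-assoc ok false _)
  same-loop (false ∷ as) []           ok = trans (same-loop as [] (ok ∧ false)) (∧-assoc ok false _)
  same-loop (true ∷ as)  (true ∷ bs)  ok = trans (same-loop as bs (ok ∧ true)) (∧-assoc ok true _)
  same-loop (true ∷ as)  (false ∷ bs) ok = trans (same-loop as bs (ok ∧ false)) (∧-assoc ok false _)
  same-loop (false ∷ as) (true ∷ bs)  ok = trans (same-loop as bs (ok ∧ false)) (∧-assoc ok false _)
  same-loop (false ∷ as) (false ∷ bs) ok = trans (same-loop as bs (ok ∧ true)) (∧-assoc ok true _)

  sameP : ∀ {Γ as bs} → PT Γ (list bool) as → PT Γ (list bool) bs → PT Γ bool (λ x → same (as x) (bs x))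
  sameP {Γ} {as} {bs} AS BS = extP (λ x → same-loop (as x) (bs x) true)
    ((sndP ∧ᴾ nullP fstP) ∘ᴾ foldˢP AS (BS ,ᴾ constP bool true) stepP (κ 3) additive)
    where
    S = list bool ⊗ bool
    stepP : PT ((Γ ⊗ S) ⊗ bool) S (λ x → same-step (proj₂ (proj₁ x)) (proj₂ x))
    stepP = tailP (fstP ∘ᴾ v1) ,ᴾ (sndP ∘ᴾ v1) ∧ᴾ
      extP (λ { ((g , ([] , ok)) , true) → refl ; ((g , (true ∷ bs , ok)) , true) → refl ; ((g , (false ∷ bs , ok)) , true) → refl
              ; ((g , ([] , ok)) , false) → refl ; ((g , (true ∷ bs , ok)) , false) → refl ; ((g , (false ∷ bs , ok)) , false) → refl })
        (ifP v0 (tableP (λ { 1F → true ; _ → false }) (head₃P (fstP ∘ᴾ v1)))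
                (tableP (λ { 2F → true ; _ → false }) (head₃P (fstP ∘ᴾ v1))))
    sz-bool : ∀ b → sz bool b ≤ 3
    sz-bool true  = ≤-refl
    sz-bool false = s≤s z≤n
    additive : ∀ (g : El Γ) s (b : Bool) → sz S (same-step s b) ≤ sz S s + 3
    additive g (bs , ok) b = ≤-trans
      (s≤s (+-mono-≤ (sz-tail {bool} bs) (sz-bool (ok ∧ eq₃ (head₃ bs) b))))
      (+-monoˡ-≤ 3 (s≤s (m≤m+n _ (sz bool ok))))

  eqBin : ℕ → ℕ → Bool
  eqBin m n = same (digits m) (digits n)

  eqBin⇒≡ : ∀ m n → eqBin m n ≡ true → m ≡ n
  eqBin⇒≡ m n eq = trans (sym (val-digits m)) (trans (cong val (same⇒≡ (digits m) (digits n) eq)) (val-digits n))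

  eqBin-refl : ∀ n → eqBin n n ≡ true
  eqBin-refl n = same-refl (digits n)

  eqBinP : ∀ {Γ m n} → PT Γ bin m → PT Γ bin n → PT Γ bool (λ x → eqBin (m x) (n x))
  eqBinP M N = sameP (digitsP M) (digitsP N)

  same-replicate : ∀ m n → same (replicate m false) (replicate n false) ≡ (m ≡ᵇ n)
  same-replicate zero    zero    = refl
  same-replicate zero    (suc n) = refl
  same-replicate (suc m) zero    = refl
  same-replicate (suc m) (suc n) = same-replicate m n

  eqUnP : ∀ {Γ m n} → PT Γ un m → PT Γ un n → PT Γ bool (λ x → m x ≡ᵇ n x)
  eqUnP {m = m} {n} M N = extP (λ x → same-replicate (m x) (n x)) (sameP (recode go ∘ᴾ M) (recode go ∘ᴾ N))
    where
    go : ∀ n → encodeUnary n ≡ enc (list bool) (replicate n false)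
    go zero    = refl
    go (suc n) = cong (cons nil) (go n)

  foldl-suc : ∀ m n → foldl (λ b _ → suc b) n (replicate m 0) ≡ m + n
  foldl-suc zero    n = refl
  foldl-suc (suc m) n = trans (foldl-suc m (suc n)) (+-suc m n)

  infixl 6 _+ᵁᴾ_
  _+ᵁᴾ_ : ∀ {Γ m n} → PT Γ un m → PT Γ un n → PT Γ un (λ x → m x + n x)
  _+ᵁᴾ_ {m = m} {n} M N = extP (λ x → foldl-suc (m x) (n x))
    (foldˢP (unit-list ∘ᴾ M) N (sucP ∘ᴾ v1) (κ 2) λ g b a → ≤-reflexive (+-comm 2 (sz un b)))

-- Congruences, gcds and prime powers

module Congruences where

  open import Data.Nat.Base hiding (_/_)
  open import Data.Nat.Properties
  open import Data.Nat.Divisibility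
  open import Data.Nat.DivMod using (_mod_; _/_; m%n<n; m≡m%n+[m/n]*n)
  open import Data.Fin.Properties using (toℕ-fromℕ<)
  open import Data.Nat.GCD using (gcd; gcd[m,n]∣m; gcd[m,n]∣n; gcd-GCD; module Bézout)
  open import Data.Nat.Coprimality using (Coprime; coprime-divisor; coprime-Bézout)
  open import Data.Nat.Primality using (Prime; prime⇒irreducible; prime⇒nonZero; prime⇒nonTrivial; euclidsLemma)
  open import Data.Nat.Solver using (module +-*-Solver)
  open import Data.Sum.Base using (_⊎_; inj₁; inj₂)
  open import Relation.Binary.PropositionalEquality
  open import Relation.Nullary using (¬_; yes; no; contradiction)
  open +-*-Solver using (solve; _:+_; _:*_; _:=_; con)

  infix 4 _≡_⟪_⟫
  -- Multiples of q are added on both sides, so natural numbers suffice and x and y need not be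
  -- compared.
  _≡_⟪_⟫ : ℕ → ℕ → ℕ → Set
  x ≡ y ⟪ q ⟫ = ∃[ a ] ∃[ b ] x + a * q ≡ y + b * q

  ≡⟪⟫-reflexive : ∀ {x y q} → x ≡ y → x ≡ y ⟪ q ⟫
  ≡⟪⟫-reflexive refl = 0 , 0 , refl

  ≡⟪⟫-refl : ∀ {x q} → x ≡ x ⟪ q ⟫
  ≡⟪⟫-refl = ≡⟪⟫-reflexive refl

  ≡⟪⟫-sym : ∀ {x y q} → x ≡ y ⟪ q ⟫ → y ≡ x ⟪ q ⟫
  ≡⟪⟫-sym (a , b , eq) = b , a , sym eq

  ≡⟪⟫-trans : ∀ {x y z q} → x ≡ y ⟪ q ⟫ → y ≡ z ⟪ q ⟫ → x ≡ z ⟪ q ⟫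
  ≡⟪⟫-trans {x} {y} {z} {q} (a , b , eq) (c , d , eq′) = a + c , d + b , (begin
    x + (a + c) * q     ≡⟨ solve 4 (λ x a c q → x :+ (a :+ c) :* q := (x :+ a :* q) :+ c :* q) refl x a c q ⟩
    (x + a * q) + c * q ≡⟨ cong (_+ c * q) eq ⟩
    (y + b * q) + c * q ≡⟨ solve 4 (λ y b c q → (y :+ b :* q) :+ c :* q := (y :+ c :* q) :+ b :* q) refl y b c q ⟩
    (y + c * q) + b * q ≡⟨ cong (_+ b * q) eq′ ⟩
    (z + d * q) + b * q ≡⟨ solve 4 (λ z d b q → (z :+ d :* q) :+ b :* q := z :+ (d :+ b) :* q) refl z d b q ⟩
    z + (d + b) * q     ∎)
    where open ≡-Reasoning

  ≡⟪⟫-+ : ∀ {x y z w q} → x ≡ y ⟪ q ⟫ → z ≡ w ⟪ q ⟫ → x + z ≡ y + w ⟪ q ⟫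
  ≡⟪⟫-+ {x} {y} {z} {w} {q} (a , b , eq) (c , d , eq′) = a + c , b + d , (begin
    x + z + (a + c) * q         ≡⟨ solve 5 (λ x z a c q → x :+ z :+ (a :+ c) :* q := (x :+ a :* q) :+ (z :+ c :* q)) refl x z a c q ⟩
    (x + a * q) + (z + c * q)   ≡⟨ cong₂ _+_ eq eq′ ⟩
    (y + b * q) + (w + d * q)   ≡⟨ solve 5 (λ x z a c q → (x :+ a :* q) :+ (z :+ c :* q) := x :+ z :+ (a :+ c) :* q) refl y w b d q ⟩
    y + w + (b + d) * q         ∎)
    where open ≡-Reasoning

  ≡⟪⟫-* : ∀ {x y z w q} → x ≡ y ⟪ q ⟫ → z ≡ w ⟪ q ⟫ → x * z ≡ y * w ⟪ q ⟫
  ≡⟪⟫-* {x} {y} {z} {w} {q} (a , b , eq) (c , d , eq′) =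
    x * c + a * z + a * c * q , y * d + b * w + b * d * q , (begin
    x * z + (x * c + a * z + a * c * q) * q ≡⟨ expand x z a c q ⟩
    (x + a * q) * (z + c * q)               ≡⟨ cong₂ _*_ eq eq′ ⟩
    (y + b * q) * (w + d * q)               ≡⟨ expand y w b d q ⟨
    y * w + (y * d + b * w + b * d * q) * q ∎)
    where
    open ≡-Reasoning
    expand : ∀ x z a c q → x * z + (x * c + a * z + a * c * q) * q ≡ (x + a * q) * (z + c * q)
    expand = solve 5 (λ x z a c q → x :* z :+ (x :* c :+ a :* z :+ a :* c :* q) :* q := (x :+ a :* q) :* (z :+ c :* q)) refl

  ∣-resp-≡⟪⟫ : ∀ {x y q} → x ≡ y ⟪ q ⟫ → q ∣ x → q ∣ y
  ∣-resp-≡⟪⟫ {x} {y} {q} (a , b , eq) q∣x =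
    ∣m+n∣m⇒∣n (subst (q ∣_) (trans eq (+-comm y (b * q))) (∣m∣n⇒∣m+n q∣x (n∣m*n a))) (n∣m*n b)

  ∣⇒≡⟪⟫ : ∀ {x q} → q ∣ x → x ≡ 0 ⟪ q ⟫
  ∣⇒≡⟪⟫ (divides k eq) = 0 , k , trans (+-identityʳ _) eq

  ≡⟪⟫⇒∣ : ∀ {x q} → x ≡ 0 ⟪ q ⟫ → q ∣ x
  ≡⟪⟫⇒∣ {x} {q} eq = ∣-resp-≡⟪⟫ (≡⟪⟫-sym eq) (q ∣0)

  ≡⟪⟫-∣ : ∀ {x y q r} → q ∣ r → x ≡ y ⟪ r ⟫ → x ≡ y ⟪ q ⟫
  ≡⟪⟫-∣ {x} {y} {q} (divides k refl) (a , b , eq) =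
    a * k , b * k , trans (cong (x +_) (*-assoc a k q)) (trans eq (cong (y +_) (sym (*-assoc b k q))))

  toℕ-mod : ∀ n q .{{_ : NonZero q}} → toℕ (n mod q) ≡ n ⟪ q ⟫
  toℕ-mod n q = n / q , 0 , trans (cong (_+ n / q * q) (toℕ-fromℕ< (m%n<n n q)))
    (trans (sym (m≡m%n+[m/n]*n n q)) (sym (+-identityʳ n)))

  <⇒≡⟪⟫⇒≡ : ∀ {x y q} → x < q → y < q → x ≡ y ⟪ q ⟫ → x ≡ y
  <⇒≡⟪⟫⇒≡ {x} {y} {q} x<q y<q (a , b , eq) = go a b eq
    where
    go : ∀ a b → x + a * q ≡ y + b * q → x ≡ y
    go zero    zero    eq = trans (sym (+-identityʳ x)) (trans eq (+-identityʳ y))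
    go zero    (suc b) eq = contradiction (≤-trans (≤-trans (m≤m+n q (b * q)) (m≤n+m _ y))
      (≤-reflexive (trans (sym eq) (+-identityʳ x)))) (<⇒≱ x<q)
    go (suc a) zero    eq = contradiction (≤-trans (≤-trans (m≤m+n q (a * q)) (m≤n+m _ x))
      (≤-reflexive (trans eq (+-identityʳ y)))) (<⇒≱ y<q)
    go (suc a) (suc b) eq = go a b (+-cancelˡ-≡ q _ _ (trans (swap x a) (trans eq (sym (swap y b)))))
      where
      swap : ∀ x a → q + (x + a * q) ≡ x + suc a * q
      swap x a = solve 3 (λ q x a → q :+ (x :+ a :* q) := x :+ (con 1 :+ a) :* q) refl q x a

  -- `z * pred q` plays the role of -z modulo q.
  negate-≡⟪⟫ : ∀ {z g r q} .{{_ : NonZero q}} → z ≡ g + r * q → q ∣ z * pred q + g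
  negate-≡⟪⟫ {z} {g} {r} {suc q} refl = divides (g + r * q)
    (solve 3 (λ g r q → (g :+ r :* (con 1 :+ q)) :* q :+ g := (g :+ r :* q) :* (con 1 :+ q)) refl g r q)

  -- h y ≡ - b is solvable modulo q exactly if gcd(h,q) divides b.
  solvable⇒∣ : ∀ {h q y b} → q ∣ h * y + b → gcd h q ∣ b
  solvable⇒∣ {h} {q} {y} {b} q∣ = ∣m+n∣m⇒∣n (∣-trans (gcd[m,n]∣n h q) q∣) (∣m⇒∣m*n y (gcd[m,n]∣m h q))

  ∣⇒solvable : ∀ {h q b} .{{_ : NonZero q}} → gcd h q ∣ b → ∃[ y ] q ∣ h * y + b
  ∣⇒solvable {h} {q} {b} (divides k refl) with Bézout.identity (gcd-GCD h q)
  ... | Bézout.-+ x y eq = x * k , divides (y * k) (trans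
    (solve 4 (λ h x k g → h :* (x :* k) :+ k :* g := (g :+ x :* h) :* k) refl h x k (gcd h q))
    (trans (cong (_* k) eq) (solve 3 (λ y q k → y :* q :* k := y :* k :* q) refl y q k)))
  -- Here x h is congruent to the gcd, so -x is the required multiplier, written `x * pred q`.
  ... | Bézout.+- x y eq = x * pred q * k ,
    subst (q ∣_) (solve 5 (λ h x p k g → (x :* h :* p :+ g) :* k := h :* (x :* p :* k) :+ k :* g) refl h x (pred q) k (gcd h q))
      (∣m⇒∣m*n k (negate-≡⟪⟫ {r = y} (sym eq)))

  -- With u = q / gcd(h,q), the products u b divisible by q are those with gcd(h,q) dividing b,
  -- which is the solvability criterion. Multiplication by u thus turns the existence of the
  -- eliminated unknown into an equation for the others.
  annihilator : ∀ q .{{_ : NonZero q}} h → Σ ℕ λ u → ∀ b → q ∣ u * b ⇔ (∃[ y ] q ∣ h * y + b)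
  annihilator q h with gcd[m,n]∣n h q
  ... | divides u q≡u*g = u , λ b → mk⇔
    (λ q∣ub → ∣⇒solvable {h} (*-cancelˡ-∣ u {{u≢0}} (subst (_∣ u * b) q≡u*g q∣ub)))
    (λ (y , q∣) → subst (_∣ u * b) (sym q≡u*g) (*-monoʳ-∣ u (solvable⇒∣ {h} {q} {y} {b} q∣)))
    where
    u≢0 : NonZero u
    u≢0 = m*n≢0⇒m≢0 u {{subst NonZero q≡u*g it}}
      where
      it : NonZero q
      it = >-nonZero (>-nonZero⁻¹ q)

  prime∤⇒coprime : ∀ {p n} → Prime p → ¬ p ∣ n → Coprime n p
  prime∤⇒coprime pr p∤n (d∣n , d∣p) with prime⇒irreducible pr d∣p
  ... | inj₁ d≡1 = d≡1
  ... | inj₂ refl = contradiction d∣n p∤n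

  ∣-prime-power : ∀ {p d} → Prime p → ∀ m → d ∣ p ^ m → ∃[ k ] d ≡ p ^ k
  ∣-prime-power pr zero d∣1 = 0 , ∣1⇒≡1 d∣1
  ∣-prime-power {p} {d} pr (suc m) d∣ with p ∣? d
  ... | yes (divides e refl) =
    let k , eq = ∣-prime-power pr m (*-cancelˡ-∣ p {{prime⇒nonZero pr}} (subst (_∣ p * p ^ m) (*-comm e p) d∣))
    in suc k , trans (*-comm e p) (cong (p *_) eq)
  ... | no p∤d = ∣-prime-power pr m (coprime-divisor (prime∤⇒coprime pr p∤d) d∣)

  prime-power-chain : ∀ {p d e} → Prime p → ∀ m → d ∣ p ^ m → e ∣ p ^ m → d ∣ e ⊎ e ∣ d
  prime-power-chain {p} pr m d∣ e∣ with ∣-prime-power pr m d∣ | ∣-prime-power pr m e∣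
  ... | j , refl | k , refl with ≤-total j k
  ...   | inj₁ j≤k = inj₁ (m^j∣m^k j≤k)
    where
    m^j∣m^k : ∀ {j k} → j ≤ k → p ^ j ∣ p ^ k
    m^j∣m^k {j} {k} j≤k = divides (p ^ (k ∸ j)) (trans (cong (p ^_) (sym (m∸n+n≡m j≤k))) (^-distribˡ-+-* p (k ∸ j) j))
  ...   | inj₂ k≤j = inj₂ (divides (p ^ (j ∸ k)) (trans (cong (p ^_) (sym (m∸n+n≡m k≤j))) (^-distribˡ-+-* p (j ∸ k) k)))

  -- The gcds of both coefficients with p^m divide p^m, and the divisors of a prime power form a
  -- chain; the coefficient with the smaller gcd clears the other. Here elimination relies on the
  -- modulus being a prime power.
  ratio : ∀ {p} → Prime p → ∀ m h₁ h₂ →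
    (∃[ c ] p ^ m ∣ h₁ * c + h₂) ⊎ (∃[ c ] p ^ m ∣ h₂ * c + h₁)
  ratio {p} pr m h₁ h₂ with prime-power-chain pr m (gcd[m,n]∣n h₁ (p ^ m)) (gcd[m,n]∣n h₂ (p ^ m))
  ... | inj₁ g₁∣g₂ = inj₁ (∣⇒solvable {h₁} {{m^n≢0 p m {{prime⇒nonZero pr}}}} (∣-trans g₁∣g₂ (gcd[m,n]∣m h₂ (p ^ m))))
  ... | inj₂ g₂∣g₁ = inj₂ (∣⇒solvable {h₂} {{m^n≢0 p m {{prime⇒nonZero pr}}}} (∣-trans g₂∣g₁ (gcd[m,n]∣m h₁ (p ^ m))))

  ∣-prime-power⇒≡ : ∀ {p p′} → Prime p → Prime p′ → ∀ m → p ∣ p′ ^ m → p ≡ p′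
  ∣-prime-power⇒≡ pr pr′ zero p∣ =
    contradiction (∣1⇒≡1 p∣) (nonTrivial⇒≢1 {{prime⇒nonTrivial pr}})
  ∣-prime-power⇒≡ {p} {p′} pr pr′ (suc m) p∣ with euclidsLemma p′ (p′ ^ m) pr p∣
  ... | inj₂ p∣p′^m = ∣-prime-power⇒≡ pr pr′ m p∣p′^m
  ... | inj₁ p∣p′ with prime⇒irreducible pr′ p∣p′
  ...   | inj₁ p≡1 = contradiction p≡1 (nonTrivial⇒≢1 {{prime⇒nonTrivial pr}})
  ...   | inj₂ p≡p′ = p≡p′

  prime-powers-coprime : ∀ {p p′} → Prime p → Prime p′ → p ≢ p′ → ∀ m m′ → Coprime (p ^ m) (p′ ^ m′)
  prime-powers-coprime {p} pr pr′ p≢p′ m m′ (d∣ , d∣′) with ∣-prime-power pr m d∣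
  ... | zero  , d≡1  = d≡1
  ... | suc k , refl = contradiction (∣-prime-power⇒≡ pr pr′ m′ (∣-trans (m∣m*n (p ^ k)) d∣′)) p≢p′

  coprime⇒idempotent : ∀ {m n} .{{_ : NonZero m}} .{{_ : NonZero n}} → Coprime m n → ∃[ x ] (x ≡ 1 ⟪ m ⟫ × n ∣ x)
  coprime⇒idempotent {m} {n} cop with coprime-Bézout cop
  ... | Bézout.-+ x y eq = y * n , (0 , x , trans (+-identityʳ _) (sym eq)) , n∣m*n y
  -- Here y n is congruent to -1 modulo m; the factor `pred m` corrects the sign.
  ... | Bézout.+- x y eq = y * n * pred m ,
    (x , y * n , lemma m y eq) , ∣m⇒∣m*n (pred m) (n∣m*n y)
    where
    lemma : ∀ m .{{_ : NonZero m}} y → 1 + y * n ≡ x * m → y * n * pred m + x * m ≡ 1 + y * n * m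
    lemma (suc m) y eq = trans (cong (y * n * m +_) (sym eq))
      (solve 2 (λ yn m → yn :* m :+ (con 1 :+ yn) := con 1 :+ yn :* (con 1 :+ m)) refl (y * n) m)

-- Elimination of one unknown from a linear system modulo a prime power

module Elimination where

  open Congruences
  open import Data.Bool.Base using (Bool; true; false) renaming (if_then_else_ to if′_then_else_)
  open import Data.List.Base using (List; []; _∷_; length; foldl; map; zip)
  open import Data.List.Properties using (length-map)
  open import Data.List.Relation.Unary.All using (All; []; _∷_)
  open import Data.List.Relation.Binary.Pointwise using (Pointwise; []; _∷_)
  open import Data.Nat.Base hiding (_/_)
  open import Data.Nat.Properties
  open import Data.Nat.Divisibility
  open import Data.Nat.DivMod using (_mod_)
  open import Data.Nat.Solver using (module +-*-Solver)
  open import Relation.Binary.PropositionalEquality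
  open +-*-Solver using (solve; _:+_; _:*_; _:=_; con)

  -- A multiplier that clears h₂ with h₁, or h₁ with h₂, modulo q.
  data Choice (q : ℕ) {Q : ℕ} (h₁ h₂ : Fin Q) : Set where
    first  : ∀ (c : Fin Q) → q ∣ toℕ h₁ * toℕ c + toℕ h₂ → Choice q h₁ h₂
    second : ∀ (c : Fin Q) → q ∣ toℕ h₂ * toℕ c + toℕ h₁ → Choice q h₁ h₂

  side : ∀ {q Q} {h₁ h₂ : Fin Q} → Choice q h₁ h₂ → Bool
  side (first _ _)  = true
  side (second _ _) = false

  factor : ∀ {q Q} {h₁ h₂ : Fin Q} → Choice q h₁ h₂ → Fin Q
  factor (first c _)  = c
  factor (second c _) = c

  module Rows {s : ℕ} (q : Fin s → ℕ) (Q′ : ℕ) (q∣Q : ∀ t → q t ∣ suc Q′)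
    (ratio : ∀ t (h₁ h₂ : Fin (suc Q′)) → Choice (q t) h₁ h₂)
    (annih : ∀ t (h : Fin (suc Q′)) → Σ (Fin (suc Q′)) λ u → ∀ b → q t ∣ toℕ u * b ⇔ (∃[ y ] q t ∣ toℕ h * y + b))
    where

    Q : ℕ
    Q = suc Q′

    -- The equation c + Σ aᵢ xᵢ ≡ 0, to be read modulo some q t.  The coefficients are kept
    -- modulo a common multiple Q of all q t, so that one type serves every sort.
    Row : Set
    Row = Fin Q × List (Fin Q)

    abstract
      -- The single arithmetic operation on coefficients: y = 0 gives scaling and c = 1 addition, so
      -- one table serves the whole algorithm.
      cmb : Fin Q → Fin Q → Fin Q → Fin Q
      cmb c x y = (toℕ y + toℕ c * toℕ x) mod Q

      cmb-≡ : ∀ t c x y → toℕ (cmb c x y) ≡ toℕ y + toℕ c * toℕ x ⟪ q t ⟫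
      cmb-≡ t c x y = ≡⟪⟫-∣ (q∣Q t) (toℕ-mod (toℕ y + toℕ c * toℕ x) Q)

    dot : List (Fin Q) → List ℕ → ℕ
    dot []       _        = 0
    dot (a ∷ as) []       = 0
    dot (a ∷ as) (x ∷ xs) = toℕ a * x + dot as xs

    lin : Row → List ℕ → ℕ
    lin (k , as) xs = toℕ k + dot as xs

    hd₀ : List (Fin Q) → Fin Q
    hd₀ []      = zero
    hd₀ (a ∷ _) = a

    dropHead : Row → Row
    dropHead (k , [])     = k , []
    dropHead (k , _ ∷ as) = k , as

    lead : Row → Fin Q
    lead r = hd₀ (proj₂ r)

    combine : Fin Q → Fin Q × Fin Q → Fin Q
    combine c (x , y) = cmb c x y

    axpy : Fin Q → Row → Row → Row
    axpy c (k , as) (l , bs) = cmb c k l , map (combine c) (zip as bs)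

    scale : Fin Q → Row → Row
    scale u (k , as) = cmb u k zero , map (λ a → cmb u a zero) as

    -- Whichever of the pivot and the next row can clear the other becomes the pivot, so each row
    -- costs one combination. The finished rows have already lost the unknown; the pivot keeps it
    -- until `finish`.
    elim-step : Fin s → Row × List Row → Row → Row × List Row
    elim-step t (p , done) r =
      if′ side (ratio t (lead p) (lead r))
      then (p , dropHead (axpy (factor (ratio t (lead p) (lead r))) p r) ∷ done)
      else (r , dropHead (axpy (factor (ratio t (lead p) (lead r))) r p) ∷ done)

    finish : Fin s → Row × List Row → List Row
    finish t (p , done) = dropHead (scale (proj₁ (annih t (lead p))) p) ∷ done

    elim : Fin s → List Row → List Row
    elim t []       = []
    elim t (r ∷ rs) = finish t (foldl (elim-step t) (r , []) rs)

    Sat : Fin s → List Row → List ℕ → Set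
    Sat t rows xs = All (λ r → q t ∣ lin r xs) rows

    WF : ℕ → List Row → Set
    WF n = All (λ r → length (proj₂ r) ≡ n)

    lin-drop : ∀ r y xs → lin r (y ∷ xs) ≡ toℕ (lead r) * y + lin (dropHead r) xs
    lin-drop (k , [])     y xs = refl
    lin-drop (k , a ∷ as) y xs = solve 3 (λ k ay d → k :+ (ay :+ d) := ay :+ (k :+ d)) refl (toℕ k) (toℕ a * y) (dot as xs)

    lin-axpy : ∀ t c r r′ xs → length (proj₂ r) ≡ length (proj₂ r′) →
      lin (axpy c r r′) xs ≡ lin r′ xs + toℕ c * lin r xs ⟪ q t ⟫
    lin-axpy t c (k , as) (l , bs) xs eq = ≡⟪⟫-trans (≡⟪⟫-+ (cmb-≡ t c k l) (go as bs xs eq))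
      (≡⟪⟫-reflexive (solve 5 (λ l c k e d → (l :+ c :* k) :+ (e :+ c :* d) := (l :+ e) :+ c :* (k :+ d)) refl
        (toℕ l) (toℕ c) (toℕ k) (dot bs xs) (dot as xs)))
      where
      go : ∀ as bs xs → length as ≡ length bs →
        dot (map (combine c) (zip as bs)) xs ≡ dot bs xs + toℕ c * dot as xs ⟪ q t ⟫
      go []       []       xs       eq = ≡⟪⟫-reflexive (sym (*-zeroʳ (toℕ c)))
      go (a ∷ as) (b ∷ bs) []       eq = ≡⟪⟫-reflexive (sym (*-zeroʳ (toℕ c)))
      go (a ∷ as) (b ∷ bs) (x ∷ xs) eq =
        ≡⟪⟫-trans (≡⟪⟫-+ (≡⟪⟫-* (cmb-≡ t c a b) ≡⟪⟫-refl) (go as bs xs (suc-injective eq)))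
          (≡⟪⟫-reflexive (solve 6 (λ b c a x e d → (b :+ c :* a) :* x :+ (e :+ c :* d) := (b :* x :+ e) :+ c :* (a :* x :+ d)) refl
            (toℕ b) (toℕ c) (toℕ a) x (dot bs xs) (dot as xs)))

    lin-scale : ∀ t u r xs → lin (scale u r) xs ≡ toℕ u * lin r xs ⟪ q t ⟫
    lin-scale t u (k , as) xs = ≡⟪⟫-trans (≡⟪⟫-+ (cmb-≡ t u k zero) (go as xs))
      (≡⟪⟫-reflexive (sym (*-distribˡ-+ (toℕ u) (toℕ k) (dot as xs))))
      where
      go : ∀ as xs → dot (map (λ a → cmb u a zero) as) xs ≡ toℕ u * dot as xs ⟪ q t ⟫
      go []       xs       = ≡⟪⟫-reflexive (sym (*-zeroʳ (toℕ u)))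
      go (a ∷ as) []       = ≡⟪⟫-reflexive (sym (*-zeroʳ (toℕ u)))
      go (a ∷ as) (x ∷ xs) = ≡⟪⟫-trans (≡⟪⟫-+ (≡⟪⟫-* (cmb-≡ t u a zero) ≡⟪⟫-refl) (go as xs))
        (≡⟪⟫-reflexive (solve 4 (λ u a x d → (u :* a) :* x :+ u :* d := u :* (a :* x :+ d)) refl (toℕ u) (toℕ a) x (dot as xs)))

    lead-axpy : ∀ t c r r′ → length (proj₂ r) ≡ length (proj₂ r′) →
      q t ∣ toℕ (lead r) * toℕ c + toℕ (lead r′) → q t ∣ toℕ (lead (axpy c r r′))
    lead-axpy t c (k , [])     (l , [])     eq d = q t ∣0
    lead-axpy t c (k , a ∷ as) (l , b ∷ bs) eq d = ∣-resp-≡⟪⟫ (≡⟪⟫-sym (cmb-≡ t c a b))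
      (subst (q t ∣_) (solve 3 (λ a c b → a :* c :+ b := b :+ c :* a) refl (toℕ a) (toℕ c) (toℕ b)) d)

    -- Adding a multiple of a satisfied row changes no value modulo q, and the leading coefficient
    -- of the result is 0 modulo q, so it may be dropped. A congruence, rather than an implication,
    -- gives both directions of `elim-step-Sat`.
    reduced-≡ : ∀ t c r r′ y xs → length (proj₂ r) ≡ length (proj₂ r′) →
      q t ∣ toℕ (lead r) * toℕ c + toℕ (lead r′) → q t ∣ lin r (y ∷ xs) →
      lin r′ (y ∷ xs) ≡ lin (dropHead (axpy c r r′)) xs ⟪ q t ⟫
    reduced-≡ t c r r′ y xs eq d sat = ≡⟪⟫-sym (begin-≡
      (≡⟪⟫-trans (≡⟪⟫-sym (≡⟪⟫-+ (∣⇒≡⟪⟫ (∣m⇒∣m*n y (lead-axpy t c r r′ eq d))) ≡⟪⟫-refl))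
      (≡⟪⟫-trans (≡⟪⟫-reflexive (sym (lin-drop (axpy c r r′) y xs)))
      (≡⟪⟫-trans (lin-axpy t c r r′ (y ∷ xs) eq)
      (≡⟪⟫-trans (≡⟪⟫-+ ≡⟪⟫-refl (∣⇒≡⟪⟫ (∣n⇒∣m*n (toℕ c) sat))) (≡⟪⟫-reflexive (+-identityʳ _)))))))
      where
      begin-≡ : ∀ {x y} → x ≡ y ⟪ q t ⟫ → x ≡ y ⟪ q t ⟫
      begin-≡ p = p

    length-axpy : ∀ c r r′ {n} → length (proj₂ r) ≡ n → length (proj₂ r′) ≡ n → length (proj₂ (axpy c r r′)) ≡ n
    length-axpy c (k , as) (l , bs) refl eq = go as bs eq
      where
      go : ∀ as bs → length bs ≡ length as → length (map (combine c) (zip as bs)) ≡ length as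
      go []       []       eq = refl
      go (a ∷ as) (b ∷ bs) eq = cong suc (go as bs (suc-injective eq))

    length-drop : ∀ r {n} → length (proj₂ r) ≡ suc n → length (proj₂ (dropHead r)) ≡ n
    length-drop (k , a ∷ as) eq = suc-injective eq

    length-scale : ∀ u r {n} → length (proj₂ r) ≡ n → length (proj₂ (scale u r)) ≡ n
    length-scale u (k , as) eq = trans (length-map _ as) eq

    State : ℕ → Row × List Row → Set
    State n (p , done) = length (proj₂ p) ≡ suc n × WF n done

    Holds : Fin s → Row × List Row → ℕ → List ℕ → Set
    Holds t (p , done) y xs = q t ∣ lin p (y ∷ xs) × Sat t done xs

    elim-step-WF : ∀ {n} t st r → State n st → length (proj₂ r) ≡ suc n → State n (elim-step t st r)
    elim-step-WF t (p , done) r (lp , ld) lr with ratio t (lead p) (lead r)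
    ... | first c _ = lp , length-drop (axpy c p r) (length-axpy c p r lp lr) ∷ ld
    ... | second c _ = lr , length-drop (axpy c r p) (length-axpy c r p lr lp) ∷ ld

    elim-step-Sat : ∀ {n} t st r y xs → State n st → length (proj₂ r) ≡ suc n →
      (Holds t st y xs × q t ∣ lin r (y ∷ xs)) ⇔ Holds t (elim-step t st r) y xs
    elim-step-Sat t (p , done) r y xs (lp , ld) lr with ratio t (lead p) (lead r)
    ... | first c d = mk⇔
      (λ ((sp , sd) , sr) → sp , ∣-resp-≡⟪⟫ (reduced-≡ t c p r y xs (trans lp (sym lr)) d sp) sr ∷ sd)
      (λ { (sp , s ∷ sd) → (sp , sd) , ∣-resp-≡⟪⟫ (≡⟪⟫-sym (reduced-≡ t c p r y xs (trans lp (sym lr)) d sp)) s })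
    ... | second c d = mk⇔
      (λ ((sp , sd) , sr) → sr , ∣-resp-≡⟪⟫ (reduced-≡ t c r p y xs (trans lr (sym lp)) d sr) sp ∷ sd)
      (λ { (sr , s ∷ sd) → (∣-resp-≡⟪⟫ (≡⟪⟫-sym (reduced-≡ t c r p y xs (trans lr (sym lp)) d sr)) s , sd) , sr })

    elim-fold-WF : ∀ {n} t st rs → State n st → WF (suc n) rs → State n (foldl (elim-step t) st rs)
    elim-fold-WF t st []       ws []         = ws
    elim-fold-WF t st (r ∷ rs) ws (wr ∷ wrs) = elim-fold-WF t (elim-step t st r) rs (elim-step-WF t st r ws wr) wrs

    elim-fold-Sat : ∀ {n} t st rs y xs → State n st → WF (suc n) rs →
      (Holds t st y xs × Sat t rs (y ∷ xs)) ⇔ Holds t (foldl (elim-step t) st rs) y xs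
    elim-fold-Sat t st []       y xs ws []         = mk⇔ proj₁ (_, [])
    elim-fold-Sat t st (r ∷ rs) y xs ws (wr ∷ wrs) = mk⇔
      (λ { (h , sr ∷ srs) → Equivalence.to rest (Equivalence.to step (h , sr) , srs) })
      (λ h → let h′ , srs = Equivalence.from rest h ; h″ , sr = Equivalence.from step h′ in h″ , sr ∷ srs)
      where
      step = elim-step-Sat t st r y xs ws wr
      rest = elim-fold-Sat t (elim-step t st r) rs y xs (elim-step-WF t st r ws wr) wrs

    elim-WF : ∀ {n} t rows → WF (suc n) rows → WF n (elim t rows)
    elim-WF t []       []         = []
    elim-WF t (r ∷ rs) (wr ∷ wrs)
      with foldl (elim-step t) (r , []) rs | elim-fold-WF t (r , []) rs (wr , []) wrs
    ... | p , done | lp , ld = length-drop (scale u p) (length-scale u p lp) ∷ ld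
      where u = proj₁ (annih t (lead p))

    -- The pivot is by now the only row that contains y, so the existence of y is a condition on
    -- this row alone, and the annihilator makes it linear.
    finish-Sat : ∀ t st xs → Sat t (finish t st) xs ⇔ (∃[ y ] Holds t st y xs)
    finish-Sat t (p , done) xs = mk⇔
      (λ { (s ∷ sd) →
        let y , d = Equivalence.to (annihilates (lin (dropHead p) xs)) (∣-resp-≡⟪⟫ scaled s)
        in y , subst (q t ∣_) (sym (lin-drop p y xs)) d , sd })
      (λ (y , sp , sd) → ∣-resp-≡⟪⟫ (≡⟪⟫-sym scaled)
        (Equivalence.from (annihilates (lin (dropHead p) xs)) (y , subst (q t ∣_) (lin-drop p y xs) sp)) ∷ sd)
      where
      u = proj₁ (annih t (lead p))
      annihilates = proj₂ (annih t (lead p))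
      drop-scale : ∀ r → dropHead (scale u r) ≡ scale u (dropHead r)
      drop-scale (k , [])     = refl
      drop-scale (k , a ∷ as) = refl
      scaled : lin (dropHead (scale u p)) xs ≡ toℕ u * lin (dropHead p) xs ⟪ q t ⟫
      scaled = ≡⟪⟫-trans (≡⟪⟫-reflexive (cong (λ r → lin r xs) (drop-scale p))) (lin-scale t u (dropHead p) xs)

    elim-Sat : ∀ {n} t rows xs → WF (suc n) rows → Sat t (elim t rows) xs ⇔ (∃[ y ] Sat t rows (y ∷ xs))
    elim-Sat t []       xs []         = mk⇔ (λ _ → 0 , []) (λ _ → [])
    elim-Sat t (r ∷ rs) xs (wr ∷ wrs) = mk⇔
      (λ s → let y , h = Equivalence.to fin s ; (sr , _) , srs = Equivalence.from (fold y) h in y , sr ∷ srs)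
      (λ { (y , sr ∷ srs) → Equivalence.from fin (y , Equivalence.to (fold y) ((sr , []) , srs)) })
      where
      fin = finish-Sat t (foldl (elim-step t) (r , []) rs) xs
      fold = λ y → elim-fold-Sat t (r , []) rs y xs (wr , []) wrs

    infix 4 _≐_
    -- Systems that differ in their constants only. Pivots, multipliers and annihilators are chosen
    -- from leading coefficients, so elimination runs in parallel on such systems.
    _≐_ : List Row → List Row → Set
    _≐_ = Pointwise (λ r r′ → proj₂ r ≡ proj₂ r′)

    _≐ᶠ_ : Row × List Row → Row × List Row → Set
    (p , done) ≐ᶠ (p′ , done′) = proj₂ p ≡ proj₂ p′ × done ≐ done′

    proj₂-drop : ∀ {r r′} → proj₂ r ≡ proj₂ r′ → proj₂ (dropHead r) ≡ proj₂ (dropHead r′)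
    proj₂-drop {_ , []}     {_ , _} refl = refl
    proj₂-drop {_ , _ ∷ _} {_ , _} refl = refl

    elim-step-≐ : ∀ t {st st′ r r′} → st ≐ᶠ st′ → proj₂ r ≡ proj₂ r′ → elim-step t st r ≐ᶠ elim-step t st′ r′
    elim-step-≐ t {((k , as) , done)} {((k′ , .as) , done′)} {(l , bs)} {(l′ , .bs)} (refl , eq) refl
      with ratio t (hd₀ as) (hd₀ bs)
    ... | first c _ = refl , proj₂-drop {axpy c (k , as) (l , bs)} {axpy c (k′ , as) (l′ , bs)} refl ∷ eq
    ... | second c _ = refl , proj₂-drop {axpy c (l , bs) (k , as)} {axpy c (l′ , bs) (k′ , as)} refl ∷ eq

    elim-fold-≐ : ∀ t {st st′ rs rs′} → st ≐ᶠ st′ → rs ≐ rs′ → foldl (elim-step t) st rs ≐ᶠ foldl (elim-step t) st′ rs′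
    elim-fold-≐ t eq []         = eq
    elim-fold-≐ t {st} {st′} eq (_∷_ {r} {r′} eqr eqs) = elim-fold-≐ t (elim-step-≐ t {st} {st′} {r} {r′} eq eqr) eqs

    elim-≐ : ∀ t {rows rows′} → rows ≐ rows′ → elim t rows ≐ elim t rows′
    elim-≐ t []         = []
    elim-≐ t {r ∷ rs} {r′ ∷ rs′} (eqr ∷ eqs)
      with foldl (elim-step t) (r , []) rs | foldl (elim-step t) (r′ , []) rs′
         | elim-fold-≐ t {r , []} {r′ , []} (eqr , []) eqs
    ... | (k , as) , done | (k′ , .as) , done′ | refl , eq =
      proj₂-drop {scale u (k , as)} {scale u (k′ , as)} refl ∷ eq
      where u = proj₁ (annih t (hd₀ as))

-- Finite sums in a commutative semiring

module FiniteSums where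

  open import Algebra.Bundles using (CommutativeSemiring)
  open import Data.List.Base using (List; []; _∷_; map; concatMap; _++_)
  open import Level using (0ℓ)

  module Sums (R : CommutativeSemiring 0ℓ 0ℓ) where
    open CommutativeSemiring R
    open import Relation.Binary.Reasoning.Setoid setoid

    ∑ : ∀ {A : Set} → List A → (A → Carrier) → Carrier
    ∑ []       f = 0#
    ∑ (a ∷ as) f = f a + ∑ as f

    ∑-cong : ∀ {A : Set} {f g : A → Carrier} (as : List A) → (∀ a → f a ≈ g a) → ∑ as f ≈ ∑ as g
    ∑-cong []       eq = refl
    ∑-cong (a ∷ as) eq = +-cong (eq a) (∑-cong as eq)

    ∑-map : ∀ {A B : Set} (f : B → Carrier) (h : A → B) as → ∑ (map h as) f ≈ ∑ as (λ a → f (h a))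
    ∑-map f h []       = refl
    ∑-map f h (a ∷ as) = +-congˡ (∑-map f h as)

    ∑-++ : ∀ {A : Set} (f : A → Carrier) as bs → ∑ (as ++ bs) f ≈ ∑ as f + ∑ bs f
    ∑-++ f []       bs = sym (+-identityˡ _)
    ∑-++ f (a ∷ as) bs = trans (+-congˡ (∑-++ f as bs)) (sym (+-assoc _ _ _))

    ∑-concatMap : ∀ {A B : Set} (f : B → Carrier) (h : A → List B) as →
      ∑ (concatMap h as) f ≈ ∑ as (λ a → ∑ (h a) f)
    ∑-concatMap f h []       = refl
    ∑-concatMap f h (a ∷ as) = trans (∑-++ f (h a) _) (+-congˡ (∑-concatMap f h as))

    ∑-zero : ∀ {A : Set} (as : List A) → ∑ as (λ _ → 0#) ≈ 0#
    ∑-zero []       = refl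
    ∑-zero (a ∷ as) = trans (+-identityˡ _) (∑-zero as)

    ∑-+ : ∀ {A : Set} (f g : A → Carrier) as → ∑ as (λ a → f a + g a) ≈ ∑ as f + ∑ as g
    ∑-+ f g []       = sym (+-identityˡ 0#)
    ∑-+ f g (a ∷ as) = begin
      f a + g a + ∑ as (λ a → f a + g a)  ≈⟨ +-congˡ (∑-+ f g as) ⟩
      f a + g a + (∑ as f + ∑ as g)       ≈⟨ +-assoc _ _ _ ⟩
      f a + (g a + (∑ as f + ∑ as g))     ≈⟨ +-congˡ (+-assoc _ _ _) ⟨
      f a + (g a + ∑ as f + ∑ as g)       ≈⟨ +-congˡ (+-congʳ (+-comm _ _)) ⟩
      f a + (∑ as f + g a + ∑ as g)       ≈⟨ +-congˡ (+-assoc _ _ _) ⟩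
      f a + (∑ as f + (g a + ∑ as g))     ≈⟨ +-assoc _ _ _ ⟨
      f a + ∑ as f + (g a + ∑ as g)       ∎

    ∑-swap : ∀ {A B : Set} (f : A → B → Carrier) as bs →
      ∑ as (λ a → ∑ bs (f a)) ≈ ∑ bs (λ b → ∑ as (λ a → f a b))
    ∑-swap f []       bs = sym (∑-zero bs)
    ∑-swap f (a ∷ as) bs = trans (+-congˡ (∑-swap f as bs)) (sym (∑-+ (f a) _ bs))

    ∑-*ˡ : ∀ {A : Set} c (f : A → Carrier) as → c * ∑ as f ≈ ∑ as (λ a → c * f a)
    ∑-*ˡ c f []       = zeroʳ c
    ∑-*ˡ c f (a ∷ as) = trans (distribˡ c _ _) (+-congˡ (∑-*ˡ c f as))

-- Moments of the solution set by fixing and eliminating variables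

module Counting where

  open import Defs
  open Congruences
  open Elimination
  open FiniteSums
  open import Data.Bool.Base using (Bool; true; false; _∨_) renaming (if_then_else_ to if′_then_else_)
  open import Data.Bool.ListAction using (all)
  open import Data.Fin.Base using (inject≤; inject₁)
  open import Data.Fin.Properties using (toℕ-inject≤; toℕ-inject₁) renaming (_≟_ to _≟ᶠ_; all? to allᶠ?)
  open import Data.List.Base using (List; []; _∷_; length; map; concatMap; allFin; tabulate; foldl; _++_)
  open import Data.List.Properties using (map-∘; concatMap-++; ++-identityʳ)
  open import Data.List.Relation.Unary.All using (All; []; _∷_)
  import Data.List.Relation.Unary.All as All
  open import Data.List.Relation.Unary.All.Properties using () renaming (map⁺ to All-map⁺; map⁻ to All-map⁻)
  open import Data.List.Membership.Propositional.Properties using (∈-allFin)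
  open import Data.List.Relation.Binary.Pointwise using ([]; _∷_)
  open import Data.Nat.Base hiding (_/_)
  open import Data.Nat.Properties
  open import Data.Nat.Divisibility
  open import Data.Nat.Solver using (module +-*-Solver)
  open import Data.Vec.Base using (Vec; []; _∷_)
  import Data.Vec.Relation.Unary.All as Vecᴬ
  open Vecᴬ using ([]; _∷_)
  open import Function.Base using (_∘_)
  open import Relation.Binary.PropositionalEquality
  open import Relation.Nullary using (Dec; does; yes; no)
  open import Relation.Nullary.Decidable using (does-⇔; dec-true; dec-false)
  open +-*-Solver using (solve; _:+_; _:*_; _:=_; con)
  open Sums +-*-commutativeSemiring public

  sum-below : ℕ → (ℕ → ℕ) → ℕ
  sum-below zero    f = 0
  sum-below (suc n) f = f 0 + sum-below n (f ∘ suc)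

  ∑-allFin : ∀ n (f : ℕ → ℕ) → ∑ (allFin n) (f ∘ toℕ) ≡ sum-below n f
  ∑-allFin n f = go n (λ i → i) f (λ _ → refl)
    where
    go : ∀ {m} n (h : Fin n → Fin m) g → (∀ i → f (toℕ (h i)) ≡ g (toℕ i)) → ∑ (tabulate h) (f ∘ toℕ) ≡ sum-below n g
    go zero    h g eq = refl
    go (suc n) h g eq = cong₂ _+_ (eq zero) (go n (h ∘ suc) (g ∘ suc) (eq ∘ suc))

  sum-below-rotate : ∀ n f → sum-below n (f ∘ suc) + f 0 ≡ sum-below n f + f n
  sum-below-rotate zero    f = refl
  sum-below-rotate (suc n) f = begin
    f 1 + sum-below n (λ y → f (suc (suc y))) + f 0 ≡⟨ cong (_+ f 0) (trans (+-comm (f 1) _) (sum-below-rotate n (f ∘ suc))) ⟩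
    sum-below n (f ∘ suc) + f (suc n) + f 0 ≡⟨ solve 3 (λ a b c → a :+ b :+ c := c :+ a :+ b) refl (sum-below n (f ∘ suc)) (f (suc n)) (f 0) ⟩
    f 0 + sum-below n (f ∘ suc) + f (suc n) ∎
    where open ≡-Reasoning

  sum-below-cong : ∀ n {f g} → (∀ y → f y ≡ g y) → sum-below n f ≡ sum-below n g
  sum-below-cong zero    eq = refl
  sum-below-cong (suc n) eq = cong₂ _+_ (eq 0) (sum-below-cong n (eq ∘ suc))

  -- A shift by one trades a value for the one a full period later, which is the same. This carries
  -- the solutions of a linear system over to those of its homogeneous form.
  sum-below-shift : ∀ n f → (∀ y → f (y + n) ≡ f y) → ∀ k → sum-below n (λ y → f (y + k)) ≡ sum-below n f
  sum-below-shift n f periodic zero    = sum-below-cong n (λ y → cong f (+-identityʳ y))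
  sum-below-shift n f periodic (suc k) = trans (sum-below-cong n (λ y → cong f (+-suc y k)))
    (trans (+-cancelʳ-≡ (f k) _ _ (trans (sum-below-rotate n (λ y → f (y + k)))
              (cong (sum-below n (λ y → f (y + k)) +_) (trans (cong f (+-comm n k)) (periodic k)))))
           (sum-below-shift n f periodic k))

  ind : Bool → ℕ → ℕ
  ind true  x = x
  ind false x = 0

  ind-* : ∀ b x → ind b x ≡ x * ind b 1
  ind-* true  x = sym (*-identityʳ x)
  ind-* false x = sym (*-zeroʳ x)

  module Count {s : ℕ} (q : Fin s → ℕ) (Q′ : ℕ) (q∣Q : ∀ t → q t ∣ suc Q′) (0<q : ∀ t → 0 < q t)
    (ratio : ∀ t (h₁ h₂ : Fin (suc Q′)) → Choice (q t) h₁ h₂)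
    (annih : ∀ t (h : Fin (suc Q′)) → Σ (Fin (suc Q′)) λ u → ∀ b → q t ∣ toℕ u * b ⇔ (∃[ y ] q t ∣ toℕ h * y + b))
    where
    open Rows q Q′ q∣Q ratio annih public
    open MCSP q using (D) public

    q≤Q : ∀ t → q t ≤ Q
    q≤Q t = ∣⇒≤ (q∣Q t)

    -- Each sort has a system in all variables, in which entries of other sorts are set to 0. All
    -- rows then have equal length, and one step removes the same variable from every system.
    mask : Fin s → ∀ {n} {δ : Vec (Fin s) n} → Vecᴬ.All D δ → List ℕ
    mask t []                    = []
    mask t (_∷_ {x = t′} a as) = (if′ does (t ≟ᶠ t′) then toℕ a else 0) ∷ mask t as

    assigns : ∀ {n} (δ : Vec (Fin s) n) → List (Vecᴬ.All D δ)
    assigns []      = [] ∷ []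
    assigns (t ∷ δ) = concatMap (λ a → map (a ∷_) (assigns δ)) (allFin (q t))

    ∑-assigns : ∀ {n} t (δ : Vec (Fin s) n) f →
      ∑ (assigns (t ∷ δ)) f ≡ ∑ (allFin (q t)) (λ a → ∑ (assigns δ) (λ as → f (a ∷ as)))
    ∑-assigns t δ f = trans (∑-concatMap f (λ a → map (a ∷_) (assigns δ)) (allFin (q t)))
      (∑-cong (allFin (q t)) (λ a → ∑-map f (a ∷_) (assigns δ)))

    Sys : Set
    Sys = List (Fin s × List Row)

    System : Set
    System = Fin s → List Row

    tab : System → Sys
    tab R = map (λ t → t , R t) (allFin s)

    SatAll : System → ∀ {n} {δ : Vec (Fin s) n} → Vecᴬ.All D δ → Set
    SatAll R a = ∀ t → Sat t (R t) (mask t a)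

    sat-row? : ∀ t rows xs → Dec (Sat t rows xs)
    sat-row? t rows xs = All.all? (λ r → q t ∣? lin r xs) rows

    sat? : ∀ R {n} {δ : Vec (Fin s) n} (a : Vecᴬ.All D δ) → Dec (SatAll R a)
    sat? R a = allᶠ? (λ t → sat-row? t (R t) (mask t a))

    -- A variable of sort t is masked to 0 in the systems of all other sorts, so there its column
    -- can simply be dropped.
    elimAt : Fin s → System → System
    elimAt t R t′ = if′ does (t′ ≟ᶠ t) then elim t′ (R t′) else map dropHead (R t′)

    plug : Fin Q → Row → Row
    plug a r = cmb a (lead r) (proj₁ r) , proj₂ (dropHead r)

    plugAt : Fin s → Fin Q → System → System
    plugAt t a R t′ = if′ does (t′ ≟ᶠ t) then map (plug a) (R t′) else map dropHead (R t′)

    embed : ∀ t → Fin (q t) → Fin Q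
    embed t a = inject≤ a (q≤Q t)

    map-Sat : ∀ t (g : Row → Row) xs ys → (∀ r → lin r xs ≡ lin (g r) ys ⟪ q t ⟫) →
      ∀ rows → Sat t rows xs ⇔ Sat t (map g rows) ys
    map-Sat t g xs ys eq rows = mk⇔ (to rows) (from rows)
      where
      to : ∀ rows → Sat t rows xs → Sat t (map g rows) ys
      to []       []       = []
      to (r ∷ rs) (s ∷ ss) = ∣-resp-≡⟪⟫ (eq r) s ∷ to rs ss
      from : ∀ rows → Sat t (map g rows) ys → Sat t rows xs
      from []       []       = []
      from (r ∷ rs) (s ∷ ss) = ∣-resp-≡⟪⟫ (≡⟪⟫-sym (eq r)) s ∷ from rs ss

    drop-Sat : ∀ t rows xs → Sat t rows (0 ∷ xs) ⇔ Sat t (map dropHead rows) xs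
    drop-Sat t rows xs = map-Sat t dropHead (0 ∷ xs) xs (λ r → ≡⟪⟫-reflexive
      (trans (lin-drop r 0 xs) (cong (_+ lin (dropHead r) xs) (*-zeroʳ (toℕ (lead r)))))) rows

    plug-Sat : ∀ t (a : Fin Q) rows xs → Sat t rows (toℕ a ∷ xs) ⇔ Sat t (map (plug a) rows) xs
    plug-Sat t a rows xs = map-Sat t (plug a) (toℕ a ∷ xs) xs plugged rows
      where
      plugged : ∀ r → lin r (toℕ a ∷ xs) ≡ lin (plug a r) xs ⟪ q t ⟫
      plugged (k , [])     = ≡⟪⟫-sym (≡⟪⟫-+ (≡⟪⟫-trans (cmb-≡ t a zero k)
        (≡⟪⟫-reflexive (trans (cong (toℕ k +_) (*-zeroʳ (toℕ a))) (+-identityʳ (toℕ k))))) ≡⟪⟫-refl)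
      plugged (k , h ∷ as) = ≡⟪⟫-sym (≡⟪⟫-trans (≡⟪⟫-+ (cmb-≡ t a h k) ≡⟪⟫-refl)
        (≡⟪⟫-reflexive (solve 4 (λ k a h d → (k :+ a :* h) :+ d := k :+ (h :* a :+ d)) refl (toℕ k) (toℕ a) (toℕ h) (dot as xs))))

    plugAt-SatAll : ∀ {n} {δ : Vec (Fin s) n} t R (a : Fin (q t)) (as : Vecᴬ.All D δ) →
      SatAll R {δ = t ∷ δ} (a ∷ as) ⇔ SatAll (plugAt t (embed t a) R) as
    plugAt-SatAll t R a as = mk⇔ (λ S t′ → Equivalence.to (each t′) (S t′)) (λ S t′ → Equivalence.from (each t′) (S t′))
      where
      each : ∀ t′ → Sat t′ (R t′) (mask t′ (_∷_ {x = t} a as)) ⇔ Sat t′ (plugAt t (embed t a) R t′) (mask t′ as)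
      each t′ with t′ ≟ᶠ t
      ... | yes refl = subst (λ y → Sat t′ (R t′) (y ∷ mask t′ as) ⇔ Sat t′ (map (plug (embed t a)) (R t′)) (mask t′ as))
                         (toℕ-inject≤ a (q≤Q t)) (plug-Sat t′ (embed t a) (R t′) (mask t′ as))
      ... | no  _    = drop-Sat t′ (R t′) (mask t′ as)

    homogeneous? : ∀ t rows y → Dec (All (λ r → q t ∣ toℕ (lead r) * y) rows)
    homogeneous? t rows y = All.all? (λ r → q t ∣? toℕ (lead r) * y) rows

    -- Only leading coefficients occur, so the value is the same in all branches; y = 0 always
    -- counts, so it is positive and can be cancelled.
    kernel : Fin s → List Row → ℕ
    kernel t rows = sum-below (q t) (λ y → ind (does (homogeneous? t rows y)) 1)

    1≤kernel : ∀ t rows → 1 ≤ kernel t rows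
    1≤kernel t rows with q t | 0<q t | (λ y → homogeneous? t rows y) | trivial
      where
      trivial : does (homogeneous? t rows 0) ≡ true
      trivial = dec-true (homogeneous? t rows 0) (All.universal (λ r → ∣n⇒∣m*n (toℕ (lead r)) (q t ∣0)) rows)
    ... | suc n | _ | h | eq = ≤-trans (≤-reflexive (sym (cong (λ b → ind b 1) eq))) (m≤m+n _ _)

    kernel-≐ : ∀ t {rows rows′} → rows ≐ rows′ → kernel t rows ≡ kernel t rows′
    kernel-≐ t {rows} {rows′} eq = sum-below-cong (q t) (λ y → cong (λ b → ind b 1)
      (does-⇔ (mk⇔ (transfer y eq) (transfer y (≐-sym eq))) (homogeneous? t rows y) (homogeneous? t rows′ y)))
      where
      transfer : ∀ y {rows rows′} → rows ≐ rows′ →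
        All (λ r → q t ∣ toℕ (lead r) * y) rows → All (λ r → q t ∣ toℕ (lead r) * y) rows′
      transfer y []         []       = []
      transfer y (eq ∷ eqs) (h ∷ hs) = subst (λ as → q t ∣ toℕ (hd₀ as) * y) eq h ∷ transfer y eqs hs
      ≐-sym : ∀ {rows rows′} → rows ≐ rows′ → rows′ ≐ rows
      ≐-sym []         = []
      ≐-sym (eq ∷ eqs) = sym eq ∷ ≐-sym eqs

    -- The solutions of the rows of sort t in their first unknown form a coset of the kernel or are absent.
    fiber : ∀ {n} {δ : Vec (Fin s) n} t R (as : Vecᴬ.All D δ) {m} → WF (suc m) (R t) →
      ∑ (allFin (q t)) (λ a → ind (does (sat? R {δ = t ∷ δ} (a ∷ as))) 1) ≡
      kernel t (R t) * ind (does (sat? (elimAt t R) as)) 1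
    fiber {δ = δ} t R as wf = by-cases (sat? (elimAt t R) as)
      where
      xs = mask t as
      elim-at : elimAt t R t ≡ elim t (R t)
      elim-at = cong (λ b → if′ b then elim t (R t) else map dropHead (R t)) (dec-true (t ≟ᶠ t) refl)
      project : ∀ a → SatAll R {δ = t ∷ δ} (a ∷ as) → SatAll (elimAt t R) as
      project a S t′ with t′ ≟ᶠ t | S t′
      ... | yes refl | St = Equivalence.from (elim-Sat t (R t) xs wf) (toℕ a , St)
      ... | no  _    | St = Equivalence.to (drop-Sat t′ (R t′) (mask t′ as)) St
      here : ∀ a → SatAll R {δ = t ∷ δ} (a ∷ as) → Sat t (R t) (toℕ a ∷ xs)
      here a S = subst (λ b → Sat t (R t) ((if′ b then toℕ a else 0) ∷ xs)) (dec-true (t ≟ᶠ t) refl) (S t)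
      others : SatAll (elimAt t R) as → ∀ a → Sat t (R t) (toℕ a ∷ xs) → SatAll R {δ = t ∷ δ} (a ∷ as)
      others S a St t′ with t′ ≟ᶠ t | S t′
      ... | yes refl | _  = St
      ... | no  _    | S′ = Equivalence.from (drop-Sat t′ (R t′) (mask t′ as)) S′
      lin-shift : ∀ r y z → lin r ((y + z) ∷ xs) ≡ toℕ (lead r) * y + lin r (z ∷ xs)
      lin-shift r y z = trans (lin-drop r (y + z) xs)
        (trans (solve 4 (λ h y z l → h :* (y :+ z) :+ l := h :* y :+ (h :* z :+ l)) refl (toℕ (lead r)) y z (lin (dropHead r) xs))
               (cong (toℕ (lead r) * y +_) (sym (lin-drop r z xs))))
      ψ : ℕ → ℕ
      ψ y = ind (does (sat-row? t (R t) (y ∷ xs))) 1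
      ψ-cong : ∀ {y} {P : Set} (P? : Dec P) → Sat t (R t) (y ∷ xs) ⇔ P → ψ y ≡ ind (does P?) 1
      ψ-cong {y} P? eq = cong (λ b → ind b 1) (does-⇔ eq (sat-row? t (R t) (y ∷ xs)) P?)
      periodic : ∀ y → ψ (y + q t) ≡ ψ y
      periodic y = ψ-cong (sat-row? t (R t) (y ∷ xs)) (mk⇔
        (All.map (λ {r} → ∣-resp-≡⟪⟫ (shifted r)))
        (All.map (λ {r} → ∣-resp-≡⟪⟫ (≡⟪⟫-sym (shifted r)))))
        where
        shifted : ∀ r → lin r ((y + q t) ∷ xs) ≡ lin r (y ∷ xs) ⟪ q t ⟫
        shifted r = ≡⟪⟫-trans (≡⟪⟫-reflexive (trans (cong (λ z → lin r (z ∷ xs)) (+-comm y (q t))) (lin-shift r (q t) y)))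
          (≡⟪⟫-+ (∣⇒≡⟪⟫ (n∣m*n (toℕ (lead r)))) ≡⟪⟫-refl)
      coset : ∀ y₀ → Sat t (R t) (y₀ ∷ xs) → ∀ y → ψ (y + y₀) ≡ ind (does (homogeneous? t (R t) y)) 1
      coset y₀ S₀ y = ψ-cong (homogeneous? t (R t) y) (mk⇔
        (λ S → All.zipWith (λ {r} (d , d₀) → ∣m+n∣m⇒∣n (subst (q t ∣_) (trans (lin-shift r y y₀) (+-comm _ (lin r (y₀ ∷ xs)))) d) d₀) (S , S₀))
        (λ H → All.zipWith (λ {r} (d , d₀) → subst (q t ∣_) (sym (lin-shift r y y₀)) (∣m∣n⇒∣m+n d d₀)) (H , S₀)))
      by-cases : (d : Dec (SatAll (elimAt t R) as)) →
        ∑ (allFin (q t)) (λ a → ind (does (sat? R {δ = t ∷ δ} (a ∷ as))) 1) ≡ kernel t (R t) * ind (does d) 1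
      by-cases (no ¬S) = trans
        (∑-cong (allFin (q t)) (λ a → cong (λ b → ind b 1) (dec-false (sat? R (a ∷ as)) (λ S → ¬S (project a S)))))
        (trans (∑-zero (allFin (q t))) (sym (*-zeroʳ (kernel t (R t)))))
      by-cases (yes S) =
        -- `elim-Sat` yields y₀ as a natural number of any size; since ψ has period q t, it can
        -- still serve as the origin of the coset.
        let y₀ , S₀ = Equivalence.to (elim-Sat t (R t) xs wf) (subst (λ rows → Sat t rows xs) elim-at (S t))
        in begin
        ∑ (allFin (q t)) (λ a → ind (does (sat? R {δ = t ∷ δ} (a ∷ as))) 1)
          ≡⟨ ∑-cong (allFin (q t)) (λ a → sym (ψ-cong (sat? R (a ∷ as)) (mk⇔ (others S a) (here a)))) ⟩
        ∑ (allFin (q t)) (ψ ∘ toℕ)           ≡⟨ ∑-allFin (q t) ψ ⟩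
        sum-below (q t) ψ                    ≡⟨ sum-below-shift (q t) ψ periodic y₀ ⟨
        sum-below (q t) (λ y → ψ (y + y₀))   ≡⟨ sum-below-cong (q t) (coset y₀ S₀) ⟩
        kernel t (R t)                       ≡⟨ *-identityʳ _ ⟨
        kernel t (R t) * 1 ∎
        where open ≡-Reasoning

    Item : Set
    Item = Fin s × ℕ

    module Branches (F : ℕ) where

      -- The number of values that may still be fixed, the remaining system and the product of powers so far.
      Branch : Set
      Branch = Fin (suc F) × (Sys × ℕ)

      elimBlock : Fin s → Fin s × List Row → Fin s × List Row
      elimBlock t (t′ , rows) = t′ , (if′ does (t′ ≟ᶠ t) then elim t′ rows else map dropHead rows)

      plugBlock : Fin s → Fin Q → Fin s × List Row → Fin s × List Row
      plugBlock t a (t′ , rows) = t′ , (if′ does (t′ ≟ᶠ t) then map (plug a) rows else map dropHead rows)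

      predF : Fin (suc F) → Fin (suc F)
      predF zero    = zero
      predF (suc i) = inject₁ i

      isZero : Fin (suc F) → Bool
      isZero zero    = true
      isZero (suc _) = false

      values : Fin s → List (Fin Q)
      values t = map (embed t) (allFin (q t))

      fix : Item → Branch → Fin Q → Branch
      fix (t , e) (f , (sys , v)) a = predF f , (map (plugBlock t a) sys , v * toℕ a ^ e)

      -- For monomials within the degree bound the budget never runs out before an exponent is met.
      -- The test `isZero f` keeps the number of branches bounded on all other encoded arguments
      -- too, as the time bound of a program demands.
      grow : Item → Branch → List Branch
      grow (t , e) (f , (sys , v)) =
        if′ (e ≡ᵇ 0) ∨ isZero f then (f , (map (elimBlock t) sys , v)) ∷ []
        else map (fix (t , e) (f , (sys , v))) (values t)

      leaves : List Item → Branch → List Branch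
      leaves []         b = b ∷ []
      leaves (it ∷ its) b = concatMap (leaves its) (grow it b)

      -- The program advances all branches level by level, whereas the counting argument recurses
      -- along single branches.
      foldl-grow : ∀ its bs → foldl (λ bs it → concatMap (grow it) bs) bs its ≡ concatMap (leaves its) bs
      foldl-grow []         bs = sym (concatMap-singleton bs)
        where
        concatMap-singleton : ∀ {A : Set} (as : List A) → concatMap (_∷ []) as ≡ as
        concatMap-singleton []       = refl
        concatMap-singleton (a ∷ as) = cong (a ∷_) (concatMap-singleton as)
      foldl-grow (it ∷ its) bs = trans (foldl-grow its (concatMap (grow it) bs)) (concatMap-concatMap bs)
        where
        concatMap-concatMap : ∀ bs → concatMap (leaves its) (concatMap (grow it) bs) ≡ concatMap (leaves (it ∷ its)) bs
        concatMap-concatMap []       = refl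
        concatMap-concatMap (b ∷ bs) = trans (concatMap-++ (leaves its) (grow it b) (concatMap (grow it) bs))
          (cong (leaves (it ∷ its) b ++_) (concatMap-concatMap bs))

      consistent : Sys → Bool
      consistent = all (λ (t , rows) → all (λ r → does (q t ∣? toℕ (proj₁ r))) rows)

      consistent-tab : ∀ R → consistent (tab R) ≡ does (sat? R {δ = []} [])
      consistent-tab R = trans (all-does (λ (t , rows) → sat-row? t rows []) same (tab R))
        (does-⇔ (mk⇔ (λ S t → All-lookup S t) (λ S → All-map⁺ (All.tabulate (λ {t} _ → S t))))
          (All.all? (λ (t , rows) → sat-row? t rows []) (tab R)) (sat? R []))
        where
        all-does : ∀ {A : Set} {P : A → Set} (P? : ∀ a → Dec (P a)) {p : A → Bool} → (∀ a → p a ≡ does (P? a)) →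
          ∀ as → all p as ≡ does (All.all? P? as)
        all-does P? eq []       = refl
        all-does P? eq (a ∷ as) = cong₂ Data.Bool.Base._∧_ (eq a) (all-does P? eq as)
        no-unknowns : ∀ t r → does (q t ∣? toℕ (proj₁ r)) ≡ does (q t ∣? lin r [])
        no-unknowns t (k , [])     = cong (λ n → does (q t ∣? n)) (sym (+-identityʳ (toℕ k)))
        no-unknowns t (k , a ∷ as) = cong (λ n → does (q t ∣? n)) (sym (+-identityʳ (toℕ k)))
        same : ∀ b → all (λ r → does (q (proj₁ b) ∣? toℕ (proj₁ r))) (proj₂ b) ≡ does (sat-row? (proj₁ b) (proj₂ b) [])
        same (t , rows) = all-does (λ r → q t ∣? lin r []) (no-unknowns t) rows
        All-lookup : All (λ (t , rows) → Sat t rows []) (tab R) → ∀ t → Sat t (R t) []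
        All-lookup S t = All.lookup (All-map⁻ S) (∈-allFin t)

      count : List Branch → ℕ
      count bs = ∑ bs (λ (f , (sys , v)) → ind (consistent sys) 1)

      total : List Branch → ℕ
      total bs = ∑ bs (λ (f , (sys , v)) → ind (consistent sys) v)

      items : ∀ {n} → Vec (Fin s) n → Vec ℕ n → List Item
      items []      []      = []
      items (t ∷ δ) (e ∷ γ) = (t , e) ∷ items δ γ

      support : ∀ {n} → Vec ℕ n → ℕ
      support []          = 0
      support (zero ∷ γ)  = support γ
      support (suc _ ∷ γ) = suc (support γ)

      monomial : ∀ {n} {δ : Vec (Fin s) n} → Vec ℕ n → Vecᴬ.All D δ → ℕ
      monomial []      []       = 1
      monomial (e ∷ γ) (a ∷ as) = toℕ a ^ e * monomial γ as

      drop-WF : ∀ {n rows} → WF (suc n) rows → WF n (map dropHead rows)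
      drop-WF wf = All-map⁺ (All.map (λ {r} → length-drop r) wf)

      elimAt-WF : ∀ {n} t R → (∀ t → WF (suc n) (R t)) → ∀ t′ → WF n (elimAt t R t′)
      elimAt-WF t R wf t′ with does (t′ ≟ᶠ t)
      ... | true  = elim-WF t′ (R t′) (wf t′)
      ... | false = drop-WF (wf t′)

      drop-≐ : ∀ {rows rows′} → rows ≐ rows′ → map dropHead rows ≐ map dropHead rows′
      drop-≐ []                  = []
      drop-≐ (_∷_ {r} {r′} eq eqs) = proj₂-drop {r} {r′} eq ∷ drop-≐ eqs

      plug-≐ : ∀ a {rows rows′} → rows ≐ rows′ → map dropHead rows ≐ map (plug a) rows′
      plug-≐ a []                    = []
      plug-≐ a (_∷_ {r} {r′} eq eqs) = proj₂-drop {r} {r′} eq ∷ plug-≐ a eqs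

      elimAt-≐ : ∀ t {R R′ : System} → (∀ t → R t ≐ R′ t) → ∀ t′ → elimAt t R t′ ≐ elimAt t R′ t′
      elimAt-≐ t eq t′ with does (t′ ≟ᶠ t)
      ... | true  = elim-≐ t′ (eq t′)
      ... | false = drop-≐ (eq t′)

      plugAt-≐ : ∀ t a {R R′ : System} → (∀ t → R t ≐ R′ t) → ∀ t′ → map dropHead (R t′) ≐ plugAt t a R′ t′
      plugAt-≐ t a eq t′ with does (t′ ≟ᶠ t)
      ... | true  = plug-≐ a (eq t′)
      ... | false = drop-≐ (eq t′)

      -- The weight does not depend on the eliminated unknown, so after interchanging the sums each
      -- fibre contributes its weight times the kernel.
      elim-sum : ∀ {n} t (δ : Vec (Fin s) n) R {m} → WF (suc m) (R t) → (x : Vecᴬ.All D δ → ℕ) →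
        ∑ (allFin (q t)) (λ a → ∑ (assigns δ) (λ as → ind (does (sat? R {δ = t ∷ δ} (a ∷ as))) (x as))) ≡
        kernel t (R t) * ∑ (assigns δ) (λ as → ind (does (sat? (elimAt t R) as)) (x as))
      elim-sum t δ R wf x = begin
        ∑ (allFin (q t)) (λ a → ∑ (assigns δ) (λ as → ind (S a as) (x as)))
          ≡⟨ ∑-swap (λ a as → ind (S a as) (x as)) (allFin (q t)) (assigns δ) ⟩
        ∑ (assigns δ) (λ as → ∑ (allFin (q t)) (λ a → ind (S a as) (x as)))
          ≡⟨ ∑-cong (assigns δ) (λ as → trans
               (trans (∑-cong (allFin (q t)) (λ a → ind-* (S a as) (x as)))
                      (sym (∑-*ˡ (x as) (λ a → ind (S a as) 1) (allFin (q t)))))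
               (trans (cong (x as *_) (fiber t R as wf)) (trans (swap (x as) (kernel t (R t)) _)
                 (cong (kernel t (R t) *_) (sym (ind-* (does (sat? (elimAt t R) as)) (x as))))))) ⟩
        ∑ (assigns δ) (λ as → kernel t (R t) * ind (does (sat? (elimAt t R) as)) (x as))
          ≡⟨ ∑-*ˡ (kernel t (R t)) _ (assigns δ) ⟨
        kernel t (R t) * ∑ (assigns δ) (λ as → ind (does (sat? (elimAt t R) as)) (x as)) ∎
        where
        open ≡-Reasoning
        S : Fin (q t) → Vecᴬ.All D δ → Bool
        S a as = does (sat? R {δ = t ∷ δ} (a ∷ as))
        swap : ∀ x k i → x * (k * i) ≡ k * (x * i)
        swap = solve 3 (λ x k i → x :* (k :* i) := k :* (x :* i)) refl

      -- Total and count share one factor c. It cancels in their quotient, so its existence suffices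
      -- and the algorithm never computes it.
      Proportional : ∀ {n} (δ : Vec (Fin s) n) → Vec ℕ n → Fin (suc F) → ℕ → System → Set
      Proportional δ γ f c R = ∀ v →
        (∑ (assigns δ) (λ a → ind (does (sat? R a)) (v * monomial γ a)) ≡ c * total (leaves (items δ γ) (f , (tab R , v)))) ×
        (∑ (assigns δ) (λ a → ind (does (sat? R a)) 1) ≡ c * count (leaves (items δ γ) (f , (tab R , v))))

      -- The factor is the same for all systems with equal coefficients: the branches differ in the constants only.
      proportional : ∀ {n} (δ : Vec (Fin s) n) γ f R → support γ ≤ toℕ f → (∀ t → WF n (R t)) →
        ∃[ c ] (1 ≤ c × (∀ R′ → (∀ t → R t ≐ R′ t) → Proportional δ γ f c R′))
      proportional [] [] f R le wf = 1 , ≤-refl , λ R′ eq v →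
        trans (cong₂ (λ b x → ind b x + 0) (sym (consistent-tab R′)) (*-identityʳ v)) (sym (*-identityˡ _)) ,
        trans (cong (λ b → ind b 1 + 0) (sym (consistent-tab R′))) (sym (*-identityˡ _))
      proportional (t ∷ δ) (zero ∷ γ) f R le wf
        with proportional δ γ f (elimAt t R) le (elimAt-WF t R wf)
      ... | c , 1≤c , prop = kernel t (R t) * c , *-mono-≤ (1≤kernel t (R t)) 1≤c , λ R′ eq v →
        let wf′ = wf-≐ (eq t) (wf t)
            P   = prop (elimAt t R′) (elimAt-≐ t eq) v
            step : (x : Vecᴬ.All D δ → ℕ) (y : Vecᴬ.All D (t ∷ δ) → ℕ) (m : List Branch → ℕ) →
              (∀ a as → y (a ∷ as) ≡ x as) →
              ∑ (assigns δ) (λ as → ind (does (sat? (elimAt t R′) as)) (x as)) ≡ c * m (leaves (items δ γ) (f , (tab (elimAt t R′) , v))) →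
              ∑ (assigns (t ∷ δ)) (λ a → ind (does (sat? R′ a)) (y a)) ≡
              kernel t (R t) * c * m (leaves (items (t ∷ δ) (0 ∷ γ)) (f , (tab R′ , v)))
            step x y m yx p = trans (∑-assigns t δ (λ a → ind (does (sat? R′ a)) (y a)))
              (trans (∑-cong (allFin (q t)) (λ a → ∑-cong (assigns δ) (λ as → cong (ind (does (sat? R′ (a ∷ as)))) (yx a as))))
              (trans (elim-sum t δ R′ wf′ x)
              (trans (cong₂ _*_ (sym (kernel-≐ t (eq t))) p)
              (trans (sym (*-assoc (kernel t (R t)) c _))
                (cong (λ l → kernel t (R t) * c * m l) (trans
                  (cong (λ sys → leaves (items δ γ) (f , (sys , v))) (map-∘ (allFin s)))
                  (sym (++-identityʳ (leaves (items δ γ) (f , (map (elimBlock t) (tab R′) , v)))))))))))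
        in step (λ as → v * monomial γ as) (λ a → v * monomial (zero ∷ γ) a) total
             (λ a as → cong (v *_) (*-identityˡ (monomial γ as))) (proj₁ P) ,
           step (λ _ → 1) (λ _ → 1) count (λ _ _ → refl) (proj₂ P)
        where
        wf-≐ : ∀ {n rows rows′} → rows ≐ rows′ → WF n rows → WF n rows′
        wf-≐ []         []       = []
        wf-≐ (eq ∷ eqs) (w ∷ ws) = trans (cong length (sym eq)) w ∷ wf-≐ eqs ws
      proportional (t ∷ δ) (suc e ∷ γ) zero R () wf
      proportional (t ∷ δ) (suc e ∷ γ) (suc f) R le wf
        -- Fixing a value alters the constants only. The system with its first column dropped
        -- therefore represents all values at once, and a single recursive call gives one c valid in
        -- every branch.
        with proportional δ γ (inject₁ f) (λ t → map dropHead (R t))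
               (≤-trans (s≤s⁻¹ le) (≤-reflexive (sym (toℕ-inject₁ f)))) (λ t → drop-WF (wf t))
      ... | c , 1≤c , prop = c , 1≤c , λ R′ eq v →
        let P = λ a → prop (plugAt t (embed t a) R′) (plugAt-≐ t (embed t a) eq) (v * toℕ a ^ suc e)
            step : (x : ℕ → ∀ {δ : Vec (Fin s) _} → Vecᴬ.All D δ → ℕ) (y : Vecᴬ.All D (t ∷ δ) → ℕ) (h : Branch → ℕ) →
              (∀ a as → y (a ∷ as) ≡ x (v * toℕ a ^ suc e) as) →
              (∀ a → ∑ (assigns δ) (λ as → ind (does (sat? (plugAt t (embed t a) R′) as)) (x (v * toℕ a ^ suc e) as)) ≡
                c * ∑ (leaves (items δ γ) (inject₁ f , (tab (plugAt t (embed t a) R′) , v * toℕ a ^ suc e))) h) →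
              ∑ (assigns (t ∷ δ)) (λ a → ind (does (sat? R′ a)) (y a)) ≡
              c * ∑ (leaves (items (t ∷ δ) (suc e ∷ γ)) (suc f , (tab R′ , v))) h
            step x y h yx p = trans (∑-assigns t δ (λ a → ind (does (sat? R′ a)) (y a)))
              (trans (∑-cong (allFin (q t)) (λ a → trans
                (∑-cong (assigns δ) (λ as → cong₂ ind
                  (does-⇔ (plugAt-SatAll t R′ a as) (sat? R′ (a ∷ as)) (sat? (plugAt t (embed t a) R′) as)) (yx a as)))
                (p a)))
              (trans (sym (∑-*ˡ c _ (allFin (q t)))) (cong (c *_) (sym
                (trans (∑-concatMap h (leaves (items δ γ)) (map (fix (t , suc e) (suc f , (tab R′ , v))) (values t)))
                (trans (∑-map _ (fix (t , suc e) (suc f , (tab R′ , v))) (values t))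
                (trans (∑-map _ (embed t) (allFin (q t)))
                  (∑-cong (allFin (q t)) (λ a → cong (λ b → ∑ (leaves (items δ γ) (inject₁ f , b)) h)
                    (cong₂ _,_ (sym (map-∘ (allFin s)))
                      (cong (λ n → v * n ^ suc e) (toℕ-inject≤ a (q≤Q t)))))))))))))
        in step (λ v as → v * monomial γ as) (λ a → v * monomial (suc e ∷ γ) a) (λ (f , (sys , v)) → ind (consistent sys) v)
             (λ a as → sym (*-assoc v (toℕ a ^ suc e) (monomial γ as))) (λ a → proj₁ (P a)) ,
           step (λ _ _ → 1) (λ _ → 1) (λ (f , (sys , v)) → ind (consistent sys) 1) (λ _ _ → refl) (λ a → proj₂ (P a))

-- Affine invariant relations as systems of linear equations

module LinearSystems where

  open import Defs
  open Congruences
  open Elimination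
  open Counting
  open import Data.Bool.Base using (Bool; false) renaming (if_then_else_ to if′_then_else_)
  open import Data.Bool.Properties using (T?)
  open import Data.Fin.Properties using (toℕ<n; toℕ-injective) renaming (_≟_ to _≟ᶠ_; suc-injective to suc-injectiveᶠ)
  open import Data.List.Base using (List; []; _∷_; length; map; concatMap; allFin; tabulate; zip; foldl; applyUpTo; upTo; null; replicate; filter)
  open import Data.List.Properties using (length-map; length-replicate; map-applyUpTo; length-applyUpTo)
  open import Data.List.Membership.Propositional using (_∈_)
  open import Data.List.Membership.Propositional.Properties using (∈-allFin; ∈-filter⁺; ∈-filter⁻; ∈-concatMap⁺; ∈-map⁺)
  open import Data.List.Relation.Unary.Any using (Any; here; there)
  import Data.List.Relation.Unary.Any as Any
  open import Data.List.Relation.Unary.All using (All; []; _∷_)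
  import Data.List.Relation.Unary.All as All
  open import Data.List.Relation.Unary.All.Properties using () renaming (map⁺ to All-map⁺; map⁻ to All-map⁻; ++⁺ to All-++⁺; ++⁻ˡ to All-++⁻ˡ; ++⁻ʳ to All-++⁻ʳ)
  open import Data.List.Relation.Binary.Pointwise using (Pointwise; []; _∷_)
  import Data.List.Relation.Binary.Pointwise as PW
  open import Data.Nat.Base hiding (_/_)
  open import Data.Nat.Properties
  open import Data.Nat.Divisibility
  open import Data.Nat.DivMod using (_mod_)
  open import Data.Nat.Coprimality using (Coprime)
  open import Data.Nat.Solver using (module +-*-Solver)
  open import Data.Vec.Base using (Vec; []; _∷_; lookup)
  import Data.Vec.Relation.Unary.All as Vecᴬ
  open Vecᴬ using ([]; _∷_)
  open import Data.Vec.Relation.Unary.All.Properties using (lookup⁺)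
  open import Function.Base using (_∘_)
  open import Relation.Binary.PropositionalEquality
  open import Relation.Nullary using (does; yes; no; contradiction)
  open import Relation.Nullary.Decidable using (dec-true)
  open +-*-Solver using (solve; _:+_; _:*_; _:=_; con)

  infix 4 _≋_⟪_⟫
  _≋_⟪_⟫ : List ℕ → List ℕ → ℕ → Set
  xs ≋ ys ⟪ q ⟫ = Pointwise (_≡_⟪ q ⟫) xs ys

  ≋-refl : ∀ {q xs} → xs ≋ xs ⟪ q ⟫
  ≋-refl = PW.refl ≡⟪⟫-refl

  ≋-sym : ∀ {q xs ys} → xs ≋ ys ⟪ q ⟫ → ys ≋ xs ⟪ q ⟫
  ≋-sym = PW.symmetric ≡⟪⟫-sym

  ≋-trans : ∀ {q xs ys zs} → xs ≋ ys ⟪ q ⟫ → ys ≋ zs ⟪ q ⟫ → xs ≋ zs ⟪ q ⟫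
  ≋-trans = PW.transitive ≡⟪⟫-trans

  infixl 6 _⊞_·_
  _⊞_·_ : List ℕ → ℕ → List ℕ → List ℕ
  []       ⊞ y · gs       = []
  (x ∷ xs) ⊞ y · []       = x ∷ xs
  (x ∷ xs) ⊞ y · (g ∷ gs) = x + y * g ∷ xs ⊞ y · gs

  ⊞-cong : ∀ {q xs xs′} gs {y y′} → xs ≋ xs′ ⟪ q ⟫ → y ≡ y′ ⟪ q ⟫ → xs ⊞ y · gs ≋ xs′ ⊞ y′ · gs ⟪ q ⟫
  ⊞-cong gs       []         eqy = []
  ⊞-cong []       (eq ∷ eqs) eqy = eq ∷ eqs
  ⊞-cong (g ∷ gs) (eq ∷ eqs) eqy = ≡⟪⟫-+ eq (≡⟪⟫-* eqy ≡⟪⟫-refl) ∷ ⊞-cong gs eqs eqy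

  ⊞-⊞ : ∀ q xs y z gs → xs ⊞ y · gs ⊞ z · gs ≋ xs ⊞ (y + z) · gs ⟪ q ⟫
  ⊞-⊞ q []       y z gs       = []
  ⊞-⊞ q (x ∷ xs) y z []       = ≋-refl
  ⊞-⊞ q (x ∷ xs) y z (g ∷ gs) =
    ≡⟪⟫-reflexive (solve 4 (λ x y z g → (x :+ y :* g) :+ z :* g := x :+ (y :+ z) :* g) refl x y z g) ∷ ⊞-⊞ q xs y z gs

  ⊞-0 : ∀ q xs gs → xs ⊞ 0 · gs ≋ xs ⟪ q ⟫
  ⊞-0 q []       gs       = []
  ⊞-0 q (x ∷ xs) []       = ≋-refl
  ⊞-0 q (x ∷ xs) (g ∷ gs) = ≡⟪⟫-reflexive (+-identityʳ x) ∷ ⊞-0 q xs gs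

  module Equations {s : ℕ} (q : Fin s → ℕ) (Q′ : ℕ) (q∣Q : ∀ t → q t ∣ suc Q′) (0<q : ∀ t → 0 < q t)
    (coprime : ∀ t t′ → t ≢ t′ → Coprime (q t) (q t′))
    (ratio : ∀ t (h₁ h₂ : Fin (suc Q′)) → Choice (q t) h₁ h₂)
    (annih : ∀ t (h : Fin (suc Q′)) → Σ (Fin (suc Q′)) λ u → ∀ b → q t ∣ toℕ u * b ⇔ (∃[ y ] q t ∣ toℕ h * y + b))
    where
    open Count q Q′ q∣Q 0<q ratio annih public
    open MCSP q hiding (D) public

    residue : ℕ → Fin Q
    residue n = n mod Q

    residue-≡ : ∀ t n → toℕ (residue n) ≡ n ⟪ q t ⟫
    residue-≡ t n = ≡⟪⟫-∣ (q∣Q t) (toℕ-mod n Q)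

    -- `Q′` serves as -1 for every sort, because each modulus divides `suc Q′`.
    1+Q′≡0 : ∀ t n → n + Q′ * n ≡ 0 ⟪ q t ⟫
    1+Q′≡0 t n = ∣⇒≡⟪⟫ (∣m⇒∣m*n n (q∣Q t))

    dot-⊞ : ∀ cs xs y gs → length xs ≡ length gs → dot cs (xs ⊞ y · gs) ≡ dot cs xs + y * dot cs gs
    dot-⊞ []       xs       y gs       eq = sym (*-zeroʳ y)
    dot-⊞ (c ∷ cs) []       y []       eq = sym (*-zeroʳ y)
    dot-⊞ (c ∷ cs) (x ∷ xs) y (g ∷ gs) eq rewrite dot-⊞ cs xs y gs (suc-injective eq) =
      solve 6 (λ c x y g d e → c :* (x :+ y :* g) :+ (d :+ y :* e) := (c :* x :+ d) :+ y :* (c :* g :+ e)) refl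
        (toℕ c) x y g (dot cs xs) (dot cs gs)

    prepend : Fin Q → Row → Row
    prepend a (k , cs) = k , a ∷ cs

    -- The equations y_i - x_i = 0, whose solution is a single point modulo q.
    pointRows : List ℕ → List Row
    pointRows []       = []
    pointRows (x ∷ xs) = (residue (Q′ * x) , residue 1 ∷ replicate (length xs) zero) ∷ map (prepend zero) (pointRows xs)

    dot-zeros : ∀ n xs → dot (replicate n zero) xs ≡ 0
    dot-zeros zero    xs       = refl
    dot-zeros (suc n) []       = refl
    dot-zeros (suc n) (x ∷ xs) = dot-zeros n xs

    pointRows-WF : ∀ xs → WF (length xs) (pointRows xs)
    pointRows-WF []       = []
    pointRows-WF (x ∷ xs) = cong suc (length-replicate (length xs)) ∷ All-map⁺ (All.map (cong suc) (pointRows-WF xs))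

    pointRows-Sat : ∀ t xs ys → length ys ≡ length xs → Sat t (pointRows xs) ys ⇔ ys ≋ xs ⟪ q t ⟫
    pointRows-Sat t []       []       eq = mk⇔ (λ _ → []) (λ _ → [])
    pointRows-Sat t (x ∷ xs) (y ∷ ys) eq = mk⇔
      (λ { (d ∷ ds) → to d ∷ Equivalence.to rest (All-map⁻ ds) })
      (λ { (e ∷ es) → from e ∷ All-map⁺ (Equivalence.from rest es) })
      where
      rest = pointRows-Sat t xs ys (suc-injective eq)
      row = residue (Q′ * x) , residue 1 ∷ replicate (length xs) zero
      row≡ : lin row (y ∷ ys) ≡ Q′ * x + y ⟪ q t ⟫
      row≡ = ≡⟪⟫-+ (residue-≡ t (Q′ * x)) (≡⟪⟫-trans
        (≡⟪⟫-+ (≡⟪⟫-* (residue-≡ t 1) ≡⟪⟫-refl) (≡⟪⟫-reflexive (dot-zeros (length xs) ys)))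
        (≡⟪⟫-reflexive (trans (+-identityʳ (1 * y)) (*-identityˡ y))))
      to : q t ∣ lin row (y ∷ ys) → y ≡ x ⟪ q t ⟫
      to d = ≡⟪⟫-trans (≡⟪⟫-sym (≡⟪⟫-+ (1+Q′≡0 t x) ≡⟪⟫-refl))
        (≡⟪⟫-trans (≡⟪⟫-reflexive (+-assoc x (Q′ * x) y))
        (≡⟪⟫-trans (≡⟪⟫-+ (≡⟪⟫-refl {x}) (≡⟪⟫-trans (≡⟪⟫-sym row≡) (∣⇒≡⟪⟫ d))) (≡⟪⟫-reflexive (+-identityʳ x))))
      from : y ≡ x ⟪ q t ⟫ → q t ∣ lin row (y ∷ ys)
      from e = ≡⟪⟫⇒∣ (≡⟪⟫-trans row≡ (≡⟪⟫-trans (≡⟪⟫-+ (≡⟪⟫-refl {Q′ * x}) e)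
        (≡⟪⟫-trans (≡⟪⟫-reflexive (+-comm (Q′ * x) x)) (1+Q′≡0 t x))))

    -- Replaces the unknown vector x by x - y g, the new unknown y being the first.
    widen : List ℕ → Row → Row
    widen g r = prepend (residue (Q′ * dot (proj₂ r) g)) r

    -- A vector lies in the affine span of x with directions g ∷ gs exactly if subtracting some
    -- multiple of g brings it into the span with directions gs. Eliminating that multiple yields
    -- the equations, so no dual module has to be computed.
    spanRows : Fin s → List ℕ → List (List ℕ) → List Row
    spanRows t x []       = pointRows x
    spanRows t x (g ∷ gs) = elim t (map (widen g) (spanRows t x gs))

    spanned : List ℕ → (ℕ → ℕ) → List (List ℕ) → List ℕ
    spanned x λs []       = x
    spanned x λs (g ∷ gs) = spanned x (λs ∘ suc) gs ⊞ λs 0 · g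

    spanRows-WF : ∀ t x gs → WF (length x) (spanRows t x gs)
    spanRows-WF t x []       = pointRows-WF x
    spanRows-WF t x (g ∷ gs) = elim-WF t _ (All-map⁺ (All.map (cong suc) (spanRows-WF t x gs)))

    length-⊞ : ∀ xs y gs → length (xs ⊞ y · gs) ≡ length xs
    length-⊞ []       y gs       = refl
    length-⊞ (x ∷ xs) y []       = refl
    length-⊞ (x ∷ xs) y (g ∷ gs) = cong suc (length-⊞ xs y gs)

    _▸_ : ℕ → (ℕ → ℕ) → ℕ → ℕ
    (y ▸ λs) zero    = y
    (y ▸ λs) (suc n) = λs n

    spanRows-Sat : ∀ t x gs → All (λ g → length g ≡ length x) gs → ∀ ys → length ys ≡ length x →
      Sat t (spanRows t x gs) ys ⇔ (∃[ λs ] ys ≋ spanned x λs gs ⟪ q t ⟫)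
    spanRows-Sat t x []       []         ys eq = mk⇔
      (λ S → (λ _ → 0) , Equivalence.to (pointRows-Sat t x ys eq) S)
      (λ (_ , e) → Equivalence.from (pointRows-Sat t x ys eq) e)
    spanRows-Sat t x (g ∷ gs) (lg ∷ lgs) ys eq = mk⇔ to from
      where
      rows = spanRows t x gs
      elimination = elim-Sat t (map (widen g) rows) ys (All-map⁺ (All.map (cong suc) (spanRows-WF t x gs)))
      -- This is ys - y g, with `y * Q′` for -y.
      moved = λ y → ys ⊞ (y * Q′) · g
      widened : ∀ y r → lin r (moved y) ≡ lin (widen g r) (y ∷ ys) ⟪ q t ⟫
      widened y (k , cs) = ≡⟪⟫-+ (≡⟪⟫-refl {toℕ k}) (≡⟪⟫-trans
        (≡⟪⟫-reflexive (trans (dot-⊞ cs ys (y * Q′) g (trans eq (sym lg)))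
          (solve 4 (λ d y k e → d :+ y :* k :* e := (k :* e) :* y :+ d) refl (dot cs ys) y Q′ (dot cs g))))
        (≡⟪⟫-+ (≡⟪⟫-* (≡⟪⟫-sym (residue-≡ t (Q′ * dot cs g))) ≡⟪⟫-refl) ≡⟪⟫-refl))
      translate : ∀ y → Sat t rows (moved y) ⇔ Sat t (map (widen g) rows) (y ∷ ys)
      translate y = map-Sat t (widen g) (moved y) (y ∷ ys) (widened y) rows
      IH = λ y → spanRows-Sat t x gs lgs (moved y) (trans (length-⊞ ys (y * Q′) g) eq)
      cancel : ∀ y → y * Q′ + y ≡ 0 ⟪ q t ⟫
      cancel y = ≡⟪⟫-trans (≡⟪⟫-reflexive (trans (+-comm (y * Q′) y) (cong (y +_) (*-comm y Q′)))) (1+Q′≡0 t y)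
      to : Sat t (elim t (map (widen g) rows)) ys → ∃[ λs ] ys ≋ spanned x λs (g ∷ gs) ⟪ q t ⟫
      to S = let y , S′ = Equivalence.to elimination S
                 λs , e = Equivalence.to (IH y) (Equivalence.from (translate y) S′)
             in y ▸ λs , ≋-trans (≋-sym (≋-trans (⊞-⊞ (q t) ys (y * Q′) y g)
                  (≋-trans (⊞-cong g ≋-refl (cancel y)) (⊞-0 (q t) ys g))))
                  (⊞-cong g e ≡⟪⟫-refl)
      from : (∃[ λs ] ys ≋ spanned x λs (g ∷ gs) ⟪ q t ⟫) → Sat t (elim t (map (widen g) rows)) ys
      from (λs , e) = Equivalence.from elimination (y , Equivalence.to (translate y) (Equivalence.from (IH y)
        (λs ∘ suc , ≋-trans (⊞-cong g e ≡⟪⟫-refl) (≋-trans (⊞-⊞ (q t) _ y (y * Q′) g)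
          (≋-trans (⊞-cong g ≋-refl (≡⟪⟫-trans (≡⟪⟫-reflexive (+-comm y (y * Q′))) (cancel y))) (⊞-0 (q t) _ g))))))
        where y = λs 0

    idempotents : ∀ t t′ → ∃[ x ] (x ≡ 1 ⟪ q t ⟫ × (t′ ≢ t → q t′ ∣ x))
    idempotents t t′ with t′ ≟ᶠ t
    ... | yes t′≡t = 1 , ≡⟪⟫-refl , contradiction t′≡t
    ... | no  t′≢t with coprime⇒idempotent {{>-nonZero (0<q t)}} {{>-nonZero (0<q t′)}} (coprime t t′ (t′≢t ∘ sym))
    ...   | x , x≡1 , ∣x = x , x≡1 , λ _ → ∣x

    -- The Chinese remainder idempotent of t: a product of pairwise ones, each 1 modulo `q t` and 0
    -- modulo one other modulus.
    unity : Fin s → List (Fin s) → ℕ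
    unity t []       = 1
    unity t (u ∷ us) = proj₁ (idempotents t u) * unity t us

    unity-≡1 : ∀ t us → unity t us ≡ 1 ⟪ q t ⟫
    unity-≡1 t []       = ≡⟪⟫-refl
    unity-≡1 t (u ∷ us) = ≡⟪⟫-* (proj₁ (proj₂ (idempotents t u))) (unity-≡1 t us)

    ∣-unity : ∀ t {u us} → u ∈ us → u ≢ t → q u ∣ unity t us
    ∣-unity t {u} {v ∷ us} (here refl) u≢t = ∣m⇒∣m*n (unity t us) (proj₂ (proj₂ (idempotents t v)) u≢t)
    ∣-unity t {u} {v ∷ us} (there u∈) u≢t = ∣n⇒∣m*n (proj₁ (idempotents t v)) (∣-unity t u∈ u≢t)

    crt : (Fin s → ℕ) → ℕ
    crt f = ∑ (allFin s) (λ t → unity t (allFin s) * f t)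

    crt-≡ : ∀ f t → crt f ≡ f t ⟪ q t ⟫
    crt-≡ f t = ≡⟪⟫-trans
      (single (λ t′ → t′) (λ t′ → unity t′ (allFin s) * f t′) t
        (λ t′ t′≢t → ∣⇒≡⟪⟫ (∣m⇒∣m*n (f t′) (∣-unity t′ (∈-allFin t) (t′≢t ∘ sym)))))
      (≡⟪⟫-trans (≡⟪⟫-* (unity-≡1 t (allFin s)) ≡⟪⟫-refl) (≡⟪⟫-reflexive (*-identityˡ (f t))))
      where
      vanish : ∀ {n} (h : Fin n → Fin s) g → (∀ j → g (h j) ≡ 0 ⟪ q t ⟫) → ∑ (tabulate h) g ≡ 0 ⟪ q t ⟫
      vanish {zero}  h g eq = ≡⟪⟫-refl
      vanish {suc n} h g eq = ≡⟪⟫-+ (eq zero) (vanish (h ∘ suc) g (eq ∘ suc))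
      single : ∀ {n} (h : Fin n → Fin s) g i → (∀ j → j ≢ i → g (h j) ≡ 0 ⟪ q t ⟫) →
        ∑ (tabulate h) g ≡ g (h i) ⟪ q t ⟫
      single h g zero    eq = ≡⟪⟫-trans (≡⟪⟫-+ ≡⟪⟫-refl (vanish (h ∘ suc) g (λ j → eq (suc j) (λ ()))))
        (≡⟪⟫-reflexive (+-identityʳ _))
      single h g (suc i) eq = ≡⟪⟫-+ (eq zero (λ ()))
        (single (h ∘ suc) g i (λ j j≢i → eq (suc j) (λ e → j≢i (suc-injectiveᶠ e))))

    -- The direction r - x in the entries of sort t, with `q t ∸ toℕ x` for -x.
    shift : Fin s → ∀ {k} {σ : Vec (Fin s) k} → Vecᴬ.All D σ → Vecᴬ.All D σ → List ℕ
    shift t []                    []       = []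
    shift t (_∷_ {x = t′} x xs) (r ∷ rs) = (if′ does (t ≟ᶠ t′) then (q t ∸ toℕ x) + toℕ r else 0) ∷ shift t xs rs

    length-mask : ∀ t {k} {σ : Vec (Fin s) k} (a : Vecᴬ.All D σ) → length (mask t a) ≡ k
    length-mask t []       = refl
    length-mask t (a ∷ as) = cong suc (length-mask t as)

    length-shift : ∀ t {k} {σ : Vec (Fin s) k} (x r : Vecᴬ.All D σ) → length (shift t x r) ≡ k
    length-shift t []       []       = refl
    length-shift t (x ∷ xs) (r ∷ rs) = cong suc (length-shift t xs rs)

    affine-≡ : ∀ {n} (a b c : Fin n) → toℕ (affine a b c) ≡ toℕ a + ((n ∸ toℕ b) + toℕ c) ⟪ n ⟫
    affine-≡ {suc n} a b c = ≡⟪⟫-trans (toℕ-mod (toℕ a + (suc n ∸ toℕ b) + toℕ c) (suc n))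
      (≡⟪⟫-reflexive (+-assoc (toℕ a) (suc n ∸ toℕ b) (toℕ c)))

    mask-affine : ∀ t {k} {σ : Vec (Fin s) k} (a x r : Vecᴬ.All D σ) →
      mask t (affineTuple a x r) ≋ mask t a ⊞ 1 · shift t x r ⟪ q t ⟫
    mask-affine t [] [] [] = []
    mask-affine t (_∷_ {x = t′} a as) (x ∷ xs) (r ∷ rs) with t ≟ᶠ t′
    ... | yes refl = ≡⟪⟫-trans (affine-≡ a x r) (≡⟪⟫-reflexive (cong (toℕ a +_) (sym (*-identityˡ _)))) ∷ mask-affine t as xs rs
    ... | no  _    = ≡⟪⟫-refl ∷ mask-affine t as xs rs

    mask-self : ∀ t {k} {σ : Vec (Fin s) k} (x r : Vecᴬ.All D σ) →
      mask t r ≋ mask t x ⊞ 1 · shift t x r ⟪ q t ⟫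
    mask-self t [] [] = []
    mask-self t (_∷_ {x = t′} x xs) (r ∷ rs) with t ≟ᶠ t′
    ... | yes refl = (1 , 0 , trans (+-comm (toℕ r) (1 * q t)) (sym (trans (+-identityʳ _) self))) ∷ mask-self t xs rs
      where
      self : toℕ x + 1 * ((q t ∸ toℕ x) + toℕ r) ≡ 1 * q t + toℕ r
      self = trans (cong (toℕ x +_) (*-identityˡ _)) (trans (sym (+-assoc (toℕ x) _ (toℕ r)))
        (cong (_+ toℕ r) (trans (m+[n∸m]≡n (<⇒≤ (toℕ<n x))) (sym (*-identityˡ (q t))))))
    ... | no  _    = ≡⟪⟫-refl ∷ mask-self t xs rs

    mask-injective : ∀ {k} {σ : Vec (Fin s) k} (a b : Vecᴬ.All D σ) → (∀ t → mask t a ≋ mask t b ⟪ q t ⟫) → a ≡ b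
    mask-injective []                   []       eqs = refl
    mask-injective (_∷_ {x = t} a as) (b ∷ bs) eqs = cong₂ _∷_
      (toℕ-injective (<⇒≡⟪⟫⇒≡ (toℕ<n a) (toℕ<n b)
        (subst (λ c → (if′ c then toℕ a else 0) ≡ (if′ c then toℕ b else 0) ⟪ q t ⟫) (dec-true (t ≟ᶠ t) refl) (PW.head (eqs t)))))
      (mask-injective as bs (λ t → PW.tail (eqs t)))

    ∈-assigns : ∀ {k} {σ : Vec (Fin s) k} (a : Vecᴬ.All D σ) → a ∈ assigns σ
    ∈-assigns []                   = here refl
    ∈-assigns (_∷_ {x = t} a as) = ∈-concatMap⁺ (λ a → map (a ∷_) (assigns _)) (Any.map (λ { refl → ∈-map⁺ (a ∷_) (∈-assigns as) }) (∈-allFin a))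

    module Affine {k : ℕ} {σ : Vec (Fin s) k} (holds : Vecᴬ.All D σ → Bool)
      (invariant : ∀ a b c → a ∈ᴿ holds → b ∈ᴿ holds → c ∈ᴿ holds → affineTuple a b c ∈ᴿ holds)
      (x : Vecᴬ.All D σ) (x∈ : x ∈ᴿ holds) where

      -- The map sending a to a - x + r, iterated n times, that is a + n (r - x). The same n acts on
      -- all sorts, which is why coefficients chosen sort by sort have to be merged first.
      times : ℕ → Vecᴬ.All D σ → Vecᴬ.All D σ → Vecᴬ.All D σ
      times zero    r a = a
      times (suc n) r a = affineTuple (times n r a) x r

      walk : (ℕ → ℕ) → List (Vecᴬ.All D σ) → Vecᴬ.All D σ
      walk λs []       = x
      walk λs (r ∷ rs) = times (λs 0) r (walk (λs ∘ suc) rs)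

      times-∈ : ∀ n r a → r ∈ᴿ holds → a ∈ᴿ holds → times n r a ∈ᴿ holds
      times-∈ zero    r a r∈ a∈ = a∈
      times-∈ (suc n) r a r∈ a∈ = invariant _ _ _ (times-∈ n r a r∈ a∈) x∈ r∈

      walk-∈ : ∀ λs rs → All (_∈ᴿ holds) rs → walk λs rs ∈ᴿ holds
      walk-∈ λs []       []         = x∈
      walk-∈ λs (r ∷ rs) (r∈ ∷ rs∈) = times-∈ (λs 0) r _ r∈ (walk-∈ (λs ∘ suc) rs rs∈)

      mask-times : ∀ t n r a → mask t (times n r a) ≋ mask t a ⊞ n · shift t x r ⟪ q t ⟫
      mask-times t zero    r a = ≋-sym (⊞-0 (q t) _ _)
      mask-times t (suc n) r a = ≋-trans (mask-affine t (times n r a) x r)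
        (≋-trans (⊞-cong (shift t x r) (mask-times t n r a) ≡⟪⟫-refl)
        (≋-trans (⊞-⊞ (q t) (mask t a) n 1 (shift t x r)) (⊞-cong (shift t x r) ≋-refl (≡⟪⟫-reflexive (+-comm n 1)))))

      mask-walk : ∀ t λs μs rs → (∀ n → λs n ≡ μs n ⟪ q t ⟫) →
        mask t (walk λs rs) ≋ spanned (mask t x) μs (map (shift t x) rs) ⟪ q t ⟫
      mask-walk t λs μs []       eq = ≋-refl
      mask-walk t λs μs (r ∷ rs) eq = ≋-trans (mask-times t (λs 0) r _)
        (⊞-cong (shift t x r) (mask-walk t (λs ∘ suc) (μs ∘ suc) rs (eq ∘ suc)) (eq 0))

      spanned-zero : ∀ t rs → spanned (mask t x) (λ _ → 0) (map (shift t x) rs) ≋ mask t x ⟪ q t ⟫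
      spanned-zero t []       = ≋-refl
      spanned-zero t (r ∷ rs) = ≋-trans (⊞-0 (q t) _ (shift t x r)) (spanned-zero t rs)

      ∈-spanned : ∀ t {a rs} → a ∈ rs → ∃[ λs ] mask t a ≋ spanned (mask t x) λs (map (shift t x) rs) ⟪ q t ⟫
      ∈-spanned t {a} {r ∷ rs} (here refl) = 1 ▸ (λ _ → 0) ,
        ≋-trans (mask-self t x a) (⊞-cong (shift t x a) (≋-sym (spanned-zero t rs)) ≡⟪⟫-refl)
      ∈-spanned t {a} {r ∷ rs} (there a∈) with ∈-spanned t a∈
      ... | λs , e = 0 ▸ λs , ≋-trans e (≋-sym (⊞-0 (q t) _ (shift t x r)))

      -- `crt` replaces the coefficients that the sorts prescribe for a direction by one natural
      -- number with all these residues. The walk with these numbers stays inside the relation and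
      -- ends at a.
      spanned-∈ : ∀ rs → All (_∈ᴿ holds) rs → ∀ a →
        (∀ t → ∃[ λs ] mask t a ≋ spanned (mask t x) λs (map (shift t x) rs) ⟪ q t ⟫) → a ∈ᴿ holds
      spanned-∈ rs rs∈ a spans = subst (_∈ᴿ holds)
        (mask-injective (walk λs rs) a (λ t → ≋-trans
          (mask-walk t λs (proj₁ (spans t)) rs (λ n → crt-≡ (λ t → proj₁ (spans t) n) t)) (≋-sym (proj₂ (spans t)))))
        (walk-∈ λs rs rs∈)
        where
        λs : ℕ → ℕ
        λs n = crt (λ t → proj₁ (spans t) n)

    members : (R : Relation) → List (Vecᴬ.All D (signature R))
    members R = filter (λ a → T? (holds R a)) (assigns (signature R))

    -- The value at the empty list is a default: the empty system holds everywhere, so empty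
    -- relations are caught separately by `unsatisfiable`. The base point is kept among the
    -- directions, so that every member is reached in the same way.
    equations′ : Fin s → ∀ {k} {σ : Vec (Fin s) k} → List (Vecᴬ.All D σ) → List Row
    equations′ t []       = []
    equations′ t (x ∷ xs) = spanRows t (mask t x) (map (shift t x) (x ∷ xs))

    equations : Fin s → Relation → List Row
    equations t R = equations′ t (members R)

    equations-Sat : ∀ R → AffineInvariant R → null (members R) ≡ false → ∀ a →
      a ∈ᴿ holds R ⇔ (∀ t → Sat t (equations t R) (mask t a))
    equations-Sat R inv nonempty a
      with members R | (λ {a} → ∈-filter⁺ (λ a → T? (holds R a)) {x = a} {xs = assigns (signature R)})
         | All.tabulate (λ {a} a∈ → proj₂ (∈-filter⁻ (λ a → T? (holds R a)) {v = a} {xs = assigns (signature R)} a∈))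
    ... | x ∷ xs | complete | sound@(x∈ ∷ _) = mk⇔
      (λ a∈ t → Equivalence.from (span t) (∈-spanned t (complete (∈-assigns a) a∈)))
      (λ S → spanned-∈ (x ∷ xs) sound a (λ t → Equivalence.to (span t) (S t)))
      where
      open Affine (holds R) inv x x∈
      span : ∀ t → _
      span t = spanRows-Sat t (mask t x) (map (shift t x) (x ∷ xs))
        (All-map⁺ (All.universal (λ r → trans (length-shift t x r) (sym (length-mask t x))) (x ∷ xs)))
        (mask t a) (trans (length-mask t a) (sym (length-mask t x)))

    one : Fin Q
    one = residue 1

    -- A scope may repeat a variable, so coefficients at equal positions have to be added up.
    accumulate : ℕ → Fin Q → ℕ × Fin Q → Fin Q
    accumulate i acc (v , c) = if′ v ≡ᵇ i then cmb one c acc else acc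

    coefficient : List (ℕ × Fin Q) → ℕ → Fin Q
    coefficient vcs i = foldl (accumulate i) zero vcs

    dense : ℕ → List ℕ → Row → Row
    dense n vs (k , cs) = k , map (coefficient (zip vs cs)) (upTo n)

    dense-WF : ∀ n vs rows → WF n (map (dense n vs) rows)
    dense-WF n vs rows = All-map⁺ (All.universal (λ r → trans (length-map _ (upTo n)) (length-applyUpTo (λ i → i) n)) rows)

    nth : List ℕ → ℕ → ℕ
    nth []       _       = 0
    nth (x ∷ xs) zero    = x
    nth (x ∷ xs) (suc n) = nth xs n

    dot-accumulate : ∀ t v c f n xs → length xs ≡ n → v < n →
      dot (applyUpTo (λ i → accumulate i (f i) (v , c)) n) xs ≡ dot (applyUpTo f n) xs + toℕ c * nth xs v ⟪ q t ⟫
    dot-accumulate t zero c f (suc n) (x ∷ xs) eq _ = ≡⟪⟫-trans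
      (≡⟪⟫-+ (≡⟪⟫-* (≡⟪⟫-trans (cmb-≡ t one c (f 0)) (≡⟪⟫-+ (≡⟪⟫-refl {toℕ (f 0)}) (≡⟪⟫-* (residue-≡ t 1) ≡⟪⟫-refl))) (≡⟪⟫-refl {x}))
        (≡⟪⟫-refl {dot (applyUpTo (f ∘ suc) n) xs}))
      (≡⟪⟫-reflexive (solve 4 (λ f c x d → (f :+ con 1 :* c) :* x :+ d := (f :* x :+ d) :+ c :* x) refl
        (toℕ (f 0)) (toℕ c) x (dot (applyUpTo (f ∘ suc) n) xs)))
    dot-accumulate t (suc v) c f (suc n) (x ∷ xs) eq v<n = ≡⟪⟫-trans
      (≡⟪⟫-+ (≡⟪⟫-refl {toℕ (f 0) * x}) (dot-accumulate t v c (f ∘ suc) n xs (suc-injective eq) (s≤s⁻¹ v<n)))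
      (≡⟪⟫-reflexive (sym (+-assoc (toℕ (f 0) * x) _ _)))

    weighted : List ℕ → List (ℕ × Fin Q) → ℕ
    weighted xs []              = 0
    weighted xs ((v , c) ∷ vcs) = toℕ c * nth xs v + weighted xs vcs

    dot-coefficients : ∀ t vcs f n xs → length xs ≡ n → All (λ (v , _) → v < n) vcs →
      dot (applyUpTo (λ i → foldl (accumulate i) (f i) vcs) n) xs ≡ dot (applyUpTo f n) xs + weighted xs vcs ⟪ q t ⟫
    dot-coefficients t []              f n xs eq []         = ≡⟪⟫-reflexive (sym (+-identityʳ _))
    dot-coefficients t ((v , c) ∷ vcs) f n xs eq (v<n ∷ lt) = ≡⟪⟫-trans
      (dot-coefficients t vcs (λ i → accumulate i (f i) (v , c)) n xs eq lt)
      (≡⟪⟫-trans (≡⟪⟫-+ (dot-accumulate t v c f n xs eq v<n) (≡⟪⟫-refl {weighted xs vcs})) (≡⟪⟫-reflexive (+-assoc (dot (applyUpTo f n) xs) (toℕ c * nth xs v) (weighted xs vcs))))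

    dot-zero : ∀ n xs → dot (applyUpTo (λ _ → zero) n) xs ≡ 0
    dot-zero zero    xs       = refl
    dot-zero (suc n) []       = refl
    dot-zero (suc n) (x ∷ xs) = dot-zero n xs

    lin-dense : ∀ t n vs r xs → length xs ≡ n → All (_< n) vs →
      lin (dense n vs r) xs ≡ toℕ (proj₁ r) + weighted xs (zip vs (proj₂ r)) ⟪ q t ⟫
    lin-dense t n vs (k , cs) xs eq lt = ≡⟪⟫-+ (≡⟪⟫-refl {toℕ k}) (≡⟪⟫-trans
      (≡⟪⟫-reflexive (cong (λ as → dot as xs) (map-applyUpTo (λ i → i) (coefficient (zip vs cs)) n)))
      (≡⟪⟫-trans (dot-coefficients t (zip vs cs) (λ _ → zero) n xs eq (go vs cs lt))
        (≡⟪⟫-reflexive (cong (_+ weighted xs (zip vs cs)) (dot-zero n xs)))))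
      where
      go : ∀ vs (cs : List (Fin Q)) → All (_< n) vs → All (λ (v , _) → v < n) (zip vs cs)
      go []       _        []         = []
      go (v ∷ vs) []       (lt ∷ lts) = []
      go (v ∷ vs) (c ∷ cs) (lt ∷ lts) = lt ∷ go vs cs lts

    module _ {n : ℕ} (δ : Vec (Fin s) n) where

      Scope : ∀ {k} → Vec (Fin s) k → Set
      Scope σ = Vecᴬ.All (λ t → Σ (Fin n) λ x → lookup δ x ≡ t) σ

      positions : ∀ {k} {σ : Vec (Fin s) k} → Scope σ → List ℕ
      positions []                = []
      positions ((x , _) ∷ scope) = toℕ x ∷ positions scope

      restrict : ∀ {k} {σ : Vec (Fin s) k} → Scope σ → Vecᴬ.All D δ → Vecᴬ.All D σ
      restrict []                   a = []
      restrict ((x , refl) ∷ scope) a = lookup⁺ a x ∷ restrict scope a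

      positions-< : ∀ {k} {σ : Vec (Fin s) k} (scope : Scope σ) → All (_< n) (positions scope)
      positions-< []                = []
      positions-< ((x , _) ∷ scope) = toℕ<n x ∷ positions-< scope

    nth-mask : ∀ t {n} {δ : Vec (Fin s) n} (a : Vecᴬ.All D δ) x →
      nth (mask t a) (toℕ x) ≡ (if′ does (t ≟ᶠ lookup δ x) then toℕ (lookup⁺ a x) else 0)
    nth-mask t (a ∷ as) zero    = refl
    nth-mask t (a ∷ as) (suc x) = nth-mask t as x

    weighted-positions : ∀ t {n k} (δ : Vec (Fin s) n) {σ : Vec (Fin s) k} (scope : Scope δ σ) a cs →
      weighted (mask t a) (zip (positions δ scope) cs) ≡ dot cs (mask t (restrict δ scope a))
    weighted-positions t δ []                   a []       = refl
    weighted-positions t δ []                   a (c ∷ cs) = refl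
    weighted-positions t δ ((x , refl) ∷ scope) a []       = refl
    weighted-positions t δ ((x , refl) ∷ scope) a (c ∷ cs) =
      cong₂ _+_ (cong (toℕ c *_) (nth-mask t a x)) (weighted-positions t δ scope a cs)

    dense-Sat : ∀ t {n k} (δ : Vec (Fin s) n) {σ : Vec (Fin s) k} (scope : Scope δ σ) a rows →
      Sat t rows (mask t (restrict δ scope a)) ⇔ Sat t (map (dense n (positions δ scope)) rows) (mask t a)
    dense-Sat t {n} δ scope a rows = map-Sat t (dense n (positions δ scope)) (mask t (restrict δ scope a)) (mask t a)
      (λ r → ≡⟪⟫-sym (≡⟪⟫-trans (lin-dense t n (positions δ scope) r (mask t a) (length-mask t a) (positions-< δ scope))
        (≡⟪⟫-reflexive (cong (toℕ (proj₁ r) +_) (weighted-positions t δ scope a (proj₂ r)))))) rows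

    module Instances {l : ℕ} (Γ : Language l) (invariant : ∀ r → AffineInvariant (lookup Γ r)) where

      eqTable : Fin s → Fin l → List Row
      eqTable t r = equations t (lookup Γ r)

      unsatisfiable : Fin l → Bool
      unsatisfiable r = null (members (lookup Γ r))

      constraintRows : ℕ → Fin s → Fin l × List ℕ → List Row
      constraintRows n t (r , vs) = map (dense n vs) (eqTable t r)

      initial : ℕ → List (Fin l × List ℕ) → System
      initial n cs t = concatMap (constraintRows n t) cs

      initial-WF : ∀ n cs t → WF n (initial n cs t)
      initial-WF n []             t = []
      initial-WF n ((r , vs) ∷ cs) t = All-++⁺ (dense-WF n vs (eqTable t r)) (initial-WF n cs t)

      plain : ∀ {n} {δ : Vec (Fin s) n} → Constraint Γ δ → Fin l × List ℕ
      plain {δ = δ} C = rel C , positions δ (scope C)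

      Holds! : ∀ {n} {δ : Vec (Fin s) n} → Vecᴬ.All D δ → Constraint Γ δ → Set
      Holds! {δ = δ} a C = restrict δ (scope C) a ∈ᴿ holds (lookup Γ (rel C))

      initial-Sat : ∀ {n} {δ : Vec (Fin s) n} (cs : List (Constraint Γ δ)) a →
        All (λ C → unsatisfiable (rel C) ≡ false) cs →
        SatAll (initial n (map plain cs)) a ⇔ All (Holds! a) cs
      initial-Sat []       a []       = mk⇔ (λ _ → []) (λ _ t → [])
      initial-Sat {n} {δ} (C ∷ cs) a (e ∷ es) = mk⇔
        (λ S → Equivalence.from relation (λ t → Equivalence.from (dense-Sat t δ (scope C) a (eqTable t (rel C))) (All-++⁻ˡ _ (S t)))
             ∷ Equivalence.to rest (λ t → All-++⁻ʳ (constraintRows n t (plain C)) (S t)))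
        (λ { (H ∷ Hs) t → All-++⁺ (Equivalence.to (dense-Sat t δ (scope C) a (eqTable t (rel C))) (Equivalence.to relation H t))
                                  (Equivalence.from rest Hs t) })
        where
        relation = equations-Sat (lookup Γ (rel C)) (invariant (rel C)) e (restrict δ (scope C) a)
        rest = initial-Sat cs a es

      unsatisfiable-sound : ∀ {n} {δ : Vec (Fin s) n} (C : Constraint Γ δ) a → Holds! a C → unsatisfiable (rel C) ≡ false
      unsatisfiable-sound {δ = δ} C a H with members (lookup Γ (rel C))
        | ∈-filter⁺ (λ a → T? (holds (lookup Γ (rel C)) a)) (∈-assigns (restrict δ (scope C) a)) H
      ... | _ ∷ _ | _ = refl

-- Programs for elimination and for the expansion into branches

module CountingPrograms where

  open import Defs
  open TreePrograms
  open ListPrograms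
  open BinaryArithmetic
  open Elimination
  open Counting
  open LinearSystems
  open import Data.Bool.Base using (true; false; T; _∨_) renaming (if_then_else_ to if′_then_else_)
  open import Data.Fin.Properties using (toℕ<n; toℕ-inject₁) renaming (_≟_ to _≟ᶠ_)
  open import Data.List.Base using (List; []; _∷_; length; map; concatMap; allFin; zip; foldl; upTo; downFrom; replicate; reverse)
  open import Data.List.Properties
  open import Data.List.Relation.Unary.All using (All; []; _∷_)
  import Data.List.Relation.Unary.All as All
  open import Data.List.Relation.Unary.All.Properties using () renaming (map⁺ to All-map⁺; concat⁺ to All-concat⁺)
  open import Data.Nat.Base hiding (_/_)
  open import Data.Nat.Properties
  open import Data.Nat.Divisibility
  open import Data.Nat.Coprimality using (Coprime)
  open import Data.Nat.Solver using (module +-*-Solver)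
  open import Data.Vec.Base using ([]; _∷_)
  open import Relation.Binary.PropositionalEquality
  open import Relation.Nullary using (does)
  open +-*-Solver using (solve; _:+_; _:*_; _:=_; con)

  foldl-∑ : ∀ {A : Set} (g : A → ℕ) z as → foldl (λ acc a → acc + g a) z as ≡ z + ∑ as g
  foldl-∑ g z []       = sym (+-identityʳ z)
  foldl-∑ g z (a ∷ as) = trans (foldl-∑ g (z + g a) as) (+-assoc z (g a) _)

  sumP : ∀ {Γ A g l} → PT (Γ ⊗ A) bin g → PT Γ (list A) l → PT Γ bin (λ x → ∑ (l x) (λ a → g (x , a)))
  sumP {Γ} {A} {g} {l} G L = extP (λ x → foldl-∑ (λ a → g (x , a)) 0 (l x))
    (foldμP L (constP bin 0) (v1 +ᴾ skip G) len 4 (κ 1 ⊕ space G) len≤sz sz≤len λ x b a →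
      ≤-trans (len-+ b (g (x , a))) (≤-trans (≤-reflexive (sym (+-suc (len b) _)))
        (+-monoʳ-≤ (len b) (s≤s (≤-trans (len≤sz (g (x , a))) (small G (x , a)))))))

  foldl-* : ∀ a v e → foldl (λ acc _ → acc * a) v (replicate e 0) ≡ v * a ^ e
  foldl-* a v zero    = sym (*-identityʳ v)
  foldl-* a v (suc e) = trans (foldl-* a (v * a) e) (*-assoc v a (a ^ e))

  len-*-^ : ∀ a v e → len (v * a ^ e) ≤ len v + e * suc (len a)
  len-*-^ a v zero    = ≤-reflexive (trans (cong len (*-identityʳ v)) (sym (+-identityʳ (len v))))
  len-*-^ a v (suc e) = ≤-trans (≤-reflexive (cong len (sym (*-assoc v a (a ^ e)))))
    (≤-trans (len-*-^ a (v * a) e) (≤-trans (+-monoˡ-≤ (e * suc (len a)) (len-* v a))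
      (≤-reflexive (solve 3 (λ v a e → con 1 :+ (v :+ a) :+ e := v :+ ((con 1 :+ a) :+ e)) refl (len v) (len a) (e * suc (len a))))))

  -- The exponent is unary, so one multiplication per unit is affordable, and each adds at most
  -- `suc (len a)` digits.
  powerP : ∀ {Γ a v e} → PT Γ bin v → PT Γ bin a → PT Γ un e → PT Γ bin (λ x → v x * a x ^ e x)
  powerP {a = a} {v} {e} V A E = extP (λ x → foldl-* (a x) (v x) (e x))
    (foldμP (unit-list ∘ᴾ E) V (v1 *ᴾ wk (A ∘ᴾ fstP)) len 4 (κ 1 ⊕ space A) len≤sz sz≤len λ g b n →
      ≤-trans (len-* b (a g)) (≤-trans (≤-reflexive (sym (+-suc (len b) _)))
        (+-monoʳ-≤ (len b) (s≤s (≤-trans (len≤sz (a g)) (≤-trans (small A g)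
          (⟦⟧-mono (space A) (≤-trans (m≤m+n _ (sz un n)) (n≤1+n _)))))))))

  -- The accumulator is the descending list built so far; its head is the latest index, so no
  -- separate counter is carried.
  next : List ℕ → List ℕ
  next []       = 0 ∷ []
  next (n ∷ ns) = suc n ∷ n ∷ ns

  foldl-next : ∀ {A : Set} m (as : List A) → foldl (λ ns _ → next ns) (downFrom m) as ≡ downFrom (length as + m)
  foldl-next m       []       = refl
  foldl-next zero    (a ∷ as) = trans (foldl-next 1 as) (cong downFrom (+-suc (length as) 0))
  foldl-next (suc m) (a ∷ as) = trans (foldl-next (suc (suc m)) as) (cong downFrom (+-suc (length as) (suc m)))

  indicesP : ∀ {Γ A l} → PT Γ (list A) l → PT Γ (list un) (λ x → upTo (length (l x)))
  indicesP {Γ} {A} {l} L = extP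
    (λ x → trans (cong reverse (trans (foldl-next 0 (l x)) (cong downFrom (+-identityʳ (length (l x)))))) (reverse-downFrom (length (l x))))
    -- The new entry grows with the accumulator, so growth is not additive in the sense of `foldμP`;
    -- a quadratic bound is given directly.
    (reverseP (foldP L []ᴾ nextP bound bounded))
    where
    nextP : PT ((Γ ⊗ list un) ⊗ A) (list un) (λ x → next (proj₂ (proj₁ x)))
    nextP = extP (λ { ((g , []) , a) → refl ; ((g , _ ∷ _) , a) → refl })
      (caseListP (constP un 0 ∷ᴾ []ᴾ) ((sucP ∘ᴾ v1) ∷ᴾ (v1 ∷ᴾ v0)) ∘ᴾ (v1 ,ᴾ idP))
    head+ : List ℕ → ℕ
    head+ []      = 0
    head+ (n ∷ _) = suc n
    head+-next : ∀ ns → head+ (next ns) ≡ suc (head+ ns)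
    head+-next []      = refl
    head+-next (_ ∷ _) = refl
    sz-un : ∀ n → sz un n ≡ 1 + 2 * n
    sz-un zero    = refl
    sz-un (suc n) = trans (cong (λ k → suc (suc k)) (sz-un n)) (cong suc (sym (*-suc 2 n)))
    sz-next : ∀ ns → sz (list un) (next ns) ≡ sz (list un) ns + (2 + 2 * head+ ns)
    sz-next []       = refl
    sz-next (n ∷ ns) = trans (cong (λ k → suc (k + sz (list un) (n ∷ ns))) (sz-un (suc n)))
      (+-comm (2 + 2 * suc n) (sz (list un) (n ∷ ns)))
    head+≤ : ∀ ns → head+ ns ≤ sz (list un) ns
    head+≤ []       = z≤n
    head+≤ (n ∷ ns) = s≤s (≤-trans (≤-trans (m≤m+n n _) (≤-trans (n≤1+n _) (≤-reflexive (sym (sz-un n))))) (m≤m+n _ _))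
    grows : ∀ ns (as : List (El A)) → sz (list un) (foldl (λ ns _ → next ns) ns as) ≤
      sz (list un) ns + length as * (2 + 2 * (head+ ns + length as))
    grows ns []       = m≤m+n _ 0
    grows ns (a ∷ as) = ≤-trans (grows (next ns) as) (begin
      sz (list un) (next ns) + length as * (2 + 2 * (head+ (next ns) + length as))
        ≡⟨ cong₂ (λ a b → a + length as * (2 + 2 * (b + length as))) (sz-next ns) (head+-next ns) ⟩
      (sz (list un) ns + (2 + 2 * h)) + length as * (2 + 2 * (suc h + length as))
        ≤⟨ m≤m+n _ (2 + 2 * length as) ⟩
      (sz (list un) ns + (2 + 2 * h)) + length as * (2 + 2 * (suc h + length as)) + (2 + 2 * length as)
        ≡⟨ solve 3 (λ z h n → (z :+ (con 2 :+ con 2 :* h)) :+ n :* (con 2 :+ con 2 :* (con 1 :+ h :+ n)) :+ (con 2 :+ con 2 :* n)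
                    := z :+ (con 1 :+ n) :* (con 2 :+ con 2 :* (h :+ (con 1 :+ n)))) refl (sz (list un) ns) h (length as) ⟩
      sz (list un) ns + suc (length as) * (2 + 2 * (h + suc (length as))) ∎)
      where
      open ≤-Reasoning
      h = head+ ns
    bound : Bd
    bound = X ⊕ (X ⊙ (κ 2 ⊕ (κ 2 ⊙ (X ⊕ X))))
    bounded : ∀ g ns (as : List (El A)) → sz (list un) (foldl (λ ns _ → next ns) ns as) ≤
      ⟦ bound ⟧ (sz ((Γ ⊗ list un) ⊗ list A) ((g , ns) , as))
    bounded g ns as = ≤-trans (grows ns as) (+-mono-≤ ns≤ (*-mono-≤ as≤ (+-monoʳ-≤ 2 (*-monoʳ-≤ 2 (+-mono-≤ (≤-trans (head+≤ ns) ns≤) as≤)))))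
      where
      ns≤ : sz (list un) ns ≤ sz ((Γ ⊗ list un) ⊗ list A) ((g , ns) , as)
      ns≤ = ≤-trans (m≤n+m _ (sz Γ g)) (≤-trans (n≤1+n _) (≤-trans (m≤m+n _ _) (n≤1+n _)))
      as≤ : length as ≤ sz ((Γ ⊗ list un) ⊗ list A) ((g , ns) , as)
      as≤ = ≤-trans (length≤sz A as) (m≤n+m _ (suc (sz (Γ ⊗ list un) (g , ns))))

  sz-fin : ∀ {n} (i : Fin n) → sz (fin n) i ≤ 1 + 2 * n
  sz-fin i = ≤-trans (≤-reflexive (go (toℕ i))) (s≤s (*-monoʳ-≤ 2 (<⇒≤ (toℕ<n i))))
    where
    go : ∀ n → size (encodeUnary n) ≡ 1 + 2 * n
    go zero    = refl
    go (suc n) = trans (cong (λ k → suc (suc k)) (go n)) (cong suc (sym (*-suc 2 n)))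

  sz-list : ∀ A W as → All (λ a → sz A a ≤ W) as → sz (list A) as ≤ 1 + length as * suc W
  sz-list A W []       []       = ≤-refl
  sz-list A W (a ∷ as) (p ∷ ps) = ≤-trans (s≤s (+-mono-≤ p (sz-list A W as ps)))
    (≤-reflexive (cong suc (+-suc W _)))

  module Programs {s : ℕ} (q : Fin s → ℕ) (Q′ : ℕ) (q∣Q : ∀ t → q t ∣ suc Q′) (0<q : ∀ t → 0 < q t)
    (coprime : ∀ t t′ → t ≢ t′ → Coprime (q t) (q t′))
    (ratio : ∀ t (h₁ h₂ : Fin (suc Q′)) → Choice (q t) h₁ h₂)
    (annih : ∀ t (h : Fin (suc Q′)) → Σ (Fin (suc Q′)) λ u → ∀ b → q t ∣ toℕ u * b ⇔ (∃[ y ] q t ∣ toℕ h * y + b))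
    where
    open Equations q Q′ q∣Q 0<q coprime ratio annih public

    rowT blockT sysT : Ty
    rowT   = fin Q ⊗ list (fin Q)
    blockT = fin s ⊗ list rowT
    sysT   = list blockT

    cmbP : ∀ {Γ c x y} → PT Γ (fin Q) c → PT Γ (fin Q) x → PT Γ (fin Q) y → PT Γ (fin Q) (λ z → cmb (c z) (x z) (y z))
    cmbP = table₃P cmb

    leadP : ∀ {Γ r} → PT Γ rowT r → PT Γ (fin Q) (λ x → lead (r x))
    leadP {r = r} R = extP (λ x → by-cases (proj₂ (r x)))
      (caseListP (constP (fin Q) zero) v1 ∘ᴾ (sndP ∘ᴾ R ,ᴾ R))
      where
      by-cases : ∀ {Γ : Set} {x : Γ} cs → caseList (λ _ → zero) (λ y → proj₂ (proj₁ y)) (cs , x) ≡ hd₀ cs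
      by-cases []      = refl
      by-cases (c ∷ _) = refl

    dropHeadP : ∀ {Γ r} → PT Γ rowT r → PT Γ rowT (λ x → dropHead (r x))
    dropHeadP {r = r} R = extP (λ x → by-cases (r x)) (fstP ∘ᴾ R ,ᴾ tailP (sndP ∘ᴾ R))
      where
      by-cases : ∀ r → (proj₁ r , tail₀ (proj₂ r)) ≡ dropHead r
      by-cases (k , [])    = refl
      by-cases (k , _ ∷ _) = refl

    axpyP : ∀ {Γ c r r′} → PT Γ (fin Q) c → PT Γ rowT r → PT Γ rowT r′ → PT Γ rowT (λ x → axpy (c x) (r x) (r′ x))
    axpyP C R R′ = cmbP C (fstP ∘ᴾ R) (fstP ∘ᴾ R′) ,ᴾ
      mapP (cmbP (wk C) (fstP ∘ᴾ v0) (sndP ∘ᴾ v0)) (zipP (sndP ∘ᴾ R) (sndP ∘ᴾ R′))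

    scaleP : ∀ {Γ u r} → PT Γ (fin Q) u → PT Γ rowT r → PT Γ rowT (λ x → scale (u x) (r x))
    scaleP U R = cmbP U (fstP ∘ᴾ R) (constP (fin Q) zero) ,ᴾ
      mapP (cmbP (wk U) v0 (constP (fin Q) zero)) (sndP ∘ᴾ R)

    -- Each entry of `Fin Q` has bounded size, so up to constants the size of a system is its number
    -- of entries, constants included. Elimination and substitution do not increase this number.
    cells : List Row → ℕ
    cells []             = 0
    cells ((_ , cs) ∷ rs) = suc (length cs) + cells rs

    β : ℕ
    β = 1 + 2 * Q

    sz-row : ∀ r → sz rowT r ≤ (2 + β) * suc (length (proj₂ r))
    sz-row (k , cs) = ≤-trans (s≤s (+-mono-≤ (sz-fin k) (sz-list (fin Q) β cs (All.universal sz-fin cs))))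
      (≤-trans (m≤m+n _ (length cs)) (≤-reflexive
        (solve 2 (λ b n → (con 1 :+ (b :+ (con 1 :+ n :* (con 1 :+ b)))) :+ n := (con 2 :+ b) :* (con 1 :+ n)) refl β (length cs))))

    sz-rows : ∀ rs → sz (list rowT) rs ≤ 1 + (3 + β) * cells rs
    sz-rows []       = s≤s z≤n
    sz-rows ((k , cs) ∷ rs) = ≤-trans (s≤s (+-mono-≤ (sz-row (k , cs)) (sz-rows rs)))
      (≤-trans (m≤m+n _ (length cs)) (≤-reflexive
        (solve 3 (λ b n c → (con 1 :+ ((con 2 :+ b) :* (con 1 :+ n) :+ (con 1 :+ (con 3 :+ b) :* c))) :+ n
          := con 1 :+ (con 3 :+ b) :* ((con 1 :+ n) :+ c)) refl β (length cs) (cells rs))))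

    row≤sz : ∀ r → suc (length (proj₂ r)) ≤ sz rowT r
    row≤sz (k , cs) = s≤s (≤-trans (length≤sz (fin Q) cs) (m≤n+m _ (sz (fin Q) k)))

    cells≤sz : ∀ rs → cells rs ≤ sz (list rowT) rs
    cells≤sz []              = z≤n
    cells≤sz ((k , cs) ∷ rs) = ≤-trans (+-mono-≤ (row≤sz (k , cs)) (cells≤sz rs)) (n≤1+n _)

    length-zip-≤ʳ : ∀ {A B : Set} (as : List A) (bs : List B) → length (zip as bs) ≤ length bs
    length-zip-≤ʳ as bs = ≤-trans (≤-reflexive (length-zipWith _,_ as bs)) (m⊓n≤n (length as) _)

    length-dropHead : ∀ r → length (proj₂ (dropHead r)) ≤ length (proj₂ r)
    length-dropHead (k , [])    = ≤-refl
    length-dropHead (k , _ ∷ _) = n≤1+n _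

    -- Rows may have different lengths here, since the bounds of a program must hold on every
    -- encoded argument; `zip` cuts off at the shorter row, which keeps the estimate valid.
    cells-elim-step : ∀ t p done r → let p′ , done′ = elim-step t (p , done) r in
      cells (p′ ∷ done′) ≤ cells (p ∷ done) + suc (length (proj₂ r))
    cells-elim-step t p done r with ratio t (lead p) (lead r)
    ... | first c _ = ≤-trans (+-monoʳ-≤ (suc (length (proj₂ p))) (+-monoˡ-≤ (cells done) (s≤s
            (≤-trans (length-dropHead (axpy c p r)) (≤-trans (≤-reflexive (length-map (combine c) (zip (proj₂ p) (proj₂ r)))) (length-zip-≤ʳ (proj₂ p) (proj₂ r)))))))
          (≤-reflexive (solve 3 (λ p r d → (con 1 :+ p) :+ ((con 1 :+ r) :+ d) := ((con 1 :+ p) :+ d) :+ (con 1 :+ r)) refl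
            (length (proj₂ p)) (length (proj₂ r)) (cells done)))
    ... | second c _ = ≤-trans (+-monoʳ-≤ (suc (length (proj₂ r))) (+-monoˡ-≤ (cells done) (s≤s
            (≤-trans (length-dropHead (axpy c r p)) (≤-trans (≤-reflexive (length-map (combine c) (zip (proj₂ r) (proj₂ p)))) (length-zip-≤ʳ (proj₂ r) (proj₂ p)))))))
          (≤-reflexive (+-comm (suc (length (proj₂ r))) _))

    cells-elim-fold : ∀ t st rs → let p , done = foldl (elim-step t) st rs in
      cells (p ∷ done) ≤ cells (proj₁ st ∷ proj₂ st) + cells rs
    cells-elim-fold t st            []       = m≤m+n _ 0
    cells-elim-fold t (p , done) (r ∷ rs) = ≤-trans (cells-elim-fold t (elim-step t (p , done) r) rs)
      (≤-trans (+-monoˡ-≤ (cells rs) (cells-elim-step t p done r)) (≤-reflexive (+-assoc (cells (p ∷ done)) _ (cells rs))))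

    cells-elim : ∀ t rs → cells (elim t rs) ≤ cells rs
    cells-elim t []       = z≤n
    cells-elim t (r ∷ rs) with foldl (elim-step t) (r , []) rs | cells-elim-fold t (r , []) rs
    ... | p , done | le = ≤-trans (+-monoˡ-≤ (cells done) (s≤s
          (≤-trans (length-dropHead (scale _ p)) (≤-reflexive (length-map _ (proj₂ p))))))
        (≤-trans le (≤-reflexive (cong (_+ cells rs) (+-identityʳ _))))

    cells-map : ∀ (g : Row → Row) → (∀ r → length (proj₂ (g r)) ≤ length (proj₂ r)) → ∀ rs → cells (map g rs) ≤ cells rs
    cells-map g le []       = z≤n
    cells-map g le (r ∷ rs) = +-mono-≤ (s≤s (le r)) (cells-map g le rs)

    elim-stepP : ∀ {Γ t p done r} → PT Γ (fin s) t → PT Γ rowT p → PT Γ (list rowT) done → PT Γ rowT r →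
      PT Γ (rowT ⊗ list rowT) (λ x → elim-step (t x) (p x , done x) (r x))
    elim-stepP T P DN R = ifP (table₃P (λ t h₁ h₂ → side (ratio t h₁ h₂)) T (leadP P) (leadP R))
      (P ,ᴾ dropHeadP (axpyP F P R) ∷ᴾ DN) (R ,ᴾ dropHeadP (axpyP F R P) ∷ᴾ DN)
      where F = table₃P (λ t h₁ h₂ → factor (ratio t h₁ h₂)) T (leadP P) (leadP R)

    elimP : ∀ {Γ t rows} → PT Γ (fin s) t → PT Γ (list rowT) rows → PT Γ (list rowT) (λ x → elim (t x) (rows x))
    elimP {t = t} {rows} T ROWS = closed ∘ᴾ (T ,ᴾ ROWS)
      where
      S = rowT ⊗ list rowT
      fold : PT ((fin s ⊗ S) ⊗ list rowT) S (λ ((t , st) , rs) → foldl (elim-step t) st rs)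
      fold = loopP (elim-stepP (fstP ∘ᴾ fstP) (fstP ∘ᴾ v1) (sndP ∘ᴾ v1) v0) (κ (3 + β) ⊙ X)
        λ t st rs → ≤-trans (sz-st (foldl (elim-step t) st rs))
          (*-monoʳ-≤ (3 + β) (≤-trans (s≤s (≤-trans (cells-elim-fold t st rs)
            (+-mono-≤ (st≤ st) (cells≤sz rs)))) (s≤s (+-monoˡ-≤ _ (m≤n⇒m≤1+n (m≤n+m _ (sz (fin s) t)))))))
        where
        st≤ : ∀ st → cells (proj₁ st ∷ proj₂ st) ≤ sz S st
        st≤ (p , done) = ≤-trans (+-mono-≤ (row≤sz p) (cells≤sz done)) (n≤1+n _)
        sz-st : ∀ st → sz S st ≤ (3 + β) * suc (cells (proj₁ st ∷ proj₂ st))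
        sz-st (p , done) = ≤-trans (sz-rows (p ∷ done)) (≤-trans (+-monoˡ-≤ _ (m≤m+n 1 (2 + β)))
          (≤-reflexive (sym (*-suc (3 + β) (cells (p ∷ done))))))
      closed : PT (fin s ⊗ list rowT) (list rowT) (λ x → elim (proj₁ x) (proj₂ x))
      closed = extP (λ { (t , []) → refl ; (t , r ∷ rs) → refl })
        (caseListP []ᴾ (finishP ∘ᴾ (wk (wk fstP) ,ᴾ fold ∘ᴾ ((wk (wk fstP) ,ᴾ (v1 ,ᴾ []ᴾ)) ,ᴾ v0))) ∘ᴾ (sndP ,ᴾ idP))
        where
        finishP : PT (fin s ⊗ S) (list rowT) (λ x → finish (proj₁ x) (proj₂ x))
        finishP = dropHeadP (scaleP (table₂P (λ t h → proj₁ (annih t h)) fstP (leadP (fstP ∘ᴾ sndP))) (fstP ∘ᴾ sndP)) ∷ᴾ (sndP ∘ᴾ sndP)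

    plugP : ∀ {Γ a r} → PT Γ (fin Q) a → PT Γ rowT r → PT Γ rowT (λ x → plug (a x) (r x))
    plugP A R = cmbP A (leadP R) (fstP ∘ᴾ R) ,ᴾ (sndP ∘ᴾ dropHeadP R)

    orP : ∀ {Γ p r} → PT Γ bool p → PT Γ bool r → PT Γ bool (λ x → p x ∨ r x)
    orP {p = p} {r} P R = extP (λ x → by-cases (p x)) (ifP P (constP bool true) R)
      where
      by-cases : ∀ b {c} → (if′ b then true else c) ≡ b ∨ c
      by-cases true  = refl
      by-cases false = refl

    equalP : ∀ {Γ t u} → PT Γ (fin s) t → PT Γ (fin s) u → PT Γ bool (λ x → does (t x ≟ᶠ u x))
    equalP = table₂P (λ t u → does (t ≟ᶠ u))

    module Expansion (F : ℕ) where
      open Branches F public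

      branchT itemT : Ty
      branchT = fin (suc F) ⊗ (sysT ⊗ bin)
      itemT   = fin s ⊗ un

      elimBlockP : ∀ {Γ t b} → PT Γ (fin s) t → PT Γ blockT b → PT Γ blockT (λ x → elimBlock (t x) (b x))
      elimBlockP T B = fstP ∘ᴾ B ,ᴾ ifP (equalP (fstP ∘ᴾ B) T) (elimP (fstP ∘ᴾ B) (sndP ∘ᴾ B)) (mapP (dropHeadP v0) (sndP ∘ᴾ B))

      plugBlockP : ∀ {Γ t a b} → PT Γ (fin s) t → PT Γ (fin Q) a → PT Γ blockT b → PT Γ blockT (λ x → plugBlock (t x) (a x) (b x))
      plugBlockP T A B = fstP ∘ᴾ B ,ᴾ ifP (equalP (fstP ∘ᴾ B) T) (mapP (plugP (wk A) v0) (sndP ∘ᴾ B)) (mapP (dropHeadP v0) (sndP ∘ᴾ B))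

      growP : PT (itemT ⊗ branchT) (list branchT) (λ x → grow (proj₁ x) (proj₂ x))
      growP = ifP (orP (eqUnP e (constP un 0)) (tableP isZero f))
        ((f ,ᴾ (mapP (elimBlockP (wk t) v0) sys ,ᴾ v)) ∷ᴾ []ᴾ)
        (mapP (tableP predF (wk f) ,ᴾ (mapP (plugBlockP (wk (wk t)) v1 v0) (wk sys) ,ᴾ powerP (wk v) (tableP toℕ v0) (wk e)))
          (tableP values t))
        where
        t   = fstP ∘ᴾ fstP
        e   = sndP ∘ᴾ fstP
        f   = fstP ∘ᴾ sndP
        sys = fstP ∘ᴾ sndP ∘ᴾ sndP
        v   = sndP ∘ᴾ sndP ∘ᴾ sndP

      sysCells : Sys → ℕ
      sysCells []                 = 0
      sysCells ((_ , rows) ∷ sys) = suc (cells rows) + sysCells sys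

      sz-sys : ∀ sys → sz sysT sys ≤ 1 + (4 + 2 * s + (3 + β)) * sysCells sys
      sz-sys []                 = s≤s z≤n
      sz-sys ((t , rows) ∷ sys) = ≤-trans
        (s≤s (+-mono-≤ (s≤s (+-mono-≤ (sz-fin t) (sz-rows rows))) (sz-sys sys)))
        (≤-trans (m≤m+n _ (3 + β + (4 + 2 * s) * cells rows)) (≤-reflexive
          (solve 4 (λ s b c d → (con 1 :+ ((con 1 :+ ((con 1 :+ con 2 :* s) :+ (con 1 :+ (con 3 :+ b) :* c))) :+ (con 1 :+ (con 4 :+ con 2 :* s :+ (con 3 :+ b)) :* d)))
              :+ (con 3 :+ b :+ (con 4 :+ con 2 :* s) :* c)
            := con 1 :+ (con 4 :+ con 2 :* s :+ (con 3 :+ b)) :* ((con 1 :+ c) :+ d)) refl s β (cells rows) (sysCells sys))))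

      sysCells≤sz : ∀ sys → sysCells sys ≤ sz sysT sys
      sysCells≤sz []                 = z≤n
      sysCells≤sz ((t , rows) ∷ sys) = ≤-trans
        (+-mono-≤ (s≤s (≤-trans (cells≤sz rows) (m≤n+m _ (sz (fin s) t)))) (sysCells≤sz sys)) (n≤1+n _)

      sysCells-map : ∀ (g : Fin s × List Row → Fin s × List Row) → (∀ b → cells (proj₂ (g b)) ≤ cells (proj₂ b)) →
        ∀ sys → sysCells (map g sys) ≤ sysCells sys
      sysCells-map g le []        = z≤n
      sysCells-map g le (b ∷ sys) = +-mono-≤ (s≤s (le b)) (sysCells-map g le sys)

      cells-elimBlock : ∀ t b → cells (proj₂ (elimBlock t b)) ≤ cells (proj₂ b)
      cells-elimBlock t (t′ , rows) with does (t′ ≟ᶠ t)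
      ... | true  = cells-elim t′ rows
      ... | false = cells-map dropHead length-dropHead rows

      cells-plugBlock : ∀ t a b → cells (proj₂ (plugBlock t a b)) ≤ cells (proj₂ b)
      cells-plugBlock t a (t′ , rows) with does (t′ ≟ᶠ t)
      ... | true  = cells-map (plug a) length-dropHead rows
      ... | false = cells-map dropHead length-dropHead rows

      exponents : List Item → ℕ
      exponents []               = 0
      exponents ((_ , e) ∷ its) = e + exponents its

      Within : ℕ → ℕ → Branch → Set
      Within c l (f , (sys , v)) = sysCells sys ≤ c × len v ≤ l

      len≤ : ∀ n → len n ≤ n
      len≤ n = s≤s⁻¹ (≤-trans (m<2^m (len n)) (2^len≤ n))
        where
        m<2^m : ∀ m → suc m ≤ 2 ^ m
        m<2^m zero    = ≤-refl
        m<2^m (suc m) = ≤-trans (s≤s (m<2^m m)) (≤-trans (+-monoˡ-≤ (2 ^ m) (m^n>0 2 m))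
          (+-monoʳ-≤ (2 ^ m) (m≤m+n (2 ^ m) 0)))

      -- The product v receives e factors below Q, each with at most Q digits, and multiplication
      -- can add one digit on top: hence `suc Q` per factor.
      grow-within : ∀ t e c l b → Within c l b → All (Within c (l + e * suc Q)) (grow (t , e) b)
      grow-within t e c l (f , (sys , v)) (le-c , le-l) with (e ≡ᵇ 0) ∨ isZero f
      ... | true  = (≤-trans (sysCells-map (elimBlock t) (cells-elimBlock t) sys) le-c , ≤-trans le-l (m≤m+n l _)) ∷ []
      ... | false = All-map⁺ (All.universal (λ a →
            ≤-trans (sysCells-map (plugBlock t a) (cells-plugBlock t a) sys) le-c ,
            ≤-trans (len-*-^ (toℕ a) v e) (+-mono-≤ le-l (*-monoʳ-≤ e (s≤s (≤-trans (len≤ (toℕ a)) (<⇒≤ (toℕ<n a)))))))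
          (values t))

      leaves-within : ∀ its c l b → Within c l b → All (Within c (l + exponents its * suc Q)) (leaves its b)
      leaves-within []              c l b w = subst (λ n → Within c n b) (sym (+-identityʳ l)) w ∷ []
      leaves-within ((t , e) ∷ its) c l b w = All-concat⁺ (All-map⁺ (All.map (λ {b} w′ →
        subst (λ n → All (Within c n) (leaves its b))
          (solve 4 (λ l e n q → (l :+ e :* q) :+ n :* q := l :+ (e :+ n) :* q) refl l e (exponents its) (suc Q))
          (leaves-within its c (l + e * suc Q) b w′)) (grow-within t e c l b w)))

      length-concatMap : ∀ {A B : Set} (h : A → List B) n as → All (λ a → length (h a) ≤ n) as →
        length (concatMap h as) ≤ length as * n
      length-concatMap h n []       []       = z≤n
      length-concatMap h n (a ∷ as) (p ∷ ps) = ≤-trans (≤-reflexive (length-++ (h a))) (+-mono-≤ p (length-concatMap h n as ps))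

      -- Only fixing a value branches, into at most Q children, and each time the budget drops by
      -- one; an elimination has a single child. The exponent is thus the budget and does not grow
      -- with the number of variables.
      length-leaves : ∀ its b → length (leaves its b) ≤ Q ^ toℕ (proj₁ b)
      length-leaves []              b = m^n>0 Q (toℕ (proj₁ b))
      length-leaves ((t , zero) ∷ its) (f , (sys , v)) =
        ≤-trans (length-concatMap (leaves its) (Q ^ toℕ f) _ (length-leaves its _ ∷ [])) (≤-reflexive (+-identityʳ _))
      length-leaves ((t , suc e) ∷ its) (zero , (sys , v)) =
        ≤-trans (length-concatMap (leaves its) 1 _ (length-leaves its _ ∷ [])) ≤-refl
      length-leaves ((t , suc e) ∷ its) (suc f , (sys , v)) =
        ≤-trans (length-concatMap (leaves its) (Q ^ toℕ f) (map (fix (t , suc e) (suc f , (sys , v))) (values t))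
                  (All-map⁺ (All.universal (λ a → ≤-trans (length-leaves its _)
                    (≤-reflexive (cong (Q ^_) (toℕ-inject₁ f)))) (values t))))
                (*-monoˡ-≤ (Q ^ toℕ f) (≤-trans (≤-reflexive (trans (length-map _ (values t))
                  (trans (length-map (embed t) (allFin (q t))) (length-tabulate (λ i → i))))) (q≤Q t)))

      leafBound : Bd
      leafBound = κ (4 + 2 * suc F) ⊕ ((κ (4 + 2 * s + (3 + β)) ⊙ X) ⊕ (κ 4 ⊙ (κ 1 ⊕ (X ⊕ (X ⊙ κ (suc Q))))))

      sz-leaf : ∀ n b → Within n (n + n * suc Q) b → sz branchT b ≤ ⟦ leafBound ⟧ n
      sz-leaf n (f , (sys , v)) (le-c , le-l) = ≤-trans
        (s≤s (+-mono-≤ (sz-fin f) (s≤s (+-mono-≤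
          (≤-trans (sz-sys sys) (s≤s (*-monoʳ-≤ (4 + 2 * s + (3 + β)) le-c)))
          (≤-trans (sz≤len v) (*-monoʳ-≤ 4 (s≤s le-l)))))))
        (≤-reflexive (solve 3 (λ f c l → con 1 :+ ((con 1 :+ f) :+ (con 1 :+ ((con 1 :+ c) :+ l))) := con 4 :+ f :+ (c :+ l)) refl
          (2 * suc F) ((4 + 2 * s + (3 + β)) * n) (4 * suc (n + n * suc Q))))

      expandP : ∀ {Γ its b} → PT Γ (list itemT) its → PT Γ branchT b → PT Γ (list branchT) (λ x → leaves (its x) (b x))
      expandP {Γ} {its} {b} ITS B = extP (λ x → trans (foldl-grow (its x) (b x ∷ [])) (++-identityʳ (leaves (its x) (b x))))
        (foldP ITS (B ∷ᴾ []ᴾ) (concatMapP (growP ∘ᴾ (v1 ,ᴾ v0)) v1) bound bounded)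
        where
        bound : Bd
        bound = κ 1 ⊕ ((X ⊙ κ (Q ^ F)) ⊙ (κ 1 ⊕ leafBound))
        exponents≤ : ∀ its → exponents its ≤ sz (list itemT) its
        exponents≤ []               = z≤n
        exponents≤ ((t , e) ∷ its) = ≤-trans (+-mono-≤ (≤-trans (≤-trans (≤un e) (m≤n+m _ (sz (fin s) t))) (n≤1+n _)) (exponents≤ its)) (n≤1+n _)
          where
          ≤un : ∀ e → e ≤ sz un e
          ≤un zero    = z≤n
          ≤un (suc e) = s≤s (m≤n⇒m≤1+n (≤un e))
        bounded : ∀ g bs its → sz (list branchT) (foldl (λ bs it → concatMap (grow it) bs) bs its) ≤
          ⟦ bound ⟧ (sz ((Γ ⊗ list branchT) ⊗ list itemT) ((g , bs) , its))
        bounded g bs its rewrite foldl-grow its bs = ≤-trans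
          (sz-list branchT (⟦ leafBound ⟧ n) (concatMap (leaves its) bs)
            (All-concat⁺ (All-map⁺ (All.map (λ {b} w → All.map (λ {b} → sz-leaf n b) (loosen b w)) (within bs bs≤)))))
          (s≤s (*-monoˡ-≤ (suc (⟦ leafBound ⟧ n)) (≤-trans
            (length-concatMap (leaves its) (Q ^ F) bs (All.universal (λ b → ≤-trans (length-leaves its b)
              (^-monoʳ-≤ Q (s≤s⁻¹ (toℕ<n (proj₁ b))))) bs))
            (*-monoˡ-≤ (Q ^ F) (≤-trans (length≤sz branchT bs) bs≤)))))
          where
          n = sz ((Γ ⊗ list branchT) ⊗ list itemT) ((g , bs) , its)
          bs≤ : sz (list branchT) bs ≤ n
          bs≤ = ≤-trans (m≤n+m _ (sz Γ g)) (≤-trans (n≤1+n _) (≤-trans (m≤m+n _ _) (n≤1+n _)))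
          its≤ : sz (list itemT) its ≤ n
          its≤ = m≤n+m _ (suc (sz (Γ ⊗ list branchT) (g , bs)))
          within : ∀ bs → sz (list branchT) bs ≤ n → All (Within n n) bs
          within []                    le = []
          within ((f , (sys , v)) ∷ bs) le =
            (≤-trans (sysCells≤sz sys) (≤-trans (≤-trans (m≤m+n _ _) (≤-trans (n≤1+n _) (≤-trans (m≤n+m _ (sz (fin (suc F)) f)) (n≤1+n _)))) b≤) ,
             ≤-trans (len≤sz v) (≤-trans (≤-trans (m≤n+m _ (sz sysT sys)) (≤-trans (n≤1+n _) (≤-trans (m≤n+m _ (sz (fin (suc F)) f)) (n≤1+n _)))) b≤))
            ∷ within bs (≤-trans (≤-trans (m≤n+m _ (sz branchT (f , (sys , v)))) (n≤1+n _)) le)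
            where
            b≤ : sz branchT (f , (sys , v)) ≤ n
            b≤ = ≤-trans (≤-trans (m≤m+n _ _) (n≤1+n _)) le
          loosen : ∀ b → Within n n b → All (Within n (n + n * suc Q)) (leaves its b)
          loosen b w = All.map (λ (c , l) → c , ≤-trans l (+-monoʳ-≤ n (*-monoˡ-≤ (suc Q) (≤-trans (exponents≤ its) its≤))))
            (leaves-within its n n b w)

      consistentP : ∀ {Γ b} → PT Γ branchT b → PT Γ bool (λ x → consistent (proj₁ (proj₂ (b x))))
      consistentP B = allP (allP (table₂P (λ t k → does (q t ∣? toℕ k)) (wk (fstP ∘ᴾ v0)) (fstP ∘ᴾ v0)) (sndP ∘ᴾ v0)) (fstP ∘ᴾ sndP ∘ᴾ B)

      indP : ∀ {Γ p n} → PT Γ bool p → PT Γ bin n → PT Γ bin (λ x → ind (p x) (n x))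
      indP {p = p} P N = extP (λ x → by-cases (p x)) (ifP P N (constP bin 0))
        where
        by-cases : ∀ b {n} → (if′ b then n else 0) ≡ ind b n
        by-cases true  = refl
        by-cases false = refl

      totalP : ∀ {Γ bs} → PT Γ (list branchT) bs → PT Γ bin (λ x → total (bs x))
      totalP BS = sumP (indP (consistentP v0) (sndP ∘ᴾ sndP ∘ᴾ v0)) BS

      countP : ∀ {Γ bs} → PT Γ (list branchT) bs → PT Γ bin (λ x → count (bs x))
      countP BS = sumP (indP (consistentP v0) (constP bin 1)) BS

-- The decision procedure as a program

module VerdictProgram where

  open import Defs
  open TreePrograms
  open ListPrograms
  open BinaryArithmetic
  open Elimination
  open CountingPrograms
  open import Data.Bool.Base using (Bool; true; false; not) renaming (if_then_else_ to if′_then_else_)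
  open import Data.Bool.ListAction using (all)
  open import Data.Fin.Base using (fromℕ)
  open import Data.List.Base using (List; []; _∷_; length; map; allFin; zip; foldl; upTo; replicate; drop)
  open import Data.List.Properties
  open import Data.Nat.Base hiding (_/_)
  open import Data.Nat.Properties
  open import Data.Nat.Divisibility
  open import Data.Nat.Coprimality using (Coprime)
  open import Data.Nat.Solver using (module +-*-Solver)
  open import Data.Vec.Base using ([]; _∷_; lookup)
  open import Relation.Binary.PropositionalEquality
  open +-*-Solver using (solve; _:+_; _:*_; _:=_; con)

  PT⇒PolynomialTime : ∀ {P : DecisionProblem} {A f} → PT A bool f →
    let open DecisionProblem P in
    (repr : Input → El A) → (∀ x → encode x ≡ enc A (repr x)) → (∀ x → f (repr x) ≡ true ⇔ Yes x) →
    PolynomialTime P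
  PT⇒PolynomialTime {P} {A} {f} F repr encodes correct =
    let a , e , bound = ⟦⟧-polynomial (time F) in
    1 , prog F , a , e , λ x →
    let t , ev , t≤ = runs F (repr x) nil in
    t , _ , subst (λ u → ⟨ prog F , u ∷ nil ∷ [] ⟩⇓[ t ] _) (sym (encodes x)) ev ,
    ≤-trans t≤ (subst (λ u → ⟦ time F ⟧ (sz A (repr x)) ≤ a * size u ^ e) (sym (encodes x)) (bound _ (1≤sz A (repr x)))) ,
    mk⇔ (λ ≢nil → Equivalence.to (correct x) (accepted (f (repr x)) ≢nil))
        (λ yes → rejected (Equivalence.from (correct x) yes))
    where
    accepted : ∀ b → enc bool b ≢ nil → b ≡ true
    accepted true  _    = refl
    accepted false ≢nil with () ← ≢nil refl
    rejected : ∀ {b} → b ≡ true → enc bool b ≢ nil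
    rejected refl ()

  ratT : Ty
  ratT = (bool ⊗ bin) ⊗ bin

  Rat : Set
  Rat = El ratT

  foldl-tail : ∀ {A : Set} j (as : List A) → foldl (λ as _ → tail₀ as) as (replicate j 0) ≡ drop j as
  foldl-tail zero    as       = refl
  foldl-tail (suc j) []       = trans (foldl-tail j []) (drop-[] j)
  foldl-tail (suc j) (a ∷ as) = foldl-tail j as

  dropP : ∀ {Γ A j as} → PT Γ un j → PT Γ (list A) as → PT Γ (list A) (λ x → drop (j x) (as x))
  dropP {A = A} {j} {as} J AS = extP (λ x → foldl-tail (j x) (as x))
    (foldˢP (unit-list ∘ᴾ J) AS (tailP v1) (κ 0) λ g as n → ≤-trans (sz-tail {A} as) (m≤m+n _ 0))

  headOr : ∀ {A : Set} → A → List A → A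
  headOr z []      = z
  headOr z (a ∷ _) = a

  headOrP : ∀ {Γ A as} z → PT Γ (list A) as → PT Γ A (λ x → headOr z (as x))
  headOrP {A = A} {as} z AS = extP (λ x → by-cases (as x)) (caseListP (constP A z) v1 ∘ᴾ (AS ,ᴾ AS))
    where
    by-cases : ∀ {Γ : Set} {x : Γ} as → caseList (λ _ → z) (λ y → proj₂ (proj₁ y)) (as , x) ≡ headOr z as
    by-cases []      = refl
    by-cases (_ ∷ _) = refl

  entry : ℕ → List Rat → Rat
  entry j u = headOr ((false , 0) , 1) (drop j u)

  -- A negative sign with magnitude n encodes -(n + 1), as in the constructor `-[1+ n ]`; hence the
  -- shift by one.
  posPart negPart : Rat → ℕ
  posPart ((sign , n) , _) = if′ sign then 0 else n
  negPart ((sign , n) , _) = if′ sign then 1 + n else 0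

  accT fracT : Ty
  accT  = bin ⊗ (bin ⊗ bin)
  fracT = ratT ⊗ (bin ⊗ bin)

  -- The accumulator (P,N,M) stands for (P - N) / M, to which r v / k is added.
  addFrac : El accT → El fracT → El accT
  addFrac (P , (N , M)) (r , (v , k)) =
    P * (proj₂ r * k) + posPart r * v * M , (N * (proj₂ r * k) + negPart r * v * M , M * (proj₂ r * k))

  -- Fractions are never reduced. Denominators multiply, but their digits only add, and the sum is
  -- zero when P = N, so neither gcd nor division is programmed.
  zeroTest : List (El fracT) → Bool
  zeroTest fs = eqBin (proj₁ (foldl addFrac (0 , (0 , 1)) fs)) (proj₁ (proj₂ (foldl addFrac (0 , (0 , 1)) fs)))

  zeroTestP : ∀ {Γ fs} → PT Γ (list fracT) fs → PT Γ bool (λ x → zeroTest (fs x))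
  zeroTestP FS = closed ∘ᴾ FS
    where
    addFracP : PT ((list fracT ⊗ accT) ⊗ fracT) accT (λ x → addFrac (proj₂ (proj₁ x)) (proj₂ x))
    addFracP = P *ᴾ (D *ᴾ K) +ᴾ pos *ᴾ V *ᴾ M ,ᴾ (N *ᴾ (D *ᴾ K) +ᴾ neg *ᴾ V *ᴾ M ,ᴾ M *ᴾ (D *ᴾ K))
      where
      P = fstP ∘ᴾ v1
      N = fstP ∘ᴾ sndP ∘ᴾ v1
      M = sndP ∘ᴾ sndP ∘ᴾ v1
      sign = fstP ∘ᴾ fstP ∘ᴾ fstP ∘ᴾ v0
      mag  = sndP ∘ᴾ fstP ∘ᴾ fstP ∘ᴾ v0
      D = sndP ∘ᴾ fstP ∘ᴾ v0
      V = fstP ∘ᴾ sndP ∘ᴾ v0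
      K = sndP ∘ᴾ sndP ∘ᴾ v0
      pos = ifP sign (constP bin 0) mag
      neg = ifP sign (constP bin 1 +ᴾ mag) (constP bin 0)
    -- P and N both receive terms with the factor M, so growth is additive only for the three
    -- jointly, measured by the digits of their sum. The factor 14 below is three times the 4 of
    -- `sz≤len` plus two pair nodes.
    μ : El accT → ℕ
    μ (P , (N , M)) = len (P + (N + M))
    μ≤sz : ∀ b → μ b ≤ sz accT b
    μ≤sz (P , (N , M)) = ≤-trans (len-+ P (N + M)) (s≤s (+-mono-≤ (len≤sz P)
      (≤-trans (len-+ N M) (s≤s (+-mono-≤ (len≤sz N) (len≤sz M))))))
    sz≤μ : ∀ b → sz accT b ≤ 14 * suc (μ b)
    sz≤μ (P , (N , M)) = ≤-trans
      (s≤s (+-mono-≤ (part P (m≤m+n P _)) (s≤s (+-mono-≤ (part N (≤-trans (m≤m+n N M) (m≤n+m _ P))) (part M (≤-trans (m≤n+m M N) (m≤n+m _ P)))))))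
      (≤-trans (m≤m+n _ (2 * l)) (≤-reflexive
        (solve 1 (λ l → (con 1 :+ (con 4 :* (con 1 :+ l) :+ (con 1 :+ (con 4 :* (con 1 :+ l) :+ con 4 :* (con 1 :+ l))))) :+ con 2 :* l
          := con 14 :* (con 1 :+ l)) refl l)))
      where
      l = len (P + (N + M))
      part : ∀ n → n ≤ P + (N + M) → sz bin n ≤ 4 * suc l
      part n le = ≤-trans (sz≤len n) (*-monoʳ-≤ 4 (s≤s (len-mono le)))
    additive : ∀ g b a → μ (addFrac b a) ≤ μ b + (8 + sz (list fracT ⊗ fracT) (g , a))
    additive g (P , (N , M)) (((sign , n) , d) , (v , k)) = ≤-trans
      (len-product (P + (N + M)) (d * k + (1 + n) * v) product≤)
      (≤-trans (≤-reflexive (sym (+-suc (len (P + (N + M))) _))) (+-monoʳ-≤ (len (P + (N + M))) weight≤))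
      where
      r = (sign , n) , d
      parts : ∀ sign → posPart ((sign , n) , d) + negPart ((sign , n) , d) ≤ 1 + n
      parts true  = ≤-refl
      parts false = ≤-trans (≤-reflexive (+-identityʳ n)) (n≤1+n n)
      product≤ : suc ((P * (d * k) + posPart r * v * M) + ((N * (d * k) + negPart r * v * M) + M * (d * k))) ≤
        suc (P + (N + M)) * suc (d * k + (1 + n) * v)
      product≤ = begin
        suc ((P * (d * k) + posPart r * v * M) + ((N * (d * k) + negPart r * v * M) + M * (d * k)))
          ≡⟨ solve 7 (λ P N M D p n v → con 1 :+ ((P :* D :+ p :* v :* M) :+ ((N :* D :+ n :* v :* M) :+ M :* D))
               := con 1 :+ ((P :+ (N :+ M)) :* D :+ M :* ((p :+ n) :* v))) refl P N M (d * k) (posPart r) (negPart r) v ⟩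
        suc ((P + (N + M)) * (d * k) + M * ((posPart r + negPart r) * v))
          ≤⟨ s≤s (+-monoʳ-≤ _ (*-mono-≤ (≤-trans (m≤n+m M N) (m≤n+m _ P)) (*-monoˡ-≤ v (parts sign)))) ⟩
        suc ((P + (N + M)) * (d * k) + (P + (N + M)) * ((1 + n) * v))
          ≡⟨ cong suc (sym (*-distribˡ-+ (P + (N + M)) (d * k) ((1 + n) * v))) ⟩
        suc ((P + (N + M)) * (d * k + (1 + n) * v))
          ≤⟨ s≤s (≤-trans (*-monoʳ-≤ (P + (N + M)) (n≤1+n (d * k + (1 + n) * v))) (m≤n+m _ (d * k + (1 + n) * v))) ⟩
        suc (P + (N + M)) * suc (d * k + (1 + n) * v) ∎
        where open ≤-Reasoning
      weight≤ : suc (len (d * k + (1 + n) * v)) ≤ 8 + sz (list fracT ⊗ fracT) (g , (r , (v , k)))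
      weight≤ = ≤-trans (s≤s (≤-trans (len-+ (d * k) _) (s≤s (+-mono-≤
          (≤-trans (len-* d k) (s≤s (+-mono-≤ (len≤sz d) (len≤sz k))))
          (≤-trans (len-* (1 + n) v) (s≤s (+-mono-≤ (≤-trans (len-+ 1 n) (s≤s (s≤s (len≤sz n)))) (len≤sz v))))))))
        (≤-trans (m≤m+n _ (7 + sz (list fracT) g + sz bool sign)) (≤-reflexive
          (solve 6 (λ g b n d v k → (con 1 :+ (con 1 :+ ((con 1 :+ (d :+ k)) :+ (con 1 :+ ((con 2 :+ n) :+ v))))) :+ (con 7 :+ g :+ b)
            := con 8 :+ (con 1 :+ (g :+ (con 1 :+ ((con 1 :+ ((con 1 :+ (b :+ n)) :+ d)) :+ (con 1 :+ (v :+ k))))))) refl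
            (sz (list fracT) g) (sz bool sign) (sz bin n) (sz bin d) (sz bin v) (sz bin k))))
    accP : PT (list fracT) accT (λ fs → foldl addFrac (0 , (0 , 1)) fs)
    accP = foldμP idP (constP accT (0 , (0 , 1))) addFracP μ 14 (κ 8 ⊕ X) μ≤sz sz≤μ additive
    closed : PT (list fracT) bool zeroTest
    closed = eqBinP (fstP ∘ᴾ accP) (fstP ∘ᴾ sndP ∘ᴾ accP)

  module Algorithm {s : ℕ} (q : Fin s → ℕ) (Q′ : ℕ) (q∣Q : ∀ t → q t ∣ suc Q′) (0<q : ∀ t → 0 < q t)
    (coprime : ∀ t t′ → t ≢ t′ → Coprime (q t) (q t′))
    (ratio : ∀ t (h₁ h₂ : Fin (suc Q′)) → Choice (q t) h₁ h₂)
    (annih : ∀ t (h : Fin (suc Q′)) → Σ (Fin (suc Q′)) λ u → ∀ b → q t ∣ toℕ u * b ⇔ (∃[ y ] q t ∣ toℕ h * y + b))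
    where
    open Programs q Q′ q∣Q 0<q coprime ratio annih public

    module Verdict {l : ℕ} (Γ : Language l) (invariant : ∀ r → AffineInvariant (lookup Γ r)) (F : ℕ) where
      open Instances Γ invariant public
      open Expansion F public

      conT termT inputT : Ty
      conT   = fin l ⊗ list un
      termT  = list ratT ⊗ list un
      inputT = (list (fin s) ⊗ list conT) ⊗ list termT

      Con Term Input : Set
      Con   = El conT
      Term  = El termT
      Input = El inputT

      itemsOf : List (Fin s) → List ℕ → List ℕ → List Item
      itemsOf δ α β = map (λ (t , (a , b)) → t , a + b) (zip δ (zip α β))

      branches : List (Fin s) → List Con → List ℕ → List ℕ → List Branch
      branches δ cs α β = leaves (itemsOf δ α β) (fromℕ F , (tab (initial (length δ) cs) , 1))

      frac : Input → List ℕ → ℕ → Term → El fracT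
      frac ((δ , cs) , _) β j (u , α) = entry j u , (total (branches δ cs α β) , count (branches δ cs α β))

      orthogonal : Input → Term → Bool
      orthogonal x (u , β) = all (λ j → zeroTest (map (frac x β j) (proj₂ x))) (upTo (length u))

      -- An instance with a constraint on an empty relation has no solution, so its ideal is the
      -- whole ring and the answer is yes.
      verdict : Input → Bool
      verdict x =
        if′ all (λ (r , _) → not (unsatisfiable r)) (proj₂ (proj₁ x))
        then all (orthogonal x) (proj₂ x) else true

      tabP : ∀ {Γ δ cs} → PT Γ (list (fin s)) δ → PT Γ (list conT) cs → PT Γ sysT (λ x → tab (initial (length (δ x)) (cs x)))
      tabP DS CS = mapP (v0 ,ᴾ concatMapP (mapP (denseP (wk (wk (wk DS))) (sndP ∘ᴾ v1) v0) (table₂P eqTable v1 (fstP ∘ᴾ v0))) (wk CS))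
        (constP (list (fin s)) (allFin s))
        where
        coefficientP : PT ((list (un ⊗ fin Q)) ⊗ un) (fin Q) (λ x → coefficient (proj₁ x) (proj₂ x))
        coefficientP = foldP fstP (constP (fin Q) zero)
          (ifP (eqUnP (fstP ∘ᴾ v0) (sndP ∘ᴾ wk fstP)) (cmbP (constP (fin Q) one) (sndP ∘ᴾ v0) v1) v1)
          (κ (1 + 2 * Q)) (λ g b as → sz-fin (foldl (accumulate (proj₂ g)) b as))
        denseP : ∀ {Γ A δ vs r} → PT Γ (list A) δ → PT Γ (list un) vs → PT Γ rowT r → PT Γ rowT (λ x → dense (length (δ x)) (vs x) (r x))
        denseP DS VS R = fstP ∘ᴾ R ,ᴾ mapP (coefficientP ∘ᴾ (wk (zipP VS (sndP ∘ᴾ R)) ,ᴾ v0)) (indicesP DS)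

      branchesP : ∀ {Γ δ cs α β} → PT Γ (list (fin s)) δ → PT Γ (list conT) cs → PT Γ (list un) α → PT Γ (list un) β →
        PT Γ (list branchT) (λ x → branches (δ x) (cs x) (α x) (β x))
      branchesP DS CS AS BS = expandP
        (mapP (fstP ∘ᴾ v0 ,ᴾ (fstP ∘ᴾ sndP ∘ᴾ v0) +ᵁᴾ (sndP ∘ᴾ sndP ∘ᴾ v0)) (zipP DS (zipP AS BS)))
        (constP (fin (suc F)) (fromℕ F) ,ᴾ (tabP DS CS ,ᴾ constP bin 1))

      fracP : PT (((inputT ⊗ list un) ⊗ un) ⊗ termT) fracT (λ x → frac (proj₁ (proj₁ (proj₁ x))) (proj₂ (proj₁ (proj₁ x))) (proj₂ (proj₁ x)) (proj₂ x))
      fracP = headOrP ((false , 0) , 1) (dropP v1 (fstP ∘ᴾ v0)) ,ᴾ (totalP bs ,ᴾ countP bs)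
        where
        inst = fstP ∘ᴾ fstP ∘ᴾ fstP ∘ᴾ fstP
        bs = branchesP (fstP ∘ᴾ inst) (sndP ∘ᴾ inst) (sndP ∘ᴾ v0) v2

      orthogonalP : PT (inputT ⊗ termT) bool (λ x → orthogonal (proj₁ x) (proj₂ x))
      orthogonalP = allP (zeroTestP (mapP (fracP ∘ᴾ (((wk (wk fstP) ,ᴾ wk (wk (sndP ∘ᴾ sndP))) ,ᴾ v1) ,ᴾ v0)) (wk (sndP ∘ᴾ fstP))))
        (indicesP (fstP ∘ᴾ sndP))

      verdictP : PT inputT bool verdict
      verdictP = ifP (allP (tableP (λ r → not (unsatisfiable r)) (fstP ∘ᴾ v0)) (sndP ∘ᴾ fstP))
        (allP orthogonalP sndP) (constP bool true)

-- The commutative ring of complex numbers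

module ComplexNumbers where

  open import Defs
  open import Algebra.Bundles using (CommutativeRing)
  open import Data.Nat.Base as ℕ using (ℕ)
  import Data.Nat.Properties as ℕₚ
  open import Data.Rational.Base as Rat using (ℚ; 0ℚ; 1ℚ; ½; _+_; _*_; -_; _-_; _<_; _≤_; ∣_∣)
  import Data.Rational.Properties as ℚₚ
  open import Data.Rational.Solver using (module +-*-Solver)
  open import Level using (0ℓ)
  open import Relation.Binary.PropositionalEquality using (_≡_; refl; sym; trans; cong; subst)
  open +-*-Solver

  0<½* : ∀ {ε} → 0ℚ < ε → 0ℚ < ε * ½
  0<½* {ε} 0<ε = ℚₚ.positive⁻¹ (ε * ½) {{ℚₚ.pos*pos⇒pos ε {{Rat.positive 0<ε}} ½}}

  half+half : ∀ ε → ε * ½ + ε * ½ ≡ ε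
  half+half ε = trans (sym (ℚₚ.*-distribˡ-+ ε ½ ½)) (ℚₚ.*-identityʳ ε)

  ≃-pointwise : ∀ {x y} → (∀ n → seq x n ≡ seq y n) → x ≃ᴿ y
  ≃-pointwise {x} {y} eq ε 0<ε = 0 , λ n _ → subst (_< ε)
    (sym (trans (cong (λ p → ∣ seq x n - p ∣) (sym (eq n))) (cong ∣_∣ (ℚₚ.+-inverseʳ (seq x n))))) 0<ε

  ≃-refl : ∀ {x} → x ≃ᴿ x
  ≃-refl {x} = ≃-pointwise {x} {x} (λ _ → refl)

  ∣-∣-comm : ∀ p q → ∣ p - q ∣ ≡ ∣ q - p ∣
  ∣-∣-comm p q = trans (sym (ℚₚ.∣-p∣≡∣p∣ (p - q))) (cong ∣_∣ (solve 2 (λ p q → :- (p :- q) := q :- p) refl p q))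

  ≃-sym : ∀ {x y} → x ≃ᴿ y → y ≃ᴿ x
  ≃-sym {x} {y} x≃y ε 0<ε with x≃y ε 0<ε
  ... | N , h = N , λ n N≤n → subst (_< ε) (∣-∣-comm (seq x n) (seq y n)) (h n N≤n)

  ∣+∣< : ∀ {p r ε} → ∣ p ∣ < ε * ½ → ∣ r ∣ < ε * ½ → ∣ p + r ∣ < ε
  ∣+∣< {p} {r} {ε} p< r< = ℚₚ.≤-<-trans (ℚₚ.∣p+q∣≤∣p∣+∣q∣ p r)
    (subst (∣ p ∣ + ∣ r ∣ <_) (half+half ε) (ℚₚ.+-mono-< p< r<))

  ≃-trans : ∀ {x y z} → x ≃ᴿ y → y ≃ᴿ z → x ≃ᴿ z
  ≃-trans {x} {y} {z} x≃y y≃z ε 0<ε with x≃y (ε * ½) (0<½* 0<ε) | y≃z (ε * ½) (0<½* 0<ε)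
  ... | M , hx | N , hy = M ℕ.⊔ N , λ n n≥ → subst (λ p → ∣ p ∣ < ε)
    (solve 3 (λ x y z → (x :- y) :+ (y :- z) := x :- z) refl (seq x n) (seq y n) (seq z n))
    (∣+∣< {seq x n - seq y n} (hx n (ℕₚ.m⊔n≤o⇒m≤o M N n≥)) (hy n (ℕₚ.m⊔n≤o⇒n≤o M N n≥)))

  +ᴿ-cong : ∀ {x x′ y y′} → x ≃ᴿ x′ → y ≃ᴿ y′ → (x +ᴿ y) ≃ᴿ (x′ +ᴿ y′)
  +ᴿ-cong {x} {x′} {y} {y′} eqx eqy ε 0<ε with eqx (ε * ½) (0<½* 0<ε) | eqy (ε * ½) (0<½* 0<ε)
  ... | M , hx | N , hy = M ℕ.⊔ N , λ n n≥ → subst (λ p → ∣ p ∣ < ε)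
    (solve 4 (λ x x′ y y′ → (x :- x′) :+ (y :- y′) := (x :+ y) :- (x′ :+ y′)) refl (seq x n) (seq x′ n) (seq y n) (seq y′ n))
    (∣+∣< {seq x n - seq x′ n} (hx n (ℕₚ.m⊔n≤o⇒m≤o M N n≥)) (hy n (ℕₚ.m⊔n≤o⇒n≤o M N n≥)))

  -ᴿ-cong : ∀ {x y} → x ≃ᴿ y → (-ᴿ x) ≃ᴿ (-ᴿ y)
  -ᴿ-cong {x} {y} eq ε 0<ε with eq ε 0<ε
  ... | N , h = N , λ n N≤n → subst (_< ε)
    (trans (∣-∣-comm (seq x n) (seq y n)) (cong ∣_∣ (solve 2 (λ x y → y :- x := :- x :- (:- y)) refl (seq x n) (seq y n)))) (h n N≤n)

  eventually-bounded : ∀ x → ∃[ N ] ∃[ B ] (0ℚ < B × (∀ n → N ℕ.≤ n → ∣ seq x n ∣ ≤ B))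
  eventually-bounded x with cauchy x 1ℚ (ℚₚ.positive⁻¹ 1ℚ)
  ... | N , h = N , 1ℚ + c , positive , bounded
    where
    c = ∣ seq x N ∣
    0≤c : 0ℚ ≤ c
    0≤c = ℚₚ.nonNegative⁻¹ c {{ℚₚ.∣-∣-nonNeg (seq x N)}}
    positive : 0ℚ < 1ℚ + c
    positive = ℚₚ.+-mono-<-≤ {0ℚ} {1ℚ} {0ℚ} {c} (ℚₚ.positive⁻¹ 1ℚ) 0≤c
    bounded : ∀ n → N ℕ.≤ n → ∣ seq x n ∣ ≤ 1ℚ + c
    bounded n N≤n = subst (λ p → ∣ p ∣ ≤ 1ℚ + c) (solve 2 (λ a b → (a :- b) :+ b := a) refl (seq x n) (seq x N))
      (ℚₚ.≤-trans (ℚₚ.∣p+q∣≤∣p∣+∣q∣ (seq x n - seq x N) (seq x N))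
        (ℚₚ.+-monoˡ-≤ c (ℚₚ.<⇒≤ (h n N N≤n ℕₚ.≤-refl))))

  shrink : ∀ {B ε} → 0ℚ < B → 0ℚ < ε → ∃[ δ ] (0ℚ < δ × δ * B ≡ ε)
  shrink {B} {ε} 0<B 0<ε = ε * 1/B ,
    ℚₚ.positive⁻¹ (ε * 1/B) {{ℚₚ.pos*pos⇒pos ε {{Rat.positive 0<ε}} 1/B {{ℚₚ.1/pos⇒pos B {{Rat.positive 0<B}}}}}} ,
    trans (ℚₚ.*-assoc ε 1/B B)
      (trans (cong (ε *_) (ℚₚ.*-inverseˡ B {{Rat.>-nonZero 0<B}})) (ℚₚ.*-identityʳ ε))
    where 1/B = (Rat.1/ B) {{Rat.>-nonZero 0<B}}

  null-*-bounded : ∀ (u v : ℕ → ℚ) → (∀ ε → 0ℚ < ε → ∃[ N ] (∀ n → N ℕ.≤ n → ∣ u n ∣ < ε)) →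
    (∃[ N ] ∃[ B ] (0ℚ < B × (∀ n → N ℕ.≤ n → ∣ v n ∣ ≤ B))) →
    ∀ ε → 0ℚ < ε → ∃[ N ] (∀ n → N ℕ.≤ n → ∣ u n * v n ∣ < ε)
  null-*-bounded u v null (M , B , 0<B , bounded) ε 0<ε with shrink 0<B 0<ε
  ... | δ , 0<δ , δB≡ε with null δ 0<δ
  ...   | N , h = M ℕ.⊔ N , λ n n≥ → ℚₚ.≤-<-trans
    (subst (_≤ ∣ u n ∣ * B) (sym (ℚₚ.∣p*q∣≡∣p∣*∣q∣ (u n) (v n)))
      (ℚₚ.*-monoˡ-≤-nonNeg ∣ u n ∣ {{ℚₚ.∣-∣-nonNeg (u n)}} (bounded n (ℕₚ.m⊔n≤o⇒m≤o M N n≥))))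
    (subst (∣ u n ∣ * B <_) δB≡ε (ℚₚ.*-monoˡ-<-pos B {{Rat.positive 0<B}} (h n (ℕₚ.m⊔n≤o⇒n≤o M N n≥))))

  ∣-∣-transport : ∀ {p r ε} → p ≡ r → ∣ p ∣ < ε → ∣ r ∣ < ε
  ∣-∣-transport refl p< = p<

  *-distribʳ-minus : ∀ a b c → (a - b) * c ≡ a * c - b * c
  *-distribʳ-minus = solve 3 (λ a b c → (a :- b) :* c := a :* c :- b :* c) refl

  -- x y - x′ y is a null sequence times a Cauchy sequence, and the latter is eventually bounded.
  *ᴿ-congʳ : ∀ {x x′ y} → x ≃ᴿ x′ → (x *ᴿ y) ≃ᴿ (x′ *ᴿ y)
  *ᴿ-congʳ {x} {x′} {y} eq ε 0<ε =
    let N , h = null-*-bounded (λ n → seq x n - seq x′ n) (seq y) eq (eventually-bounded y) ε 0<ε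
    in N , λ n N≤n → ∣-∣-transport {(seq x n - seq x′ n) * seq y n} {seq x n * seq y n - seq x′ n * seq y n} {ε}
      (*-distribʳ-minus (seq x n) (seq x′ n) (seq y n)) (h n N≤n)

  *ᴿ-comm : ∀ x y → (x *ᴿ y) ≃ᴿ (y *ᴿ x)
  *ᴿ-comm x y = ≃-pointwise {x *ᴿ y} {y *ᴿ x} (λ n → ℚₚ.*-comm (seq x n) (seq y n))

  *ᴿ-cong : ∀ {x x′ y y′} → x ≃ᴿ x′ → y ≃ᴿ y′ → (x *ᴿ y) ≃ᴿ (x′ *ᴿ y′)
  *ᴿ-cong {x} {x′} {y} {y′} eqx eqy = ≃-trans {x *ᴿ y} {x′ *ᴿ y} {x′ *ᴿ y′} (*ᴿ-congʳ {x} {x′} {y} eqx)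
    (≃-trans {x′ *ᴿ y} {y *ᴿ x′} {x′ *ᴿ y′} (*ᴿ-comm x′ y)
      (≃-trans {y *ᴿ x′} {y′ *ᴿ x′} {x′ *ᴿ y′} (*ᴿ-congʳ {y} {y′} {x′} eqy) (*ᴿ-comm y′ x′)))

  -- The operations act on sequences termwise, so every ring law reduces to the same identity in ℚ;
  -- estimates are needed only for the compatibility of the operations with equality.
  ≈ᶜ-pointwise : ∀ {z w} → (∀ n → seq (re z) n ≡ seq (re w) n) → (∀ n → seq (im z) n ≡ seq (im w) n) → z ≈ᶜ w
  ≈ᶜ-pointwise {z} {w} eqr eqi = ≃-pointwise {re z} {re w} eqr , ≃-pointwise {im z} {im w} eqi

  ℂ-commutativeRing : CommutativeRing 0ℓ 0ℓ
  ℂ-commutativeRing = record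
    { Carrier = ℂ ; _≈_ = _≈ᶜ_ ; _+_ = _+ᶜ_ ; _*_ = _*ᶜ_ ; -_ = -ᶜ_ ; 0# = 0ᶜ ; 1# = 1ᶜ
    ; isCommutativeRing = record
      { isRing = record
        { +-isAbelianGroup = record
          { isGroup = record
            { isMonoid = record
              { isSemigroup = record
                { isMagma = record
                  { isEquivalence = record
                    { refl  = λ {z} → ≃-refl {re z} , ≃-refl {im z}
                    ; sym   = λ {z} {w} (r , i) → ≃-sym {re z} {re w} r , ≃-sym {im z} {im w} i
                    ; trans = λ {z} {w} {v} (r , i) (r′ , i′) → ≃-trans {re z} {re w} {re v} r r′ , ≃-trans {im z} {im w} {im v} i i′
                    }
                  ; ∙-cong = λ {z} {z′} {w} {w′} (r , i) (r′ , i′) →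
                      +ᴿ-cong {re z} {re z′} {re w} {re w′} r r′ , +ᴿ-cong {im z} {im z′} {im w} {im w′} i i′
                  }
                ; assoc = λ z w v → ≈ᶜ-pointwise {(z +ᶜ w) +ᶜ v} {z +ᶜ (w +ᶜ v)}
                    (λ n → ℚₚ.+-assoc (seq (re z) n) (seq (re w) n) (seq (re v) n))
                    (λ n → ℚₚ.+-assoc (seq (im z) n) (seq (im w) n) (seq (im v) n))
                }
              ; identity = (λ z → ≈ᶜ-pointwise {0ᶜ +ᶜ z} {z} (λ n → ℚₚ.+-identityˡ _) (λ n → ℚₚ.+-identityˡ _)) ,
                           (λ z → ≈ᶜ-pointwise {z +ᶜ 0ᶜ} {z} (λ n → ℚₚ.+-identityʳ _) (λ n → ℚₚ.+-identityʳ _))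
              }
            ; inverse = (λ z → ≈ᶜ-pointwise {(-ᶜ z) +ᶜ z} {0ᶜ} (λ n → ℚₚ.+-inverseˡ (seq (re z) n)) (λ n → ℚₚ.+-inverseˡ (seq (im z) n))) ,
                        (λ z → ≈ᶜ-pointwise {z +ᶜ (-ᶜ z)} {0ᶜ} (λ n → ℚₚ.+-inverseʳ (seq (re z) n)) (λ n → ℚₚ.+-inverseʳ (seq (im z) n)))
            ; ⁻¹-cong = λ {z} {w} (r , i) → -ᴿ-cong {re z} {re w} r , -ᴿ-cong {im z} {im w} i
            }
          ; comm = λ z w → ≈ᶜ-pointwise {z +ᶜ w} {w +ᶜ z} (λ n → ℚₚ.+-comm (seq (re z) n) _) (λ n → ℚₚ.+-comm (seq (im z) n) _)
          }
        ; *-cong = λ {z} {z′} {w} {w′} (r , i) (r′ , i′) →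
            +ᴿ-cong {re z *ᴿ re w} {re z′ *ᴿ re w′} { -ᴿ (im z *ᴿ im w)} { -ᴿ (im z′ *ᴿ im w′)}
              (*ᴿ-cong {re z} {re z′} {re w} {re w′} r r′)
              (-ᴿ-cong {im z *ᴿ im w} {im z′ *ᴿ im w′} (*ᴿ-cong {im z} {im z′} {im w} {im w′} i i′)) ,
            +ᴿ-cong {re z *ᴿ im w} {re z′ *ᴿ im w′} {im z *ᴿ re w} {im z′ *ᴿ re w′}
              (*ᴿ-cong {re z} {re z′} {im w} {im w′} r i′) (*ᴿ-cong {im z} {im z′} {re w} {re w′} i r′)
        ; *-assoc = λ z w v → ≈ᶜ-pointwise {(z *ᶜ w) *ᶜ v} {z *ᶜ (w *ᶜ v)}
            (λ n → solve 6 (λ a b c d e f → (a :* c :+ :- (b :* d)) :* e :+ :- ((a :* d :+ b :* c) :* f)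
               := a :* (c :* e :+ :- (d :* f)) :+ :- (b :* (c :* f :+ d :* e))) refl
               (seq (re z) n) (seq (im z) n) (seq (re w) n) (seq (im w) n) (seq (re v) n) (seq (im v) n))
            (λ n → solve 6 (λ a b c d e f → (a :* c :+ :- (b :* d)) :* f :+ (a :* d :+ b :* c) :* e
               := a :* (c :* f :+ d :* e) :+ b :* (c :* e :+ :- (d :* f))) refl
               (seq (re z) n) (seq (im z) n) (seq (re w) n) (seq (im w) n) (seq (re v) n) (seq (im v) n))
        ; *-identity =
            (λ z → ≈ᶜ-pointwise {1ᶜ *ᶜ z} {z}
              (λ n → solve 2 (λ a b → con 1ℚ :* a :+ :- (con 0ℚ :* b) := a) refl (seq (re z) n) (seq (im z) n))
              (λ n → solve 2 (λ a b → con 1ℚ :* b :+ con 0ℚ :* a := b) refl (seq (re z) n) (seq (im z) n))) ,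
            (λ z → ≈ᶜ-pointwise {z *ᶜ 1ᶜ} {z}
              (λ n → solve 2 (λ a b → a :* con 1ℚ :+ :- (b :* con 0ℚ) := a) refl (seq (re z) n) (seq (im z) n))
              (λ n → solve 2 (λ a b → a :* con 0ℚ :+ b :* con 1ℚ := b) refl (seq (re z) n) (seq (im z) n)))
        ; distrib =
            (λ z w v → ≈ᶜ-pointwise {z *ᶜ (w +ᶜ v)} {(z *ᶜ w) +ᶜ (z *ᶜ v)}
              (λ n → solve 6 (λ a b c d e f → a :* (c :+ e) :+ :- (b :* (d :+ f)) := (a :* c :+ :- (b :* d)) :+ (a :* e :+ :- (b :* f))) refl
                (seq (re z) n) (seq (im z) n) (seq (re w) n) (seq (im w) n) (seq (re v) n) (seq (im v) n))
              (λ n → solve 6 (λ a b c d e f → a :* (d :+ f) :+ b :* (c :+ e) := (a :* d :+ b :* c) :+ (a :* f :+ b :* e)) refl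
                (seq (re z) n) (seq (im z) n) (seq (re w) n) (seq (im w) n) (seq (re v) n) (seq (im v) n))) ,
            (λ v z w → ≈ᶜ-pointwise {(z +ᶜ w) *ᶜ v} {(z *ᶜ v) +ᶜ (w *ᶜ v)}
              (λ n → solve 6 (λ a b c d e f → (a :+ c) :* e :+ :- ((b :+ d) :* f) := (a :* e :+ :- (b :* f)) :+ (c :* e :+ :- (d :* f))) refl
                (seq (re z) n) (seq (im z) n) (seq (re w) n) (seq (im w) n) (seq (re v) n) (seq (im v) n))
              (λ n → solve 6 (λ a b c d e f → (a :+ c) :* f :+ (b :+ d) :* e := (a :* f :+ b :* e) :+ (c :* f :+ d :* e)) refl
                (seq (re z) n) (seq (im z) n) (seq (re w) n) (seq (im w) n) (seq (re v) n) (seq (im v) n)))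
        }
      ; *-comm = λ z w → ≈ᶜ-pointwise {z *ᶜ w} {w *ᶜ z}
          (λ n → solve 4 (λ a b c d → a :* c :+ :- (b :* d) := c :* a :+ :- (d :* b)) refl (seq (re z) n) (seq (im z) n) (seq (re w) n) (seq (im w) n))
          (λ n → solve 4 (λ a b c d → a :* d :+ b :* c := c :* b :+ d :* a) refl (seq (re z) n) (seq (im z) n) (seq (re w) n) (seq (im w) n))
      }
    }

-- Polynomials as formal sums, and their evaluation

module PolynomialEvaluation where

  open import Defs using (module Polynomials)
  open import Algebra.Bundles using (CommutativeRing)
  open import Algebra.Bundles.Raw using (RawRing)
  open import Algebra.Structures using (IsCommutativeRing)
  open import Data.List.Base as List using (List; []; _∷_; _++_; length)
  open import Data.List.Membership.Propositional using (_∈_)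
  open import Data.List.Membership.Propositional.Properties using (∈-map⁺)
  open import Data.List.Relation.Unary.Any using (here; there)
  open import Data.Nat.Base as ℕ using (ℕ; zero; suc)
  import Data.Nat.Properties as ℕₚ
  open import Data.Vec.Base as Vec using (Vec; []; _∷_; lookup; replicate; zipWith; updateAt; _[_]≔_)
  open import Data.Vec.Properties using (≡-dec; zipWith-assoc; zipWith-comm; zipWith-identityˡ)
  open import Level using (0ℓ)
  open import Relation.Binary.PropositionalEquality as ≡ using (_≡_)
  open import Relation.Nullary using (yes; no; contradiction)
  import Algebra.Properties.Ring as RingProperties

  -- The ring is given by its operations and laws separately, so that the polynomials are
  -- literally those over the given operations.
  module Theory (raw : RawRing 0ℓ 0ℓ) (isCommutativeRing : IsCommutativeRing
      (RawRing._≈_ raw) (RawRing._+_ raw) (RawRing._*_ raw) (RawRing.-_ raw) (RawRing.0# raw) (RawRing.1# raw)) where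
    coefficients : CommutativeRing 0ℓ 0ℓ
    coefficients = record { isCommutativeRing = isCommutativeRing }
    open CommutativeRing coefficients hiding (isCommutativeRing)
    open Polynomials raw
    open RingProperties ring using (-‿distribˡ-*; -‿+-comm; -0#≈0#)
    open import Relation.Binary.Reasoning.Setoid setoid
    open import Algebra.Solver.Ring.NaturalCoefficients.Default commutativeSemiring
      using (solve; _:+_; _:*_; _:=_; con)

    infixl 6 _∔_
    _∔_ : ∀ {n} → Monomial n → Monomial n → Monomial n
    _∔_ = zipWith ℕ._+_

    -- The linear functional on formal sums that sends a monomial α to φ α. Evaluation at a point
    -- and extraction of a coefficient are both instances.
    pair : ∀ {n} → Poly n → (Monomial n → Carrier) → Carrier
    pair f φ = List.foldr (λ (a , α) r → a * φ α + r) 0# f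

    -- Two formal sums are identified if every linear functional agrees on them.
    infix 4 _≋_
    _≋_ : ∀ {n} → Poly n → Poly n → Set
    f ≋ g = ∀ φ → pair f φ ≈ pair g φ

    pair-cong : ∀ {n} (f : Poly n) {φ ψ} → (∀ α → φ α ≈ ψ α) → pair f φ ≈ pair f ψ
    pair-cong []            eq = refl
    pair-cong ((a , α) ∷ f) eq = +-cong (*-congˡ (eq α)) (pair-cong f eq)

    pair-++ : ∀ {n} (f g : Poly n) φ → pair (f ++ g) φ ≈ pair f φ + pair g φ
    pair-++ []            g φ = sym (+-identityˡ _)
    pair-++ ((a , α) ∷ f) g φ = trans (+-congˡ (pair-++ f g φ)) (sym (+-assoc _ _ _))

    pair-scale : ∀ {n} a α (g : Poly n) φ →
      pair (List.map (λ (b , β) → a * b , α ∔ β) g) φ ≈ a * pair g (λ β → φ (α ∔ β))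
    pair-scale a α []            φ = sym (zeroʳ a)
    pair-scale a α ((b , β) ∷ g) φ = trans (+-cong (*-assoc a b _) (pair-scale a α g φ)) (sym (distribˡ a _ _))

    pair-* : ∀ {n} (f g : Poly n) φ → pair (f *ₚ g) φ ≈ pair f (λ α → pair g (λ β → φ (α ∔ β)))
    pair-* []            g φ = refl
    pair-* ((a , α) ∷ f) g φ = trans (pair-++ (List.map (λ (b , β) → a * b , α ∔ β) g) (f *ₚ g) φ)
      (+-cong (pair-scale a α g φ) (pair-* f g φ))

    pair-zero : ∀ {n} (f : Poly n) → pair f (λ _ → 0#) ≈ 0#
    pair-zero []            = refl
    pair-zero ((a , α) ∷ f) = trans (+-cong (zeroʳ a) (pair-zero f)) (+-identityˡ 0#)

    pair-+ : ∀ {n} (f : Poly n) φ ψ → pair f (λ α → φ α + ψ α) ≈ pair f φ + pair f ψ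
    pair-+ []            φ ψ = sym (+-identityˡ 0#)
    pair-+ ((a , α) ∷ f) φ ψ = trans (+-congˡ (pair-+ f φ ψ))
      (solve 5 (λ a x y u v → a :* (x :+ y) :+ (u :+ v) := (a :* x :+ u) :+ (a :* y :+ v)) refl a (φ α) (ψ α) (pair f φ) (pair f ψ))

    pair-*ˡ : ∀ {n} (f : Poly n) c φ → pair f (λ α → c * φ α) ≈ c * pair f φ
    pair-*ˡ []            c φ = sym (zeroʳ c)
    pair-*ˡ ((a , α) ∷ f) c φ = trans (+-congˡ (pair-*ˡ f c φ))
      (solve 4 (λ a c x u → a :* (c :* x) :+ c :* u := c :* (a :* x :+ u)) refl a c (φ α) (pair f φ))

    pair-swap : ∀ {n} (f g : Poly n) (φ : Monomial n → Monomial n → Carrier) →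
      pair f (λ α → pair g (φ α)) ≈ pair g (λ β → pair f (λ α → φ α β))
    pair-swap []            g φ = sym (pair-zero g)
    pair-swap ((a , α) ∷ f) g φ = trans (+-cong (sym (pair-*ˡ g a (φ α))) (pair-swap f g φ))
      (sym (pair-+ g (λ β → a * φ α β) (λ β → pair f (λ α → φ α β))))

    negₚ : ∀ {n} → Poly n → Poly n
    negₚ = List.map (λ (a , α) → - a , α)

    pair-neg : ∀ {n} (f : Poly n) φ → pair (negₚ f) φ ≈ - pair f φ
    pair-neg []            φ = sym -0#≈0#
    pair-neg ((a , α) ∷ f) φ = trans (+-cong (sym (-‿distribˡ-* a (φ α))) (pair-neg f φ)) (-‿+-comm (a * φ α) (pair f φ))

    -- With equality tested by functionals a product is a nested `pair`, so the ring laws come from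
    -- adding exponents and interchanging finite sums; like terms are never collected.
    polynomialRing : ℕ → CommutativeRing 0ℓ 0ℓ
    polynomialRing n = record
      { Carrier = Poly n ; _≈_ = _≋_ ; _+_ = _+ₚ_ ; _*_ = _*ₚ_ ; -_ = negₚ ; 0# = [] ; 1# = constₚ 1#
      ; isCommutativeRing = record
        { isRing = record
          { +-isAbelianGroup = record
            { isGroup = record
              { isMonoid = record
                { isSemigroup = record
                  { isMagma = record
                    { isEquivalence = record
                      { refl = λ φ → refl ; sym = λ eq φ → sym (eq φ) ; trans = λ eq eq′ φ → trans (eq φ) (eq′ φ) }
                    ; ∙-cong = λ {f} {f′} {g} {g′} eq eq′ φ →
                        trans (pair-++ f g φ) (trans (+-cong (eq φ) (eq′ φ)) (sym (pair-++ f′ g′ φ)))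
                    }
                  ; assoc = λ f g h φ → trans (trans (pair-++ (f ++ g) h φ) (+-congʳ (pair-++ f g φ)))
                      (trans (+-assoc _ _ _) (sym (trans (pair-++ f (g ++ h) φ) (+-congˡ (pair-++ g h φ)))))
                  }
                ; identity = (λ f φ → refl) , (λ f φ → trans (pair-++ f [] φ) (+-identityʳ _))
                }
              ; inverse = (λ f φ → trans (pair-++ (negₚ f) f φ) (trans (+-congʳ (pair-neg f φ)) (-‿inverseˡ _))) ,
                          (λ f φ → trans (pair-++ f (negₚ f) φ) (trans (+-congˡ (pair-neg f φ)) (-‿inverseʳ _)))
              ; ⁻¹-cong = λ {f} {g} eq φ → trans (pair-neg f φ) (trans (-‿cong (eq φ)) (sym (pair-neg g φ)))
              }
            ; comm = +ₚ-comm
            }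
          ; *-cong = λ {f} {f′} {g} {g′} eq eq′ φ → trans (pair-* f g φ)
              (trans (eq _) (trans (pair-cong f′ (λ α → eq′ _)) (sym (pair-* f′ g′ φ))))
          ; *-assoc = λ f g h φ → trans (pair-* (f *ₚ g) h φ) (trans (pair-* f g _)
              (trans (pair-cong f (λ α → trans
                (pair-cong g (λ β → pair-cong h (λ γ → reflexive (≡.cong φ (zipWith-assoc ℕₚ.+-assoc α β γ)))))
                (sym (pair-* g h (λ β → φ (α ∔ β))))))
              (sym (pair-* f (g *ₚ h) φ))))
          ; *-identity = *ₚ-identityˡ , (λ f φ → trans (*ₚ-comm f (constₚ 1#) φ) (*ₚ-identityˡ f φ))
          ; distrib = *ₚ-distribˡ , (λ f g h φ → trans (*ₚ-comm (g +ₚ h) f φ) (trans (*ₚ-distribˡ f g h φ)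
              (trans (pair-++ (f *ₚ g) (f *ₚ h) φ)
              (trans (+-cong (*ₚ-comm f g φ) (*ₚ-comm f h φ)) (sym (pair-++ (g *ₚ f) (h *ₚ f) φ))))))
          }
        ; *-comm = *ₚ-comm
        }
      }
      where
      +ₚ-comm : ∀ (f g : Poly n) → (f +ₚ g) ≋ (g +ₚ f)
      +ₚ-comm f g φ = trans (pair-++ f g φ) (trans (+-comm _ _) (sym (pair-++ g f φ)))
      *ₚ-comm : ∀ (f g : Poly n) → (f *ₚ g) ≋ (g *ₚ f)
      *ₚ-comm f g φ = trans (pair-* f g φ) (trans (pair-swap f g (λ α β → φ (α ∔ β)))
        (trans (pair-cong g (λ β → pair-cong f (λ α → reflexive (≡.cong φ (zipWith-comm ℕₚ.+-comm α β)))))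
          (sym (pair-* g f φ))))
      *ₚ-identityˡ : ∀ (f : Poly n) → (constₚ 1# *ₚ f) ≋ f
      *ₚ-identityˡ f φ = trans (pair-* (constₚ 1#) f φ) (trans (+-identityʳ _) (trans (*-identityˡ _)
        (pair-cong f (λ α → reflexive (≡.cong φ (zipWith-identityˡ ℕₚ.+-identityˡ α))))))
      *ₚ-distribˡ : ∀ (f g h : Poly n) → (f *ₚ (g +ₚ h)) ≋ (f *ₚ g +ₚ f *ₚ h)
      *ₚ-distribˡ f g h φ = trans (pair-* f (g +ₚ h) φ) (trans (pair-cong f (λ α → pair-++ g h _))
        (trans (pair-+ f _ _) (sym (trans (pair-++ (f *ₚ g) (f *ₚ h) φ) (+-cong (pair-* f g φ) (pair-* f h φ))))))

    delta : ∀ {n} → Monomial n → Monomial n → Carrier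
    delta α β with ≡-dec ℕₚ._≟_ β α
    ... | yes _ = 1#
    ... | no  _ = 0#

    coeff-pair : ∀ {n} (f : Poly n) α → coeff f α ≈ pair f (delta α)
    coeff-pair []            α = refl
    coeff-pair ((a , β) ∷ f) α with ≡-dec ℕₚ._≟_ β α
    ... | yes _ = +-cong (sym (*-identityʳ a)) (coeff-pair f α)
    ... | no  _ = trans (coeff-pair f α) (sym (trans (+-congʳ (zeroʳ a)) (+-identityˡ _)))

    ≋⇒≈ₚ : ∀ {n} (f g : Poly n) → f ≋ g → f ≈ₚ g
    ≋⇒≈ₚ f g eq α = trans (coeff-pair f α) (trans (eq (delta α)) (sym (coeff-pair g α)))

    remove : ∀ {n} → Monomial n → Poly n → Poly n
    remove α []            = []
    remove α ((a , β) ∷ f) with ≡-dec ℕₚ._≟_ β α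
    ... | yes _ = remove α f
    ... | no  _ = (a , β) ∷ remove α f

    length-remove : ∀ {n} α (f : Poly n) → length (remove α f) ℕ.≤ length f
    length-remove α []            = ℕ.z≤n
    length-remove α ((a , β) ∷ f) with ≡-dec ℕₚ._≟_ β α
    ... | yes _ = ℕₚ.m≤n⇒m≤1+n (length-remove α f)
    ... | no  _ = ℕ.s≤s (length-remove α f)

    pair-remove : ∀ {n} α (f : Poly n) φ → pair f φ ≈ coeff f α * φ α + pair (remove α f) φ
    pair-remove α []            φ = sym (trans (+-congʳ (zeroˡ (φ α))) (+-identityˡ 0#))
    pair-remove α ((a , β) ∷ f) φ with ≡-dec ℕₚ._≟_ β α
    ... | yes ≡.refl = trans (+-congˡ (pair-remove α f φ))
      (solve 4 (λ a c x r → a :* x :+ (c :* x :+ r) := (a :+ c) :* x :+ r) refl a (coeff f α) (φ α) (pair (remove α f) φ))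
    ... | no  _ = trans (+-congˡ (pair-remove α f φ))
      (solve 3 (λ a c r → a :+ (c :+ r) := c :+ (a :+ r)) refl (a * φ β) (coeff f α * φ α) (pair (remove α f) φ))

    coeff-remove : ∀ {n} α (f : Poly n) γ → coeff f γ ≈ 0# → coeff (remove α f) γ ≈ 0#
    coeff-remove α f γ eq with ≡-dec ℕₚ._≟_ γ α
    ... | yes ≡.refl = removed f
      where
      removed : ∀ f → coeff (remove γ f) γ ≈ 0#
      removed []            = refl
      removed ((a , β) ∷ f) with ≡-dec ℕₚ._≟_ β γ in e
      ... | yes _ = removed f
      ... | no  _ rewrite e = removed f
    ... | no γ≢α = trans (kept f) eq
      where
      kept : ∀ f → coeff (remove α f) γ ≈ coeff f γ
      kept []            = refl
      kept ((a , β) ∷ f) with ≡-dec ℕₚ._≟_ β α | ≡-dec ℕₚ._≟_ β γ in e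
      ... | yes ≡.refl | yes ≡.refl = contradiction ≡.refl γ≢α
      ... | yes _      | no  _ = kept f
      ... | no  _      | yes _ rewrite e = +-congˡ (kept f)
      ... | no  _      | no  _ rewrite e = kept f

    -- All terms with the first monomial together contribute its coefficient, which is 0, times a
    -- value of φ, and are removed at once. Removal may also delete later terms, so the induction is
    -- on a bound k for the length.
    coeffs-zero⇒pair-zero : ∀ k {n} (f : Poly n) → length f ℕ.≤ k → (∀ α → coeff f α ≈ 0#) → ∀ φ → pair f φ ≈ 0#
    coeffs-zero⇒pair-zero k       []            le eq φ = refl
    coeffs-zero⇒pair-zero (suc k) ((a , α) ∷ f) le eq φ =
      trans (pair-remove α ((a , α) ∷ f) φ) (trans (+-cong (trans (*-congʳ (eq α)) (zeroˡ _))
        (coeffs-zero⇒pair-zero k (remove α ((a , α) ∷ f)) (shorter (ℕ.s≤s⁻¹ le))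
          (λ γ → coeff-remove α ((a , α) ∷ f) γ (eq γ)) φ)) (+-identityˡ 0#))
      where
      shorter : length f ℕ.≤ k → length (remove α ((a , α) ∷ f)) ℕ.≤ k
      shorter le with ≡-dec ℕₚ._≟_ α α
      ... | yes _  = ℕₚ.≤-trans (length-remove α f) le
      ... | no α≢α = contradiction ≡.refl α≢α

    coeff-++ : ∀ {n} (f g : Poly n) α → coeff (f ++ g) α ≈ coeff f α + coeff g α
    coeff-++ f g α = trans (coeff-pair (f ++ g) α) (trans (pair-++ f g (delta α))
      (sym (+-cong (coeff-pair f α) (coeff-pair g α))))

    ≈ₚ⇒≋ : ∀ {n} (f g : Poly n) → f ≈ₚ g → f ≋ g
    ≈ₚ⇒≋ f g eq φ = begin
      pair f φ                           ≈⟨ trans (+-congˡ (-‿inverseˡ (pair g φ))) (+-identityʳ (pair f φ)) ⟨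
      pair f φ + (- pair g φ + pair g φ) ≈⟨ +-assoc _ _ _ ⟨
      pair f φ + - pair g φ + pair g φ   ≈⟨ +-congʳ (trans (pair-++ f (negₚ g) φ) (+-congˡ (pair-neg g φ))) ⟨
      pair (f ++ negₚ g) φ + pair g φ    ≈⟨ +-congʳ (coeffs-zero⇒pair-zero _ (f ++ negₚ g) ℕₚ.≤-refl difference φ) ⟩
      0# + pair g φ                      ≈⟨ +-identityˡ _ ⟩
      pair g φ                           ∎
      where
      difference : ∀ α → coeff (f ++ negₚ g) α ≈ 0#
      difference α = trans (coeff-++ f (negₚ g) α) (trans (+-cong (eq α)
        (trans (coeff-pair (negₚ g) α) (trans (pair-neg g (delta α)) (-‿cong (sym (coeff-pair g α)))))) (-‿inverseʳ (coeff g α)))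

    power-+ : ∀ a d e → power a (d ℕ.+ e) ≈ power a d * power a e
    power-+ a zero    e = sym (*-identityˡ _)
    power-+ a (suc d) e = trans (*-congˡ (power-+ a d e)) (sym (*-assoc a _ _))

    evalMonomial-∔ : ∀ {n} (α β : Monomial n) v → evalMonomial (α ∔ β) v ≈ evalMonomial α v * evalMonomial β v
    evalMonomial-∔ []      []      []      = sym (*-identityˡ 1#)
    evalMonomial-∔ (d ∷ α) (e ∷ β) (a ∷ v) = trans (*-cong (power-+ a d e) (evalMonomial-∔ α β v))
      (solve 4 (λ x y u w → (x :* y) :* (u :* w) := (x :* u) :* (y :* w)) refl
        (power a d) (power a e) (evalMonomial α v) (evalMonomial β v))

    eval-+ : ∀ {n} (f g : Poly n) v → eval (f +ₚ g) v ≈ eval f v + eval g v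
    eval-+ f g v = pair-++ f g (λ α → evalMonomial α v)

    eval-* : ∀ {n} (f g : Poly n) v → eval (f *ₚ g) v ≈ eval f v * eval g v
    eval-* f g v = begin
      pair (f *ₚ g) ev                     ≈⟨ pair-* f g ev ⟩
      pair f (λ α → pair g (λ β → ev (α ∔ β)))
        ≈⟨ pair-cong f (λ α → trans (pair-cong g (λ β → evalMonomial-∔ α β v)) (trans (pair-*ˡ g (ev α) ev) (*-comm (ev α) (pair g ev)))) ⟩
      pair f (λ α → pair g ev * ev α)      ≈⟨ pair-*ˡ f (pair g ev) ev ⟩
      pair g ev * pair f ev                ≈⟨ *-comm _ _ ⟩
      pair f ev * pair g ev                ∎
      where
      ev : Monomial _ → Carrier
      ev α = evalMonomial α v

    evalMonomial-0 : ∀ {n} (v : Vec Carrier n) → evalMonomial (replicate n 0) v ≈ 1#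
    evalMonomial-0 []      = refl
    evalMonomial-0 (a ∷ v) = trans (*-identityˡ _) (evalMonomial-0 v)

    eval-const : ∀ {n} a (v : Vec Carrier n) → eval (constₚ a) v ≈ a
    eval-const a v = trans (+-identityʳ _) (trans (*-congˡ (evalMonomial-0 v)) (*-identityʳ a))

    evalMonomial-var : ∀ {n} (i : Fin n) (v : Vec Carrier n) → evalMonomial (replicate n 0 [ i ]≔ 1) v ≈ lookup v i
    evalMonomial-var zero    (a ∷ v) = trans (*-cong (*-identityʳ a) (evalMonomial-0 v)) (*-identityʳ a)
    evalMonomial-var (suc i) (a ∷ v) = trans (*-identityˡ _) (evalMonomial-var i v)

    eval-var : ∀ {n} (i : Fin n) (v : Vec Carrier n) → eval (varₚ i) v ≈ lookup v i
    eval-var i v = trans (+-identityʳ _) (trans (*-identityˡ _) (evalMonomial-var i v))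

    evalMonomial-updateAt : ∀ {n} (α : Monomial n) j e v →
      evalMonomial (updateAt α j (e ℕ.+_)) v ≈ power (lookup v j) e * evalMonomial α v
    evalMonomial-updateAt (d ∷ α) zero    e (a ∷ v) = trans (*-congʳ (power-+ a e d)) (*-assoc _ _ _)
    evalMonomial-updateAt (d ∷ α) (suc j) e (a ∷ v) = trans (*-congˡ (evalMonomial-updateAt α j e v))
      (solve 3 (λ x y z → x :* (y :* z) := y :* (x :* z)) refl (power a d) (power (lookup v j) e) (evalMonomial α v))

    evalMonomial-rename : ∀ {k n} (ρ : Vec (Fin n) k) α v →
      evalMonomial (renameMonomial ρ α) v ≈ evalMonomial α (Vec.map (lookup v) ρ)
    evalMonomial-rename []      []      v = evalMonomial-0 v
    evalMonomial-rename (j ∷ ρ) (e ∷ α) v = trans (evalMonomial-updateAt (renameMonomial ρ α) j e v)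
      (*-congˡ (evalMonomial-rename ρ α v))

    eval-rename : ∀ {k n} (ρ : Vec (Fin n) k) (f : Poly k) v → eval (rename ρ f) v ≈ eval f (Vec.map (lookup v) ρ)
    eval-rename ρ []            v = refl
    eval-rename ρ ((a , α) ∷ f) v = +-cong (*-congˡ (evalMonomial-rename ρ α v)) (eval-rename ρ f v)

    vanishing : ∀ {n g} {f : Poly n} {G : Poly n → Set g} → f ∈⟨ G ⟩ → ∀ v → (∀ {h} → G h → eval h v ≈ 0#) → eval f v ≈ 0#
    vanishing {f = f} {G} (hs , eq) v zeros =
      trans (≈ₚ⇒≋ f (sumₚ (List.map (λ (h , g , _) → h *ₚ g) hs)) eq (λ α → evalMonomial α v)) (go hs)
      where
      go : ∀ hs → eval (sumₚ (List.map (λ (h , g , _) → h *ₚ g) hs)) v ≈ 0#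
      go []                  = refl
      go ((h , g , Gg) ∷ hs) = trans (eval-+ (h *ₚ g) _ v)
        (trans (+-cong (trans (eval-* h g v) (trans (*-congˡ (zeros Gg)) (zeroʳ _))) (go hs)) (+-identityˡ 0#))

    eval-rename-at : ∀ {k n} (ρ : Vec (Fin n) k) (f : Poly k) v w → Vec.map (lookup v) ρ ≡ w → eval f w ≈ 0# → eval (rename ρ f) v ≈ 0#
    eval-rename-at ρ f v _ ≡.refl eq = trans (eval-rename ρ f v) eq

    eval-rename-unit : ∀ {k n} (ρ : Vec (Fin n) k) (f : Poly k) v w → Vec.map (lookup v) ρ ≡ w →
      (∃[ z ] eval f w * z ≈ 1#) → ∃[ z ] eval (rename ρ f) v * z ≈ 1#
    eval-rename-unit ρ f v _ ≡.refl (z , eq) = z , trans (*-congʳ (eval-rename ρ f v)) eq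

    eval-product : ∀ {n} v (fs : List (Poly n)) {f} → f ∈ fs → eval f v ≈ 0# → eval (productₚ fs) v ≈ 0#
    eval-product v (f ∷ fs) (here ≡.refl) eq = trans (eval-* f (productₚ fs) v) (trans (*-congʳ eq) (zeroˡ _))
    eval-product v (f ∷ fs) (there f∈)    eq = trans (eval-* f (productₚ fs) v) (trans (*-congˡ (eval-product v fs f∈ eq)) (zeroʳ _))

    eval-domain : ∀ {n} {B : Set} v (i : Fin n) (c : B → Carrier) {b} {bs : List B} → b ∈ bs → lookup v i ≡ c b →
      eval (productₚ (List.map (λ b → varₚ i +ₚ constₚ (- c b)) bs)) v ≈ 0#
    eval-domain v i c {b} b∈ eq = eval-product v _ (∈-map⁺ (λ b → varₚ i +ₚ constₚ (- c b)) b∈)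
      (trans (eval-+ (varₚ i) (constₚ (- c b)) v)
      (trans (+-cong (trans (eval-var i v) (reflexive eq)) (eval-const (- c b) v)) (-‿inverseʳ (c b))))

-- A constructive Nullstellensatz on finite grids

module VanishingIdeals where

  open import Defs using (module Polynomials)
  open PolynomialEvaluation
  open import Algebra.Bundles using (CommutativeRing)
  open import Algebra.Bundles.Raw using (RawRing)
  open import Algebra.Structures using (IsCommutativeRing)
  open import Data.List.Base as List using (List; []; _∷_; _++_; allFin)
  open import Data.List.Membership.Propositional using (_∈_)
  open import Data.List.Membership.Propositional.Properties using (∈-allFin)
  open import Data.List.Relation.Unary.Any using (here; there)
  open import Data.List.Relation.Unary.All as All using (All; []; _∷_)
  open import Data.List.Relation.Unary.AllPairs using (AllPairs; []; _∷_)
  open import Data.List.Relation.Unary.Unique.Propositional using (Unique)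
  open import Data.List.Relation.Unary.Unique.Propositional.Properties using (tabulate⁺)
  open import Data.Nat.Base as ℕ using (ℕ; zero; suc)
  import Data.Nat.Properties as ℕₚ
  open import Data.Sum.Base using (_⊎_; inj₁; inj₂)
  open import Data.Vec.Base as Vec using (Vec; []; _∷_; lookup; replicate; zipWith; _[_]≔_)
  open import Level using (0ℓ)
  open import Relation.Binary.PropositionalEquality as ≡ using (_≡_; _≢_)
  import Algebra.Properties.Ring as RingProperties

  module Ideals (A : CommutativeRing 0ℓ 0ℓ) where
    open CommutativeRing A
    open RingProperties ring using (-1*x≈-x)
    open import Relation.Binary.Reasoning.Setoid setoid
    open import Algebra.Solver.Ring.NaturalCoefficients.Default commutativeSemiring
      using (solve; _:+_; _:*_; _:=_; con)

    record Ideal : Set₁ where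
      field
        Mem    : Carrier → Set
        resp   : ∀ {x y} → x ≈ y → Mem x → Mem y
        zero∈  : Mem 0#
        add∈   : ∀ {x y} → Mem x → Mem y → Mem (x + y)
        mul∈   : ∀ x {y} → Mem y → Mem (x * y)
    open Ideal public

    adjoin : Ideal → Carrier → Ideal
    adjoin J g = record
      { Mem   = λ f → ∃[ h ] ∃[ j ] (Mem J j × f ≈ h * g + j)
      ; resp  = λ eq (h , j , j∈ , e) → h , j , j∈ , trans (sym eq) e
      ; zero∈ = 0# , 0# , zero∈ J , sym (trans (+-identityʳ _) (zeroˡ g))
      ; add∈  = λ (h , j , j∈ , e) (h′ , j′ , j′∈ , e′) → h + h′ , j + j′ , add∈ J j∈ j′∈ , trans (+-cong e e′)
          (solve 5 (λ h g j h′ j′ → (h :* g :+ j) :+ (h′ :* g :+ j′) := (h :+ h′) :* g :+ (j :+ j′)) refl h g j h′ j′)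
      ; mul∈  = λ x (h , j , j∈ , e) → x * h , x * j , mul∈ J x j∈ , trans (*-congˡ e)
          (solve 4 (λ x h g j → x :* (h :* g :+ j) := x :* h :* g :+ x :* j) refl x h g j)
      }

    ⊆-adjoin : ∀ J g {f} → Mem J f → Mem (adjoin J g) f
    ⊆-adjoin J g {f} f∈ = 0# , f , f∈ , sym (trans (+-congʳ (zeroˡ g)) (+-identityˡ f))

    ∈-adjoin : ∀ J g → Mem (adjoin J g) g
    ∈-adjoin J g = 1# , 0# , zero∈ J , sym (trans (+-identityʳ _) (*-identityˡ g))

    Comaximal : Carrier → Carrier → Set
    Comaximal g h = ∃[ u ] ∃[ v ] 1# ≈ u * g + v * h

    product : List Carrier → Carrier
    product = List.foldr _*_ 1#

    comaximal-product : ∀ g hs → All (Comaximal g) hs → Comaximal g (product hs)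
    comaximal-product g []       []                   = 0# , 1# , sym (trans (+-cong (zeroˡ g) (*-identityˡ 1#)) (+-identityˡ 1#))
    comaximal-product g (h ∷ hs) ((u , v , e) ∷ com) =
      let u′ , v′ , e′ = comaximal-product g hs com
          p = product hs
      in u * (u′ * g + v′ * p) + u′ * (v * h) , v * v′ , trans (sym (*-identityˡ 1#)) (trans (*-cong e e′)
        (solve 7 (λ g h p u v u′ v′ → (u :* g :+ v :* h) :* (u′ :* g :+ v′ :* p)
          := (u :* (u′ :* g :+ v′ :* p) :+ u′ :* (v :* h)) :* g :+ v :* v′ :* (h :* p)) refl g h p u v u′ v′))

    -- f = u g f + v h f. Writing the first f as a multiple of h and the second as a multiple of g,
    -- both up to J, makes each summand a multiple of g h up to J.
    adjoin-* : ∀ J f g h → Comaximal g h → Mem (adjoin J g) f → Mem (adjoin J h) f → Mem (adjoin J (g * h)) f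
    adjoin-* J f g h (u , v , e) (a , j , j∈ , ea) (b , k , k∈ , eb) =
      u * b + v * a , u * g * k + v * h * j , add∈ J (mul∈ J (u * g) k∈) (mul∈ J (v * h) j∈) , (begin
      f                                         ≈⟨ trans (sym (*-identityʳ f)) (*-congˡ e) ⟩
      f * (u * g + v * h)                       ≈⟨ solve 5 (λ f u g v h → f :* (u :* g :+ v :* h) := u :* g :* f :+ v :* h :* f) refl f u g v h ⟩
      u * g * f + v * h * f                     ≈⟨ +-cong (*-congˡ eb) (*-congˡ ea) ⟩
      u * g * (b * h + k) + v * h * (a * g + j)
        ≈⟨ solve 8 (λ u g v h a j b k → u :* g :* (b :* h :+ k) :+ v :* h :* (a :* g :+ j)
             := (u :* b :+ v :* a) :* (g :* h) :+ (u :* g :* k :+ v :* h :* j)) refl u g v h a j b k ⟩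
      (u * b + v * a) * (g * h) + (u * g * k + v * h * j) ∎)

    adjoin-product : ∀ {B : Set} J f (g : B → Carrier) bs → AllPairs (λ b b′ → Comaximal (g b) (g b′)) bs →
      (∀ b → Mem (adjoin J (g b)) f) → Mem (adjoin J (product (List.map g bs))) f
    adjoin-product J f g []       []          mem = f , 0# , zero∈ J , sym (trans (+-identityʳ _) (*-identityʳ f))
    adjoin-product J f g (b ∷ bs) (com ∷ coms) mem =
      adjoin-* J f (g b) (product (List.map g bs)) (comaximal-product (g b) (List.map g bs) (go com)) (mem b)
        (adjoin-product J f g bs coms mem)
      where
      go : ∀ {bs} → All (λ b′ → Comaximal (g b) (g b′)) bs → All (Comaximal (g b)) (List.map g bs)
      go []       = []
      go (c ∷ cs) = c ∷ go cs

    -- J contains the product already, so adjoining it adds nothing. This lets membership be tested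
    -- after setting one variable to each of its values.
    ∈-by-cases : ∀ {B : Set} J f (g : B → Carrier) bs → AllPairs (λ b b′ → Comaximal (g b) (g b′)) bs →
      Mem J (product (List.map g bs)) → (∀ b → Mem (adjoin J (g b)) f) → Mem J f
    ∈-by-cases J f g bs com prod∈ mem =
      let h , j , j∈ , e = adjoin-product J f g bs com mem
      in resp J (sym e) (add∈ J (mul∈ J h prod∈) j∈)

    adjoinAll : ∀ {I : Set} {B : I → Set} → Ideal → (∀ i → B i → Carrier) → ∀ is → All B is → Ideal
    adjoinAll J g []       []       = J
    adjoinAll J g (i ∷ is) (b ∷ bs) = adjoinAll (adjoin J (g i b)) g is bs

    ⊆-adjoinAll : ∀ {I : Set} {B : I → Set} J (g : ∀ i → B i → Carrier) is bs {f} → Mem J f → Mem (adjoinAll J g is bs) f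
    ⊆-adjoinAll J g []       []       f∈ = f∈
    ⊆-adjoinAll J g (i ∷ is) (b ∷ bs) f∈ = ⊆-adjoinAll (adjoin J (g i b)) g is bs (⊆-adjoin J (g i b) f∈)

    ∈-adjoinAll : ∀ {I : Set} {B : I → Set} J (g : ∀ i → B i → Carrier) is bs {i} (i∈ : i ∈ is) →
      Mem (adjoinAll J g is bs) (g i (All.lookup bs i∈))
    ∈-adjoinAll J g (i ∷ is) (b ∷ bs) (here ≡.refl) = ⊆-adjoinAll (adjoin J (g i b)) g is bs (∈-adjoin J (g i b))
    ∈-adjoinAll J g (i ∷ is) (b ∷ bs) (there i∈)    = ∈-adjoinAll (adjoin J (g i b)) g is bs i∈

    ∈-by-all-cases : ∀ {I : Set} {B : I → Set} (J : Ideal) f (g : ∀ i → B i → Carrier) (values : ∀ i → List (B i)) →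
      (∀ i → AllPairs (λ b b′ → Comaximal (g i b) (g i b′)) (values i)) →
      ∀ is → (∀ i → Mem J (product (List.map (g i) (values i)))) →
      (∀ bs → Mem (adjoinAll J g is bs) f) → Mem J f
    ∈-by-all-cases J f g values com []       prod∈ mem = mem []
    ∈-by-all-cases J f g values com (i ∷ is) prod∈ mem =
      ∈-by-cases J f (g i) (values i) (com i) (prod∈ i) (λ b →
        ∈-by-all-cases (adjoin J (g i b)) f g values com is (λ i′ → ⊆-adjoin J (g i b) (prod∈ i′)) (λ bs → mem (b ∷ bs)))

    infix 4 _~_⟨_⟩
    _~_⟨_⟩ : Carrier → Carrier → Ideal → Set
    x ~ y ⟨ J ⟩ = ∃[ j ] (Mem J j × x ≈ y + j)

    ~-reflexive : ∀ {x y} J → x ≈ y → x ~ y ⟨ J ⟩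
    ~-reflexive J eq = 0# , zero∈ J , trans eq (sym (+-identityʳ _))

    ~-+ : ∀ {x x′ y y′} J → x ~ x′ ⟨ J ⟩ → y ~ y′ ⟨ J ⟩ → (x + y) ~ (x′ + y′) ⟨ J ⟩
    ~-+ {x′ = x′} {y′ = y′} J (j , j∈ , e) (k , k∈ , e′) = j + k , add∈ J j∈ k∈ , trans (+-cong e e′)
      (solve 4 (λ x j y k → (x :+ j) :+ (y :+ k) := (x :+ y) :+ (j :+ k)) refl x′ j y′ k)

    ~-* : ∀ {x x′ y y′} J → x ~ x′ ⟨ J ⟩ → y ~ y′ ⟨ J ⟩ → (x * y) ~ (x′ * y′) ⟨ J ⟩
    ~-* {x′ = x′} {y′ = y′} J (j , j∈ , e) (k , k∈ , e′) =
      x′ * k + (y′ + k) * j , add∈ J (mul∈ J x′ k∈) (mul∈ J (y′ + k) j∈) , trans (*-cong e e′)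
      (solve 4 (λ x j y k → (x :+ j) :* (y :+ k) := x :* y :+ (x :* k :+ (y :+ k) :* j)) refl x′ j y′ k)

    ~-resp : ∀ {x x′ y y′} J → x ≈ x′ → y ≈ y′ → x ~ y ⟨ J ⟩ → x′ ~ y′ ⟨ J ⟩
    ~-resp J ex ey (j , j∈ , e) = j , j∈ , trans (sym ex) (trans e (+-congʳ ey))

    ~-∈ : ∀ {x y} J → x ~ y ⟨ J ⟩ → Mem J y → Mem J x
    ~-∈ J (j , j∈ , e) y∈ = resp J (sym e) (add∈ J y∈ j∈)

    ~-∋ : ∀ {x y} J → x ~ y ⟨ J ⟩ → Mem J x → Mem J y
    ~-∋ {x} {y} J (j , j∈ , e) x∈ = resp J
      (trans (+-cong e (-1*x≈-x j)) (trans (+-assoc y j (- j)) (trans (+-congˡ (-‿inverseʳ j)) (+-identityʳ y))))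
      (add∈ J x∈ (mul∈ J (- 1#) j∈))

  peel : ∀ {n} (α : Vec ℕ n) → α ≡ replicate n 0 ⊎
    (∃[ i ] ∃[ β ] (α ≡ zipWith ℕ._+_ (replicate n 0 [ i ]≔ 1) β × Vec.sum α ≡ suc (Vec.sum β)))
  peel []            = inj₁ ≡.refl
  peel (suc e ∷ α)   = inj₂ (zero , e ∷ α , ≡.cong (suc e ∷_) (≡.sym (zipWith-identityˡ ℕₚ.+-identityˡ α)) , ≡.refl)
    where open import Data.Vec.Properties using (zipWith-identityˡ)
  peel (zero ∷ α) with peel α
  ... | inj₁ eq = inj₁ (≡.cong (0 ∷_) eq)
  ... | inj₂ (i , β , eq , s) = inj₂ (suc i , 0 ∷ β , ≡.cong (0 ∷_) eq , s)

  module Nullstellensatz (raw : RawRing 0ℓ 0ℓ) (isCommutativeRing : IsCommutativeRing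
      (RawRing._≈_ raw) (RawRing._+_ raw) (RawRing._*_ raw) (RawRing.-_ raw) (RawRing.0# raw) (RawRing.1# raw)) (n : ℕ) where
    open Theory raw isCommutativeRing
    open CommutativeRing coefficients hiding (zero; isCommutativeRing)
    open Polynomials raw
    open RingProperties ring using (-‿distribˡ-*; -‿distribʳ-*; -‿involutive)

    open Ideals (polynomialRing n)
    private module P = CommutativeRing (polynomialRing n)

    generated : (Poly n → Set) → Ideal
    generated G = record
      { Mem   = λ f → Σ (List (Poly n × Σ (Poly n) G)) λ hs → f ≋ combine hs
      ; resp  = λ {f} {g} eq (hs , e) → hs , P.trans {g} {f} {combine hs} (P.sym {f} {g} eq) e
      ; zero∈ = [] , P.refl {[]}
      ; add∈  = λ {f} {g} (hs , e) (ks , e′) → hs ++ ks ,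
          P.trans {f +ₚ g} {combine hs +ₚ combine ks} {combine (hs ++ ks)}
            (P.+-cong {f} {combine hs} {g} {combine ks} e e′) (combine-++ hs ks)
      ; mul∈  = λ x {f} (hs , e) → List.map (λ (h , g) → x *ₚ h , g) hs ,
          P.trans {x *ₚ f} {x *ₚ combine hs} {combine (List.map (λ (h , g) → x *ₚ h , g) hs)}
            (P.*-congˡ {x} {f} {combine hs} e) (combine-map x hs)
      }
      where
      combine : List (Poly n × Σ (Poly n) G) → Poly n
      combine hs = sumₚ (List.map (λ (h , g , _) → h *ₚ g) hs)
      combine-++ : ∀ hs ks → (combine hs +ₚ combine ks) ≋ combine (hs ++ ks)
      combine-++ []                 ks = P.refl {combine ks}
      combine-++ ((h , g , _) ∷ hs) ks = P.trans {(h *ₚ g +ₚ combine hs) +ₚ combine ks} {h *ₚ g +ₚ (combine hs +ₚ combine ks)} {h *ₚ g +ₚ combine (hs ++ ks)}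
        (P.+-assoc (h *ₚ g) (combine hs) (combine ks))
        (P.+-congˡ {h *ₚ g} {combine hs +ₚ combine ks} {combine (hs ++ ks)} (combine-++ hs ks))
      combine-map : ∀ x hs → (x *ₚ combine hs) ≋ combine (List.map (λ (h , g) → x *ₚ h , g) hs)
      combine-map x []                 = P.zeroʳ x
      combine-map x ((h , g , _) ∷ hs) =
        P.trans {x *ₚ (h *ₚ g +ₚ combine hs)} {x *ₚ (h *ₚ g) +ₚ x *ₚ combine hs} {x *ₚ h *ₚ g +ₚ combine (List.map (λ (h , g) → x *ₚ h , g) hs)}
          (P.distribˡ x (h *ₚ g) (combine hs))
          (P.+-cong {x *ₚ (h *ₚ g)} {x *ₚ h *ₚ g} {x *ₚ combine hs} {combine (List.map (λ (h , g) → x *ₚ h , g) hs)}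
            (P.sym {x *ₚ h *ₚ g} {x *ₚ (h *ₚ g)} (P.*-assoc x h g)) (combine-map x hs))

    generated-∈ : ∀ {G : Poly n → Set} {g} → G g → Mem (generated G) g
    generated-∈ {G} {g} Gg = (constₚ 1# , g , Gg) ∷ [] ,
      P.sym {constₚ 1# *ₚ g +ₚ []} {g} (P.trans {constₚ 1# *ₚ g +ₚ []} {constₚ 1# *ₚ g} {g} (P.+-identityʳ (constₚ 1# *ₚ g)) (P.*-identityˡ g))

    generated⇒∈⟨⟩ : ∀ {G : Poly n → Set} {f} → Mem (generated G) f → f ∈⟨ G ⟩
    generated⇒∈⟨⟩ {f = f} (hs , e) = hs , ≋⇒≈ₚ f (sumₚ (List.map (λ (h , g , _) → h *ₚ g) hs)) e

    const-+ : ∀ a b → (constₚ {n} a +ₚ constₚ b) ≋ constₚ (a + b)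
    const-+ a b φ = trans (+-congˡ (+-identityʳ _)) (trans (sym (distribʳ _ a b)) (sym (+-identityʳ _)))

    const-* : ∀ a b → (constₚ {n} a *ₚ constₚ b) ≋ constₚ (a * b)
    const-* a b φ = +-congʳ (*-congˡ (reflexive (≡.cong φ (Data.Vec.Properties.zipWith-identityˡ ℕₚ.+-identityˡ (replicate n 0)))))
      where import Data.Vec.Properties

    const-cong : ∀ {a b} → a ≈ b → constₚ {n} a ≋ constₚ b
    const-cong eq φ = +-congʳ (*-congʳ eq)

    const-0 : constₚ {n} 0# ≋ []
    const-0 φ = trans (+-identityʳ _) (zeroˡ _)

    term : Monomial n → Poly n
    term α = (1# , α) ∷ []

    term-∷ : ∀ a α f → (a , α) ∷ f ≋ (constₚ a *ₚ term α +ₚ f)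
    term-∷ a α f φ = +-cong (*-cong (sym (*-identityʳ a))
      (reflexive (≡.cong φ (≡.sym (Data.Vec.Properties.zipWith-identityˡ ℕₚ.+-identityˡ α))))) refl
      where import Data.Vec.Properties

    module _ (J : Ideal) (v : Vec Carrier n) (vars : ∀ i → varₚ i ~ constₚ (lookup v i) ⟨ J ⟩) where

      -- The congruences are known for single variables only, so one variable at a time is split off
      -- the monomial, by induction on a bound for the degree.
      term~ : ∀ k α → Vec.sum α ℕ.≤ k → term α ~ constₚ (evalMonomial α v) ⟨ J ⟩
      term~ k α le with peel α
      ... | inj₁ ≡.refl = ~-reflexive {x = term α} {constₚ (evalMonomial α v)} J (const-cong (sym (evalMonomial-0 v)))
      term~ zero    α le | inj₂ (i , β , eq , s) with () ← ≡.subst (ℕ._≤ 0) s le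
      term~ (suc k) α le | inj₂ (i , β , ≡.refl , s) =
        ~-resp {varₚ i *ₚ term β} {term α} {constₚ (lookup v i) *ₚ constₚ (evalMonomial β v)} {constₚ (evalMonomial α v)} J
          (λ φ → +-congʳ (*-congʳ (*-identityˡ 1#)))
          (P.trans {constₚ (lookup v i) *ₚ constₚ (evalMonomial β v)} {constₚ (lookup v i * evalMonomial β v)} {constₚ (evalMonomial α v)}
            (const-* (lookup v i) (evalMonomial β v))
            (const-cong (sym (trans (evalMonomial-∔ (replicate n 0 [ i ]≔ 1) β v) (*-congʳ (evalMonomial-var i v))))))
          (~-* {varₚ i} {constₚ (lookup v i)} {term β} {constₚ (evalMonomial β v)} J (vars i)
            (term~ k β (ℕ.s≤s⁻¹ (≡.subst (ℕ._≤ suc k) s le))))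

      eval~ : ∀ f → f ~ constₚ (eval f v) ⟨ J ⟩
      eval~ []            = ~-reflexive {x = []} {constₚ 0#} J (P.sym {constₚ 0#} {[]} const-0)
      eval~ ((a , α) ∷ f) =
        ~-resp {constₚ a *ₚ term α +ₚ f} {(a , α) ∷ f} {constₚ a *ₚ constₚ (evalMonomial α v) +ₚ constₚ (eval f v)} {constₚ (eval ((a , α) ∷ f) v)} J
          (P.sym {(a , α) ∷ f} {constₚ a *ₚ term α +ₚ f} (term-∷ a α f))
          (P.trans {constₚ a *ₚ constₚ (evalMonomial α v) +ₚ constₚ (eval f v)} {constₚ (a * evalMonomial α v) +ₚ constₚ (eval f v)} {constₚ (a * evalMonomial α v + eval f v)}
            (P.+-congʳ {constₚ (eval f v)} {constₚ a *ₚ constₚ (evalMonomial α v)} {constₚ (a * evalMonomial α v)} (const-* a (evalMonomial α v)))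
            (const-+ (a * evalMonomial α v) (eval f v)))
          (~-+ {constₚ a *ₚ term α} {constₚ a *ₚ constₚ (evalMonomial α v)} {f} {constₚ (eval f v)} J
            (~-* {constₚ a} {constₚ a} {term α} {constₚ (evalMonomial α v)} J (~-reflexive {x = constₚ a} {constₚ a} J (P.refl {constₚ a})) (term~ (Vec.sum α) α ℕₚ.≤-refl))
            (eval~ f))

      eval-zero⇒∈ : ∀ f → eval f v ≈ 0# → Mem J f
      eval-zero⇒∈ f eq = ~-∈ {x = f} {constₚ (eval f v)} J (eval~ f)
        (resp J {[]} {constₚ (eval f v)} (P.sym {constₚ (eval f v)} {[]} (P.trans {constₚ (eval f v)} {constₚ 0#} {[]} (const-cong eq) const-0)) (zero∈ J))

      -- Modulo J every polynomial is the constant given by its value at v. So J contains the unit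
      -- `eval g v`, and hence everything.
      eval-unit⇒∈ : ∀ g → Mem J g → ∀ w → eval g v * w ≈ 1# → ∀ f → Mem J f
      eval-unit⇒∈ g g∈ w unit f = resp J {f *ₚ (constₚ w *ₚ constₚ (eval g v))} {f}
        (P.trans {f *ₚ (constₚ w *ₚ constₚ (eval g v))} {f *ₚ constₚ 1#} {f}
          (P.*-congˡ {f} {constₚ w *ₚ constₚ (eval g v)} {constₚ 1#}
            (P.trans {constₚ w *ₚ constₚ (eval g v)} {constₚ (w * eval g v)} {constₚ 1#} (const-* w (eval g v)) (const-cong (trans (*-comm w _) unit))))
          (P.*-identityʳ f))
        (mul∈ J f {constₚ w *ₚ constₚ (eval g v)} (mul∈ J (constₚ w) {constₚ (eval g v)} (~-∋ {g} {constₚ (eval g v)} J (eval~ g) g∈)))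

    linear : Fin n → Carrier → Poly n
    linear i c = varₚ i +ₚ constₚ (- c)

    open import Algebra.Solver.Ring.NaturalCoefficients.Default commutativeSemiring
      using (solve; _:+_; _:*_; _:=_; con)

    -- w (x - d) - w (x - c) = w (c - d) = 1.
    linear-comaximal : ∀ (i : Fin n) c d w → w * (c + - d) ≈ 1# → Comaximal (linear i d) (linear i c)
    linear-comaximal i c d w unit = constₚ w , constₚ (- w) , λ φ →
      let x = φ (replicate n 0 ∔ (replicate n 0 [ i ]≔ 1))
          z = φ (replicate n 0 ∔ replicate n 0)
      in begin
      1# * φ (replicate n 0) + 0#
        ≈⟨ +-congʳ (*-congˡ (reflexive (≡.cong φ (≡.sym (zipWith-identityˡ ℕₚ.+-identityˡ (replicate n 0)))))) ⟩
      1# * z + 0#                                          ≈⟨ +-cong (*-congʳ (sym difference)) (sym (zeroˡ x)) ⟩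
      (w * - d + - w * - c) * z + 0# * x                   ≈⟨ +-congˡ (*-congʳ (sym (-‿inverseʳ w))) ⟩
      (w * - d + - w * - c) * z + (w + - w) * x
        ≈⟨ solve 6 (λ w w′ d c x z → (w :* d :+ w′ :* c) :* z :+ (w :+ w′) :* x
             := w :* con 1 :* x :+ (w :* d :* z :+ (w′ :* con 1 :* x :+ (w′ :* c :* z :+ con 0)))) refl w (- w) (- d) (- c) x z ⟩
      w * 1# * x + (w * - d * z + (- w * 1# * x + (- w * - c * z + 0#))) ∎
      where
      open import Relation.Binary.Reasoning.Setoid setoid
      open import Data.Vec.Properties using (zipWith-identityˡ)
      difference : w * - d + - w * - c ≈ 1#
      difference = trans (+-congˡ (trans (sym (-‿distribˡ-* w (- c))) (trans (-‿cong (sym (-‿distribʳ-* w c))) (-‿involutive (w * c)))))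
        (trans (+-comm (w * - d) (w * c)) (trans (sym (distribˡ w c (- d))) unit))

    -- The hypotheses provide explicit inverses, both for the differences of the roots and for a
    -- generator at each point where f is not known to vanish, so no equality in the coefficient
    -- ring is ever decided.
    nullstellensatz : ∀ (G : Poly n → Set) (m : Fin n → ℕ) (c : ∀ i → Fin (m i) → Carrier) →
      (∀ i b b′ → b ≢ b′ → ∃[ w ] w * (c i b + - c i b′) ≈ 1#) →
      (∀ i → G (productₚ (List.map (λ b → linear i (c i b)) (allFin (m i))))) →
      ∀ f → (∀ (b : ∀ i → Fin (m i)) v → (∀ i → lookup v i ≡ c i (b i)) →
        eval f v ≈ 0# ⊎ (∃[ g ] (G g × ∃[ w ] eval g v * w ≈ 1#))) →
      f ∈⟨ G ⟩
    nullstellensatz G m c units domain f cases = generated⇒∈⟨⟩ {f = f}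
      (∈-by-all-cases {B = λ i → Fin (m i)} J f g (λ i → allFin (m i)) (λ i → comaximal i (tabulate⁺ (λ e → e))) (allFin n)
        (λ i → generated-∈ {G = G} (domain i)) λ bs →
        let b = λ i → All.lookup bs (∈-allFin i)
            v = Vec.tabulate (λ i → c i (b i))
            K = adjoinAll {B = λ i → Fin (m i)} J g (allFin n) bs
            vars = λ i → linear i (c i (b i)) , ∈-adjoinAll {B = λ i → Fin (m i)} J g (allFin n) bs (∈-allFin i) ,
              ≡.subst (λ a → varₚ i ≋ (constₚ a +ₚ linear i (c i (b i)))) (≡.sym (lookup∘tabulate (λ i → c i (b i)) i)) (split i (c i (b i)))
        in finish bs v vars (cases b v (lookup∘tabulate (λ i → c i (b i)))))
      where
      open import Data.Vec.Properties using (lookup∘tabulate)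
      J = generated G
      g : ∀ i → Fin (m i) → Poly n
      g i b = linear i (c i b)
      comaximal : ∀ i {bs} → Unique bs → AllPairs (λ b b′ → Comaximal (g i b) (g i b′)) bs
      comaximal i []          = []
      comaximal i (neq ∷ unq) = All.map (λ {b′} b≢b′ →
        let w , e = units i b′ _ (λ eq → b≢b′ (≡.sym eq)) in linear-comaximal i (c i b′) (c i _) w e) neq ∷ comaximal i unq
      split : ∀ i a → varₚ i ≋ (constₚ a +ₚ linear i a)
      split i a φ = begin
        1# * x + 0#                             ≈⟨ +-congˡ (trans (*-congʳ (-‿inverseʳ a)) (zeroˡ z)) ⟨
        1# * x + (a + - a) * z                  ≈⟨ solve 5 (λ u x a a′ z → u :* x :+ (a :+ a′) :* z := a :* z :+ (u :* x :+ (a′ :* z :+ con 0))) refl 1# x a (- a) z ⟩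
        a * z + (1# * x + (- a * z + 0#)) ∎
        where
        open import Relation.Binary.Reasoning.Setoid setoid
        x = φ (replicate n 0 [ i ]≔ 1)
        z = φ (replicate n 0)
      finish : ∀ bs v → let K = adjoinAll {B = λ i → Fin (m i)} J g (allFin n) bs in
        (∀ i → varₚ i ~ constₚ (lookup v i) ⟨ K ⟩) →
        eval f v ≈ 0# ⊎ (∃[ h ] (G h × ∃[ w ] eval h v * w ≈ 1#)) → Mem K f
      finish bs v vars (inj₁ eq) = eval-zero⇒∈ (adjoinAll {B = λ i → Fin (m i)} J g (allFin n) bs) v vars f eq
      finish bs v vars (inj₂ (h , Gh , w , eq)) = eval-unit⇒∈ (adjoinAll {B = λ i → Fin (m i)} J g (allFin n) bs) v vars h
        (⊆-adjoinAll {B = λ i → Fin (m i)} J g (allFin n) bs {h} (generated-∈ {G = G} Gh)) w eq f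

-- Correctness of the exact zero test

module RationalTest where

  open import Defs using (encodeℚ)
  open TreePrograms
  open BinaryArithmetic
  open FiniteSums
  open VerdictProgram
  open import Algebra.Bundles using (CommutativeRing)
  open import Data.Bool.Base using (Bool; true; false) renaming (if_then_else_ to if′_then_else_)
  open import Data.Integer.Base as ℤ using (ℤ; +_; -[1+_])
  import Data.Integer.Properties as ℤₚ
  open import Data.List.Base using (List; []; _∷_; map; foldl)
  open import Data.List.Membership.Propositional using (_∈_)
  open import Data.List.Relation.Unary.Any using (here; there)
  open import Data.List.Relation.Unary.All using ([]; _∷_)
  open import Data.Nat.Base as ℕ using (ℕ; suc)
  import Data.Nat.Properties as ℕₚ
  open import Data.Rational.Base as Rat using (ℚ; 0ℚ; 1ℚ; _+_; _*_; -_; _-_; _≤_; _<_; _/_; ↥_; ↧ₙ_; mkℚ; toℚᵘ)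
  open import Data.Rational.Properties as ℚₚ using (toℚᵘ-injective; toℚᵘ-fromℚᵘ; toℚᵘ-homo-+; toℚᵘ-homo-*)
  open import Data.Rational.Unnormalised.Base as ℚᵘ using (ℚᵘ; mkℚᵘ; *≡*) renaming (_≃_ to _≃ᵘ_)
  import Data.Rational.Unnormalised.Properties as ℚᵘₚ
  open import Data.Rational.Solver using (module +-*-Solver)
  open import Data.Sum.Base using (inj₁; inj₂)
  open import Relation.Binary.PropositionalEquality
  open import Relation.Nullary using (yes; no)
  open +-*-Solver using (solve; _:+_; _:*_; _:-_; :-_; _:=_; con)

  module ℚSums = Sums (CommutativeRing.commutativeSemiring ℚₚ.+-*-commutativeRing)
  open ℚSums using () renaming (∑ to ∑ℚ; ∑-cong to ∑ℚ-cong; ∑-swap to ∑ℚ-swap; ∑-*ˡ to ∑ℚ-*ˡ; ∑-zero to ∑ℚ-zero) public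
  open Sums ℕₚ.+-*-commutativeSemiring using (∑)

  abstract
    ι : ℕ → ℚ
    ι n = + n / 1

    ι-def : ∀ n → ι n ≡ + n / 1
    ι-def n = refl

    ι-ᵘ : ∀ n → toℚᵘ (ι n) ≃ᵘ mkℚᵘ (+ n) 0
    ι-ᵘ n = toℚᵘ-fromℚᵘ (mkℚᵘ (+ n) 0)

  ι-+ : ∀ m n → ι (m ℕ.+ n) ≡ ι m + ι n
  ι-+ m n = toℚᵘ-injective (ℚᵘₚ.≃-trans (ι-ᵘ (m ℕ.+ n)) (ℚᵘₚ.≃-trans sum
    (ℚᵘₚ.≃-sym (ℚᵘₚ.≃-trans (toℚᵘ-homo-+ (ι m) (ι n)) (ℚᵘₚ.+-cong (ι-ᵘ m) (ι-ᵘ n))))))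
    where
    sum : mkℚᵘ (+ (m ℕ.+ n)) 0 ≃ᵘ mkℚᵘ (+ m) 0 ℚᵘ.+ mkℚᵘ (+ n) 0
    sum = *≡* (cong (ℤ._* + 1) (trans (ℤₚ.pos-+ m n) (sym (cong₂ ℤ._+_ (ℤₚ.*-identityʳ (+ m)) (ℤₚ.*-identityʳ (+ n))))))

  ι-* : ∀ m n → ι (m ℕ.* n) ≡ ι m * ι n
  ι-* m n = toℚᵘ-injective (ℚᵘₚ.≃-trans (ι-ᵘ (m ℕ.* n)) (ℚᵘₚ.≃-trans (*≡* (cong (ℤ._* + 1) (ℤₚ.pos-* m n)))
    (ℚᵘₚ.≃-sym (ℚᵘₚ.≃-trans (toℚᵘ-homo-* (ι m) (ι n)) (ℚᵘₚ.*-cong (ι-ᵘ m) (ι-ᵘ n))))))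

  ι-injective : ∀ {m n} → ι m ≡ ι n → m ≡ n
  ι-injective {m} {n} eq with ℚᵘₚ.≃-trans (ℚᵘₚ.≃-sym (ι-ᵘ m)) (ℚᵘₚ.≃-trans (ℚᵘₚ.≃-reflexive (cong toℚᵘ eq)) (ι-ᵘ n))
  ... | *≡* e = ℤₚ.+-injective (trans (sym (ℤₚ.*-identityʳ (+ m))) (trans e (ℤₚ.*-identityʳ (+ n))))

  ι-0 : ι 0 ≡ 0ℚ
  ι-0 = ι-def 0

  ι-1 : ι 1 ≡ 1ℚ
  ι-1 = ι-def 1

  p*q≡0⇒q≡0 : ∀ {p q} → p ≢ 0ℚ → p * q ≡ 0ℚ → q ≡ 0ℚ
  p*q≡0⇒q≡0 {p} {q} p≢0 eq = begin
    q                ≡⟨ ℚₚ.*-identityˡ q ⟨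
    1ℚ * q           ≡⟨ cong (_* q) (ℚₚ.*-inverseˡ p {{nonzero}}) ⟨
    1/p * p * q      ≡⟨ ℚₚ.*-assoc 1/p p q ⟩
    1/p * (p * q)    ≡⟨ cong (1/p *_) eq ⟩
    1/p * 0ℚ         ≡⟨ ℚₚ.*-zeroʳ 1/p ⟩
    0ℚ               ∎
    where
    open ≡-Reasoning
    nonzero : Rat.NonZero p
    nonzero = Rat.≢-nonZero p≢0
    1/p = (Rat.1/ p) {{nonzero}}

  ι≢0 : ∀ {n} → 0 ℕ.< n → ι n ≢ 0ℚ
  ι≢0 {suc n} _ eq with () ← ι-injective (trans eq (sym ι-0))

  signed : ℤ → Bool × ℕ
  signed (+ n)    = false , n
  signed -[1+ n ] = true , n

  ratOf : ℚ → Rat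
  ratOf u = signed (↥ u) , ↧ₙ u

  encode-ratOf : ∀ u → encodeℚ u ≡ enc ratT (ratOf u)
  encode-ratOf u with ↥ u
  ... | + n      = refl
  ... | -[1+ n ] = refl

  numerator : ∀ u → u * ι (↧ₙ u) ≡ ι (posPart (ratOf u)) - ι (negPart (ratOf u))
  numerator u = trans (toℚᵘ-injective (ℚᵘₚ.≃-trans (toℚᵘ-homo-* u (ι (↧ₙ u)))
      (ℚᵘₚ.≃-trans (ℚᵘₚ.*-cong (ℚᵘₚ.≃-refl {toℚᵘ u}) (ι-ᵘ (↧ₙ u)))
      (ℚᵘₚ.≃-trans (clear u) (ℚᵘₚ.≃-sym (toℚᵘ-fromℚᵘ (mkℚᵘ (↥ u) 0)))))))
    (parts (↥ u))
    where
    clear : ∀ u → toℚᵘ u ℚᵘ.* mkℚᵘ (+ (↧ₙ u)) 0 ≃ᵘ mkℚᵘ (↥ u) 0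
    clear (mkℚ n d c) = *≡* (trans (ℤₚ.*-identityʳ (n ℤ.* + suc d))
      (cong (n ℤ.*_) (cong (λ k → + suc k) (sym (ℕₚ.*-identityʳ d)))))
    parts : ∀ z → z / 1 ≡ ι (if′ proj₁ (signed z) then 0 else proj₂ (signed z)) - ι (if′ proj₁ (signed z) then 1 ℕ.+ proj₂ (signed z) else 0)
    parts (+ n)    = trans (sym (ι-def n)) (sym (trans (cong (λ z → ι n - z) ι-0) (ℚₚ.+-identityʳ (ι n))))
    parts -[1+ n ] = trans (cong -_ (sym (ι-def (suc n)))) (sym (trans (cong (_- ι (suc n)) ι-0) (ℚₚ.+-identityˡ (- ι (suc n)))))

  -- `balanced` is v / k = S / N without division. In the application v and k are total and count
  -- over the leaves, S the sum of a monomial over the solutions and N the number of solutions.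
  module _ {A : Set} (u : A → ℚ) (v k S : A → ℕ) (N : ℕ) (balanced : ∀ a → N ℕ.* v a ≡ k a ℕ.* S a) where

    item : A → Rat × (ℕ × ℕ)
    item a = ratOf (u a) , (v a , k a)

    -- Without solutions every fraction is 0/0. The two numerators then stay equal and the test
    -- accepts, as it must: every polynomial vanishes on the empty set.
    zeroTest-empty : ∀ as → (∀ a → v a ≡ 0) → (∀ a → k a ≡ 0) → zeroTest (map item as) ≡ true
    zeroTest-empty as v≡0 k≡0 = subst (λ n → eqBin (proj₁ (state as)) n ≡ true) (go as 0 1) (eqBin-refl (proj₁ (state as)))
      where
      state : List A → ℕ × (ℕ × ℕ)
      state as = foldl addFrac (0 , (0 , 1)) (map item as)
      go : ∀ as P M → let P′ , (N′ , _) = foldl addFrac (P , (P , M)) (map item as) in P′ ≡ N′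
      go []       P M = refl
      go (a ∷ as) P M rewrite v≡0 a | k≡0 a | ℕₚ.*-zeroʳ (↧ₙ (u a)) | ℕₚ.*-zeroʳ P
        | ℕₚ.*-zeroʳ (posPart (ratOf (u a))) | ℕₚ.*-zeroʳ (negPart (ratOf (u a))) = go as 0 (M ℕ.* 0)

    -- The invariant is (P - N′) / M = T / N, cleared of denominators: the accumulator represents
    -- the partial sum T up to the common factor 1 / N.
    total-step : ∀ P N′ M T a → ι N * (ι P - ι N′) ≡ ι M * T →
      let P₁ , (N₁ , M₁) = addFrac (P , (N′ , M)) (item a) in
      ι N * (ι P₁ - ι N₁) ≡ ι M₁ * (T + u a * ι (S a))
    total-step P N′ M T a eq = begin
      ι N * (ι (P ℕ.* (d ℕ.* k a) ℕ.+ p ℕ.* v a ℕ.* M) - ι (N′ ℕ.* (d ℕ.* k a) ℕ.+ n ℕ.* v a ℕ.* M))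
        ≡⟨ cong₂ (λ x y → ι N * (x - y)) (expand P p) (expand N′ n) ⟩
      ι N * ((ι P * (ι d * ι (k a)) + ι p * ι (v a) * ι M) - (ι N′ * (ι d * ι (k a)) + ι n * ι (v a) * ι M))
        ≡⟨ solve 9 (λ N P N′ d k p n v M → N :* ((P :* (d :* k) :+ p :* v :* M) :- (N′ :* (d :* k) :+ n :* v :* M))
             := (N :* (P :- N′)) :* (d :* k) :+ (p :- n) :* (N :* v) :* M) refl
             (ι N) (ι P) (ι N′) (ι d) (ι (k a)) (ι p) (ι n) (ι (v a)) (ι M) ⟩
      (ι N * (ι P - ι N′)) * (ι d * ι (k a)) + (ι p - ι n) * (ι N * ι (v a)) * ι M
        ≡⟨ cong₂ (λ x y → x * (ι d * ι (k a)) + y * ι M) eq (cong₂ _*_ (sym (numerator (u a))) weights) ⟩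
      (ι M * T) * (ι d * ι (k a)) + (u a * ι d) * (ι (k a) * ι (S a)) * ι M
        ≡⟨ solve 6 (λ M T d k u S → (M :* T) :* (d :* k) :+ (u :* d) :* (k :* S) :* M := (M :* (d :* k)) :* (T :+ u :* S)) refl
             (ι M) T (ι d) (ι (k a)) (u a) (ι (S a)) ⟩
      (ι M * (ι d * ι (k a))) * (T + u a * ι (S a))
        ≡⟨ cong (_* (T + u a * ι (S a))) (trans (ι-* M (d ℕ.* k a)) (cong (ι M *_) (ι-* d (k a)))) ⟨
      ι (M ℕ.* (d ℕ.* k a)) * (T + u a * ι (S a)) ∎
      where
      open ≡-Reasoning
      d = ↧ₙ (u a)
      p = posPart (ratOf (u a))
      n = negPart (ratOf (u a))
      expand : ∀ P p → ι (P ℕ.* (d ℕ.* k a) ℕ.+ p ℕ.* v a ℕ.* M) ≡ ι P * (ι d * ι (k a)) + ι p * ι (v a) * ι M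
      expand P p = trans (ι-+ (P ℕ.* (d ℕ.* k a)) (p ℕ.* v a ℕ.* M)) (cong₂ _+_
        (trans (ι-* P (d ℕ.* k a)) (cong (ι P *_) (ι-* d (k a))))
        (trans (ι-* (p ℕ.* v a) M) (cong (_* ι M) (ι-* p (v a)))))
      weights : ι N * ι (v a) ≡ ι (k a) * ι (S a)
      weights = trans (sym (ι-* N (v a))) (trans (cong ι (balanced a)) (ι-* (k a) (S a)))

    zeroTest-correct : ∀ as → 0 ℕ.< N → (∀ a → 0 ℕ.< k a) →
      zeroTest (map item as) ≡ true ⇔ ∑ℚ as (λ a → u a * ι (S a)) ≡ 0ℚ
    zeroTest-correct as 0<N 0<k = mk⇔
      (λ eq → let P≡N = eqBin⇒≡ P N′ eq in
        trans (sym (ℚₚ.+-identityˡ _)) (p*q≡0⇒q≡0 (ι≢0 0<M) (trans (sym invariant)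
          (trans (cong (ι N *_) (trans (cong (λ n → ι n - ι N′) P≡N) (ℚₚ.+-inverseʳ (ι N′)))) (ℚₚ.*-zeroʳ (ι N))))))
      (λ T≡0 → subst (λ n → eqBin P n ≡ true) (ι-injective (difference (p*q≡0⇒q≡0 (ι≢0 0<N)
        (trans invariant (trans (cong (ι M *_) (trans (ℚₚ.+-identityˡ _) T≡0)) (ℚₚ.*-zeroʳ (ι M))))))) (eqBin-refl P))
      where
      final = foldl addFrac (0 , (0 , 1)) (map item as)
      P  = proj₁ final
      N′ = proj₁ (proj₂ final)
      M  = proj₂ (proj₂ final)
      difference : ∀ {x y} → x - y ≡ 0ℚ → x ≡ y
      difference {x} {y} eq = trans (solve 2 (λ x y → x := (x :- y) :+ y) refl x y) (trans (cong (_+ y) eq) (ℚₚ.+-identityˡ y))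
      go : ∀ as P N′ M T → 0 ℕ.< M → ι N * (ι P - ι N′) ≡ ι M * T →
        let P₁ , (N₁ , M₁) = foldl addFrac (P , (N′ , M)) (map item as) in
        0 ℕ.< M₁ × ι N * (ι P₁ - ι N₁) ≡ ι M₁ * (T + ∑ℚ as (λ a → u a * ι (S a)))
      go []       P N′ M T 0<M eq = 0<M , trans eq (cong (ι M *_) (sym (ℚₚ.+-identityʳ T)))
      go (a ∷ as) P N′ M T 0<M eq =
        let P₁ , (N₁ , M₁) = addFrac (P , (N′ , M)) (item a)
            0<M₁ , eq₁ = go as P₁ N₁ M₁ (T + u a * ι (S a))
              (ℕₚ.*-mono-< 0<M (ℕₚ.*-mono-< (denominator-pos (u a)) (0<k a))) (total-step P N′ M T a eq)
        in 0<M₁ , trans eq₁ (cong (ι _ *_) (ℚₚ.+-assoc T (u a * ι (S a)) _))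
        where
        denominator-pos : ∀ u → 0 ℕ.< ↧ₙ u
        denominator-pos (mkℚ n d c) = ℕ.s≤s ℕ.z≤n
      base : ι N * (ι 0 - ι 0) ≡ ι 1 * 0ℚ
      base = trans (cong (ι N *_) (ℚₚ.+-inverseʳ (ι 0))) (trans (ℚₚ.*-zeroʳ (ι N)) (sym (ℚₚ.*-zeroʳ (ι 1))))
      0<M : 0 ℕ.< M
      0<M = proj₁ (go as 0 0 1 0ℚ (ℕ.s≤s ℕ.z≤n) base)
      invariant : ι N * (ι P - ι N′) ≡ ι M * (0ℚ + ∑ℚ as (λ a → u a * ι (S a)))
      invariant = proj₂ (go as 0 0 1 0ℚ (ℕ.s≤s ℕ.z≤n) base)

  ι-∑ : ∀ {A : Set} (f : A → ℕ) as → ι (∑ as f) ≡ ∑ℚ as (λ a → ι (f a))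
  ι-∑ f []       = ι-0
  ι-∑ f (a ∷ as) = trans (ι-+ (f a) (∑ as f)) (cong (λ z → ι (f a) + z) (ι-∑ f as))

  0≤p*p : ∀ p → 0ℚ ≤ p * p
  0≤p*p p with ℚₚ.≤-total 0ℚ p
  ... | inj₁ 0≤p = ℚₚ.nonNegative⁻¹ (p * p) {{ℚₚ.nonNeg*nonNeg⇒nonNeg p {{Rat.nonNegative 0≤p}} p {{Rat.nonNegative 0≤p}}}}
  ... | inj₂ p≤0 = subst (0ℚ ≤_) (solve 1 (λ p → (:- p) :* (:- p) := p :* p) refl p)
    (ℚₚ.nonNegative⁻¹ (- p * - p) {{ℚₚ.nonNeg*nonNeg⇒nonNeg (- p) {{Rat.nonNegative 0≤-p}} (- p) {{Rat.nonNegative 0≤-p}}}})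
    where
    0≤-p : 0ℚ ≤ - p
    0≤-p = ℚₚ.neg-antimono-≤ p≤0

  p*p≡0⇒p≡0 : ∀ p → p * p ≡ 0ℚ → p ≡ 0ℚ
  p*p≡0⇒p≡0 p eq with p ℚₚ.≟ 0ℚ
  ... | yes p≡0 = p≡0
  ... | no  p≢0 = p*q≡0⇒q≡0 p≢0 eq

  ∑-nonneg-zero : ∀ {A : Set} (f : A → ℚ) as → (∀ a → 0ℚ ≤ f a) → ∑ℚ as f ≡ 0ℚ → ∀ {a} → a ∈ as → f a ≡ 0ℚ
  ∑-nonneg-zero f as 0≤f eq a∈ = go as eq a∈
    where
    0≤∑ : ∀ as → 0ℚ ≤ ∑ℚ as f
    0≤∑ []       = ℚₚ.≤-refl
    0≤∑ (a ∷ as) = ℚₚ.+-mono-≤ (0≤f a) (0≤∑ as)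
    go : ∀ as → ∑ℚ as f ≡ 0ℚ → ∀ {a} → a ∈ as → f a ≡ 0ℚ
    go (b ∷ as) eq (here refl) = ℚₚ.≤-antisym
      (subst₂ _≤_ (ℚₚ.+-identityʳ (f b)) eq (ℚₚ.+-monoʳ-≤ (f b) (0≤∑ as))) (0≤f b)
    go (b ∷ as) eq (there a∈) = go as (ℚₚ.≤-antisym
      (subst₂ _≤_ (ℚₚ.+-identityˡ (∑ℚ as f)) eq (ℚₚ.+-monoˡ-≤ (∑ℚ as f) (0≤f b))) (0≤∑ as)) a∈

-- Membership in the ideal as vanishing of rational coordinates

module ComplexPoints where

  open import Defs
  open ComplexNumbers
  open PolynomialEvaluation
  open VanishingIdeals
  open RationalTest using (ι; ι-def; ι-*; ι-1; ι-injective)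
  open VerdictProgram using (headOr)
  open import Algebra.Bundles using (CommutativeRing)
  open import Algebra.Bundles.Raw using (RawRing)
  open import Algebra.Structures using (IsCommutativeRing)
  open import Level using (0ℓ)
  open import Data.Bool.Properties using (T?)
  open import Data.Fin.Properties using (toℕ-injective)
  open import Data.List.Base as List using (List; []; _∷_; drop)
  open import Data.List.Membership.Propositional using (_∈_; find)
  open import Data.List.Membership.Propositional.Properties using (∈-allFin)
  open import Data.List.Relation.Unary.All as All using (All; []; _∷_)
  open import Data.List.Relation.Unary.All.Properties using (¬All⇒Any¬)
  open import Data.Nat.Base as ℕ using (ℕ; zero; suc)
  open import Data.Rational.Base as Rat using (ℚ; 0ℚ; _+_; _*_; -_; _-_)
  import Data.Rational.Properties as ℚₚ
  open import Data.Rational.Solver using (module +-*-Solver)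
  open import Data.Sum.Base using (_⊎_; inj₁; inj₂)
  open import Data.Vec.Base as Vec using (Vec; []; _∷_; lookup; replicate; zipWith)
  import Data.Vec.Relation.Unary.All as Vecᴬ
  open Vecᴬ using ([]; _∷_)
  open import Data.Vec.Relation.Unary.All.Properties using (lookup⁺)
  open import Relation.Binary.PropositionalEquality as ≡ using (_≡_; _≢_)
  open import Relation.Nullary using (¬_; Dec; yes; no)

  module Rearrangements (R : CommutativeRing 0ℓ 0ℓ) where
    open CommutativeRing R renaming (_+_ to infixl 6 _⊕_; _*_ to infixl 7 _⊛_)
    open import Algebra.Solver.Ring.NaturalCoefficients.Default commutativeSemiring using (solve; _:+_; _:*_; _:=_)

    collect : ∀ x y z u w → x ⊛ z ⊕ u ⊕ (y ⊛ z ⊕ w) ≈ (x ⊕ y) ⊛ z ⊕ (u ⊕ w)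
    collect = solve 5 (λ x y z u w → (x :* z :+ u) :+ (y :* z :+ w) := (x :+ y) :* z :+ (u :+ w)) refl

    expand : ∀ x z u r → (x ⊛ z ⊕ u) ⊛ r ≈ x ⊛ r ⊛ z ⊕ u ⊛ r
    expand = solve 4 (λ x z u r → (x :* z :+ u) :* r := x :* r :* z :+ u :* r) refl

  -- Lists of terms whose coefficients are presented by elements of U, together with their
  -- sum in U when each monomial is replaced by its rational weight.
  data Presents {U K : Set} {n : ℕ} (_⊞_ : U → U → U) (_⊡_ : U → ℚ → U) (zeroᵁ : U) (weight : Vec ℕ n → ℚ) (value : U → K) :
      List (K × Vec ℕ n) → U → Set where
    []  : Presents _⊞_ _⊡_ zeroᵁ weight value [] zeroᵁ
    _∷_ : ∀ {f w} u {α} → Presents _⊞_ _⊡_ zeroᵁ weight value f w →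
          Presents _⊞_ _⊡_ zeroᵁ weight value ((value u , α) ∷ f) ((u ⊡ weight α) ⊞ w)

  module Evaluation (raw : RawRing 0ℓ 0ℓ) (isCommutativeRing : IsCommutativeRing
      (RawRing._≈_ raw) (RawRing._+_ raw) (RawRing._*_ raw) (RawRing.-_ raw) (RawRing.0# raw) (RawRing.1# raw)) where
    open Polynomials raw using () renaming (eval to evaluate; evalMonomial to evaluateMonomial)
    open CommutativeRing (Theory.coefficients raw isCommutativeRing) renaming (_+_ to infixl 6 _⊕_; _*_ to infixl 7 _⊛_) hiding (zero; isCommutativeRing)

    module _ {U : Set} {n : ℕ} (_⊞_ : U → U → U) (_⊡_ : U → ℚ → U) (zeroᵁ : U) (weight : Vec ℕ n → ℚ) (value : U → Carrier)
      (h : ℚ → Carrier) (value-⊞ : ∀ u w → value u ⊕ value w ≈ value (u ⊞ w)) (value-⊡ : ∀ u r → value u ⊛ h r ≈ value (u ⊡ r))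
      (value-0 : value zeroᵁ ≈ 0#) (v : Vec Carrier n) (evaluates : ∀ α → evaluateMonomial α v ≈ h (weight α)) where

      eval-presented : ∀ f w → Presents _⊞_ _⊡_ zeroᵁ weight value f w → evaluate f v ≈ value w
      eval-presented _ _ []                    = sym value-0
      eval-presented _ _ (_∷_ {f} {w} u {α} p) = trans
        (+-cong (trans (*-congˡ (evaluates α)) (value-⊡ u (weight α))) (eval-presented f w p))
        (value-⊞ (u ⊡ weight α) w)

      presented-zero⇔ : (Zero : U → Set) → (∀ w → value w ≈ 0# ⇔ Zero w) →
        ∀ f w → Presents _⊞_ _⊡_ zeroᵁ weight value f w → evaluate f v ≈ 0# ⇔ Zero w
      presented-zero⇔ Zero zero⇔ f w p = mk⇔
        (λ eq → Equivalence.to (zero⇔ w) (trans (sym (eval-presented f w p)) eq))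
        (λ z → trans (eval-presented f w p) (Equivalence.from (zero⇔ w) z))

  private
    module C = CommutativeRing ℂ-commutativeRing
    module S = +-*-Solver
  open Theory ℂ-ring C.isCommutativeRing hiding (coefficients)
  open Rearrangements ℂ-commutativeRing

  ℚ→ℂ-* : ∀ p q → (ℚ→ℂ p *ᶜ ℚ→ℂ q) ≈ᶜ ℚ→ℂ (p * q)
  ℚ→ℂ-* p q = ≈ᶜ-pointwise {ℚ→ℂ p *ᶜ ℚ→ℂ q} {ℚ→ℂ (p * q)}
    (λ _ → S.solve 2 (λ p q → p S.:* q S.:+ S.:- (S.con 0ℚ S.:* S.con 0ℚ) S.:= p S.:* q) ≡.refl p q)
    (λ _ → S.solve 2 (λ p q → p S.:* S.con 0ℚ S.:+ S.con 0ℚ S.:* q S.:= S.con 0ℚ) ≡.refl p q)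

  ℚ→ℂ-+ : ∀ p q → (ℚ→ℂ p +ᶜ ℚ→ℂ q) ≈ᶜ ℚ→ℂ (p + q)
  ℚ→ℂ-+ p q = ≈ᶜ-pointwise {ℚ→ℂ p +ᶜ ℚ→ℂ q} {ℚ→ℂ (p + q)} (λ _ → ≡.refl) (λ _ → ≡.refl)

  ℚ→ℂ-cong : ∀ {p q} → p ≡ q → ℚ→ℂ p ≈ᶜ ℚ→ℂ q
  ℚ→ℂ-cong {p} ≡.refl = C.refl {ℚ→ℂ p}

  ℕ→ℂ-ι : ∀ n → ℕ→ℂ n ≈ᶜ ℚ→ℂ (ι n)
  ℕ→ℂ-ι n = ℚ→ℂ-cong (≡.sym (ι-def n))

  power-ι : ∀ a e → power (ℕ→ℂ a) e ≈ᶜ ℚ→ℂ (ι (a ℕ.^ e))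
  power-ι a zero    = ℚ→ℂ-cong (≡.sym ι-1)
  power-ι a (suc e) = C.trans {ℕ→ℂ a *ᶜ power (ℕ→ℂ a) e} {ℚ→ℂ (ι a) *ᶜ ℚ→ℂ (ι (a ℕ.^ e))} {ℚ→ℂ (ι (a ℕ.^ suc e))}
    (C.*-cong {ℕ→ℂ a} {ℚ→ℂ (ι a)} {power (ℕ→ℂ a) e} {ℚ→ℂ (ι (a ℕ.^ e))} (ℕ→ℂ-ι a) (power-ι a e))
    (C.trans {ℚ→ℂ (ι a) *ᶜ ℚ→ℂ (ι (a ℕ.^ e))} {ℚ→ℂ (ι a * ι (a ℕ.^ e))} {ℚ→ℂ (ι (a ℕ.^ suc e))}
      (ℚ→ℂ-* (ι a) (ι (a ℕ.^ e))) (ℚ→ℂ-cong (≡.sym (ι-* a (a ℕ.^ e)))))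

  -- The inverse of m - n in ℚ, carried over to ℂ. It makes the linear factors of a domain
  -- polynomial comaximal.
  nat-difference-unit : ∀ m n → m ≢ n → ∃[ w ] (w *ᶜ (ℕ→ℂ m +ᶜ -ᶜ ℕ→ℂ n)) ≈ᶜ 1ᶜ
  nat-difference-unit m n m≢n = ℚ→ℂ w , C.trans {ℚ→ℂ w *ᶜ (ℕ→ℂ m +ᶜ -ᶜ ℕ→ℂ n)} {ℚ→ℂ w *ᶜ (ℚ→ℂ (ι m) +ᶜ -ᶜ ℚ→ℂ (ι n))} {1ᶜ}
    (C.*-congˡ {ℚ→ℂ w} {ℕ→ℂ m +ᶜ -ᶜ ℕ→ℂ n} {ℚ→ℂ (ι m) +ᶜ -ᶜ ℚ→ℂ (ι n)}
      (C.+-cong {ℕ→ℂ m} {ℚ→ℂ (ι m)} { -ᶜ ℕ→ℂ n} { -ᶜ ℚ→ℂ (ι n)} (ℕ→ℂ-ι m) (C.-‿cong {ℕ→ℂ n} {ℚ→ℂ (ι n)} (ℕ→ℂ-ι n))))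
    (≈ᶜ-pointwise {ℚ→ℂ w *ᶜ (ℚ→ℂ (ι m) +ᶜ -ᶜ ℚ→ℂ (ι n))} {1ᶜ}
      (λ _ → ≡.trans (drop-zero w r) (ℚₚ.*-inverseˡ r {{nonzero}}))
      (λ _ → im-zero w r))
    where
    r = ι m - ι n
    r≢0 : r ≢ 0ℚ
    r≢0 eq = m≢n (ι-injective (≡.trans (S.solve 2 (λ x y → x S.:= (x S.:- y) S.:+ y) ≡.refl (ι m) (ι n))
      (≡.trans (≡.cong (_+ ι n) eq) (ℚₚ.+-identityˡ (ι n)))))
    nonzero : Rat.NonZero r
    nonzero = Rat.≢-nonZero r≢0
    w = (Rat.1/ r) {{nonzero}}
    drop-zero : ∀ w r → w * r + - (0ℚ * (0ℚ + - 0ℚ)) ≡ w * r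
    drop-zero w r = ℚₚ.+-identityʳ (w * r)
    im-zero : ∀ w r → w * (0ℚ + - 0ℚ) + 0ℚ * r ≡ 0ℚ
    im-zero w r = ≡.cong₂ _+_ (ℚₚ.*-zeroʳ w) (ℚₚ.*-zeroˡ r)

  nthℚ : ∀ {k} → ℕ → Vec ℚ k → ℚ
  nthℚ j u = headOr 0ℚ (drop j (Vec.toList u))

  nthℚ-+ : ∀ {k} j (u w : Vec ℚ k) → nthℚ j (zipWith _+_ u w) ≡ nthℚ j u + nthℚ j w
  nthℚ-+ zero    []      []      = ≡.refl
  nthℚ-+ zero    (x ∷ u) (y ∷ w) = ≡.refl
  nthℚ-+ (suc j) []      []      = ≡.refl
  nthℚ-+ (suc j) (x ∷ u) (y ∷ w) = nthℚ-+ j u w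

  nthℚ-* : ∀ {k} j r (u : Vec ℚ k) → nthℚ j (Vec.map (_* r) u) ≡ nthℚ j u * r
  nthℚ-* zero    r []      = ≡.sym (ℚₚ.*-zeroˡ r)
  nthℚ-* zero    r (x ∷ u) = ≡.refl
  nthℚ-* (suc j) r []      = ≡.sym (ℚₚ.*-zeroˡ r)
  nthℚ-* (suc j) r (x ∷ u) = nthℚ-* j r u

  nthℚ-0 : ∀ k j → nthℚ j (replicate k 0ℚ) ≡ 0ℚ
  nthℚ-0 zero    zero    = ≡.refl
  nthℚ-0 zero    (suc j) = ≡.refl
  nthℚ-0 (suc k) zero    = ≡.refl
  nthℚ-0 (suc k) (suc j) = nthℚ-0 k j

  nthℚ-zero : ∀ {k} (u : Vec ℚ k) → (∀ j → j ℕ.< k → nthℚ j u ≡ 0ℚ) → u ≡ replicate k 0ℚ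
  nthℚ-zero []      eq = ≡.refl
  nthℚ-zero (x ∷ u) eq = ≡.cong₂ _∷_ (eq 0 (ℕ.s≤s ℕ.z≤n)) (nthℚ-zero u (λ j j<k → eq (suc j) (ℕ.s≤s j<k)))

  combination-+ : ∀ {k} (u w : Vec ℚ k) b → (combination u b +ᶜ combination w b) ≈ᶜ combination (zipWith _+_ u w) b
  combination-+ []      []      []      = C.+-identityˡ 0ᶜ
  combination-+ (x ∷ u) (y ∷ w) (z ∷ b) = C.trans
    {((ℚ→ℂ x *ᶜ z) +ᶜ combination u b) +ᶜ ((ℚ→ℂ y *ᶜ z) +ᶜ combination w b)}
    {((ℚ→ℂ x +ᶜ ℚ→ℂ y) *ᶜ z) +ᶜ (combination u b +ᶜ combination w b)}
    {(ℚ→ℂ (x + y) *ᶜ z) +ᶜ combination (zipWith _+_ u w) b}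
    (collect (ℚ→ℂ x) (ℚ→ℂ y) z (combination u b) (combination w b))
    (C.+-cong {(ℚ→ℂ x +ᶜ ℚ→ℂ y) *ᶜ z} {ℚ→ℂ (x + y) *ᶜ z} {combination u b +ᶜ combination w b} {combination (zipWith _+_ u w) b}
      (C.*-congʳ {z} {ℚ→ℂ x +ᶜ ℚ→ℂ y} {ℚ→ℂ (x + y)} (ℚ→ℂ-+ x y)) (combination-+ u w b))

  combination-* : ∀ {k} r (u : Vec ℚ k) b → (combination u b *ᶜ ℚ→ℂ r) ≈ᶜ combination (Vec.map (_* r) u) b
  combination-* r []      []      = C.zeroˡ (ℚ→ℂ r)
  combination-* r (x ∷ u) (z ∷ b) = C.trans
    {((ℚ→ℂ x *ᶜ z) +ᶜ combination u b) *ᶜ ℚ→ℂ r}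
    {((ℚ→ℂ x *ᶜ ℚ→ℂ r) *ᶜ z) +ᶜ (combination u b *ᶜ ℚ→ℂ r)}
    {(ℚ→ℂ (x * r) *ᶜ z) +ᶜ combination (Vec.map (_* r) u) b}
    (expand (ℚ→ℂ x) z (combination u b) (ℚ→ℂ r))
    (C.+-cong {(ℚ→ℂ x *ᶜ ℚ→ℂ r) *ᶜ z} {ℚ→ℂ (x * r) *ᶜ z} {combination u b *ᶜ ℚ→ℂ r} {combination (Vec.map (_* r) u) b}
      (C.*-congʳ {z} {ℚ→ℂ x *ᶜ ℚ→ℂ r} {ℚ→ℂ (x * r)} (ℚ→ℂ-* x r)) (combination-* r u b))

  combination-0 : ∀ {k} (b : Vec ℂ k) → combination (replicate k 0ℚ) b ≈ᶜ 0ᶜ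
  combination-0 []      = C.refl {0ᶜ}
  combination-0 (z ∷ b) = C.trans {(0ᶜ *ᶜ z) +ᶜ combination (replicate _ 0ℚ) b} {0ᶜ +ᶜ 0ᶜ} {0ᶜ}
    (C.+-cong {0ᶜ *ᶜ z} {0ᶜ} {combination (replicate _ 0ℚ) b} {0ᶜ} (C.zeroˡ z) (combination-0 b)) (C.+-identityˡ 0ᶜ)

  module _ {n k : ℕ} (basis : Vec ℂ k) (weight : Vec ℕ n → ℚ) where

    -- If the weights are the values of the monomials at a point, this is the coordinate vector of
    -- the value of the polynomial there. Those weights are rational because the domain elements are
    -- integers, so the value stays in the ℚ-span of the basis.
    coordinates : List (Vec ℚ k × Vec ℕ n) → Vec ℚ k
    coordinates []             = replicate k 0ℚ
    coordinates ((u , α) ∷ ts) = zipWith _+_ (Vec.map (_* weight α) u) (coordinates ts)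

    polynomial : List (Vec ℚ k × Vec ℕ n) → Poly n
    polynomial = List.map (λ (u , α) → combination u basis , α)

    presents : ∀ ts → Presents (zipWith _+_) (λ u r → Vec.map (_* r) u) (replicate k 0ℚ) weight (λ u → combination u basis)
      (polynomial ts) (coordinates ts)
    presents []             = []
    presents ((u , α) ∷ ts) = u ∷ presents ts

    combination-zero⇔ : LinearlyIndependent basis → ∀ w → combination w basis ≈ᶜ 0ᶜ ⇔ (∀ j → j ℕ.< k → nthℚ j w ≡ 0ℚ)
    combination-zero⇔ independent w = mk⇔
      (λ eq j j<k → ≡.trans (≡.cong (nthℚ j) (independent w eq)) (nthℚ-0 k j))
      (λ eq → ≡.subst (λ u → combination u basis ≈ᶜ 0ᶜ) (≡.sym (nthℚ-zero w eq)) (combination-0 basis))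

    eval-zero⇔ : LinearlyIndependent basis → ∀ v → (∀ α → evalMonomial α v ≈ᶜ ℚ→ℂ (weight α)) → ∀ ts →
      eval (polynomial ts) v ≈ᶜ 0ᶜ ⇔ (∀ j → j ℕ.< k → nthℚ j (coordinates ts) ≡ 0ℚ)
    eval-zero⇔ independent v evaluates ts = specialised (polynomial ts) (coordinates ts) (presents ts)
      where
      specialised = Evaluation.presented-zero⇔ ℂ-ring C.isCommutativeRing (zipWith _+_) (λ u r → Vec.map (_* r) u) (replicate k 0ℚ)
        weight (λ u → combination u basis) ℚ→ℂ
        (λ u w → combination-+ u w basis) (λ u r → combination-* r u basis) (combination-0 basis)
        v evaluates (λ w → ∀ j → j ℕ.< k → nthℚ j w ≡ 0ℚ) (combination-zero⇔ independent)

  module Solutions {s : ℕ} (q : Fin s → ℕ) where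
    open MCSP q hiding (point)

    monomialValue : ∀ {n} {δ : Vec (Fin s) n} → Vec ℕ n → Vecᴬ.All D δ → ℕ
    monomialValue []      []       = 1
    monomialValue (e ∷ γ) (a ∷ as) = toℕ a ℕ.^ e ℕ.* monomialValue γ as

    fromFunction : ∀ {n} (δ : Vec (Fin s) n) → (∀ i → D (lookup δ i)) → Vecᴬ.All D δ
    fromFunction []      b = []
    fromFunction (t ∷ δ) b = b zero ∷ fromFunction δ (λ i → b (suc i))

    lookup⁺-fromFunction : ∀ {n} (δ : Vec (Fin s) n) b i → lookup⁺ (fromFunction δ b) i ≡ b i
    lookup⁺-fromFunction (t ∷ δ) b zero    = ≡.refl
    lookup⁺-fromFunction (t ∷ δ) b (suc i) = lookup⁺-fromFunction δ (λ i → b (suc i)) i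

    -- The points are kept as variables v with v ≡ point a: unfolding the arithmetic of ℂ is infeasible.
    At : ∀ {n} {δ : Vec (Fin s) n} → Vec ℂ n → Vecᴬ.All D δ → Set
    At v a = ∀ i → lookup v i ≡ ℕ→ℂ (toℕ (lookup⁺ a i))

    evalMonomial-At : ∀ {n} {δ : Vec (Fin s) n} (γ : Vec ℕ n) (a : Vecᴬ.All D δ) v → At v a →
      evalMonomial γ v ≈ᶜ ℚ→ℂ (ι (monomialValue γ a))
    evalMonomial-At []      []       []      at = ℚ→ℂ-cong (≡.sym ι-1)
    evalMonomial-At (e ∷ γ) (a ∷ as) (z ∷ v) at = C.trans
      {power z e *ᶜ evalMonomial γ v} {ℚ→ℂ (ι (toℕ a ℕ.^ e)) *ᶜ ℚ→ℂ (ι (monomialValue γ as))} {ℚ→ℂ (ι (monomialValue (e ∷ γ) (a ∷ as)))}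
      (C.*-cong {power z e} {ℚ→ℂ (ι (toℕ a ℕ.^ e))} {evalMonomial γ v} {ℚ→ℂ (ι (monomialValue γ as))}
        (power-at (at zero)) (evalMonomial-At γ as v (λ i → at (suc i))))
      (C.trans {ℚ→ℂ (ι (toℕ a ℕ.^ e)) *ᶜ ℚ→ℂ (ι (monomialValue γ as))} {ℚ→ℂ (ι (toℕ a ℕ.^ e) * ι (monomialValue γ as))} {ℚ→ℂ (ι (monomialValue (e ∷ γ) (a ∷ as)))}
        (ℚ→ℂ-* (ι (toℕ a ℕ.^ e)) (ι (monomialValue γ as))) (ℚ→ℂ-cong (≡.sym (ι-* (toℕ a ℕ.^ e) (monomialValue γ as)))))
      where
      power-at : z ≡ ℕ→ℂ (toℕ a) → power z e ≈ᶜ ℚ→ℂ (ι (toℕ a ℕ.^ e))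
      power-at ≡.refl = power-ι (toℕ a) e

    lookup-point : ∀ {n} {δ : Vec (Fin s) n} (a : Vecᴬ.All D δ) → At (MCSP.point q a) a
    lookup-point (a ∷ as) zero    = ≡.refl
    lookup-point (a ∷ as) (suc i) = lookup-point as i

    restriction : ∀ {n k} (δ : Vec (Fin s) n) {σ : Vec (Fin s) k} →
      Vecᴬ.All (λ t → Σ (Fin n) λ x → lookup δ x ≡ t) σ → Vecᴬ.All D δ → Vecᴬ.All D σ
    restriction δ []                     a = []
    restriction δ ((x , ≡.refl) ∷ scope) a = lookup⁺ a x ∷ restriction δ scope a

    point-restriction : ∀ {n k} (δ : Vec (Fin s) n) {σ : Vec (Fin s) k} (scope : Vecᴬ.All (λ t → Σ (Fin n) λ x → lookup δ x ≡ t) σ) a v → At v a →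
      Vec.map (lookup v) (Vecᴬ.reduce proj₁ scope) ≡ MCSP.point q (restriction δ scope a)
    point-restriction δ []                     a v at = ≡.refl
    point-restriction δ ((x , ≡.refl) ∷ scope) a v at = ≡.cong₂ _∷_ (at x) (point-restriction δ scope a v at)

    module _ {l : ℕ} (Γ : Language l) (F : Interpolants Γ) (P : Instance Γ) where

      Solves : Vecᴬ.All D (sort P) → Constraint Γ (sort P) → Set
      Solves a C = restriction (sort P) (scope C) a ∈ᴿ holds (lookup Γ (rel C))

      generators-vanish : ∀ a v → At v a → All (Solves a) (constraints P) → ∀ {h} → Generator Γ F P h → eval h v ≈ᶜ 0ᶜ
      generators-vanish a v at sol (domain x) = vanishes
        where
        vanishes = eval-domain v x (λ b → ℕ→ℂ (toℕ b)) (∈-allFin (lookup⁺ a x)) (at x)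
      generators-vanish a v at sol (constraint {C} C∈) = vanishes
        where
        vanishes = eval-rename-at (variables C) (proj₁ (F (rel C))) v (MCSP.point q (restriction (sort P) (scope C) a))
          (point-restriction (sort P) (scope C) a v at)
          (proj₁ (proj₂ (F (rel C)) (restriction (sort P) (scope C) a)) (All.lookup sol C∈))

      ideal⇒vanishing : ∀ f → f ∈⟨ Generator Γ F P ⟩ → ∀ a v → At v a → All (Solves a) (constraints P) → eval f v ≈ᶜ 0ᶜ
      ideal⇒vanishing f f∈ a v at sol = vanishes
        where
        vanishes = vanishing {f = f} {Generator Γ F P} f∈ v (λ {h} → generators-vanish a v at sol {h})

      violation : ∀ a v → At v a → (∃[ C ] (C ∈ constraints P × ¬ Solves a C)) → ∃[ g ] (Generator Γ F P g × ∃[ w ] (eval g v *ᶜ w) ≈ᶜ 1ᶜ)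
      violation a v at (C , C∈ , violated) = rename (variables C) (proj₁ (F (rel C))) , constraint C∈ , unit
        where
        unit = eval-rename-unit (variables C) (proj₁ (F (rel C))) v (MCSP.point q (restriction (sort P) (scope C) a))
          (point-restriction (sort P) (scope C) a v at)
          (proj₂ (proj₂ (F (rel C)) (restriction (sort P) (scope C) a)) violated)

      -- The distinction is whether the point solves the instance, which is decidable because
      -- relations are Boolean valued; vanishing of a complex number could not be decided
      -- constructively.
      cases : ∀ f → (∀ a v → At v a → All (Solves a) (constraints P) → eval f v ≈ᶜ 0ᶜ) → ∀ a v → At v a →
        Dec (All (Solves a) (constraints P)) →
        eval f v ≈ᶜ 0ᶜ ⊎ (∃[ g ] (Generator Γ F P g × ∃[ w ] (eval g v *ᶜ w) ≈ᶜ 1ᶜ))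
      cases f vanish a v at (yes sol) = inj₁ (vanish a v at sol)
      cases f vanish a v at (no ¬sol) = inj₂ (violation a v at
        (find (¬All⇒Any¬ (λ C → T? (holds (lookup Γ (rel C)) (restriction (sort P) (scope C) a))) (constraints P) ¬sol)))

      vanishing⇒ideal : ∀ f → (∀ a v → At v a → All (Solves a) (constraints P) → eval f v ≈ᶜ 0ᶜ) → f ∈⟨ Generator Γ F P ⟩
      vanishing⇒ideal f vanish = member
        where
        member = Nullstellensatz.nullstellensatz ℂ-ring C.isCommutativeRing (#vars P) (Generator Γ F P) (λ i → q (lookup (sort P) i)) (λ i b → ℕ→ℂ (toℕ b))
          (λ i b b′ b≢b′ → nat-difference-unit (toℕ b) (toℕ b′) (λ e → b≢b′ (toℕ-injective e)))
          domain f (λ b v at → cases f vanish (fromFunction (sort P) b) v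
            (λ i → ≡.trans (at i) (≡.cong (λ c → ℕ→ℂ (toℕ c)) (≡.sym (lookup⁺-fromFunction (sort P) b i))))
            (All.all? (λ C → T? (holds (lookup Γ (rel C)) (restriction (sort P) (scope C) (fromFunction (sort P) b)))) (constraints P)))

-- The verdict as vanishing on the solution set

module Orthogonality where

  open import Defs
  open Elimination
  open Counting
  open VerdictProgram
  open RationalTest
  open ComplexPoints
  open import Data.Bool.Base using (Bool; true; false; not; _∧_)
  open import Data.Bool.ListAction using (all)
  open import Data.Fin.Base using (fromℕ)
  open import Data.Fin.Properties using (toℕ-fromℕ)
  open import Data.List.Base as List using (List; []; _∷_; length; map; upTo; drop)
  open import Data.List.Properties using (map-∘; map-cong)
  open import Data.List.Membership.Propositional using (_∈_)
  open import Data.List.Membership.Propositional.Properties using (∈-upTo⁺; ∈-upTo⁻; ∈-map⁺; ∈-map⁻)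
  open import Data.List.Relation.Unary.Any using (here; there)
  open import Data.List.Relation.Unary.All as All using (All; []; _∷_)
  import Data.List.Relation.Binary.Pointwise as PW
  open import Data.Nat.Base as ℕ using (ℕ; zero; suc; z≤n; s≤s)
  import Data.Nat.Properties as ℕₚ
  open import Data.Nat.Divisibility using (_∣_)
  open import Data.Nat.Coprimality using (Coprime)
  open import Data.Rational.Base using (ℚ; 0ℚ; 1ℚ; _+_; _*_; _≤_)
  import Data.Rational.Properties as ℚₚ
  open import Data.Rational.Solver using (module +-*-Solver)
  open import Data.Vec.Base as Vec using (Vec; []; _∷_; lookup; zipWith)
  open import Data.Vec.Properties using (length-toList)
  import Data.Vec.Relation.Unary.All as Vecᴬ
  open Vecᴬ using ([]; _∷_)
  open import Relation.Binary.PropositionalEquality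
  open import Relation.Nullary using (Dec; does; yes; no; contradiction)
  open import Relation.Nullary.Decidable using (dec-true)

  all⇔ : ∀ {A : Set} (p : A → Bool) as → all p as ≡ true ⇔ (∀ {a} → a ∈ as → p a ≡ true)
  all⇔ p as = mk⇔ (to as) (from as)
    where
    to : ∀ as → all p as ≡ true → ∀ {a} → a ∈ as → p a ≡ true
    to (b ∷ as) eq a∈ with p b in pb | a∈
    ... | true | here refl = pb
    ... | true | there a∈′ = to as eq a∈′
    from : ∀ as → (∀ {a} → a ∈ as → p a ≡ true) → all p as ≡ true
    from []       h = refl
    from (b ∷ as) h = cong₂ _∧_ (h (here refl)) (from as (λ a∈ → h (there a∈)))

  encodeList-map : ∀ {A B : Set} (f : B → Tree) (h : A → B) as → encodeList f (map h as) ≡ encodeList (λ a → f (h a)) as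
  encodeList-map f h []       = refl
  encodeList-map f h (a ∷ as) = cong (cons (f (h a))) (encodeList-map f h as)

  encodeList-cong : ∀ {A : Set} {f g : A → Tree} → (∀ a → f a ≡ g a) → ∀ as → encodeList f as ≡ encodeList g as
  encodeList-cong eq []       = refl
  encodeList-cong eq (a ∷ as) = cong₂ cons (eq a) (encodeList-cong eq as)

  entry-ratOf : ∀ j us → entry j (map ratOf us) ≡ ratOf (headOr 0ℚ (drop j us))
  entry-ratOf zero    []       = refl
  entry-ratOf zero    (u ∷ us) = refl
  entry-ratOf (suc j) []       = refl
  entry-ratOf (suc j) (u ∷ us) = entry-ratOf j us

  ∑-member-zero : ∀ {A : Set} (f : A → ℕ) as → ∑ as f ≡ 0 → ∀ {a} → a ∈ as → f a ≡ 0
  ∑-member-zero f (b ∷ as) eq (here refl) = ℕₚ.m+n≡0⇒m≡0 (f b) eq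
  ∑-member-zero f (b ∷ as) eq (there a∈)  = ∑-member-zero f as (ℕₚ.m+n≡0⇒n≡0 (f b) eq) a∈

  module Correctness {s : ℕ} (q : Fin s → ℕ) (Q′ : ℕ) (q∣Q : ∀ t → q t ∣ suc Q′) (0<q : ∀ t → 0 ℕ.< q t)
    (coprime : ∀ t t′ → t ≢ t′ → Coprime (q t) (q t′))
    (ratio : ∀ t (h₁ h₂ : Fin (suc Q′)) → Choice (q t) h₁ h₂)
    (annih : ∀ t (h : Fin (suc Q′)) → Σ (Fin (suc Q′)) λ u → ∀ b → q t ∣ toℕ u ℕ.* b ⇔ (∃[ y ] q t ∣ toℕ h ℕ.* y ℕ.+ b))
    {l : ℕ} (Γ : MCSP.Language q l) (invariant : ∀ r → MCSP.AffineInvariant q (lookup Γ r)) (d : ℕ)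
    where
    open Algorithm q Q′ q∣Q 0<q coprime ratio annih
    open Verdict Γ invariant (d ℕ.+ d)

    module Solved (P : Instance Γ) {dim : ℕ} where
      n = #vars P
      δ = sort P
      cs = constraints P

      -- Each term carries its own degree bound, so that `counts`, which is indexed by pairs of
      -- terms, can verify that the budget suffices.
      Bounded : Set
      Bounded = Σ (Vec ℚ dim × Vec ℕ n) λ (_ , α) → Vec.sum α ℕ.≤ d

      coords : Bounded → Vec ℚ dim
      coords ((u , _) , _) = u

      mono : Bounded → Vec ℕ n
      mono ((_ , α) , _) = α

      plainTerm : Vec ℚ dim × Vec ℕ n → Term
      plainTerm (u , α) = map ratOf (Vec.toList u) , Vec.toList α

      R : System
      R = initial n (map plain cs)

      σ : Vecᴬ.All D δ → Bool
      σ a = does (sat? R a)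

      N : ℕ
      N = ∑ (assigns δ) (λ a → ind (σ a) 1)

      S : Vec ℕ n → ℕ
      S γ = ∑ (assigns δ) (λ a → ind (σ a) (monomial γ a))

      itemsOf-toList : ∀ {m} (δ : Vec (Fin s) m) α β → itemsOf (Vec.toList δ) (Vec.toList α) (Vec.toList β) ≡ items δ (zipWith ℕ._+_ α β)
      itemsOf-toList []      []      []      = refl
      itemsOf-toList (t ∷ δ) (a ∷ α) (b ∷ β) = cong ((t , a ℕ.+ b) ∷_) (itemsOf-toList δ α β)

      bs : Bounded → Bounded → List Branch
      bs t t′ = branches (Vec.toList δ) (map plain cs) (Vec.toList (mono t)) (Vec.toList (mono t′))

      bs≡ : ∀ t t′ → bs t t′ ≡ leaves (items δ (zipWith ℕ._+_ (mono t) (mono t′))) (fromℕ (d ℕ.+ d) , (tab R , 1))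
      bs≡ t t′ = cong₂ (λ its m → leaves its (fromℕ (d ℕ.+ d) , (tab (initial m (map plain cs)) , 1)))
        (itemsOf-toList δ (mono t) (mono t′)) (length-toList δ)

      support≤ : ∀ {m} (α β : Vec ℕ m) → support (zipWith ℕ._+_ α β) ℕ.≤ Vec.sum α ℕ.+ Vec.sum β
      support≤ []          []          = z≤n
      support≤ (zero ∷ α)  (zero ∷ β)  = support≤ α β
      support≤ (zero ∷ α)  (suc b ∷ β) = ℕₚ.≤-trans (s≤s (support≤ α β))
        (ℕₚ.≤-trans (ℕₚ.≤-reflexive (sym (ℕₚ.+-suc (Vec.sum α) (Vec.sum β)))) (ℕₚ.+-monoʳ-≤ (Vec.sum α) (s≤s (ℕₚ.m≤n+m _ b))))
      support≤ (suc a ∷ α) (b ∷ β)     = s≤s (ℕₚ.≤-trans (support≤ α β) (ℕₚ.+-mono-≤ (ℕₚ.m≤n+m _ a) (ℕₚ.m≤n+m _ b)))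

      γ : Bounded → Bounded → Vec ℕ n
      γ t t′ = zipWith ℕ._+_ (mono t) (mono t′)

      counts : ∀ t t′ → ∃[ c ] (1 ℕ.≤ c × (S (γ t t′) ≡ c ℕ.* total (bs t t′)) × (N ≡ c ℕ.* count (bs t t′)))
      counts t t′ =
        let c , 1≤c , prop = proportional δ (γ t t′) (fromℕ (d ℕ.+ d)) R
              (ℕₚ.≤-trans (support≤ (mono t) (mono t′)) (ℕₚ.≤-trans (ℕₚ.+-mono-≤ (proj₂ t) (proj₂ t′)) (ℕₚ.≤-reflexive (sym (toℕ-fromℕ (d ℕ.+ d))))))
              (initial-WF n (map plain cs))
            eqV , eqK = prop R (λ t → PW.refl refl) 1
        in c , 1≤c ,
           trans (∑-cong (assigns δ) (λ a → cong (ind (σ a)) (sym (ℕₚ.*-identityˡ (monomial (γ t t′) a)))))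
             (trans eqV (cong (λ b → c ℕ.* total b) (sym (bs≡ t t′)))) ,
           trans eqK (cong (λ b → c ℕ.* count b) (sym (bs≡ t t′)))

      -- Both sides are c times count times total. The unknown c drops out, and the quotient that
      -- the program computes is the true moment.
      balanced : ∀ t′ t → N ℕ.* total (bs t t′) ≡ count (bs t t′) ℕ.* S (γ t t′)
      balanced t′ t = let c , _ , eqV , eqK = counts t t′ in
        trans (cong (ℕ._* total (bs t t′)) (trans eqK (ℕₚ.*-comm c (count (bs t t′)))))
          (trans (ℕₚ.*-assoc (count (bs t t′)) c _) (cong (count (bs t t′) ℕ.*_) (sym eqV)))

      product-zero : ∀ {c k} → 1 ℕ.≤ c → c ℕ.* k ≡ 0 → k ≡ 0
      product-zero {suc c} {k} _ eq = ℕₚ.m+n≡0⇒m≡0 k eq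

      unsolved : N ≡ 0 → ∀ a → σ a ≡ false
      unsolved eq a = ind-zero (σ a) (∑-member-zero (λ a → ind (σ a) 1) (assigns δ) eq (∈-assigns a))
        where
        ind-zero : ∀ b → ind b 1 ≡ 0 → b ≡ false
        ind-zero false _ = refl

      S-zero : N ≡ 0 → ∀ γ → S γ ≡ 0
      S-zero eq γ = trans (∑-cong (assigns δ) (λ a → cong (λ b → ind b (monomial γ a)) (unsolved eq a))) (∑-zero (assigns δ))

      module _ (ts : List Bounded) where

        T : ℕ → Bounded → ℚ
        T j t′ = ∑ℚ ts (λ t → nthℚ j (coords t) * ι (S (γ t t′)))

        input : Input
        input = (Vec.toList δ , map plain cs) , map plainTerm (map proj₁ ts)

        fracs : ∀ j t′ → map (frac input (Vec.toList (mono t′)) j) (proj₂ input) ≡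
          map (item (λ t → nthℚ j (coords t)) (λ t → total (bs t t′)) (λ t → count (bs t t′)) (λ t → S (γ t t′)) N (balanced t′)) ts
        fracs j t′ = trans (sym (map-∘ (map proj₁ ts))) (trans (sym (map-∘ ts))
          (map-cong (λ t → cong (_, (total (bs t t′) , count (bs t t′))) (entry-ratOf j (Vec.toList (coords t)))) ts))

        zeroTest⇔ : ∀ j t′ → 0 ℕ.< N → zeroTest (map (frac input (Vec.toList (mono t′)) j) (proj₂ input)) ≡ true ⇔ T j t′ ≡ 0ℚ
        zeroTest⇔ j t′ 0<N = subst (λ fs → zeroTest fs ≡ true ⇔ T j t′ ≡ 0ℚ) (sym (fracs j t′))
          (zeroTest-correct (λ t → nthℚ j (coords t)) (λ t → total (bs t t′)) (λ t → count (bs t t′)) (λ t → S (γ t t′)) N (balanced t′) ts 0<N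
            (λ t → let c , _ , _ , eqK = counts t t′ in ℕₚ.n≢0⇒n>0 (λ k≡0 → ℕₚ.<⇒≢ 0<N (sym (trans eqK (trans (cong (c ℕ.*_) k≡0) (ℕₚ.*-zeroʳ c)))))))

        zeroTest-unsolved : ∀ j t′ → N ≡ 0 → zeroTest (map (frac input (Vec.toList (mono t′)) j) (proj₂ input)) ≡ true
        zeroTest-unsolved j t′ N≡0 = subst (λ fs → zeroTest fs ≡ true) (sym (fracs j t′))
          (zeroTest-empty (λ t → nthℚ j (coords t)) (λ t → total (bs t t′)) (λ t → count (bs t t′)) (λ t → S (γ t t′)) N (balanced t′) ts
            (λ t → let c , 1≤c , eqV , _ = counts t t′ in product-zero 1≤c (trans (sym eqV) (S-zero N≡0 (γ t t′))))
            (λ t → let c , 1≤c , _ , eqK = counts t t′ in product-zero 1≤c (trans (sym eqK) N≡0)))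

        f : ℕ → Vecᴬ.All D δ → ℚ
        f j a = ∑ℚ ts (λ t → nthℚ j (coords t) * ι (monomial (mono t) a))

        χ : Vecᴬ.All D δ → ℚ
        χ a = ι (ind (σ a) 1)

        monomial-+ : ∀ {m} {δ : Vec (Fin s) m} (α β : Vec ℕ m) (a : Vecᴬ.All D δ) →
          monomial (zipWith ℕ._+_ α β) a ≡ monomial α a ℕ.* monomial β a
        monomial-+ []      []      []       = refl
        monomial-+ (x ∷ α) (y ∷ β) (a ∷ as) = trans (cong₂ ℕ._*_ (ℕₚ.^-distribˡ-+-* (toℕ a) x y) (monomial-+ α β as))
          (ℕsolve 4 (λ p q r s → (p :* q) :* (r :* s) := (p :* r) :* (q :* s)) refl (toℕ a ℕ.^ x) (toℕ a ℕ.^ y) (monomial α as) (monomial β as))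
          where open import Data.Nat.Solver using () renaming (module +-*-Solver to ℕSolver)
                open ℕSolver using (_:*_; _:=_) renaming (solve to ℕsolve)

        open +-*-Solver using (solve; _:+_; _:*_; _:=_)

        -- Exponents add in a product of monomials, so after interchanging the sums T j t′ is the
        -- inner product, over the solutions, of the j-th coordinate of f with the monomial of t′.
        T-as-sum : ∀ j t′ → T j t′ ≡ ∑ℚ (assigns δ) (λ a → (χ a * ι (monomial (mono t′) a)) * f j a)
        T-as-sum j t′ = begin
          ∑ℚ ts (λ t → nthℚ j (coords t) * ι (S (γ t t′)))
            ≡⟨ ∑ℚ-cong ts (λ t → trans (cong (nthℚ j (coords t) *_) (ι-∑ (λ a → ind (σ a) (monomial (γ t t′) a)) (assigns δ)))
                 (∑ℚ-*ˡ (nthℚ j (coords t)) (λ a → ι (ind (σ a) (monomial (γ t t′) a))) (assigns δ))) ⟩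
          ∑ℚ ts (λ t → ∑ℚ (assigns δ) (λ a → nthℚ j (coords t) * ι (ind (σ a) (monomial (γ t t′) a))))
            ≡⟨ ∑ℚ-swap (λ t a → nthℚ j (coords t) * ι (ind (σ a) (monomial (γ t t′) a))) ts (assigns δ) ⟩
          ∑ℚ (assigns δ) (λ a → ∑ℚ ts (λ t → nthℚ j (coords t) * ι (ind (σ a) (monomial (γ t t′) a))))
            ≡⟨ ∑ℚ-cong (assigns δ) (λ a → trans (∑ℚ-cong ts (λ t → split a t)) (sym (∑ℚ-*ˡ (χ a * ι (monomial (mono t′) a)) _ ts))) ⟩
          ∑ℚ (assigns δ) (λ a → (χ a * ι (monomial (mono t′) a)) * f j a) ∎
          where
          open ≡-Reasoning
          split : ∀ a t → nthℚ j (coords t) * ι (ind (σ a) (monomial (γ t t′) a)) ≡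
            (χ a * ι (monomial (mono t′) a)) * (nthℚ j (coords t) * ι (monomial (mono t) a))
          split a t = trans (cong (nthℚ j (coords t) *_) (trans (cong ι (ind-* (σ a) (monomial (γ t t′) a)))
              (trans (ι-* (monomial (γ t t′) a) (ind (σ a) 1)) (cong (_* χ a) (trans (cong ι (monomial-+ (mono t) (mono t′) a)) (ι-* (monomial (mono t) a) (monomial (mono t′) a)))))))
            (solve 4 (λ u x y c → u :* ((x :* y) :* c) := (c :* y) :* (u :* x)) refl (nthℚ j (coords t)) (ι (monomial (mono t) a)) (ι (monomial (mono t′) a)) (χ a))

        χ-true : ∀ a → σ a ≡ true → χ a ≡ 1ℚ
        χ-true a eq = trans (cong (λ b → ι (ind b 1)) eq) ι-1

        -- One factor is expanded into monomials and the other is left inside T: the j-th coordinate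
        -- of f lies in the span of the monomials to which it is orthogonal.
        squares : ∀ j → (∀ t′ → t′ ∈ ts → T j t′ ≡ 0ℚ) → ∑ℚ (assigns δ) (λ a → χ a * (f j a * f j a)) ≡ 0ℚ
        squares j T≡0 = begin
          ∑ℚ (assigns δ) (λ a → χ a * (f j a * f j a))
            ≡⟨ ∑ℚ-cong (assigns δ) (λ a → trans (solve 2 (λ c x → c :* (x :* x) := (c :* x) :* x) refl (χ a) (f j a))
                 (trans (∑ℚ-*ˡ (χ a * f j a) (λ t′ → nthℚ j (coords t′) * ι (monomial (mono t′) a)) ts)
                   (∑ℚ-cong ts (λ t′ → solve 4 (λ c x u m → (c :* x) :* (u :* m) := u :* ((c :* m) :* x)) refl (χ a) (f j a) (nthℚ j (coords t′)) (ι (monomial (mono t′) a)))))) ⟩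
          ∑ℚ (assigns δ) (λ a → ∑ℚ ts (λ t′ → nthℚ j (coords t′) * ((χ a * ι (monomial (mono t′) a)) * f j a)))
            ≡⟨ ∑ℚ-swap (λ a t′ → nthℚ j (coords t′) * ((χ a * ι (monomial (mono t′) a)) * f j a)) (assigns δ) ts ⟩
          ∑ℚ ts (λ t′ → ∑ℚ (assigns δ) (λ a → nthℚ j (coords t′) * ((χ a * ι (monomial (mono t′) a)) * f j a)))
            ≡⟨ ∑ℚ-cong ts (λ t′ → trans (sym (∑ℚ-*ˡ (nthℚ j (coords t′)) (λ a → (χ a * ι (monomial (mono t′) a)) * f j a) (assigns δ)))
                 (cong (nthℚ j (coords t′) *_) (sym (T-as-sum j t′)))) ⟩
          ∑ℚ ts (λ t′ → nthℚ j (coords t′) * T j t′)   ≡⟨ vanish ts (λ t′∈ → t′∈) ⟩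
          0ℚ ∎
          where
          open ≡-Reasoning
          vanish : ∀ us → (∀ {t′} → t′ ∈ us → t′ ∈ ts) → ∑ℚ us (λ t′ → nthℚ j (coords t′) * T j t′) ≡ 0ℚ
          vanish []       sub = refl
          vanish (t′ ∷ us) sub = trans (cong₂ _+_ (trans (cong (nthℚ j (coords t′) *_) (T≡0 t′ (sub (here refl)))) (ℚₚ.*-zeroʳ (nthℚ j (coords t′))))
            (vanish us (λ t′∈ → sub (there t′∈)))) (ℚₚ.+-identityˡ 0ℚ)

        -- A sum of squares over ℚ vanishes only if every square does. This positivity is why the
        -- test works with rational coordinates and not with the complex values themselves.
        orthogonal⇒vanishing : ∀ j → (∀ t′ → t′ ∈ ts → T j t′ ≡ 0ℚ) → ∀ a → σ a ≡ true → f j a ≡ 0ℚ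
        orthogonal⇒vanishing j T≡0 a sat = p*p≡0⇒p≡0 (f j a) (trans (sym (trans (cong (_* (f j a * f j a)) (χ-true a sat)) (ℚₚ.*-identityˡ _)))
          (∑-nonneg-zero (λ a → χ a * (f j a * f j a)) (assigns δ) nonneg (squares j T≡0) (∈-assigns a)))
          where
          nonneg : ∀ a → 0ℚ ≤ χ a * (f j a * f j a)
          nonneg a with σ a in eq
          ... | true  = subst (0ℚ ≤_) (sym (trans (cong (_* (f j a * f j a)) ι-1) (ℚₚ.*-identityˡ _))) (0≤p*p (f j a))
          ... | false = ℚₚ.≤-reflexive (sym (trans (cong (_* (f j a * f j a)) ι-0) (ℚₚ.*-zeroˡ (f j a * f j a))))

        vanishing⇒orthogonal : ∀ j → (∀ a → σ a ≡ true → f j a ≡ 0ℚ) → ∀ t′ → T j t′ ≡ 0ℚ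
        vanishing⇒orthogonal j f≡0 t′ = trans (T-as-sum j t′) (trans (∑ℚ-cong (assigns δ) zero-term) (∑ℚ-zero (assigns δ)))
          where
          zero-term : ∀ a → (χ a * ι (monomial (mono t′) a)) * f j a ≡ 0ℚ
          zero-term a with σ a in eq
          ... | true  = trans (cong ((ι 1 * ι (monomial (mono t′) a)) *_) (f≡0 a eq)) (ℚₚ.*-zeroʳ (ι 1 * ι (monomial (mono t′) a)))
          ... | false = trans (cong (_* f j a) (trans (cong (_* ι (monomial (mono t′) a)) ι-0) (ℚₚ.*-zeroˡ (ι (monomial (mono t′) a))))) (ℚₚ.*-zeroˡ (f j a))

        main⇔ : all (orthogonal input) (proj₂ input) ≡ true ⇔ (∀ a → σ a ≡ true → ∀ j → j ℕ.< dim → f j a ≡ 0ℚ)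
        main⇔ with ℕₚ._≟_ N 0
        -- Without solutions the vanishing condition is vacuous, and the tests, run on fractions
        -- 0/0, all accept.
        ... | yes N≡0 = mk⇔
          (λ _ a sat → contradiction (trans (sym sat) (unsolved N≡0 a)) (λ ()))
          (λ _ → Equivalence.from (all⇔ (orthogonal input) (proj₂ input)) (λ β∈ → tested (∈-map⁻ plainTerm β∈)))
          where
          tested : ∀ {β} → ∃[ u ] (u ∈ map proj₁ ts × β ≡ plainTerm u) → orthogonal input β ≡ true
          tested (u , u∈ , refl) with ∈-map⁻ proj₁ u∈
          ... | t′ , t′∈ , refl = Equivalence.from (all⇔ _ (upTo (length (proj₁ (plainTerm u))))) (λ {j} _ → zeroTest-unsolved j t′ N≡0)
        ... | no N≢0 = mk⇔
          (λ eq a sat j j<dim → orthogonal⇒vanishing j (λ t′ t′∈ → Equivalence.to (zeroTest⇔ j t′ (ℕₚ.n≢0⇒n>0 N≢0))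
            (Equivalence.to (all⇔ _ (upTo (length (proj₁ (plainTerm (proj₁ t′))))))
              (Equivalence.to (all⇔ (orthogonal input) (proj₂ input)) eq (∈-map⁺ plainTerm (∈-map⁺ proj₁ t′∈)))
              (∈-upTo⁺ (subst (j ℕ.<_) (sym (length-coords t′)) j<dim)))) a sat)
          (λ f≡0 → Equivalence.from (all⇔ (orthogonal input) (proj₂ input)) (λ β∈ → tested f≡0 (∈-map⁻ plainTerm β∈)))
          where
          length-coords : ∀ t′ → length (map ratOf (Vec.toList (coords t′))) ≡ dim
          length-coords t′ = trans (Data.List.Properties.length-map ratOf (Vec.toList (coords t′))) (length-toList (coords t′))
            where import Data.List.Properties
          tested : (∀ a → σ a ≡ true → ∀ j → j ℕ.< dim → f j a ≡ 0ℚ) → ∀ {β} → ∃[ u ] (u ∈ map proj₁ ts × β ≡ plainTerm u) → orthogonal input β ≡ true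
          tested f≡0 (u , u∈ , refl) with ∈-map⁻ proj₁ u∈
          ... | t′ , t′∈ , refl = Equivalence.from (all⇔ _ (upTo (length (proj₁ (plainTerm u))))) (λ {j} j∈ →
            Equivalence.from (zeroTest⇔ j t′ (ℕₚ.n≢0⇒n>0 N≢0))
              (vanishing⇒orthogonal j (λ a sat → f≡0 a sat j (subst (j ℕ.<_) (length-coords t′) (∈-upTo⁻ j∈))) t′))

        satisfiable? : Bool
        satisfiable? = all (λ (r , _) → not (unsatisfiable r)) (map plain cs)

        satisfiable⇒ : satisfiable? ≡ true → All (λ C → unsatisfiable (rel C) ≡ false) cs
        satisfiable⇒ eq = All.tabulate (λ C∈ → not-true (Equivalence.to (all⇔ (λ (r , _) → not (unsatisfiable r)) (map plain cs)) eq (∈-map⁺ plain C∈)))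
          where
          not-true : ∀ {b} → not b ≡ true → b ≡ false
          not-true {false} _ = refl

        solved⇒satisfiable : ∀ a → All (Holds! a) cs → satisfiable? ≡ true
        solved⇒satisfiable a hs = Equivalence.from (all⇔ (λ (r , _) → not (unsatisfiable r)) (map plain cs)) (λ c∈ → go (∈-map⁻ plain c∈))
          where
          go : ∀ {c : Con} → ∃[ C ] (C ∈ cs × c ≡ plain C) → not (unsatisfiable (proj₁ c)) ≡ true
          go (C , C∈ , refl) = cong not (unsatisfiable-sound C a (All.lookup hs C∈))

        verdict⇔ : verdict input ≡ true ⇔ (∀ a → All (Holds! a) cs → ∀ j → j ℕ.< dim → f j a ≡ 0ℚ)
        verdict⇔ with satisfiable? in sat-eq
        ... | false = mk⇔ (λ _ a hs → contradiction (trans (sym sat-eq) (solved⇒satisfiable a hs)) (λ ())) (λ _ → refl)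
        ... | true  = mk⇔
          (λ eq a hs → Equivalence.to main⇔ eq a (dec-true (sat? R a) (Equivalence.from (initial-Sat cs a (satisfiable⇒ sat-eq)) hs)))
          (λ van → Equivalence.from main⇔ (λ a sat → van a (Equivalence.to (initial-Sat cs a (satisfiable⇒ sat-eq)) (true⇒ (sat? R a) sat))))
          where
          true⇒ : ∀ {A : Set} (d : Dec A) → does d ≡ true → A
          true⇒ (yes a) _ = a

-- From the encoded input to the decision in polynomial time

module Reduction where

  open import Defs
  open TreePrograms
  open Elimination
  open VerdictProgram
  open RationalTest
  open ComplexPoints
  open Orthogonality
  open import Data.Bool.Base using (true)
  open import Data.List.Base using (List; []; _∷_; map)
  open import Data.List.Relation.Unary.All as All using (All; []; _∷_)
  open import Data.Nat.Base as ℕ using (ℕ; suc)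
  open import Data.Nat.Divisibility using (_∣_)
  open import Data.Nat.Coprimality using (Coprime)
  open import Data.Rational.Base using (ℚ; 0ℚ; _+_; _*_)
  open import Data.Vec.Base as Vec using (Vec; []; _∷_; lookup)
  import Data.Vec.Relation.Unary.All as Vecᴬ
  open Vecᴬ using ([]; _∷_)
  open import Relation.Binary.PropositionalEquality

  module Decision {s : ℕ} (q : Fin s → ℕ) (Q′ : ℕ) (q∣Q : ∀ t → q t ∣ suc Q′) (0<q : ∀ t → 0 ℕ.< q t)
    (coprime : ∀ t t′ → t ≢ t′ → Coprime (q t) (q t′))
    (ratio : ∀ t (h₁ h₂ : Fin (suc Q′)) → Choice (q t) h₁ h₂)
    (annih : ∀ t (h : Fin (suc Q′)) → Σ (Fin (suc Q′)) λ u → ∀ b → q t ∣ toℕ u ℕ.* b ⇔ (∃[ y ] q t ∣ toℕ h ℕ.* y ℕ.+ b))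
    {l : ℕ} (Γ : MCSP.Language q l) (invariant : ∀ r → MCSP.AffineInvariant q (lookup Γ r)) (F : MCSP.Interpolants q Γ) (d : ℕ)
    where
    open Algorithm q Q′ q∣Q 0<q coprime ratio annih
    open Verdict Γ invariant (d ℕ.+ d)
    open Correctness q Q′ q∣Q 0<q coprime ratio annih Γ invariant d
    open Solutions q using (monomialValue; At; evalMonomial-At; lookup-point; restriction; Solves; ideal⇒vanishing; vanishing⇒ideal)

    monomialValue≡monomial : ∀ {n} {δ : Vec (Fin s) n} γ (a : Vecᴬ.All D δ) → monomialValue γ a ≡ monomial γ a
    monomialValue≡monomial []      []       = refl
    monomialValue≡monomial (e ∷ γ) (a ∷ as) = cong (toℕ a ℕ.^ e ℕ.*_) (monomialValue≡monomial γ as)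

    restriction≡restrict : ∀ {n k} (δ : Vec (Fin s) n) {σ : Vec (Fin s) k} (scope : Scope δ σ) a → restriction δ scope a ≡ restrict δ scope a
    restriction≡restrict δ []                   a = refl
    restriction≡restrict δ ((x , refl) ∷ scope) a = cong (_ ∷_) (restriction≡restrict δ scope a)

    encode-positions : ∀ {n k} (δ : Vec (Fin s) n) {σ : Vec (Fin s) k} (scope : Scope δ σ) →
      encodeVec (λ x → encodeUnary (toℕ x)) (Vecᴬ.reduce proj₁ scope) ≡ enc (list un) (positions δ scope)
    encode-positions δ []                = refl
    encode-positions δ ((x , _) ∷ scope) = cong (cons (encodeUnary (toℕ x))) (encode-positions δ scope)

    module _ (x : IMPInput Γ d) where
      open IMPInput x
      private module X = Solved inst {dim}

      bound : ∀ us → All (λ (_ , α) → Vec.sum α ℕ.≤ d) us → List X.Bounded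
      bound []       []       = []
      bound (u ∷ us) (b ∷ bs) = (u , b) ∷ bound us bs

      map-proj₁-bound : ∀ us bs → map proj₁ (bound us bs) ≡ us
      map-proj₁-bound []       []       = refl
      map-proj₁-bound (u ∷ us) (b ∷ bs) = cong (u ∷_) (map-proj₁-bound us bs)

      bounded : List X.Bounded
      bounded = bound terms deg≤d

      represent : Input
      represent = X.input bounded

      encode-represent : encodeInput Γ x ≡ enc inputT represent
      encode-represent = cong₂ cons
        (cong (cons _) (trans (encodeList-cong (λ C → cong (cons (encodeUnary (toℕ (rel C)))) (encode-positions (sort inst) (scope C))) (constraints inst))
          (sym (encodeList-map (enc conT) plain (constraints inst)))))
        (trans (encodeList-cong (λ (u , α) → cong (λ c → cons c (encodeVec encodeUnary α))
            (trans (encodeList-cong encode-ratOf (Vec.toList u)) (sym (encodeList-map (enc ratT) ratOf (Vec.toList u))))) terms)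
          (trans (sym (encodeList-map (enc termT) X.plainTerm terms))
            (cong (λ us → enc (list termT) (map X.plainTerm us)) (sym (map-proj₁-bound terms deg≤d)))))

      weight : Vecᴬ.All D (sort inst) → Vec ℕ (#vars inst) → ℚ
      weight a α = ι (monomialValue α a)

      coordinates≡f : ∀ j a bs → nthℚ j (coordinates basis (weight a) (map proj₁ bs)) ≡ X.f bs j a
      coordinates≡f j a []       = nthℚ-0 dim j
      coordinates≡f j a (b ∷ bs) = trans (nthℚ-+ j (Vec.map (_* weight a (X.mono b)) (X.coords b)) (coordinates basis (weight a) (map proj₁ bs)))
        (cong₂ _+_ (trans (nthℚ-* j (weight a (X.mono b)) (X.coords b)) (cong (λ m → nthℚ j (X.coords b) * ι m) (monomialValue≡monomial (X.mono b) a)))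
          (coordinates≡f j a bs))

      coordinates-terms : ∀ j a → nthℚ j (coordinates basis (weight a) terms) ≡ X.f bounded j a
      coordinates-terms j a = trans (cong (λ us → nthℚ j (coordinates basis (weight a) us)) (sym (map-proj₁-bound terms deg≤d))) (coordinates≡f j a bounded)

      solves⇒holds : ∀ a → All (Solves Γ F inst a) (constraints inst) → All (Holds! a) (constraints inst)
      solves⇒holds a = All.map (λ {C} → subst (_∈ᴿ holds (lookup Γ (rel C))) (restriction≡restrict (sort inst) (scope C) a))

      holds⇒solves : ∀ a → All (Holds! a) (constraints inst) → All (Solves Γ F inst a) (constraints inst)
      holds⇒solves a = All.map (λ {C} → subst (_∈ᴿ holds (lookup Γ (rel C))) (sym (restriction≡restrict (sort inst) (scope C) a)))

      poly-zero⇔ : ∀ f → f ≡ polynomial basis (λ _ → 0ℚ) terms → ∀ a v → At v a → eval f v ≈ᶜ 0ᶜ ⇔ (∀ j → j ℕ.< dim → X.f bounded j a ≡ 0ℚ)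
      poly-zero⇔ _ refl a v at = mk⇔
        (λ eq j j<dim → trans (sym (coordinates-terms j a)) (Equivalence.to specialised eq j j<dim))
        (λ eq → Equivalence.from specialised (λ j j<dim → trans (coordinates-terms j a) (eq j j<dim)))
        where
        specialised = eval-zero⇔ basis (weight a) independent v (λ α → evalMonomial-At α a v at) terms

      decides : verdict represent ≡ true ⇔ poly ∈⟨ Generator Γ F inst ⟩
      decides = mk⇔
        (λ accepted → vanishing⇒ideal Γ F inst poly (λ a v at sol →
          Equivalence.from (poly-zero⇔ poly refl a v at) (Equivalence.to (X.verdict⇔ bounded) accepted a (solves⇒holds a sol))))
        (λ member → Equivalence.from (X.verdict⇔ bounded) (λ a hs →
          Equivalence.to (poly-zero⇔ poly refl a (MCSP.point q a) (lookup-point a))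
            (ideal⇒vanishing Γ F inst poly member a (MCSP.point q a) (lookup-point a) (holds⇒solves a hs))))

    polynomialTime : PolynomialTime (IMP Γ F d)
    polynomialTime = PT⇒PolynomialTime verdictP represent encode-represent decides

-- The arithmetic tables for distinct prime powers

module Moduli where

  open Congruences
  open Elimination
  open import Data.List.Base using ([]; _∷_; map; allFin)
  open import Data.List.Membership.Propositional.Properties using (∈-allFin; ∈-map⁺)
  open import Data.List.Relation.Unary.All using (All; []; _∷_)
  open import Data.Nat.Base as ℕ using (ℕ; suc; NonZero)
  import Data.Nat.Properties as ℕₚ
  open import Data.Nat.Divisibility using (_∣_)
  open import Data.Nat.DivMod using (_mod_)
  open import Data.Nat.Coprimality using (Coprime)
  open import Data.Nat.ListAction using (product)
  open import Data.Nat.ListAction.Properties using (∈⇒∣product; product≢0)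
  open import Data.Nat.Primality using (Prime; prime⇒nonZero)
  open import Data.Sum.Base using (inj₁; inj₂)
  open import Function.Definitions using (Injective)
  open import Relation.Binary.PropositionalEquality

  open Reduction

  module PrimePowers {s : ℕ} (p m : Fin s → ℕ) (prime : ∀ t → Prime (p t)) (injective : Injective _≡_ _≡_ p) where

    q : Fin s → ℕ
    q t = p t ℕ.^ m t

    q≢0 : ∀ t → NonZero (q t)
    q≢0 t = ℕₚ.m^n≢0 (p t) (m t) {{prime⇒nonZero (prime t)}}

    -- One less than the product of the moduli, so that `suc Q′` is the common modulus of all
    -- coefficients and `Fin (suc Q′)` visibly has a zero.
    Q′ : ℕ
    Q′ = ℕ.pred (product (map q (allFin s)))

    abstract
      q∣Q : ∀ t → q t ∣ suc Q′
      q∣Q t = subst (q t ∣_) (sym (ℕₚ.suc-pred (product (map q (allFin s))) {{product≢0 (all≢0 (allFin s))}})) (∈⇒∣product (∈-map⁺ q (∈-allFin t)))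
        where
        all≢0 : ∀ ts → All NonZero (map q ts)
        all≢0 []       = []
        all≢0 (t ∷ ts) = q≢0 t ∷ all≢0 ts

      0<q : ∀ t → 0 ℕ.< q t
      0<q t = ℕ.>-nonZero⁻¹ (q t) {{q≢0 t}}

      coprime : ∀ t t′ → t ≢ t′ → Coprime (q t) (q t′)
      coprime t t′ t≢t′ = prime-powers-coprime (prime t) (prime t′) (λ eq → t≢t′ (injective eq)) (m t) (m t′)

      -- Reduction modulo the common multiple keeps the class modulo each `q t`. It turns
      -- multipliers and annihilators, found as arbitrary natural numbers, into entries of finite
      -- tables.
      reduced : ∀ t c → toℕ (c mod suc Q′) ≡ c ⟪ q t ⟫
      reduced t c = ≡⟪⟫-∣ (q∣Q t) (toℕ-mod c (suc Q′))

      multiplier : ∀ t h c h′ → q t ∣ h ℕ.* c ℕ.+ h′ → q t ∣ h ℕ.* toℕ (c mod suc Q′) ℕ.+ h′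
      multiplier t h c h′ = ∣-resp-≡⟪⟫ (≡⟪⟫-+ (≡⟪⟫-* (≡⟪⟫-refl {h}) (≡⟪⟫-sym (reduced t c))) ≡⟪⟫-refl)

      choice : ∀ t (h₁ h₂ : Fin (suc Q′)) → Choice (q t) h₁ h₂
      choice t h₁ h₂ with ratio (prime t) (m t) (toℕ h₁) (toℕ h₂)
      ... | inj₁ (c , d) = first (c mod suc Q′) (multiplier t (toℕ h₁) c (toℕ h₂) d)
      ... | inj₂ (c , d) = second (c mod suc Q′) (multiplier t (toℕ h₂) c (toℕ h₁) d)

      annihilating : ∀ t (h : Fin (suc Q′)) → Σ (Fin (suc Q′)) λ u → ∀ b → q t ∣ toℕ u ℕ.* b ⇔ (∃[ y ] q t ∣ toℕ h ℕ.* y ℕ.+ b)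
      annihilating t h = let u , spec = annihilator (q t) {{q≢0 t}} (toℕ h) in u mod suc Q′ , λ b → mk⇔
        (λ d → Equivalence.to (spec b) (∣-resp-≡⟪⟫ (≡⟪⟫-* (reduced t u) (≡⟪⟫-refl {b})) d))
        (λ s → ∣-resp-≡⟪⟫ (≡⟪⟫-* (≡⟪⟫-sym (reduced t u)) (≡⟪⟫-refl {b})) (Equivalence.from (spec b) s))

open import Defs
open import Data.Fin using (Fin)
open import Data.Nat using (ℕ; _^_; _≤_)
open import Data.Nat.Primality using (Prime)
open import Data.Vec using (lookup)
open import Function.Definitions using (Injective)
open import Relation.Binary.PropositionalEquality using (_≡_)

theorem5p6 : ∀ {s : ℕ} (p m : Fin s → ℕ) →
    (∀ t → Prime (p t)) → Injective _≡_ _≡_ p → (∀ t → 1 ≤ m t) →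
    let open MCSP (λ t → p t ^ m t) in
    ∀ {l : ℕ} (Γ : Language l) → (∀ r → AffineInvariant (lookup Γ r)) →
    ∀ (F : Interpolants Γ) (d : ℕ) →
    PolynomialTime (IMP Γ F d)
theorem5p6 {s} p m prime injective _ {l} Γ invariant F d =
  Reduction.Decision.polynomialTime (λ t → p t ^ m t) Q′ q∣Q 0<q coprime choice annihilating {l} Γ invariant F d
  where open Moduli.PrimePowers p m prime injective
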